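{- Let $s\geq 3$ and $s+2\leq t\leq 2s-1$ be integers. There exists a constant $c=c(s,t)$ such that for all sufficiently large $n$, \[f_{s,t}(n)\leq n^{\alpha_{s,t}}(\log n)^{c}.\]
   Context: For integers $s<t$ and $n$, the Erdős–Rogers function $f_{s,t}(n)$ is the minimum, over all $K_t$-free graphs $G$ on $n$ vertices, of the maximum number of vertices of an induced $K_s$-free subgraph of $G$. For $s\geq 3$ and $s+2\leq t\leq 2s-1$, call the pair $(s,t)$ regular if either $s\geq 11$ and $s+3\leq t\leq 2s-4$, or $(s,t)\in\{(10,14),(10,15)\}$; otherwise call it exceptional. Define \[\alpha_{s,t}=\frac{(s-2)(t-s)(t+s-1)+2t-2s}{(2s-3)(t-s)(t+s-1)-2s+4}\ \text{ if }(s,t)\text{ is regular},\qquad \alpha_{s,t}=\frac{(s-2)(t-s)(s-1)+s-1}{(2s-3)(t-s)(s-1)+2s-t}\ \text{ if }(s,t)\text{ is exceptional}.\] -}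

module Defs where

open import Data.Nat using (ℕ; _+_; _*_; _∸_; _≤_; _≤ᵇ_; _≡ᵇ_)
open import Data.Bool using (Bool; true; false; _∧_; _∨_; if_then_else_)
open import Data.Fin using (Fin)
open import Data.Fin.Subset using (Subset; _∈_; ∣_∣)
open import Data.Product using (Σ; _×_; ∃-syntax)
open import Relation.Binary.PropositionalEquality using (_≡_; _≢_)
open import Relation.Nullary using (¬_)
open import Function.Definitions using (Injective)

record Graph (n : ℕ) : Set where
  field
    adj    : Fin n → Fin n → Bool
    sym    : ∀ u v → adj u v ≡ adj v u
    irrefl : ∀ u → adj u u ≡ false
open Graph public

Adj : ∀ {n} → Graph n → Fin n → Fin n → Set
Adj G u v = adj G u v ≡ true

IsClique : ∀ {n} (G : Graph n) (k : ℕ) → (Fin k → Fin n) → Set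
IsClique G k f = Injective _≡_ _≡_ f × (∀ i j → i ≢ j → Adj G (f i) (f j))

KFree : ∀ {n} → Graph n → ℕ → Set
KFree {n} G k = ¬ (∃[ f ] IsClique G k f)

InducedKFree : ∀ {n} → Graph n → Subset n → ℕ → Set
InducedKFree {n} G S k = ¬ (∃[ f ] (IsClique G k f × (∀ i → f i ∈ S)))

IsMaxKFree : ∀ {n} → Graph n → ℕ → ℕ → Set
IsMaxKFree {n} G s m =
  (∃[ S ] (InducedKFree G S s × ∣ S ∣ ≡ m)) ×
  (∀ S → InducedKFree G S s → ∣ S ∣ ≤ m)

IsErdosRogers : ℕ → ℕ → ℕ → ℕ → Set
IsErdosRogers s t n m =
  (∃[ G ] (KFree {n} G t × IsMaxKFree G s m)) ×
  (∀ (G : Graph n) m' → KFree G t → IsMaxKFree G s m' → m ≤ m')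

regularᵇ : ℕ → ℕ → Bool
regularᵇ s t =
  ((11 ≤ᵇ s) ∧ ((s + 3) ≤ᵇ t) ∧ (t ≤ᵇ (2 * s ∸ 4)))
  ∨ ((s ≡ᵇ 10) ∧ ((t ≡ᵇ 14) ∨ (t ≡ᵇ 15)))

alphaNum : ℕ → ℕ → ℕ
alphaNum s t =
  if regularᵇ s t
  then (s ∸ 2) * (t ∸ s) * (t + s ∸ 1) + 2 * (t ∸ s)
  else (s ∸ 2) * (t ∸ s) * (s ∸ 1) + (s ∸ 1)

alphaDen : ℕ → ℕ → ℕ
alphaDen s t =
  if regularᵇ s t
  then ((2 * s ∸ 3) * (t ∸ s) * (t + s ∸ 1) + 4) ∸ 2 * s
  else (2 * s ∸ 3) * (t ∸ s) * (s ∸ 1) + (2 * s ∸ t)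

{-# OPTIONS --safe #-}

-- Put M random blobs on N vertices, each blob being s-partite by a random colouring, and join two
-- vertices that lie in a unique common blob with different colours there. A set of m ≈ N^α vertices
-- (up to a power of log N) meets many blobs in exactly one vertex of each colour, so it contains
-- many copies of K_s. A copy of K_t lies in no blob; it spans a linear space with lines of at
-- most s points, and the choice of α makes the expected number of copies of such a configuration
-- no larger than that of a single edge in a blob. Hence the copy contains a rare configuration: one
-- that is not more frequent than any of its parts containing an edge. Submodularity and a union
-- bound over small configurations show that only polylogarithmically many edges share a rare
-- configuration with a given edge. Keep every pair of vertices by an independent coin of
-- polylogarithmic bias and delete all edges of surviving rare configurations: K_t disappears, while
-- in every set of m vertices some K_s keeps all of its edges and has no other surviving edge related
-- to it.
--
-- Probabilities are counts over finite sample spaces, with denominators cleared. Existence is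
-- proved up to double negation, because the final inequality is stable.
module Submission where

open import Defs
open import Data.Bool using (Bool; true; false; _∧_; _∨_; not; if_then_else_; T)
open import Data.Empty using (⊥; ⊥-elim)
open import Data.Fin using (Fin; zero; suc; toℕ; fromℕ<; inject≤)
open import Data.Fin.Properties using (toℕ<n; toℕ-injective; toℕ-fromℕ<; toℕ-inject≤; inject≤-injective) renaming (_≟_ to _≟ᶠ_; suc-injective to suc-injectiveᶠ)
open import Data.Fin.Subset using (Subset; ∣_∣) renaming (_∈_ to _∈ˢ_; ⊥ to ⊥ˢ)
open import Data.Fin.Subset.Properties using (∉⊥; ∣⊥∣≡0)
open import Data.List using (List; []; _∷_; _++_; map; length; concatMap; tabulate; allFin)
open import Data.List.Membership.Propositional using (_∈_)
open import Data.List.Membership.Propositional.Properties using (∈-allFin; ∈-map⁺; ∈-map⁻; ∈-concatMap⁺)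
open import Data.List.Properties using (length-map)
open import Data.List.Relation.Unary.Any using (here; there) renaming (map to Any-map)
open import Data.Nat using (ℕ; zero; suc; _+_; _*_; _∸_; _^_; _≤_; _<_; z≤n; s≤s; _≤ᵇ_; _≡ᵇ_; _/_; _%_; ⌊_/2⌋; ⌈_/2⌉; NonZero; >-nonZero; pred)
open import Data.Nat.DivMod using (m≡m%n+[m/n]*n; m%n<n; /-mono-≤; /-monoˡ-≤; m*n/n≡m; m/n*n≤m)
open import Data.Nat.Induction using (<-wellFounded)
open import Data.Nat.Logarithm using (⌊log₂_⌋; ⌊log₂⌋-mono-≤; ⌊log₂[2^n]⌋≡n)
open import Data.Nat.Logarithm.Core using (⌊log2⌋)
open import Data.Nat.Properties
open import Data.Nat.Solver using (module +-*-Solver)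
open import Data.Product using (Σ; ∃-syntax; _×_; _,_; proj₁; proj₂)
open import Data.Sum using (_⊎_; inj₁; inj₂)
open import Data.Vec using (Vec; []; _∷_; lookup; toList) renaming (tabulate to tabulateⱽ; here to hereⱽ; there to thereⱽ; replicate to replicateⱽ)
open import Data.Vec.Properties using (lookup∘tabulate)
open import Function using (_∘_; id)
open import Induction.WellFounded using () renaming (acc to accessible)
open import Relation.Binary.PropositionalEquality using (_≡_; _≢_; refl; cong; cong₂; subst; subst₂; trans; module ≡-Reasoning) renaming (sym to ≡-sym)
open import Relation.Nullary using (¬_; Dec; yes; no)
open import Relation.Nullary.Decidable using (⌊_⌋; decidable-stable; ¬¬-excluded-middle; toWitness; _×-dec_; _→-dec_)
open +-*-Solver using (solve; _:+_; _:*_; _:=_; con)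

-- Finite sums and products

-- The exponents come from two balances. A set of `m` vertices is one of about `N^m`, so a union
-- bound requires that it meet about `m` blobs in exact rainbow copies; up to logarithms this gives
-- `M * m^s = m * P^s`. Blobs get about `m` vertices as well, hence `N` is about `m * P`. One ratio
-- of exponents stays free, and the densest linear space that a copy of K_t can span fixes it.
--
-- Deleting copies of K_t directly fails because copies through one edge may overlap in ever denser
-- unions. Minimality of a rare configuration prevents this: attaching it along an edge never raises
-- the exponent of the expected count, so a union of many of them would be as frequent as an edge
-- although it has many incidences, which the union bound excludes.
--
-- All losses are powers of `w`, a constant times log `N`. The cost of the union bound over sets,
-- the spoiled hits, the hits that are guaranteed and their exponential moment must be separated by
-- powers of `w`. Raising `m` by one factor `w` raises the number of hits by `w^s` and the cost of
-- the union bound only by `w`, so a large enough power `w^z` in `m` makes room for all of them.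

private variable
  𝒜 ℬ : Set

∑ᴸ : List 𝒜 → (𝒜 → ℕ) → ℕ
∑ᴸ []       f = 0
∑ᴸ (x ∷ xs) f = f x + ∑ᴸ xs f

∑ᴸ-cong : ∀ (xs : List 𝒜) {f g : 𝒜 → ℕ} → (∀ x → f x ≡ g x) → ∑ᴸ xs f ≡ ∑ᴸ xs g
∑ᴸ-cong []       h = refl
∑ᴸ-cong (x ∷ xs) h = cong₂ _+_ (h x) (∑ᴸ-cong xs h)

∑ᴸ-mono : ∀ (xs : List 𝒜) {f g : 𝒜 → ℕ} → (∀ x → f x ≤ g x) → ∑ᴸ xs f ≤ ∑ᴸ xs g
∑ᴸ-mono []       h = z≤n
∑ᴸ-mono (x ∷ xs) h = +-mono-≤ (h x) (∑ᴸ-mono xs h)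

+-interchange : ∀ a b c d → (a + b) + (c + d) ≡ (a + c) + (b + d)
+-interchange a b c d =
  solve 4 (λ a b c d → (a :+ b) :+ (c :+ d) := (a :+ c) :+ (b :+ d)) refl a b c d

∑ᴸ-+ : ∀ (xs : List 𝒜) (f g : 𝒜 → ℕ) → ∑ᴸ xs (λ x → f x + g x) ≡ ∑ᴸ xs f + ∑ᴸ xs g
∑ᴸ-+ []       f g = refl
∑ᴸ-+ (x ∷ xs) f g rewrite ∑ᴸ-+ xs f g = +-interchange (f x) (g x) (∑ᴸ xs f) (∑ᴸ xs g)

∑ᴸ-* : ∀ (xs : List 𝒜) c (f : 𝒜 → ℕ) → ∑ᴸ xs (λ x → c * f x) ≡ c * ∑ᴸ xs f
∑ᴸ-* []       c f = ≡-sym (*-zeroʳ c)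
∑ᴸ-* (x ∷ xs) c f rewrite ∑ᴸ-* xs c f = ≡-sym (*-distribˡ-+ c (f x) (∑ᴸ xs f))

∑ᴸ-*ʳ : ∀ (xs : List 𝒜) (f : 𝒜 → ℕ) c → ∑ᴸ xs (λ x → f x * c) ≡ ∑ᴸ xs f * c
∑ᴸ-*ʳ xs f c = trans (∑ᴸ-cong xs (λ x → *-comm (f x) c)) (trans (∑ᴸ-* xs c f) (*-comm c _))

∑ᴸ-zero : ∀ (xs : List 𝒜) → ∑ᴸ xs (λ _ → 0) ≡ 0
∑ᴸ-zero []       = refl
∑ᴸ-zero (x ∷ xs) = ∑ᴸ-zero xs

∑ᴸ-swap : ∀ (xs : List 𝒜) (ys : List ℬ) (f : 𝒜 → ℬ → ℕ) →
  ∑ᴸ xs (λ x → ∑ᴸ ys (f x)) ≡ ∑ᴸ ys (λ y → ∑ᴸ xs (λ x → f x y))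
∑ᴸ-swap []       ys f = ≡-sym (∑ᴸ-zero ys)
∑ᴸ-swap (x ∷ xs) ys f rewrite ∑ᴸ-swap xs ys f = ≡-sym (∑ᴸ-+ ys (f x) _)

∑ᴸ-++ : ∀ (xs ys : List 𝒜) f → ∑ᴸ (xs ++ ys) f ≡ ∑ᴸ xs f + ∑ᴸ ys f
∑ᴸ-++ []       ys f = refl
∑ᴸ-++ (x ∷ xs) ys f rewrite ∑ᴸ-++ xs ys f = ≡-sym (+-assoc (f x) _ _)

∑ᴸ-map : ∀ (g : 𝒜 → ℬ) (xs : List 𝒜) f → ∑ᴸ (map g xs) f ≡ ∑ᴸ xs (f ∘ g)
∑ᴸ-map g []       f = refl
∑ᴸ-map g (x ∷ xs) f = cong (f (g x) +_) (∑ᴸ-map g xs f)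

∑ᴸ-concatMap : ∀ (g : 𝒜 → List ℬ) (xs : List 𝒜) f →
  ∑ᴸ (concatMap g xs) f ≡ ∑ᴸ xs (λ x → ∑ᴸ (g x) f)
∑ᴸ-concatMap g []       f = refl
∑ᴸ-concatMap g (x ∷ xs) f =
  trans (∑ᴸ-++ (g x) (concatMap g xs) f) (cong (∑ᴸ (g x) f +_) (∑ᴸ-concatMap g xs f))

∑ᴸ-term : ∀ {xs : List 𝒜} {x} (f : 𝒜 → ℕ) → x ∈ xs → f x ≤ ∑ᴸ xs f
∑ᴸ-term f (here refl) = m≤m+n _ _
∑ᴸ-term f (there {x = y} p) = ≤-trans (∑ᴸ-term f p) (m≤n+m _ (f y))

-- The first-moment method, and the form in which every random choice is made: if the failures add
-- up to less than the number of sample points, some point has no failure.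
∑ᴸ-<⇒∃ : ∀ (xs : List 𝒜) {f g : 𝒜 → ℕ} → ∑ᴸ xs f < ∑ᴸ xs g → ∃[ x ] (f x < g x)
∑ᴸ-<⇒∃ (x ∷ xs) {f} {g} lt with suc (f x) ≤? g x
... | yes p = x , p
... | no ¬p = ∑ᴸ-<⇒∃ xs (≰⇒> λ q → <⇒≱ lt (+-mono-≤ (≮⇒≥ ¬p) q))

∑ᴸ-pos⇒∃ : ∀ (xs : List 𝒜) {f : 𝒜 → ℕ} → 0 < ∑ᴸ xs f → ∃[ x ] (0 < f x)
∑ᴸ-pos⇒∃ xs {f} lt = ∑ᴸ-<⇒∃ xs {λ _ → 0} (subst (_< ∑ᴸ xs f) (≡-sym (∑ᴸ-zero xs)) lt)

vecs : List 𝒜 → ∀ n → List (Vec 𝒜 n)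
vecs xs zero    = [] ∷ []
vecs xs (suc n) = concatMap (λ x → map (x ∷_) (vecs xs n)) xs

∑ᴸ-vecs : ∀ (xs : List 𝒜) n (f : Vec 𝒜 (suc n) → ℕ) →
  ∑ᴸ (vecs xs (suc n)) f ≡ ∑ᴸ xs (λ x → ∑ᴸ (vecs xs n) (λ v → f (x ∷ v)))
∑ᴸ-vecs xs n f = trans (∑ᴸ-concatMap _ xs f) (∑ᴸ-cong xs (λ x → ∑ᴸ-map (x ∷_) (vecs xs n) f))

∑ : ∀ n → (Fin n → ℕ) → ℕ
∑ n f = ∑ᴸ (allFin n) f

∑-suc : ∀ n f → ∑ (suc n) f ≡ f zero + ∑ n (f ∘ suc)
∑-suc n f = cong (f zero +_) (go n id suc)
  where
  go : ∀ k (h : Fin k → Fin n) (g : Fin n → Fin (suc n)) →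
       ∑ᴸ (tabulate (g ∘ h)) f ≡ ∑ᴸ (tabulate h) (f ∘ g)
  go zero    h g = refl
  go (suc k) h g = cong (f (g (h zero)) +_) (go k (h ∘ suc) g)

∏ : ∀ n → (Fin n → ℕ) → ℕ
∏ zero    f = 1
∏ (suc n) f = f zero * ∏ n (f ∘ suc)

∏-cong : ∀ n {f g : Fin n → ℕ} → (∀ i → f i ≡ g i) → ∏ n f ≡ ∏ n g
∏-cong zero    h = refl
∏-cong (suc n) h = cong₂ _*_ (h zero) (∏-cong n (h ∘ suc))

∏-mono : ∀ n {f g : Fin n → ℕ} → (∀ i → f i ≤ g i) → ∏ n f ≤ ∏ n g
∏-mono zero    h = ≤-refl
∏-mono (suc n) h = *-mono-≤ (h zero) (∏-mono n (h ∘ suc))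

*-interchange : ∀ a b c d → (a * b) * (c * d) ≡ (a * c) * (b * d)
*-interchange a b c d =
  solve 4 (λ a b c d → (a :* b) :* (c :* d) := (a :* c) :* (b :* d)) refl a b c d

∏-* : ∀ n (f g : Fin n → ℕ) → ∏ n (λ i → f i * g i) ≡ ∏ n f * ∏ n g
∏-* zero    f g = refl
∏-* (suc n) f g rewrite ∏-* n (f ∘ suc) (g ∘ suc) = *-interchange (f zero) (g zero) _ _

∏-const : ∀ n c → ∏ n (λ _ → c) ≡ c ^ n
∏-const zero    c = refl
∏-const (suc n) c = cong (c *_) (∏-const n c)

∏-^ : ∀ n c (f : Fin n → ℕ) → ∏ n (λ i → c ^ f i) ≡ c ^ ∑ n f
∏-^ zero    c f = refl
∏-^ (suc n) c f rewrite ∑-suc n f | ∏-^ n c (f ∘ suc) = ≡-sym (^-distribˡ-+-* c (f zero) _)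

-- Independence of the coordinates of a uniformly random vector.
∑ᴸ-vecs-∏ : ∀ (xs : List 𝒜) n (g : Fin n → 𝒜 → ℕ) →
  ∑ᴸ (vecs xs n) (λ v → ∏ n (λ i → g i (lookup v i))) ≡ ∏ n (λ i → ∑ᴸ xs (g i))
∑ᴸ-vecs-∏ xs zero    g = refl
∑ᴸ-vecs-∏ xs (suc n) g = begin
  ∑ᴸ (vecs xs (suc n)) (λ v → ∏ (suc n) (λ i → g i (lookup v i)))
    ≡⟨ ∑ᴸ-vecs xs n _ ⟩
  ∑ᴸ xs (λ x → ∑ᴸ (vecs xs n) (λ v → g zero x * ∏ n (λ i → g (suc i) (lookup v i))))
    ≡⟨ ∑ᴸ-cong xs (λ x → ∑ᴸ-* (vecs xs n) (g zero x) _) ⟩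
  ∑ᴸ xs (λ x → g zero x * ∑ᴸ (vecs xs n) (λ v → ∏ n (λ i → g (suc i) (lookup v i))))
    ≡⟨ ∑ᴸ-*ʳ xs (g zero) _ ⟩
  ∑ᴸ xs (g zero) * ∑ᴸ (vecs xs n) (λ v → ∏ n (λ i → g (suc i) (lookup v i)))
    ≡⟨ cong (∑ᴸ xs (g zero) *_) (∑ᴸ-vecs-∏ xs n (g ∘ suc)) ⟩
  ∏ (suc n) (λ i → ∑ᴸ xs (g i)) ∎
  where open ≡-Reasoning

length-vecs : ∀ (xs : List 𝒜) n → ∑ᴸ (vecs xs n) (λ _ → 1) ≡ ∑ᴸ xs (λ _ → 1) ^ n
length-vecs xs n =
  trans (∑ᴸ-cong (vecs xs n) (λ _ → ≡-sym (trans (∏-const n 1) (^-zeroˡ n))))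
        (trans (∑ᴸ-vecs-∏ xs n (λ _ _ → 1)) (∏-const n _))

∑-1 : ∀ n → ∑ n (λ _ → 1) ≡ n
∑-1 zero    = refl
∑-1 (suc n) = trans (∑-suc n (λ _ → 1)) (cong suc (∑-1 n))

∑-const : ∀ n c → ∑ n (λ _ → c) ≡ n * c
∑-const zero    c = refl
∑-const (suc n) c = trans (∑-suc n (λ _ → c)) (cong (c +_) (∑-const n c))

𝟙 : Bool → ℕ
𝟙 true  = 1
𝟙 false = 0

𝟙≤1 : ∀ b → 𝟙 b ≤ 1
𝟙≤1 true  = ≤-refl
𝟙≤1 false = z≤n

T⇒≡ : ∀ {b} → T b → b ≡ true
T⇒≡ {true} _ = refl

≤ᵇ-true : ∀ {m n} → m ≤ n → (m ≤ᵇ n) ≡ true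
≤ᵇ-true h = T⇒≡ (≤⇒≤ᵇ h)

≤ᵇ-true⁻¹ : ∀ m n → (m ≤ᵇ n) ≡ true → m ≤ n
≤ᵇ-true⁻¹ m n h = ≤ᵇ⇒≤ m n (subst T (≡-sym h) _)

markov : ∀ (xs : List 𝒜) (W : 𝒜 → ℕ) θ → θ * ∑ᴸ xs (λ x → 𝟙 (θ ≤ᵇ W x)) ≤ ∑ᴸ xs W
markov xs W θ = ≤-trans (≤-reflexive (≡-sym (∑ᴸ-* xs θ _))) (∑ᴸ-mono xs step)
  where
  step : ∀ x → θ * 𝟙 (θ ≤ᵇ W x) ≤ W x
  step x with θ ≤ᵇ W x in eq
  ... | true  = ≤-trans (≤-reflexive (*-identityʳ θ)) (≤ᵇ⇒≤ θ (W x) (subst T (≡-sym eq) _))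
  ... | false = ≤-trans (≤-reflexive (*-zeroʳ θ)) z≤n

-- Elementary inequalities

-- Bernoulli's inequality for `1 - 1/z` with `z = suc y`, multiplied by `z^(k+1)`.
bernoulli⁻ : ∀ y k → suc y ^ suc k ≤ y ^ k * suc y + k * suc y ^ k
bernoulli⁻ y zero    = ≤-reflexive (solve 1 (λ z → z :* con 1 := con 1 :* z :+ con 0) refl (suc y))
bernoulli⁻ y (suc k) = begin
  z ^ suc (suc k)                              ≡⟨ +-comm (z ^ suc k) (y * z ^ suc k) ⟩
  y * z ^ suc k + z ^ suc k                    ≤⟨ +-monoˡ-≤ (z ^ suc k) (*-monoʳ-≤ y (bernoulli⁻ y k)) ⟩
  y * (y ^ k * z + k * z ^ k) + z ^ suc k
    ≡⟨ solve 5 (λ y p z k q → y :* (p :* z :+ k :* q) :+ z :* q := (y :* p :* z :+ k :* (y :* q)) :+ z :* q)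
         refl y (y ^ k) z k (z ^ k) ⟩
  (y ^ suc k * z + k * (y * z ^ k)) + z ^ suc k
    ≤⟨ +-monoˡ-≤ (z ^ suc k) (+-monoʳ-≤ (y ^ suc k * z) (*-monoʳ-≤ k (*-monoˡ-≤ (z ^ k) (n≤1+n y)))) ⟩
  (y ^ suc k * z + k * z ^ suc k) + z ^ suc k
    ≡⟨ solve 3 (λ a k b → (a :+ k :* b) :+ b := a :+ (con 1 :+ k) :* b) refl (y ^ suc k * z) k (z ^ suc k) ⟩
  y ^ suc k * z + suc k * z ^ suc k ∎
  where
  open ≤-Reasoning
  z : ℕ
  z = suc y

-- Bernoulli's inequality for `1 + 1/b`, multiplied by `b^(a+1)`.
bernoulli⁺ : ∀ b a → (b + a) * b ^ a ≤ suc b ^ a * b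
bernoulli⁺ b zero    = ≤-reflexive (solve 1 (λ b → (b :+ con 0) :* con 1 := con 1 :* b) refl b)
bernoulli⁺ b (suc a) = begin
  (b + suc a) * (b * b ^ a)       ≤⟨ m≤m+n _ (a * b ^ a) ⟩
  (b + suc a) * (b * b ^ a) + a * b ^ a
    ≡⟨ solve 3 (λ b a p → (b :+ (con 1 :+ a)) :* (b :* p) :+ a :* p := (con 1 :+ b) :* ((b :+ a) :* p)) refl b a (b ^ a) ⟩
  suc b * ((b + a) * b ^ a)       ≤⟨ *-monoʳ-≤ (suc b) (bernoulli⁺ b a) ⟩
  suc b * (suc b ^ a * b)         ≡⟨ ≡-sym (*-assoc (suc b) (suc b ^ a) b) ⟩
  suc b ^ suc a * b ∎
  where open ≤-Reasoning

^-pos : ∀ x n → 1 ≤ x → 1 ≤ x ^ n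
^-pos x zero    _ = ≤-refl
^-pos x (suc n) p = *-mono-≤ p (^-pos x n p)

^-mono-exp : ∀ w {i j} → 1 ≤ w → i ≤ j → w ^ i ≤ w ^ j
^-mono-exp (suc w) _ h = ^-monoʳ-≤ (suc w) h

*-cancelʳ-≤′ : ∀ {a b} c → 1 ≤ c → a * c ≤ b * c → a ≤ b
*-cancelʳ-≤′ {a} {b} (suc c) _ h = *-cancelʳ-≤ a b (suc c) h

*-cancelˡ-≤′ : ∀ {a b} c → 1 ≤ c → c * a ≤ c * b → a ≤ b
*-cancelˡ-≤′ {a} {b} (suc c) _ h = *-cancelˡ-≤ {a} {b} (suc c) h

half-power : ∀ y k → 2 * k ≤ suc y → suc y ^ k ≤ 2 * y ^ k
half-power y k 2k≤z = *-cancelʳ-≤′ z (s≤s z≤n) (+-cancelʳ-≤ (z ^ k * z) _ _ (begin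
  z ^ k * z + z ^ k * z               ≡⟨ solve 2 (λ p z → p :* z :+ p :* z := con 2 :* (z :* p)) refl (z ^ k) z ⟩
  2 * z ^ suc k                       ≤⟨ *-monoʳ-≤ 2 (bernoulli⁻ y k) ⟩
  2 * (y ^ k * z + k * z ^ k)
    ≡⟨ solve 4 (λ p z k q → con 2 :* (p :* z :+ k :* q) := con 2 :* p :* z :+ q :* (con 2 :* k)) refl (y ^ k) z k (z ^ k) ⟩
  2 * y ^ k * z + z ^ k * (2 * k)     ≤⟨ +-monoʳ-≤ (2 * y ^ k * z) (*-monoʳ-≤ (z ^ k) 2k≤z) ⟩
  2 * y ^ k * z + z ^ k * z ∎))
  where
  open ≤-Reasoning
  z : ℕ
  z = suc y

halves : ∀ n → ∃[ a ] ∃[ b ] (n ≡ a + b × 2 * a ≤ suc n × 2 * b ≤ suc n)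
halves zero = 0 , 0 , refl , z≤n , z≤n
halves (suc zero) = 1 , 0 , refl , ≤-refl , z≤n
halves (suc (suc n)) with halves n
... | a , b , refl , p , q = suc a , suc b , cong suc (≡-sym (+-suc a b)) , up a p , up b q
  where
  up : ∀ c → 2 * c ≤ suc (a + b) → 2 * suc c ≤ suc (suc (suc (a + b)))
  up c h = subst (_≤ suc (suc (suc (a + b)))) (solve 1 (λ c → con 2 :+ con 2 :* c := con 2 :* (con 1 :+ c)) refl c) (s≤s (s≤s h))

-- Bernoulli's inequality bounds the power by 2 up to exponent about `y/2`; two such halves reach
-- `y`. The constant 4 takes the place of e.
[1+1/y]^n≤4 : ∀ y n → n ≤ y → suc y ^ n ≤ 4 * y ^ n
[1+1/y]^n≤4 y n n≤y with halves n
... | a , b , refl , p , q = begin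
  suc y ^ (a + b)                   ≡⟨ ^-distribˡ-+-* (suc y) a b ⟩
  suc y ^ a * suc y ^ b             ≤⟨ *-mono-≤ (half-power y a (≤-trans p (s≤s n≤y))) (half-power y b (≤-trans q (s≤s n≤y))) ⟩
  (2 * y ^ a) * (2 * y ^ b)         ≡⟨ solve 2 (λ a b → (con 2 :* a) :* (con 2 :* b) := con 4 :* (a :* b)) refl (y ^ a) (y ^ b) ⟩
  4 * (y ^ a * y ^ b)               ≡⟨ cong (4 *_) (≡-sym (^-distribˡ-+-* y a b)) ⟩
  4 * y ^ (a + b) ∎
  where open ≤-Reasoning

[1+1/y]^n≤4^q : ∀ y q n → n ≤ q * y → suc y ^ n ≤ 4 ^ q * y ^ n
[1+1/y]^n≤4^q y zero    zero h = ≤-refl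
[1+1/y]^n≤4^q y (suc q) n h with n ≤? y
... | yes n≤y = ≤-trans ([1+1/y]^n≤4 y n n≤y) (*-monoˡ-≤ (y ^ n) (*-monoʳ-≤ 4 (^-pos 4 q (s≤s z≤n))))
... | no n≰y  = begin
  suc y ^ n                                 ≡⟨ cong (suc y ^_) n≡ ⟩
  suc y ^ (y + (n ∸ y))                     ≡⟨ ^-distribˡ-+-* (suc y) y (n ∸ y) ⟩
  suc y ^ y * suc y ^ (n ∸ y)
    ≤⟨ *-mono-≤ ([1+1/y]^n≤4 y y ≤-refl) ([1+1/y]^n≤4^q y q (n ∸ y) (≤-trans (∸-monoˡ-≤ y h) (≤-reflexive (m+n∸m≡n y (q * y))))) ⟩
  (4 * y ^ y) * (4 ^ q * y ^ (n ∸ y))       ≡⟨ *-interchange 4 (y ^ y) (4 ^ q) _ ⟩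
  4 ^ suc q * (y ^ y * y ^ (n ∸ y))         ≡⟨ cong (4 ^ suc q *_) (≡-sym (^-distribˡ-+-* y y (n ∸ y))) ⟩
  4 ^ suc q * y ^ (y + (n ∸ y))             ≡⟨ cong (λ k → 4 ^ suc q * y ^ k) (≡-sym n≡) ⟩
  4 ^ suc q * y ^ n ∎
  where
  open ≤-Reasoning
  n≡ : n ≡ y + (n ∸ y)
  n≡ = ≡-sym (m+[n∸m]≡n (<⇒≤ (≰⇒> n≰y)))

^-distribʳ-* : ∀ m n k → (m * n) ^ k ≡ m ^ k * n ^ k
^-distribʳ-* m n zero    = refl
^-distribʳ-* m n (suc k) rewrite ^-distribʳ-* m n k = *-interchange m n (m ^ k) (n ^ k)

^-mono : ∀ {a b} n → a ≤ b → a ^ n ≤ b ^ n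
^-mono n h = ^-monoˡ-≤ n h

-- One step by `a/b` is at most `a` steps by `1/b`, which is `bernoulli⁺`; this reduces the bound to
-- unit steps. It plays the part of `(1+x)^n <= exp(nx)` in the moment estimates.
[b+a]^n≤ : ∀ b a n q → n * a ≤ q * b → 1 ≤ b → (b + a) ^ n ≤ 4 ^ q * b ^ n
[b+a]^n≤ b a n q h 1≤b = *-cancelʳ-≤′ (b ^ (a * n)) (^-pos b (a * n) 1≤b) (begin
  (b + a) ^ n * b ^ (a * n)         ≡⟨ cong ((b + a) ^ n *_) (≡-sym (^-*-assoc b a n)) ⟩
  (b + a) ^ n * (b ^ a) ^ n         ≡⟨ ≡-sym (^-distribʳ-* (b + a) (b ^ a) n) ⟩
  ((b + a) * b ^ a) ^ n             ≤⟨ ^-mono n (bernoulli⁺ b a) ⟩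
  (suc b ^ a * b) ^ n               ≡⟨ ^-distribʳ-* (suc b ^ a) b n ⟩
  (suc b ^ a) ^ n * b ^ n           ≡⟨ cong (_* b ^ n) (^-*-assoc (suc b) a n) ⟩
  suc b ^ (a * n) * b ^ n           ≤⟨ *-monoˡ-≤ (b ^ n) ([1+1/y]^n≤4^q b q (a * n) (≤-trans (≤-reflexive (*-comm a n)) h)) ⟩
  4 ^ q * b ^ (a * n) * b ^ n       ≡⟨ solve 3 (λ x y z → x :* y :* z := x :* z :* y) refl (4 ^ q) (b ^ (a * n)) (b ^ n) ⟩
  4 ^ q * b ^ n * b ^ (a * n) ∎)
  where open ≤-Reasoning

2*y^z≤z^z : ∀ y → 2 * y ^ suc y ≤ suc y ^ suc y
2*y^z≤z^z zero    = z≤n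
2*y^z≤z^z y@(suc _) = *-cancelʳ-≤′ y (s≤s z≤n) (begin
  2 * (y * y ^ y) * y                   ≡⟨ solve 2 (λ y p → con 2 :* (y :* p) :* y := y :* ((y :+ y) :* p)) refl y (y ^ y) ⟩
  y * ((y + y) * y ^ y)                 ≤⟨ *-mono-≤ (n≤1+n y) (bernoulli⁺ y y) ⟩
  suc y * (suc y ^ y * y)               ≡⟨ ≡-sym (*-assoc (suc y) (suc y ^ y) y) ⟩
  suc y ^ suc y * y ∎)
  where open ≤-Reasoning

2^q*y^n≤z^n : ∀ y q n → q * suc y ≤ n → 2 ^ q * y ^ n ≤ suc y ^ n
2^q*y^n≤z^n y zero    n h = ≤-trans (≤-reflexive (*-identityˡ (y ^ n))) (^-mono n (n≤1+n y))
2^q*y^n≤z^n y (suc q) n h = begin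
  2 ^ suc q * y ^ n                        ≡⟨ cong (λ k → 2 ^ suc q * y ^ k) n≡ ⟩
  2 ^ suc q * y ^ (suc y + (n ∸ suc y))    ≡⟨ cong (2 ^ suc q *_) (^-distribˡ-+-* y (suc y) (n ∸ suc y)) ⟩
  (2 * 2 ^ q) * (y ^ suc y * y ^ (n ∸ suc y)) ≡⟨ *-interchange 2 (2 ^ q) (y ^ suc y) (y ^ (n ∸ suc y)) ⟩
  (2 * y ^ suc y) * (2 ^ q * y ^ (n ∸ suc y))
    ≤⟨ *-mono-≤ (2*y^z≤z^z y) (2^q*y^n≤z^n y q (n ∸ suc y) (≤-trans (≤-reflexive (≡-sym (m+n∸m≡n (suc y) (q * suc y)))) (∸-monoˡ-≤ (suc y) h))) ⟩
  suc y ^ suc y * suc y ^ (n ∸ suc y)      ≡⟨ ≡-sym (^-distribˡ-+-* (suc y) (suc y) (n ∸ suc y)) ⟩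
  suc y ^ (suc y + (n ∸ suc y))            ≡⟨ cong (suc y ^_) (≡-sym n≡) ⟩
  suc y ^ n ∎
  where
  open ≤-Reasoning
  n≡ : n ≡ suc y + (n ∸ suc y)
  n≡ = ≡-sym (m+[n∸m]≡n (≤-trans (m≤m+n (suc y) (q * suc y)) h))

-- Dual to the bound above: `1 - a/b` is at most `(1 - 1/b)^a` by `bernoulli⁻`, and every `b` unit
-- steps halve the power. It gives the exponential decay of the probability of too few hits.
2^q*c^n≤ : ∀ c a n q → q * (c + a) ≤ n * a → 1 ≤ c + a → 2 ^ q * c ^ n ≤ (c + a) ^ n
2^q*c^n≤ c a n q h 1≤b with c + a in eq
... | suc y = *-cancelʳ-≤′ (suc y ^ (a * n)) (^-pos (suc y) (a * n) (s≤s z≤n)) (begin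
  2 ^ q * c ^ n * b ^ (a * n)           ≡⟨ *-assoc (2 ^ q) (c ^ n) _ ⟩
  2 ^ q * (c ^ n * b ^ (a * n))         ≡⟨ cong (λ e → 2 ^ q * (c ^ n * e)) (≡-sym (^-*-assoc b a n)) ⟩
  2 ^ q * (c ^ n * (b ^ a) ^ n)         ≡⟨ cong (2 ^ q *_) (≡-sym (^-distribʳ-* c (b ^ a) n)) ⟩
  2 ^ q * (c * b ^ a) ^ n               ≤⟨ *-monoʳ-≤ (2 ^ q) (^-mono n cb≤) ⟩
  2 ^ q * (y ^ a * b) ^ n               ≡⟨ cong (2 ^ q *_) (^-distribʳ-* (y ^ a) b n) ⟩
  2 ^ q * ((y ^ a) ^ n * b ^ n)         ≡⟨ cong (λ e → 2 ^ q * (e * b ^ n)) (^-*-assoc y a n) ⟩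
  2 ^ q * (y ^ (a * n) * b ^ n)         ≡⟨ ≡-sym (*-assoc (2 ^ q) (y ^ (a * n)) (b ^ n)) ⟩
  2 ^ q * y ^ (a * n) * b ^ n           ≤⟨ *-monoˡ-≤ (b ^ n) (2^q*y^n≤z^n y q (a * n) (≤-trans h (≤-reflexive (*-comm n a)))) ⟩
  b ^ (a * n) * b ^ n                   ≡⟨ *-comm (b ^ (a * n)) (b ^ n) ⟩
  b ^ n * b ^ (a * n) ∎)
  where
  open ≤-Reasoning
  b : ℕ
  b = suc y
  cb≤ : c * b ^ a ≤ y ^ a * b
  cb≤ = +-cancelʳ-≤ (a * b ^ a) _ _ (≤-trans (≤-reflexive
    (trans (≡-sym (*-distribʳ-+ (b ^ a) c a)) (cong (_* b ^ a) eq))) (bernoulli⁻ y a))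

n<2^n : ∀ n → n < 2 ^ n
n<2^n zero    = s≤s z≤n
n<2^n (suc n) = ≤-trans (+-mono-≤ (^-pos 2 n (s≤s z≤n)) (n<2^n n)) (≤-reflexive (cong (2 ^ n +_) (≡-sym (+-identityʳ (2 ^ n)))))

-- With `K = k+1` and `j` the integer part of `w/K`, the power `(j+1)^K` is at most `2^(jK)`. It has
-- one factor `j+1` more than needed, and this factor pays for the constant `c * K^k`.
poly≤exp : ∀ c k → ∃[ w₀ ] ∀ w → w₀ ≤ w → c * w ^ k ≤ 2 ^ w
poly≤exp c k = c * K ^ k * K , λ w h →
  let j = w / K
      w<  : w ≤ suc j * K
      w<  = ≤-trans (≤-reflexive (m≡m%n+[m/n]*n w K)) (+-monoˡ-≤ (j * K) (<⇒≤ (m%n<n w K)))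
      jK≤w : j * K ≤ w
      jK≤w = ≤-trans (m≤n+m (j * K) (w % K)) (≤-reflexive (≡-sym (m≡m%n+[m/n]*n w K)))
      j≥ : c * K ^ k ≤ j
      j≥ = subst (_≤ j) (m*n/n≡m (c * K ^ k) K) (/-mono-≤ h (≤-refl {K}))
      open ≤-Reasoning
  in begin
    c * w ^ k                   ≤⟨ *-monoʳ-≤ c (^-mono k w<) ⟩
    c * (suc j * K) ^ k         ≡⟨ cong (c *_) (^-distribʳ-* (suc j) K k) ⟩
    c * (suc j ^ k * K ^ k)     ≡⟨ solve 3 (λ a b d → a :* (b :* d) := (a :* d) :* b) refl c (suc j ^ k) (K ^ k) ⟩
    (c * K ^ k) * suc j ^ k     ≤⟨ *-monoˡ-≤ (suc j ^ k) (m≤n⇒m≤1+n j≥) ⟩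
    suc j ^ K                   ≤⟨ ^-mono K (n<2^n j) ⟩
    (2 ^ j) ^ K                 ≡⟨ ^-*-assoc 2 j K ⟩
    2 ^ (j * K)                 ≤⟨ ^-monoʳ-≤ 2 jK≤w ⟩
    2 ^ w ∎
  where
  K : ℕ
  K = suc k

-- Linear spaces

_==_ : ∀ {n} → Fin n → Fin n → Bool
i == j = ⌊ i ≟ᶠ j ⌋

==-refl : ∀ {n} (i : Fin n) → (i == i) ≡ true
==-refl i with i ≟ᶠ i
... | yes _ = refl
... | no ¬p = ⊥-elim (¬p refl)

==⇒≡ : ∀ {n} (i j : Fin n) → (i == j) ≡ true → i ≡ j
==⇒≡ i j p with i ≟ᶠ j
... | yes q = q

≢⇒== : ∀ {n} {i j : Fin n} → i ≢ j → (i == j) ≡ false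
≢⇒== {i = i} {j} p with i ≟ᶠ j
... | yes q = ⊥-elim (p q)
... | no _ = refl

==-sym : ∀ {n} (i j : Fin n) → (i == j) ≡ (j == i)
==-sym i j with i ≟ᶠ j
... | yes refl = ≡-sym (==-refl i)
... | no i≢j = ≡-sym (≢⇒== (i≢j ∘ ≡-sym))

==-suc : ∀ {n} (i j : Fin n) → (suc i == suc j) ≡ (i == j)
==-suc i j with i ≟ᶠ j
... | yes refl = refl
... | no _ = refl

∑-cong : ∀ n {f g : Fin n → ℕ} → (∀ i → f i ≡ g i) → ∑ n f ≡ ∑ n g
∑-cong n = ∑ᴸ-cong (allFin n)

∑-mono : ∀ n {f g : Fin n → ℕ} → (∀ i → f i ≤ g i) → ∑ n f ≤ ∑ n g
∑-mono n = ∑ᴸ-mono (allFin n)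

∑-term : ∀ n (f : Fin n → ℕ) i → f i ≤ ∑ n f
∑-term n f i = ∑ᴸ-term f (∈-allFin i)

∑-zero : ∀ n {f : Fin n → ℕ} → (∀ i → f i ≡ 0) → ∑ n f ≡ 0
∑-zero n h = trans (∑-cong n h) (∑ᴸ-zero (allFin n))

∑-δ : ∀ {n} (a : Fin n) (f : Fin n → ℕ) → ∑ n (λ i → 𝟙 (i == a) * f i) ≡ f a
∑-δ {suc n} zero f = begin
  ∑ (suc n) (λ i → 𝟙 (i == zero) * f i)  ≡⟨ ∑-suc n (λ i → 𝟙 (i == zero) * f i) ⟩
  f zero + 0 + ∑ n (λ i → 0)             ≡⟨ cong (f zero + 0 +_) (∑ᴸ-zero (allFin n)) ⟩
  f zero + 0 + 0                         ≡⟨ trans (+-identityʳ _) (+-identityʳ _) ⟩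
  f zero ∎
  where open ≡-Reasoning
∑-δ {suc n} (suc a) f = begin
  ∑ (suc n) (λ i → 𝟙 (i == suc a) * f i)        ≡⟨ ∑-suc n (λ i → 𝟙 (i == suc a) * f i) ⟩
  ∑ n (λ i → 𝟙 (suc i == suc a) * f (suc i))    ≡⟨ ∑-cong n (λ i → cong (λ b → 𝟙 b * f (suc i)) (==-suc i a)) ⟩
  ∑ n (λ i → 𝟙 (i == a) * f (suc i))            ≡⟨ ∑-δ a (f ∘ suc) ⟩
  f (suc a) ∎
  where open ≡-Reasoning

∑-unique≤1 : ∀ n (p : Fin n → Bool) → (∀ i j → p i ≡ true → p j ≡ true → i ≡ j) → ∑ n (λ i → 𝟙 (p i)) ≤ 1
∑-unique≤1 zero    p h = z≤n
∑-unique≤1 (suc n) p h = subst (_≤ 1) (≡-sym (∑-suc n (λ i → 𝟙 (p i)))) (go (p zero) refl)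
  where
  rest : p zero ≡ true → ∀ i → 𝟙 (p (suc i)) ≡ 0
  rest eq i with p (suc i) in eq′
  ... | true with () ← h zero (suc i) eq eq′
  ... | false = refl
  go : ∀ b → p zero ≡ b → 𝟙 (p zero) + ∑ n (λ i → 𝟙 (p (suc i))) ≤ 1
  go true  eq = ≤-reflexive (cong₂ _+_ (cong 𝟙 eq) (∑-zero n (rest eq)))
  go false eq = ≤-trans (≤-reflexive (cong (_+ ∑ n (λ i → 𝟙 (p (suc i)))) (cong 𝟙 eq)))
    (∑-unique≤1 n (p ∘ suc) (λ i j a b → suc-injectiveᶠ (h (suc i) (suc j) a b)))

card : ∀ {n} → (Fin n → Bool) → ℕ
card {n} p = ∑ n (λ x → 𝟙 (p x))

pairs : ∀ {n} → (Fin n → Bool) → ℕ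
pairs {n} p = ∑ n (λ x → ∑ n (λ y → 𝟙 (not (x == y)) * (𝟙 (p x) * 𝟙 (p y))))

𝟙-not : ∀ b → 𝟙 b + 𝟙 (not b) ≡ 1
𝟙-not true  = refl
𝟙-not false = refl

𝟙-idem : ∀ b → 𝟙 b * 𝟙 b ≡ 𝟙 b
𝟙-idem true  = refl
𝟙-idem false = refl

card² : ∀ {n} (p : Fin n → Bool) → card p * card p ≡ card p + pairs p
card² {n} p = begin
  card p * card p                                          ≡⟨ ≡-sym (∑ᴸ-*ʳ (allFin n) _ (card p)) ⟩
  ∑ n (λ x → 𝟙 (p x) * card p)                             ≡⟨ ∑-cong n row ⟩
  ∑ n (λ x → 𝟙 (p x) + ∑ n (λ y → 𝟙 (not (x == y)) * (𝟙 (p x) * 𝟙 (p y))))  ≡⟨ ∑ᴸ-+ (allFin n) _ _ ⟩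
  card p + pairs p ∎
  where
  open ≡-Reasoning
  row : ∀ x → 𝟙 (p x) * card p ≡ 𝟙 (p x) + ∑ n (λ y → 𝟙 (not (x == y)) * (𝟙 (p x) * 𝟙 (p y)))
  row x = begin
    𝟙 (p x) * card p                               ≡⟨ ≡-sym (∑ᴸ-* (allFin n) (𝟙 (p x)) _) ⟩
    ∑ n (λ y → 𝟙 (p x) * 𝟙 (p y))
      ≡⟨ ∑-cong n (λ y → trans (≡-sym (*-identityˡ _)) (trans (cong (_* (𝟙 (p x) * 𝟙 (p y))) (≡-sym (𝟙-not (y == x))))
           (*-distribʳ-+ (𝟙 (p x) * 𝟙 (p y)) (𝟙 (y == x)) _))) ⟩
    ∑ n (λ y → 𝟙 (y == x) * (𝟙 (p x) * 𝟙 (p y)) + 𝟙 (not (y == x)) * (𝟙 (p x) * 𝟙 (p y)))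
      ≡⟨ ∑ᴸ-+ (allFin n) _ _ ⟩
    ∑ n (λ y → 𝟙 (y == x) * (𝟙 (p x) * 𝟙 (p y))) + ∑ n (λ y → 𝟙 (not (y == x)) * (𝟙 (p x) * 𝟙 (p y)))
      ≡⟨ cong₂ _+_ (trans (∑-δ x (λ y → 𝟙 (p x) * 𝟙 (p y))) (𝟙-idem (p x)))
                   (∑-cong n (λ y → cong (λ b → 𝟙 (not b) * (𝟙 (p x) * 𝟙 (p y))) (==-sym y x))) ⟩
    𝟙 (p x) + ∑ n (λ y → 𝟙 (not (x == y)) * (𝟙 (p x) * 𝟙 (p y))) ∎

excess : ℕ → ℕ → ℕ → ℕ
excess δ u x = (x ∸ 2) * (suc x * u ∸ 2 * δ)

-- A line of x points weighs u + (x ∸ 2) * δ, and twice that plus excess δ u x is at least u x (x − 1).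
-- The total excess is largest for one line of s points and one of t − s + 1 points.
Extremal : (s t D δ u : ℕ) → Set
Extremal s t D δ u =
  2 * (D * (t ∸ 2) + u) + (excess δ u s + excess δ u (suc (t ∸ s))) + u * t ≤ u * (t * t)

-- Treats linear spaces in which every line has at most `t - s` points. There the total excess is at
-- most the number of ordered pairs of points times the ratio of excess to `x(x-1)` at `x = t - s`,
-- and this must not exceed the excess of one line of `s` points.
ShortLines : (s t δ u : ℕ) → Set
ShortLines s t δ u = (t * t ∸ t) * excess δ u (t ∸ s) ≤ (t ∸ s) * (t ∸ s ∸ 1) * excess δ u s

module LinearSpace
  (t M s D δ u : ℕ)
  (u≤δ : u ≤ δ) (s+2≤t : s + 2 ≤ t)
  (extremal : Extremal s t D δ u) (shortLines : ShortLines s t δ u)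
  (J : Fin M → Fin t → Bool)
  (cover : ∀ x y → x ≢ y → ∃[ B ] (J B x ≡ true × J B y ≡ true))
  (linear : ∀ x y → x ≢ y → ∀ B B′ → J B x ≡ true → J B y ≡ true → J B′ x ≡ true → J B′ y ≡ true → B ≡ B′)
  (short : ∀ B → card (J B) ≤ s)
  where

  private
    pos g : ℕ → ℕ
    pos x = suc x * u ∸ 2 * δ
    g x = (x ∸ 2) * pos x

    q : ℕ
    q = t ∸ s

    a : Fin M → ℕ
    a B = card (J B)

  weight : Fin M → ℕ
  weight B = if 2 ≤ᵇ a B then u + (a B ∸ 2) * δ else 0

  private
    pos-mono : ∀ {x y} → x ≤ y → pos x ≤ pos y
    pos-mono h = ∸-monoˡ-≤ (2 * δ) (*-monoˡ-≤ u (s≤s h))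

    g-mono : ∀ {x y} → x ≤ y → g x ≤ g y
    g-mono h = *-mono-≤ (∸-monoˡ-≤ 2 h) (pos-mono h)

    -- Without truncation `pos (suc c) / c` equals `u - 2(δ-u)/c`, which grows with `c` because
    -- `u ≤ δ`.
    pos-ratio : ∀ {b c} → c ≤ b → b * pos (suc c) ≤ c * pos (suc b)
    pos-ratio {b} {c} c≤b = begin
      b * (suc (suc c) * u ∸ 2 * δ)             ≡⟨ *-distribˡ-∸ b (suc (suc c) * u) (2 * δ) ⟩
      b * (suc (suc c) * u) ∸ b * (2 * δ)
        ≤⟨ m≤n+o⇒m∸n≤o _ _ (≤-trans main (+-monoʳ-≤ (b * (2 * δ)) (≤-refl))) ⟩
      c * (suc (suc b) * u) ∸ c * (2 * δ)       ≡⟨ ≡-sym (*-distribˡ-∸ c (suc (suc b) * u) (2 * δ)) ⟩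
      c * (suc (suc b) * u ∸ 2 * δ) ∎
      where
      open ≤-Reasoning
      e : ℕ
      e = b ∸ c
      b≡ : b ≡ c + e
      b≡ = ≡-sym (m+[n∸m]≡n c≤b)
      main : b * (suc (suc c) * u) ≤ b * (2 * δ) + (c * (suc (suc b) * u) ∸ c * (2 * δ))
      main = begin
        b * (suc (suc c) * u)
          ≡⟨ cong (λ b → b * (suc (suc c) * u)) b≡ ⟩
        (c + e) * (suc (suc c) * u)
          ≡⟨ solve 3 (λ c e u → (c :+ e) :* ((con 2 :+ c) :* u) := c :* ((con 2 :+ (c :+ e)) :* u) :+ e :* (con 2 :* u)) refl c e u ⟩
        c * (suc (suc (c + e)) * u) + e * (2 * u)
          ≡⟨ cong (λ b → c * (suc (suc b) * u) + e * (2 * u)) (≡-sym b≡) ⟩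
        c * (suc (suc b) * u) + e * (2 * u)
          ≤⟨ +-mono-≤ (m≤n+m∸n (c * (suc (suc b) * u)) (c * (2 * δ))) (*-monoʳ-≤ e (*-monoʳ-≤ 2 u≤δ)) ⟩
        (c * (2 * δ) + (c * (suc (suc b) * u) ∸ c * (2 * δ))) + e * (2 * δ)
          ≡⟨ solve 4 (λ c r e d → (c :* d :+ r) :+ e :* d := (c :+ e) :* d :+ r) refl c _ e (2 * δ) ⟩
        (c + e) * (2 * δ) + (c * (suc (suc b) * u) ∸ c * (2 * δ))
          ≡⟨ cong (λ x → x * (2 * δ) + (c * (suc (suc b) * u) ∸ c * (2 * δ))) (≡-sym b≡) ⟩
        b * (2 * δ) + (c * (suc (suc b) * u) ∸ c * (2 * δ)) ∎

    ∸-convex : ∀ α β e c → α ≤ β → (α + e ∸ c) + (β ∸ c) ≤ (β + e ∸ c) + (α ∸ c)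
    ∸-convex α β e c α≤β with c ≤? α
    ... | yes c≤α = ≤-reflexive (trans (cong (_+ (β ∸ c)) (+-∸-comm e c≤α))
          (trans (solve 3 (λ x e y → (x :+ e) :+ y := (y :+ e) :+ x) refl (α ∸ c) e (β ∸ c))
                 (cong (_+ (α ∸ c)) (≡-sym (+-∸-comm e (≤-trans c≤α α≤β))))))
    ... | no c≰α with c ≤? β
    ...   | yes c≤β = ≤-trans (+-monoˡ-≤ (β ∸ c) (≤-trans (∸-monoˡ-≤ c (+-monoˡ-≤ e (<⇒≤ (≰⇒> c≰α)))) (≤-reflexive (m+n∸m≡n c e))))
                     (≤-trans (≤-reflexive (trans (+-comm e _) (≡-sym (+-∸-comm e c≤β)))) (m≤m+n _ _))
    ...   | no c≰β  = ≤-trans (≤-reflexive (trans (cong ((α + e ∸ c) +_) (m≤n⇒m∸n≡0 (<⇒≤ (≰⇒> c≰β)))) (+-identityʳ _)))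
                     (≤-trans (∸-monoˡ-≤ c (+-monoˡ-≤ e α≤β)) (m≤m+n _ _))

    pos-convex : ∀ lo r i → lo ≤ r → pos (lo + i) + pos r ≤ pos (r + i) + pos lo
    pos-convex lo r i lo≤r = subst₂′ (split lo) (split r) (∸-convex (suc lo * u) (suc r * u) (i * u) (2 * δ) (*-monoˡ-≤ u (s≤s lo≤r)))
      where
      split : ∀ x → suc x * u + i * u ≡ suc (x + i) * u
      split x = ≡-sym (*-distribʳ-+ u (suc x) i)
      subst₂′ : ∀ {x x′ y y′} → x ≡ x′ → y ≡ y′ → (x ∸ 2 * δ) + pos r ≤ (y ∸ 2 * δ) + pos lo → (x′ ∸ 2 * δ) + pos r ≤ (y′ ∸ 2 * δ) + pos lo
      subst₂′ refl refl h = h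

    -- A product of two nonnegative, nondecreasing, convex functions is convex. The bound `2 ≤ lo`
    -- keeps the factor `x ∸ 2` linear.
    g-convex : ∀ lo r i → 2 ≤ lo → lo ≤ r → g (lo + i) + g r ≤ g (r + i) + g lo
    g-convex lo r i 2≤lo lo≤r = begin
      (lo + i ∸ 2) * p₁ + Y * p₂      ≡⟨ cong (λ z → z * p₁ + Y * p₂) (+-∸-comm i 2≤lo) ⟩
      (X + i) * p₁ + Y * p₂           ≡⟨ cong (λ z → (X + i) * z + Y * p₂) p₁≡ ⟩
      (X + i) * (p₀ + e) + Y * p₂     ≡⟨ solve 6 (λ X i p e Y q → (X :+ i) :* (p :+ e) :+ Y :* q := i :* (p :+ e) :+ X :* p :+ (X :* e :+ Y :* q)) refl X i p₀ e Y p₂ ⟩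
      i * (p₀ + e) + X * p₀ + (X * e + Y * p₂)
        ≤⟨ +-mono-≤ (+-monoˡ-≤ (X * p₀) (*-monoʳ-≤ i (≤-trans (≤-reflexive (≡-sym p₁≡)) (pos-mono (+-monoˡ-≤ i lo≤r))))) (+-monoˡ-≤ (Y * p₂) (*-monoˡ-≤ e X≤Y)) ⟩
      i * p₃ + X * p₀ + (Y * e + Y * p₂)
        ≡⟨ solve 6 (λ A X p Y e q → A :+ X :* p :+ (Y :* e :+ Y :* q) := A :+ Y :* (e :+ q) :+ X :* p) refl (i * p₃) X p₀ Y e p₂ ⟩
      i * p₃ + Y * (e + p₂) + X * p₀  ≤⟨ +-monoˡ-≤ (X * p₀) (+-monoʳ-≤ (i * p₃) (*-monoʳ-≤ Y e+p₂≤)) ⟩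
      i * p₃ + Y * p₃ + X * p₀        ≡⟨ solve 4 (λ i Y p A → i :* p :+ Y :* p :+ A := (Y :+ i) :* p :+ A) refl i Y p₃ (X * p₀) ⟩
      (Y + i) * p₃ + X * p₀           ≡⟨ cong (λ z → z * p₃ + X * p₀) (≡-sym (+-∸-comm i (≤-trans 2≤lo lo≤r))) ⟩
      (r + i ∸ 2) * p₃ + X * p₀ ∎
      where
      open ≤-Reasoning
      X Y p₀ p₁ p₂ p₃ e : ℕ
      X = lo ∸ 2
      Y = r ∸ 2
      p₀ = pos lo
      p₁ = pos (lo + i)
      p₂ = pos r
      p₃ = pos (r + i)
      e = p₁ ∸ p₀
      X≤Y : X ≤ Y
      X≤Y = ∸-monoˡ-≤ 2 lo≤r
      p₁≡ : p₁ ≡ p₀ + e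
      p₁≡ = ≡-sym (m+[n∸m]≡n (pos-mono (m≤m+n lo i)))
      e+p₂≤ : e + p₂ ≤ p₃
      e+p₂≤ = +-cancelˡ-≤ p₀ _ _ (≤-trans (≤-reflexive (trans (≡-sym (+-assoc p₀ e p₂)) (cong (_+ p₂) (≡-sym p₁≡))))
        (≤-trans (pos-convex lo r i lo≤r) (≤-reflexive (+-comm p₃ p₀))))

    s≤t : s ≤ t
    s≤t = ≤-trans (m≤m+n s 2) s+2≤t
    t≡s+q : t ≡ s + q
    t≡s+q = ≡-sym (m+[n∸m]≡n s≤t)
    2≤q : 2 ≤ q
    2≤q = subst (_≤ q) (m+n∸m≡n s 2) (∸-monoˡ-≤ s s+2≤t)

    -- Two points lie on at most one line, so the traces of the lines on `Y` use every pair at most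
    -- once.
    extend : (Y : Fin t → Bool) → ∑ M (λ B → pairs (λ x → Y x ∧ J B x)) ≤ pairs Y
    extend Y = begin
      ∑ M (λ B → pairs (λ x → Y x ∧ J B x))
        ≡⟨ trans (∑ᴸ-swap (allFin M) (allFin t) _) (∑-cong t (λ x → ∑ᴸ-swap (allFin M) (allFin t) _)) ⟩
      ∑ t (λ x → ∑ t (λ y → ∑ M (λ B → 𝟙 (not (x == y)) * (𝟙 (Y x ∧ J B x) * 𝟙 (Y y ∧ J B y)))))
        ≤⟨ ∑-mono t (λ x → ∑-mono t (λ y → cell x y)) ⟩
      pairs Y ∎
      where
      open ≤-Reasoning
      cell : ∀ x y → ∑ M (λ B → 𝟙 (not (x == y)) * (𝟙 (Y x ∧ J B x) * 𝟙 (Y y ∧ J B y))) ≤ 𝟙 (not (x == y)) * (𝟙 (Y x) * 𝟙 (Y y))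
      cell x y with x ≟ᶠ y
      ... | yes _ = ≤-reflexive (∑-zero M (λ B → refl))
      ... | no x≢y with Y x | Y y
      ...   | false | _     = ≤-reflexive (∑-zero M (λ B → refl))
      ...   | true  | false = ≤-reflexive (∑-zero M (λ B → trans (+-identityʳ _) (*-zeroʳ (𝟙 (J B x)))))
      ...   | true  | true  = ≤-trans (≤-reflexive (∑-cong M (λ B → trans (+-identityʳ _) (and (J B x) (J B y)))))
                (∑-unique≤1 M (λ B → J B x ∧ J B y) (λ B B′ h h′ → linear x y x≢y B B′ (∧ˡ h) (∧ʳ (J B x) h) (∧ˡ h′) (∧ʳ (J B′ x) h′)))
        where
        and : ∀ b c → 𝟙 b * 𝟙 c ≡ 𝟙 (b ∧ c)
        and true  c = +-identityʳ _
        and false c = refl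
        ∧ˡ : ∀ {b c} → b ∧ c ≡ true → b ≡ true
        ∧ˡ {true} _ = refl
        ∧ʳ : ∀ b {c} → b ∧ c ≡ true → c ≡ true
        ∧ʳ true h = h

    coverAll : pairs {t} (λ _ → true) ≤ ∑ M (λ B → pairs (J B))
    coverAll = begin
      pairs {t} (λ _ → true)     ≤⟨ ∑-mono t (λ x → ∑-mono t (λ y → cell x y)) ⟩
      ∑ t (λ x → ∑ t (λ y → ∑ M (λ B → 𝟙 (not (x == y)) * (𝟙 (J B x) * 𝟙 (J B y)))))
        ≡⟨ ≡-sym (trans (∑ᴸ-swap (allFin M) (allFin t) _) (∑-cong t (λ x → ∑ᴸ-swap (allFin M) (allFin t) _))) ⟩
      ∑ M (λ B → pairs (J B)) ∎
      where
      open ≤-Reasoning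
      cell : ∀ x y → 𝟙 (not (x == y)) * 1 ≤ ∑ M (λ B → 𝟙 (not (x == y)) * (𝟙 (J B x) * 𝟙 (J B y)))
      cell x y with x ≟ᶠ y
      ... | yes _ = z≤n
      ... | no x≢y with cover x y x≢y
      ...   | B , p , q = ≤-trans (≤-reflexive (≡-sym (cong₂ (λ b c → 1 * (𝟙 b * 𝟙 c)) p q))) (∑-term M _ B)

    card-all : card {t} (λ _ → true) ≡ t
    card-all = ∑-1 t

    pairs≡ : ∀ {n} (p : Fin n → Bool) → pairs p ≡ card p * card p ∸ card p
    pairs≡ p = ≡-sym (trans (cong (_∸ card p) (card² p)) (m+n∸m≡n (card p) (pairs p)))

    ut² : u * (t * t) ≤ u * ∑ M (λ B → pairs (J B)) + u * t
    ut² = ≤-trans (*-monoʳ-≤ u (≤-trans (≤-reflexive (subst (λ c → c * c ≡ c + pairs {t} (λ _ → true)) card-all (card² {t} (λ _ → true))))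
            (≤-trans (+-monoʳ-≤ t coverAll) (≤-reflexive (+-comm t _))))) (≤-reflexive (*-distribˡ-+ u _ t))

    -- From `x(x-1) = 2 + (x-2)(x+1)`: replacing `(x+1)u` by `2δ` turns the left side into twice the
    -- weight, and `g` pays for the cases where `(x+1)u` is larger.
    line-weight : ∀ B → u * pairs (J B) ≤ 2 * weight B + g (a B)
    line-weight B = subst (λ z → u * z ≤ 2 * weight B + g (a B)) (≡-sym (pairs≡ (J B))) (go (a B))
      where
      go : ∀ x → u * (x * x ∸ x) ≤ 2 * (if 2 ≤ᵇ x then u + (x ∸ 2) * δ else 0) + g x
      go 0 = ≤-reflexive (*-zeroʳ u)
      go 1 = ≤-trans (≤-reflexive (*-zeroʳ u)) z≤n
      go (suc (suc k)) = begin
        u * (x * x ∸ x)          ≡⟨ cong (u *_) (m+n∸m≡n x (suc k * x)) ⟩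
        u * (suc k * x)          ≡⟨ solve 2 (λ u k → u :* ((con 1 :+ k) :* (con 2 :+ k)) := con 2 :* u :+ k :* ((con 3 :+ k) :* u)) refl u k ⟩
        2 * u + k * (suc x * u)  ≤⟨ +-monoʳ-≤ (2 * u) (*-monoʳ-≤ k (m≤n+m∸n (suc x * u) (2 * δ))) ⟩
        2 * u + k * (2 * δ + pos x)
          ≡⟨ solve 4 (λ u k d p → con 2 :* u :+ k :* (con 2 :* d :+ p) := con 2 :* (u :+ k :* d) :+ k :* p) refl u k δ (pos x) ⟩
        2 * (u + k * δ) + k * pos x ∎
        where
        open ≤-Reasoning
        x : ℕ
        x = suc (suc k)

    meet≤1 : ∀ A B → A ≢ B → card (λ x → J A x ∧ J B x) ≤ 1
    meet≤1 A B A≢B = small _ (trans (card² p) (trans (cong (card p +_) none) (+-identityʳ _)))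
      where
      p : Fin t → Bool
      p x = J A x ∧ J B x
      none : pairs p ≡ 0
      none = ∑-zero t (λ x → ∑-zero t (λ y → cell x y))
        where
        cell : ∀ x y → 𝟙 (not (x == y)) * (𝟙 (p x) * 𝟙 (p y)) ≡ 0
        cell x y with x ≟ᶠ y
        ... | yes _ = refl
        ... | no x≢y with J A x in ax | J B x in bx | J A y in ay | J B y in by
        ...   | true | true | true | true = ⊥-elim (A≢B (linear x y x≢y A B ax ay bx by))
        ...   | true | true | true | false = refl
        ...   | true | true | false | _ = refl
        ...   | true | false | _ | _ = refl
        ...   | false | _ | _ | _ = refl
      small : ∀ c → c * c ≡ c → c ≤ 1
      small 0 _ = z≤n
      small 1 _ = ≤-refl
      small (suc (suc c)) h = ⊥-elim (m+1+n≢m (suc (suc c)) h)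

    argmax : ∀ {n} → Fin n → (f : Fin n → ℕ) → ∃[ i ] ∀ j → f j ≤ f i
    argmax {suc zero}    _ f = zero , λ { zero → ≤-refl }
    argmax {suc (suc n)} _ f with argmax zero (f ∘ suc)
    ... | i , h with f (suc i) ≤? f zero
    ...   | yes p = zero , λ { zero → ≤-refl ; (suc j) → ≤-trans (h j) p }
    ...   | no p  = suc i , λ { zero → <⇒≤ (≰⇒> p) ; (suc j) → h j }

    module _ (A : Fin M) (longest : ∀ B → a B ≤ a A) where

      outside : Fin M → Fin t → Bool
      outside B x = not (J A x) ∧ J B x
      Y : Fin t → Bool
      Y x = not (J A x)
      b : ℕ
      b = card Y
      c : Fin M → ℕ
      c B = card (outside B)

      a+b : a A + b ≡ t
      a+b = trans (≡-sym (∑ᴸ-+ (allFin t) _ _)) (trans (∑-cong t (λ x → 𝟙-not (J A x))) (∑-1 t))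

      c≤b : ∀ B → c B ≤ b
      c≤b B = ∑-mono t (λ x → ∧≤ (not (J A x)) (J B x))
        where
        ∧≤ : ∀ b c → 𝟙 (b ∧ c) ≤ 𝟙 b
        ∧≤ true  c = 𝟙≤1 c
        ∧≤ false c = z≤n

      a≤1+c : ∀ B → A ≢ B → a B ≤ suc (c B)
      a≤1+c B A≢B = ≤-trans (≤-reflexive (trans (∑-cong t (λ x → split (J A x) (J B x))) (∑ᴸ-+ (allFin t) _ _))) (+-monoˡ-≤ (c B) (meet≤1 A B A≢B))
        where
        split : ∀ b c → 𝟙 c ≡ 𝟙 (b ∧ c) + 𝟙 (not b ∧ c)
        split true  c = ≡-sym (+-identityʳ _)
        split false c = refl

      b-pos : 2 ≤ b
      b-pos = ≤-trans 2≤q (+-cancelˡ-≤ s _ _ (≤-trans (≤-reflexive (≡-sym t≡s+q)) (≤-trans (≤-reflexive (≡-sym a+b)) (+-monoˡ-≤ b (short A)))))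

      -- A line other than `A` with `c` points outside `A` has at most `c+1` points. By `pos-ratio`,
      -- `b * g (c+1)` is at most `c(c-1) * pos (b+1)`, and the numbers `c(c-1)` add up to at most
      -- `b(b-1)` by `extend`.
      others : b * ∑ M (λ B → 𝟙 (not (B == A)) * g (a B)) ≤ b * g (suc b)
      others = begin
        b * ∑ M (λ B → 𝟙 (not (B == A)) * g (a B))    ≡⟨ ≡-sym (∑ᴸ-* (allFin M) b _) ⟩
        ∑ M (λ B → b * (𝟙 (not (B == A)) * g (a B)))  ≤⟨ ∑-mono M each ⟩
        ∑ M (λ B → pairs (outside B) * pos (suc b))   ≡⟨ ∑ᴸ-*ʳ (allFin M) _ (pos (suc b)) ⟩
        ∑ M (λ B → pairs (outside B)) * pos (suc b)   ≤⟨ *-monoˡ-≤ (pos (suc b)) (extend Y) ⟩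
        pairs Y * pos (suc b)                         ≡⟨ cong (_* pos (suc b)) (trans (pairs≡ Y) (sq b)) ⟩
        b * (b ∸ 1) * pos (suc b)                     ≡⟨ *-assoc b (b ∸ 1) (pos (suc b)) ⟩
        b * g (suc b) ∎
        where
        open ≤-Reasoning
        sq : ∀ b → b * b ∸ b ≡ b * (b ∸ 1)
        sq b = trans (cong (b * b ∸_) (≡-sym (*-identityʳ b))) (≡-sym (*-distribˡ-∸ b b 1))
        each : ∀ B → b * (𝟙 (not (B == A)) * g (a B)) ≤ pairs (outside B) * pos (suc b)
        each B with B ≟ᶠ A
        ... | yes _ = ≤-trans (≤-reflexive (*-zeroʳ b)) z≤n
        ... | no B≢A = begin
          b * (1 * g (a B))                 ≡⟨ cong (b *_) (*-identityˡ _) ⟩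
          b * g (a B)                       ≤⟨ *-monoʳ-≤ b (g-mono (a≤1+c B (B≢A ∘ ≡-sym))) ⟩
          b * ((c B ∸ 1) * pos (suc (c B))) ≡⟨ solve 3 (λ b x p → b :* (x :* p) := x :* (b :* p)) refl b (c B ∸ 1) _ ⟩
          (c B ∸ 1) * (b * pos (suc (c B))) ≤⟨ *-monoʳ-≤ (c B ∸ 1) (pos-ratio (c≤b B)) ⟩
          (c B ∸ 1) * (c B * pos (suc b))   ≡⟨ solve 3 (λ x c p → x :* (c :* p) := c :* x :* p) refl (c B ∸ 1) (c B) _ ⟩
          c B * (c B ∸ 1) * pos (suc b)     ≡⟨ cong (_* pos (suc b)) (≡-sym (trans (pairs≡ (outside B)) (sq (c B)))) ⟩
          pairs (outside B) * pos (suc b) ∎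

      split-off : ∑ M (λ B → g (a B)) ≤ g (a A) + g (suc b)
      split-off = begin
        ∑ M (λ B → g (a B))
          ≡⟨ ∑-cong M (λ B → trans (≡-sym (*-identityˡ _)) (trans (cong (_* g (a B)) (≡-sym (𝟙-not (B == A)))) (*-distribʳ-+ (g (a B)) (𝟙 (B == A)) _))) ⟩
        ∑ M (λ B → 𝟙 (B == A) * g (a B) + 𝟙 (not (B == A)) * g (a B))
          ≡⟨ trans (∑ᴸ-+ (allFin M) _ _) (cong₂ _+_ (∑-δ A (g ∘ a)) refl) ⟩
        g (a A) + ∑ M (λ B → 𝟙 (not (B == A)) * g (a B))
          ≤⟨ +-monoʳ-≤ (g (a A)) (*-cancelˡ-≤′ b (≤-trans (s≤s z≤n) b-pos) others) ⟩
        g (a A) + g (suc b) ∎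
        where open ≤-Reasoning

      -- The arguments in `g (a A) + g (suc b)` have the constant sum `s + (q+1)`. If both are at
      -- least `q+1`, convexity moves them to the extreme `s` and `q+1`. Otherwise no line has more
      -- than `q` points, and comparing `g x` with `x(x-1)` leaves the case of `shortLines`.
      lines≤ : ∑ M (λ B → g (a B)) ≤ g s + g (suc q)
      lines≤ with suc q ≤? a A
      ... | yes q<a = ≤-trans split-off (subst₂′ lo≡ r≡ (g-convex (suc q) (suc b) (a A ∸ suc q) (m≤n⇒m≤1+n 2≤q) (s≤s q≤b)))
        where
        q≤b : q ≤ b
        q≤b = +-cancelˡ-≤ s _ _ (≤-trans (≤-reflexive (trans (≡-sym t≡s+q) (≡-sym a+b))) (+-monoˡ-≤ b (short A)))
        lo≡ : suc q + (a A ∸ suc q) ≡ a A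
        lo≡ = m+[n∸m]≡n q<a
        r≡ : suc b + (a A ∸ suc q) ≡ s
        r≡ = +-cancelˡ-≡ q _ _ (trans (solve 3 (λ q b e → q :+ ((con 1 :+ b) :+ e) := ((con 1 :+ q) :+ e) :+ b) refl q b (a A ∸ suc q))
               (trans (cong (_+ b) lo≡) (trans a+b (trans t≡s+q (+-comm s q)))))
        subst₂′ : ∀ {x x′ y y′} → x ≡ x′ → y ≡ y′ → g x + g (suc b) ≤ g y + g (suc q) → g x′ + g (suc b) ≤ g y′ + g (suc q)
        subst₂′ refl refl h = h
      ... | no q≮a = ≤-trans (*-cancelˡ-≤′ (q * (q ∸ 1)) (*-mono-≤ (≤-trans (s≤s z≤n) 2≤q) (∸-monoˡ-≤ 1 2≤q)) main) (m≤m+n _ _)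
        where
        open ≤-Reasoning
        a≤q : ∀ B → a B ≤ q
        a≤q B = ≤-trans (longest B) (≤-pred (≰⇒> q≮a))
        sq : ∀ b → b * b ∸ b ≡ b * (b ∸ 1)
        sq b = trans (cong (b * b ∸_) (≡-sym (*-identityʳ b))) (≡-sym (*-distribˡ-∸ b b 1))
        ratio : ∀ x → x ≤ q → q * (q ∸ 1) * g x ≤ (x * x ∸ x) * g q
        ratio 0 h = ≤-reflexive (*-zeroʳ (q * (q ∸ 1)))
        ratio (suc x) h = begin
          q * (q ∸ 1) * ((suc x ∸ 2) * pos (suc x))   ≡⟨ *-interchange q (q ∸ 1) (suc x ∸ 2) _ ⟩
          (q * (suc x ∸ 2)) * ((q ∸ 1) * pos (suc x)) ≤⟨ *-mono-≤ left right ⟩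
          (suc x * (q ∸ 2)) * (x * pos q)             ≡⟨ *-interchange (suc x) (q ∸ 2) x (pos q) ⟩
          suc x * x * g q                             ≡⟨ cong (_* g q) (≡-sym (sq (suc x))) ⟩
          (suc x * suc x ∸ suc x) * g q ∎
          where
          left : q * (suc x ∸ 2) ≤ suc x * (q ∸ 2)
          left = begin
            q * (suc x ∸ 2)        ≡⟨ *-distribˡ-∸ q (suc x) 2 ⟩
            q * suc x ∸ q * 2      ≤⟨ ∸-mono (≤-reflexive (*-comm q (suc x))) (*-monoˡ-≤ 2 h) ⟩
            suc x * q ∸ suc x * 2  ≡⟨ ≡-sym (*-distribˡ-∸ (suc x) q 2) ⟩
            suc x * (q ∸ 2) ∎
          right : (q ∸ 1) * pos (suc x) ≤ x * pos q
          right = subst (λ z → (q ∸ 1) * pos (suc x) ≤ x * pos z) (m+[n∸m]≡n (≤-trans (s≤s z≤n) 2≤q)) (pos-ratio (∸-monoˡ-≤ 1 h))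
        main : q * (q ∸ 1) * ∑ M (λ B → g (a B)) ≤ q * (q ∸ 1) * g s
        main = begin
          q * (q ∸ 1) * ∑ M (λ B → g (a B))     ≡⟨ ≡-sym (∑ᴸ-* (allFin M) (q * (q ∸ 1)) _) ⟩
          ∑ M (λ B → q * (q ∸ 1) * g (a B))     ≤⟨ ∑-mono M (λ B → ≤-trans (ratio (a B) (a≤q B)) (≤-reflexive (cong (_* g q) (≡-sym (pairs≡ (J B)))))) ⟩
          ∑ M (λ B → pairs (J B) * g q)         ≡⟨ ∑ᴸ-*ʳ (allFin M) _ (g q) ⟩
          ∑ M (λ B → pairs (J B)) * g q         ≤⟨ *-monoˡ-≤ (g q) (extend (λ _ → true)) ⟩
          pairs {t} (λ _ → true) * g q          ≡⟨ cong (_* g q) (trans (pairs≡ {t} (λ _ → true)) (cong (λ z → z * z ∸ z) card-all)) ⟩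
          (t * t ∸ t) * g q                     ≤⟨ shortLines ⟩
          q * (q ∸ 1) * g s ∎

  -- Counts `u` times the ordered pairs of points by lines. The result says that `D t` minus the
  -- total weight is at most `2D - u`, the exponent of a single edge. The argument only ensures that
  -- there is a line, so that a longest one exists.
  lines : Fin M → D * (t ∸ 2) + u ≤ ∑ M weight
  lines B₀ = *-cancelˡ-≤′ 2 (s≤s z≤n) (+-cancelʳ-≤ (G + u * t) _ _ (begin
    2 * (D * (t ∸ 2) + u) + (G + u * t)           ≡⟨ ≡-sym (+-assoc (2 * (D * (t ∸ 2) + u)) G (u * t)) ⟩
    2 * (D * (t ∸ 2) + u) + G + u * t             ≤⟨ extremal ⟩
    u * (t * t)                                   ≤⟨ ut² ⟩
    u * ∑ M (λ B → pairs (J B)) + u * t           ≤⟨ +-monoˡ-≤ (u * t) sum≤ ⟩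
    2 * ∑ M weight + G + u * t                    ≡⟨ +-assoc (2 * ∑ M weight) G (u * t) ⟩
    2 * ∑ M weight + (G + u * t) ∎))
    where
    open ≤-Reasoning
    G : ℕ
    G = g s + g (suc q)
    G≥ : ∑ M (λ B → g (a B)) ≤ G
    G≥ = lines≤ (proj₁ (argmax B₀ a)) (proj₂ (argmax B₀ a))
    sum≤ : u * ∑ M (λ B → pairs (J B)) ≤ 2 * ∑ M weight + G
    sum≤ = begin
      u * ∑ M (λ B → pairs (J B))                ≡⟨ ≡-sym (∑ᴸ-* (allFin M) u _) ⟩
      ∑ M (λ B → u * pairs (J B))                ≤⟨ ∑-mono M line-weight ⟩
      ∑ M (λ B → 2 * weight B + g (a B))         ≡⟨ trans (∑ᴸ-+ (allFin M) _ _) (cong₂ _+_ (∑ᴸ-* (allFin M) 2 weight) refl) ⟩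
      2 * ∑ M weight + ∑ M (λ B → g (a B))       ≤⟨ +-monoʳ-≤ (2 * ∑ M weight) G≥ ⟩
      2 * ∑ M weight + G ∎

-- The exponents

-- A vertex lies in a given blob with probability about N^(−δ/D), so blobs have about N^(num/D) = N^α
-- vertices; two vertices share a blob with probability about N^(−u/D).
Exponents : (s t D num δ u : ℕ) → Set
Exponents s t D num δ u =
  D ≡ num + δ × u + (s ∸ 2) * δ ≡ (s ∸ 1) * num × 1 ≤ num × num < δ × 1 ≤ u × u < δ ×
  Extremal s t D δ u × ShortLines s t δ u

record HasExponents (s t : ℕ) : Set where
  field
    {δ} {u} : ℕ
    holds   : Exponents s t (alphaDen s t) (alphaNum s t) δ u

private
  -- Decided by evaluation, since `t` is at most 19. This disposes of the two sporadic regular pairs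
  -- and of all exceptional pairs with `s` at most 10. The two equations leave no choice for `δ` and
  -- `u`.
  smallCase : ∀ {s} → s < 11 → ∀ {t} → t < 20 → 3 ≤ s → s + 2 ≤ t → t ≤ 2 * s ∸ 1 →
    let D = alphaDen s t; num = alphaNum s t; δ = D ∸ num in
    Exponents s t D num δ ((s ∸ 1) * num ∸ (s ∸ 2) * δ)
  smallCase {s} s<11 = toWitness {a? = allUpTo? (λ s → allUpTo? (λ t →
      3 ≤? s →-dec (s + 2 ≤? t →-dec (t ≤? 2 * s ∸ 1 →-dec exponents? s t))) 20) 11} _ s<11
    where
    exponents? : ∀ s t → let D = alphaDen s t; num = alphaNum s t; δ = D ∸ num in
      Dec (Exponents s t D num δ ((s ∸ 1) * num ∸ (s ∸ 2) * δ))
    exponents? s t = _ ≟ _ ×-dec _ ≟ _ ×-dec _ ≤? _ ×-dec _ ≤? _ ×-dec _ ≤? _ ×-dec _ ≤? _ ×-dec _ ≤? _ ×-dec _ ≤? _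

  -- Once neither excess is truncated, the condition `Extremal` is polynomial and can be left to the
  -- solver.
  ∸-extremal : ∀ L σ κ A B c R → c ≤ A → c ≤ B → L + σ * A + κ * B ≤ R + (σ + κ) * c →
    L + (σ * (A ∸ c) + κ * (B ∸ c)) ≤ R
  ∸-extremal L σ κ A B c R c≤A c≤B h = +-cancelʳ-≤ ((σ + κ) * c) _ _ (≤-trans (≤-reflexive (begin
    L + (σ * (A ∸ c) + κ * (B ∸ c)) + (σ + κ) * c
      ≡⟨ solve 6 (λ L σ κ a b c → L :+ (σ :* a :+ κ :* b) :+ (σ :+ κ) :* c := L :+ σ :* (a :+ c) :+ κ :* (b :+ c)) refl L σ κ (A ∸ c) (B ∸ c) c ⟩
    L + σ * (A ∸ c + c) + κ * (B ∸ c + c)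
      ≡⟨ cong₂ (λ x y → L + σ * x + κ * y) (m∸n+n≡m c≤A) (m∸n+n≡m c≤B) ⟩
    L + σ * A + κ * B ∎)) h)
    where open ≡-Reasoning

  weaken : ∀ {x y z : ℕ} → y ≡ x + z → x ≤ y
  weaken {x} {y} {z} h = ≤-trans (m≤m+n x z) (≤-reflexive (≡-sym h))

  -- Here `q = t - s` and `ρ = 2s - t`. In these cases both lines of the extremal space, with `s`
  -- and `q+1` points, have untruncated excess, and `Extremal` becomes an equality: this is the
  -- equation that defines the exceptional exponent.
  module Exceptional (j κ ρ : ℕ) (κ+ρ : suc κ + ρ ≡ 3 + j) (1≤κ : 1 ≤ κ) (1≤ρ : 1 ≤ ρ) where
    n s q t num δ u : ℕ
    n = suc j
    s = 2 + n
    q = suc κ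
    t = s + q
    num = suc n * (n * q + 1)
    δ = q * (s * n) + 1
    u = n * q + (n * n + n + 1)

    t∸s : t ∸ s ≡ q
    t∸s = m+n∸m≡n s q

    2s∸t : 2 * s ∸ t ≡ ρ
    2s∸t = trans ([m+n]∸[m+o]≡n∸o s (s + 0) q) (trans (cong (_∸ q) (trans (+-identityʳ s) (≡-sym κ+ρ))) (m+n∸m≡n q ρ))

    module _ (irregular : regularᵇ s t ≡ false) where
      num≡ : alphaNum s t ≡ num
      num≡ = trans (cong (λ b → if b then (s ∸ 2) * (t ∸ s) * (t + s ∸ 1) + 2 * (t ∸ s) else (s ∸ 2) * (t ∸ s) * (s ∸ 1) + (s ∸ 1)) irregular)
        (trans (cong (λ x → n * x * suc n + suc n) t∸s)
          (solve 2 (λ n q → n :* q :* (con 1 :+ n) :+ (con 1 :+ n) := (con 1 :+ n) :* (n :* q :+ con 1)) refl n q))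

      den≡ : alphaDen s t ≡ num + δ
      den≡ = trans (cong (λ b → if b then ((2 * s ∸ 3) * (t ∸ s) * (t + s ∸ 1) + 4) ∸ 2 * s else (2 * s ∸ 3) * (t ∸ s) * (s ∸ 1) + (2 * s ∸ t)) irregular)
        (trans (cong₂ (λ x y → (j + (s + 0)) * x * suc n + y) t∸s 2s∸t)
          (+-cancelʳ-≡ q _ _ (trans (solve 4 (λ a b c d → a :* b :* c :+ d :+ b := a :* b :* c :+ (b :+ d)) refl (j + (s + 0)) q (suc n) ρ)
            (trans (cong ((j + (s + 0)) * q * suc n +_) κ+ρ)
              (solve 2 (λ j q → (j :+ ((con 3 :+ j) :+ con 0)) :* q :* (con 2 :+ j) :+ (con 3 :+ j)
                := (con 2 :+ j) :* ((con 1 :+ j) :* q :+ con 1) :+ (q :* ((con 3 :+ j) :* (con 1 :+ j)) :+ con 1) :+ q) refl j q)))))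

      exponents′ : 2 * δ ≤ suc (suc q) * u → (t * t ∸ t) * excess δ u q ≤ q * (q ∸ 1) * excess δ u s →
        Exponents s t (alphaDen s t) (alphaNum s t) δ u
      exponents′ long shortLines = subst₂ (λ a b → Exponents s t a b δ u) (≡-sym den≡) (≡-sym num≡) (
        refl ,
        solve 2 (λ n q → n :* q :+ (n :* n :+ n :+ con 1) :+ n :* (q :* ((con 2 :+ n) :* n) :+ con 1) := (con 1 :+ n) :* ((con 1 :+ n) :* (n :* q :+ con 1))) refl n q ,
        s≤s z≤n ,
        ≤-trans (+-monoʳ-≤ 1 ≤-refl) (≤-trans (+-monoˡ-≤ num (*-mono-≤ 1≤κ (s≤s (z≤n {j})))) (≤-reflexive (solve 2 (λ n κ →
          κ :* n :+ (con 1 :+ n) :* (n :* (con 1 :+ κ) :+ con 1) := (con 1 :+ κ) :* ((con 2 :+ n) :* n) :+ con 1) refl n κ))) ,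
        s≤s z≤n ,
        ≤-trans (+-monoˡ-≤ u (*-mono-≤ 1≤κ (s≤s (z≤n {j + n * n})))) (≤-reflexive (solve 2 (λ n κ →
          κ :* (n :+ n :* n) :+ (n :* (con 1 :+ κ) :+ (n :* n :+ n :+ con 1)) := (con 1 :+ κ) :* ((con 2 :+ n) :* n) :+ con 1) refl n κ)) ,
        subst (λ x → 2 * ((num + δ) * (t ∸ 2) + u) + (excess δ u s + excess δ u (suc x)) + u * t ≤ u * (t * t)) (≡-sym t∸s) main ,
        subst (λ x → (t * t ∸ t) * excess δ u x ≤ x * (x ∸ 1) * excess δ u s) (≡-sym t∸s) shortLines)
        where
        q≤s : suc q ≤ s
        q≤s = ≤-trans (≤-trans (≤-reflexive (+-comm 1 q)) (+-monoʳ-≤ q 1≤ρ)) (≤-reflexive κ+ρ)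
        main : 2 * ((num + δ) * (t ∸ 2) + u) + (excess δ u s + excess δ u (suc q)) + u * t ≤ u * (t * t)
        main = ≤-trans (≤-reflexive (solve 3 (λ a b c → a :+ b :+ c := a :+ c :+ b) refl (2 * ((num + δ) * (t ∸ 2) + u)) (excess δ u s + excess δ u (suc q)) (u * t)))
          (∸-extremal (2 * ((num + δ) * (t ∸ 2) + u) + u * t) n κ (suc s * u) (suc (suc q) * u) (2 * δ) (u * (t * t))
            (≤-trans long (*-monoˡ-≤ u (s≤s q≤s)))
            long
            (≤-reflexive (solve 2 (λ n κ →
              let q = con 1 :+ κ ; s = con 2 :+ n ; t = s :+ q
                  num = (con 1 :+ n) :* (n :* q :+ con 1) ; δ = q :* (s :* n) :+ con 1
                  u = n :* q :+ (n :* n :+ n :+ con 1) in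
              con 2 :* ((num :+ δ) :* (n :+ q) :+ u) :+ u :* t :+ n :* ((con 1 :+ s) :* u) :+ κ :* ((con 2 :+ q) :* u)
              := u :* (t :* t) :+ (n :+ κ) :* (con 2 :* δ)) refl n κ)))

  -- The parameters are `k = t - s - 3` and `r = 2s - 4 - t`, so both ends of the regular range are
  -- built in. A line of `q+1` points now has excess zero, and `Extremal` is an equality with the
  -- line of `s` points alone.
  module Regular (k r : ℕ) (large : 4 ≤ k + r) where
    n s q t e c d num δ u : ℕ
    n = 5 + (k + r)
    s = 2 + n
    q = 3 + k
    t = s + q
    e = 1 + n + q + s
    c = 2 * q + 2 * n
    d = q * e * suc n
    num = q * (e * n + 2)
    δ = d ∸ c
    u = 2 * (q * (2 * n + 1) + n * n)

    t∸s : t ∸ s ≡ q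
    t∸s = m+n∸m≡n s q

    qe≥ : 2 * n * q + 6 * q ≤ q * e
    qe≥ = ≤-trans (≤-reflexive (solve 2 (λ n k → con 2 :* n :* (con 3 :+ k) :+ con 6 :* (con 3 :+ k) := (con 3 :+ k) :* ((con 1 :+ n) :+ con 3 :+ (con 2 :+ n))) refl n k))
      (*-monoʳ-≤ q (+-monoˡ-≤ s (+-monoʳ-≤ (1 + n) (m≤m+n 3 k))))

    1≤q : 1 ≤ q
    1≤q = s≤s z≤n

    num< : suc num + c ≤ d
    num< = ≤-trans (+-monoʳ-≤ 1 (≤-reflexive (solve 3 (λ n q e → q :* (e :* n :+ con 2) :+ (con 2 :* q :+ con 2 :* n) := (con 4 :* q :+ con 2 :* n) :+ q :* e :* n) refl n q e)))
      (≤-trans (+-monoˡ-≤ (q * e * n) small) (≤-reflexive (≡-sym (*-suc (q * e) n))))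
      where
      small : suc (4 * q + 2 * n) ≤ q * e
      small = ≤-trans (≤-trans (s≤s (+-mono-≤ (≤-refl {4 * q}) (m≤m*n (2 * n) q)))
        (≤-trans (+-monoˡ-≤ (4 * q + 2 * n * q) 1≤q) (≤-trans (m≤n+m _ q) (≤-reflexive (solve 2 (λ q x → q :+ (q :+ (con 4 :* q :+ x)) := x :+ con 6 :* q) refl q (2 * n * q)))))) qe≥

    u< : suc u + c ≤ d
    u< = ≤-trans (s≤s (≤-trans (≤-reflexive (solve 2 (λ n q → con 2 :* (q :* (con 2 :* n :+ con 1) :+ n :* n) :+ (con 2 :* q :+ con 2 :* n)
              := con 2 :* (n :* n) :+ (con 4 :* q :* n :+ con 2 :* n) :+ con 4 :* q) refl n q))
            (+-monoˡ-≤ (4 * q) (+-mono-≤ (m≤m*n (2 * (n * n)) q) (+-monoʳ-≤ (4 * q * n) (m≤m*n (2 * n) q))))))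
      (≤-trans (+-monoˡ-≤ (2 * (n * n) * q + (4 * q * n + 2 * n * q) + 4 * q) 1≤q)
      (≤-trans (m≤m+n _ (2 * n * q + q)) (≤-trans (≤-reflexive (solve 2 (λ n q →
        q :+ (con 2 :* (n :* n) :* q :+ (con 4 :* q :* n :+ con 2 :* n :* q) :+ con 4 :* q) :+ (con 2 :* n :* q :+ q)
        := (con 2 :* n :* q :+ con 6 :* q) :* (con 1 :+ n)) refl n q)) (*-monoˡ-≤ (suc n) qe≥))))

    δ+c : δ + c ≡ d
    δ+c = m∸n+n≡m (≤-trans (m≤n+m c (suc u)) u<)

    short : suc (suc q) * u ≤ 2 * δ
    short = +-cancelʳ-≤ (2 * c) _ _ (≤-trans (≤-reflexive (solve 3 (λ q v c → (con 2 :+ q) :* (con 2 :* v) :+ con 2 :* c := con 2 :* ((con 2 :+ q) :* v :+ c)) refl q (q * (2 * n + 1) + n * n) c))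
      (≤-trans (*-monoʳ-≤ 2 half) (≤-reflexive (trans (cong (2 *_) (≡-sym δ+c)) (*-distribˡ-+ 2 δ c)))))
      where
      -- This inequality is what separates regular from exceptional pairs: it holds for `k + r` at
      -- least 4, that is `s` at least 11, and for the sporadic pairs with `(k,r)` equal to (1,2) or
      -- (2,1), while (0,3), (3,0) and (1,1) give 4.
      5≤ : 5 ≤ suc k * suc r
      5≤ = ≤-trans (s≤s large) (≤-trans (m≤m+n _ (k * r)) (≤-reflexive (solve 2 (λ k r → con 1 :+ (k :+ r) :+ k :* r := (con 1 :+ k) :* (con 1 :+ r)) refl k r)))
      q≤n : q ≤ n
      q≤n = +-mono-≤ {3} {5} (≤ᵇ⇒≤ 3 5 _) (m≤m+n k r)
      inner : q * q + 2 * n + 2 + suc k * suc r ≡ q * n + q + 4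
      inner = solve 2 (λ k r → (con 3 :+ k) :* (con 3 :+ k) :+ con 2 :* (con 5 :+ (k :+ r)) :+ con 2 :+ (con 1 :+ k) :* (con 1 :+ r)
        := (con 3 :+ k) :* (con 5 :+ (k :+ r)) :+ (con 3 :+ k) :+ con 4) refl k r
      bound : q + (q * q * n + 2 * n * n + 2 * n) ≤ q * n * n + q * n
      bound = +-cancelʳ-≤ (n * (suc k * suc r)) _ _ (≤-trans (≤-reflexive (solve 3 (λ q n x → q :+ (q :* q :* n :+ con 2 :* n :* n :+ con 2 :* n) :+ n :* x
                 := q :+ n :* (q :* q :+ con 2 :* n :+ con 2 :+ x)) refl q n (suc k * suc r)))
        (≤-trans (≤-reflexive (cong (λ x → q + n * x) inner))
        (≤-trans (≤-reflexive (solve 2 (λ q n → q :+ n :* (q :* n :+ q :+ con 4) := (q :* n :* n :+ q :* n) :+ (q :+ n :* con 4)) refl q n))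
          (+-monoʳ-≤ (q * n * n + q * n) (≤-trans (+-monoˡ-≤ (n * 4) q≤n) (≤-trans (≤-reflexive (solve 1 (λ n → n :+ n :* con 4 := n :* con 5) refl n)) (*-monoʳ-≤ n 5≤)))))))
      half : suc (suc q) * (q * (2 * n + 1) + n * n) + c ≤ d
      half = +-cancelʳ-≤ (q * n * n + q * n) _ _ (≤-trans (≤-reflexive (solve 2 (λ n q →
          (con 2 :+ q) :* (q :* (con 2 :* n :+ con 1) :+ n :* n) :+ (con 2 :* q :+ con 2 :* n) :+ (q :* n :* n :+ q :* n)
          := q :* ((con 1 :+ n) :+ q :+ (con 2 :+ n)) :* (con 1 :+ n) :+ (q :+ (q :* q :* n :+ con 2 :* n :* n :+ con 2 :* n))) refl n q))
        (+-monoʳ-≤ d bound))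

    long : 2 * δ ≤ suc s * u
    long = +-cancelʳ-≤ (2 * c) _ _ (≤-trans (≤-reflexive (trans (≡-sym (*-distribˡ-+ 2 δ c)) (cong (2 *_) δ+c)))
      (+-cancelʳ-≤ (2 * suc n * (s * n + 2 * q)) _ _ (≤-trans (≤-reflexive (solve 2 (λ n q →
         con 2 :* (q :* ((con 1 :+ n) :+ q :+ (con 2 :+ n)) :* (con 1 :+ n)) :+ con 2 :* (con 1 :+ n) :* ((con 2 :+ n) :* n :+ con 2 :* q)
         := (con 3 :+ n) :* (con 2 :* (q :* (con 2 :* n :+ con 1) :+ n :* n)) :+ con 2 :* (con 2 :* q :+ con 2 :* n) :+ con 2 :* (con 1 :+ n) :* (q :* q)) refl n q))
        (+-monoʳ-≤ (suc s * u + 2 * c) (*-monoʳ-≤ (2 * suc n) (≤-trans (*-mono-≤ q≤s q≤n) (m≤m+n (s * n) (2 * q))))))))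
      where
      q≤n : q ≤ n
      q≤n = +-mono-≤ {3} {5} (≤ᵇ⇒≤ 3 5 _) (m≤m+n k r)
      q≤s : q ≤ s
      q≤s = ≤-trans q≤n (m≤n+m n 2)

    zero-excess : ∀ x → x ≤ suc q → excess δ u x ≡ 0
    zero-excess x h = trans (cong ((x ∸ 2) *_) (m≤n⇒m∸n≡0 (≤-trans (*-monoˡ-≤ u (s≤s h)) short))) (*-zeroʳ (x ∸ 2))

    main : 2 * ((num + δ) * (t ∸ 2) + u) + (excess δ u s + excess δ u (suc q)) + u * t ≤ u * (t * t)
    main = ≤-trans (≤-reflexive (trans (cong (λ x → L + (excess δ u s + x) + u * t) (zero-excess (suc q) ≤-refl))
          (solve 3 (λ a b c → a :+ (b :+ con 0) :+ c := a :+ c :+ (b :+ con 0)) refl L (excess δ u s) (u * t))))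
        -- The vanishing second line enters with coefficient 0 and the dummy value `2 * δ`. Adding
        -- `2 * q * c` on both sides replaces the difference `δ` by the product `d`.
        (∸-extremal (L + u * t) n 0 (suc s * u) (2 * δ) (2 * δ) (u * (t * t)) long ≤-refl
          (≤-reflexive (+-cancelʳ-≡ (2 * q * c) _ _ identity)))
      where
      L : ℕ
      L = 2 * ((num + δ) * (n + q) + u)
      identity : L + u * t + n * (suc s * u) + 0 * (2 * δ) + 2 * q * c ≡ u * (t * t) + (n + 0) * (2 * δ) + 2 * q * c
      identity = begin
        L + u * t + n * (suc s * u) + 0 * (2 * δ) + 2 * q * c
          ≡⟨ solve 7 (λ m d n q u x c → con 2 :* ((m :+ d) :* (n :+ q) :+ u) :+ u :* ((con 2 :+ n) :+ q) :+ x :+ con 0 :* (con 2 :* d) :+ con 2 :* q :* c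
                := (con 2 :* (m :* (n :+ q)) :+ con 2 :* u :+ u :* ((con 2 :+ n) :+ q) :+ x :+ con 2 :* q :* (d :+ c)) :+ n :* (con 2 :* d)) refl num δ n q u (n * (suc s * u)) c ⟩
        (2 * (num * (n + q)) + 2 * u + u * t + n * (suc s * u) + 2 * q * (δ + c)) + n * (2 * δ)
          ≡⟨ cong (λ x → (2 * (num * (n + q)) + 2 * u + u * t + n * (suc s * u) + 2 * q * x) + n * (2 * δ)) δ+c ⟩
        (2 * (num * (n + q)) + 2 * u + u * t + n * (suc s * u) + 2 * q * d) + n * (2 * δ)
          ≡⟨ cong (_+ n * (2 * δ)) (solve 2 (λ n q →
               let s = con 2 :+ n ; t = s :+ q ; e = con 1 :+ n :+ q :+ s ; num = q :* (e :* n :+ con 2)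
                   u = con 2 :* (q :* (con 2 :* n :+ con 1) :+ n :* n)
               in con 2 :* (num :* (n :+ q)) :+ con 2 :* u :+ u :* t :+ n :* ((con 1 :+ s) :* u) :+ con 2 :* q :* (q :* e :* (con 1 :+ n))
                  := u :* (t :* t) :+ con 2 :* q :* (con 2 :* q :+ con 2 :* n)) refl n q) ⟩
        u * (t * t) + 2 * q * c + n * (2 * δ)
          ≡⟨ solve 4 (λ a b n d → a :+ b :+ n :* d := a :+ (n :+ con 0) :* d :+ b) refl (u * (t * t)) (2 * q * c) n (2 * δ) ⟩
        u * (t * t) + (n + 0) * (2 * δ) + 2 * q * c ∎
        where open ≡-Reasoning

    module _ (regular : regularᵇ s t ≡ true) where
      num≡ : alphaNum s t ≡ num
      num≡ = trans (cong (λ b → if b then (s ∸ 2) * (t ∸ s) * (t + s ∸ 1) + 2 * (t ∸ s) else (s ∸ 2) * (t ∸ s) * (s ∸ 1) + (s ∸ 1)) regular)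
        (trans (cong (λ x → n * x * e + 2 * x) t∸s)
          (solve 3 (λ n q e → n :* q :* e :+ con 2 :* q := q :* (e :* n :+ con 2)) refl n q e))

      sum≡ : (4 + (k + r) + (s + 0)) * q * e + 4 ≡ 2 * s + (num + δ)
      sum≡ = +-cancelʳ-≡ c ((4 + (k + r) + (s + 0)) * q * e + 4) (2 * s + (num + δ)) (trans
        (solve 3 (λ m q e → (m :+ ((con 3 :+ m) :+ con 0)) :* q :* e :+ con 4 :+ (con 2 :* q :+ con 2 :* (con 1 :+ m))
           := con 2 :* (con 3 :+ m) :+ q :* (e :* (con 1 :+ m) :+ con 2) :+ q :* e :* (con 2 :+ m)) refl (4 + (k + r)) q e)
        (trans (cong (2 * s + num +_) (≡-sym δ+c)) (solve 4 (λ a b d c → a :+ b :+ (d :+ c) := a :+ (b :+ d) :+ c) refl (2 * s) num δ c)))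

      den≡ : alphaDen s t ≡ num + δ
      den≡ = trans (cong (λ b → if b then ((2 * s ∸ 3) * (t ∸ s) * (t + s ∸ 1) + 4) ∸ 2 * s else (2 * s ∸ 3) * (t ∸ s) * (s ∸ 1) + (2 * s ∸ t)) regular)
        (trans (cong (λ x → ((4 + (k + r) + (s + 0)) * x * e + 4) ∸ 2 * s) t∸s)
          (trans (cong (_∸ 2 * s) sum≡) (m+n∸m≡n (2 * s) (num + δ))))

      exponents′ : Exponents s t (alphaDen s t) (alphaNum s t) δ u
      exponents′ = subst₂ (λ a b → Exponents s t a b δ u) (≡-sym den≡) (≡-sym num≡) (
        refl ,
        +-cancelʳ-≡ (n * c) _ _ (trans (solve 4 (λ u n d c → u :+ n :* d :+ n :* c := u :+ n :* (d :+ c)) refl u n δ c)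
          (trans (cong (λ x → u + n * x) δ+c) (solve 3 (λ n q e →
            con 2 :* (q :* (con 2 :* n :+ con 1) :+ n :* n) :+ n :* (q :* e :* (con 1 :+ n)) := (con 1 :+ n) :* (q :* (e :* n :+ con 2)) :+ n :* (con 2 :* q :+ con 2 :* n)) refl n q e))) ,
        s≤s z≤n ,
        +-cancelʳ-≤ c _ _ (≤-trans num< (≤-reflexive (≡-sym δ+c))) ,
        s≤s z≤n ,
        +-cancelʳ-≤ c _ _ (≤-trans u< (≤-reflexive (≡-sym δ+c))) ,
        subst (λ x → 2 * ((num + δ) * (t ∸ 2) + u) + (excess δ u s + excess δ u (suc x)) + u * t ≤ u * (t * t)) (≡-sym t∸s) main ,
        subst (λ x → (t * t ∸ t) * excess δ u x ≤ x * (x ∸ 1) * excess δ u s) (≡-sym t∸s)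
          (≤-trans (≤-reflexive (trans (cong ((t * t ∸ t) *_) (zero-excess q (n≤1+n q))) (*-zeroʳ (t * t ∸ t)))) z≤n))

  zero-term : ∀ a δ u x → suc x * u ≤ 2 * δ → ∀ R → a * excess δ u x ≤ R
  zero-term a δ u x h R = ≤-trans (≤-reflexive (trans (cong (λ y → a * ((x ∸ 2) * y)) (m≤n⇒m∸n≡0 h))
    (trans (cong (a *_) (*-zeroʳ (x ∸ 2))) (*-zeroʳ a)))) z≤n

  exceptional₂ : ∀ j → let s = 3 + j ; t = s + 2 in regularᵇ s t ≡ false →
    HasExponents s t
  exceptional₂ j irregular = record { holds = exponents′ irregular
    (weaken {z = 4 * n + 2} (solve 1 (λ n → con 4 :* (n :* con 2 :+ (n :* n :+ n :+ con 1)) := con 2 :* (con 2 :* ((con 2 :+ n) :* n) :+ con 1) :+ (con 4 :* n :+ con 2)) refl n))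
    (≤-trans (≤-reflexive (*-zeroʳ (t * t ∸ t))) z≤n) }
    where open Exceptional j 1 (suc j) refl (s≤s z≤n) (s≤s z≤n)

  -- For `t = 2s - 1` the term `pos q` equals `n` instead of being truncated to 0, so `ShortLines`
  -- needs a real comparison; it comes down to a cubic inequality in `j`.
  exceptional₋₁ : ∀ j → let s = 3 + j ; t = s + (2 + j) in regularᵇ s t ≡ false →
    HasExponents s t
  exceptional₋₁ j irregular = record { holds = exponents′ irregular
    (weaken identity) short }
    where
    open Exceptional j (suc j) 1 (+-comm (suc (suc j)) 1) (s≤s z≤n) (s≤s z≤n)
    identity : suc (suc q) * u ≡ 2 * δ + suc n * (2 * n + 1)
    identity = solve 1 (λ n → let q = con 1 :+ n ; u = n :* q :+ (n :* n :+ n :+ con 1) in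
      (con 2 :+ q) :* u := con 2 :* (q :* ((con 2 :+ n) :* n) :+ con 1) :+ (con 1 :+ n) :* (con 2 :* n :+ con 1)) refl n
    pos-q : suc q * u ∸ 2 * δ ≡ n
    pos-q = trans (cong (_∸ 2 * δ) (solve 1 (λ n → let q = con 1 :+ n ; u = n :* q :+ (n :* n :+ n :+ con 1) in
      (con 1 :+ q) :* u := con 2 :* (q :* ((con 2 :+ n) :* n) :+ con 1) :+ n) refl n)) (m+n∸m≡n (2 * δ) n)
    pos-s : suc s * u ∸ 2 * δ ≡ suc n * (2 * n + 1)
    pos-s = trans (cong (_∸ 2 * δ) identity) (m+n∸m≡n (2 * δ) (suc n * (2 * n + 1)))
    t²∸t : t * t ∸ t ≡ (t ∸ 1) * t
    t²∸t = m+n∸m≡n t ((t ∸ 1) * t)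
    cubic : 2 * (2 * n + 3) * j ≤ n * suc n * (2 * n + 1)
    cubic = weaken {z = 2 * j * j * j + 5 * j * j + 3 * j + 6} (solve 1 (λ j → let n = con 1 :+ j in
      n :* (con 1 :+ n) :* (con 2 :* n :+ con 1) := con 2 :* (con 2 :* n :+ con 3) :* j :+ (con 2 :* j :* j :* j :+ con 5 :* j :* j :+ con 3 :* j :+ con 6)) refl j)
    open ≤-Reasoning
    short : (t * t ∸ t) * excess δ u q ≤ q * (q ∸ 1) * excess δ u s
    short = begin
      (t * t ∸ t) * (j * (suc q * u ∸ 2 * δ))     ≡⟨ cong₂ (λ x y → x * (j * y)) t²∸t pos-q ⟩
      (t ∸ 1) * t * (j * n)
        ≡⟨ solve 2 (λ j n → ((con 1 :+ n) :+ (con 1 :+ n)) :* ((con 2 :+ n) :+ (con 1 :+ n)) :* (j :* n) := (con 1 :+ n) :* n :* (con 2 :* (con 2 :* n :+ con 3) :* j)) refl j n ⟩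
      suc n * n * (2 * (2 * n + 3) * j)           ≤⟨ *-monoʳ-≤ (suc n * n) cubic ⟩
      suc n * n * (n * suc n * (2 * n + 1))       ≡⟨ cong (suc n * n *_) (*-assoc n (suc n) (2 * n + 1)) ⟩
      suc n * n * (n * (suc n * (2 * n + 1)))     ≡⟨ cong (λ y → suc n * n * (n * y)) (≡-sym pos-s) ⟩
      q * (q ∸ 1) * excess δ u s ∎

  exceptional₋₂ : ∀ j → let s = 4 + j ; t = s + (2 + j) in regularᵇ s t ≡ false →
    HasExponents s t
  exceptional₋₂ j irregular = record { holds = exponents′ irregular
    (weaken {z = n * (n + 3)} (solve 1 (λ n → let u = n :* n :+ (n :* n :+ n :+ con 1) in
      (con 2 :+ n) :* u := con 2 :* (n :* ((con 2 :+ n) :* n) :+ con 1) :+ n :* (n :+ con 3)) refl n))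
    (zero-term (t * t ∸ t) δ u q (weaken {z = suc j * suc j} (solve 1 (λ m → let n = con 1 :+ m ; u = n :* n :+ (n :* n :+ n :+ con 1) in
      con 2 :* (n :* ((con 2 :+ n) :* n) :+ con 1) := (con 1 :+ n) :* u :+ m :* m) refl (suc j))) _) }
    where open Exceptional (suc j) (suc j) 2 (+-comm (suc (suc j)) 2) (s≤s z≤n) (s≤s z≤n)

  exceptional₋₃ : ∀ j → let s = 5 + j ; t = s + (2 + j) in regularᵇ s t ≡ false →
    HasExponents s t
  exceptional₋₃ j irregular = record { holds = exponents′ irregular
    (weaken {z = 5 * q + 4} (solve 1 (λ q → let n = con 1 :+ q ; u = n :* q :+ (n :* n :+ n :+ con 1) in
      (con 2 :+ q) :* u := con 2 :* (q :* ((con 2 :+ n) :* n) :+ con 1) :+ (con 5 :* q :+ con 4)) refl q))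
    (zero-term (t * t ∸ t) δ u q (weaken {z = (2 * suc j + 3) * suc j} (solve 1 (λ m → let q = con 1 :+ m ; n = con 1 :+ q ; u = n :* q :+ (n :* n :+ n :+ con 1) in
      con 2 :* (q :* ((con 2 :+ n) :* n) :+ con 1) := (con 1 :+ q) :* u :+ (con 2 :* m :+ con 3) :* m) refl (suc j))) _) }
    where open Exceptional (suc (suc j)) (suc j) 3 (+-comm (suc (suc j)) 3) (s≤s z≤n) (s≤s z≤n)

  longLines : ∀ x t → let s = 11 + x in ¬ (t ≤ 2 * s ∸ 4) → t ≤ 2 * s ∸ 1 →
    HasExponents s t
  longLines x t t≰ t≤ with m≤n⇒∃[o]m+o≡n t≤
  ... | o , eq = go o eq
    where
    s : ℕ
    s = 11 + x
    Goal : ℕ → Set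
    Goal t = HasExponents s t
    irregular : regularᵇ s t ≡ false
    irregular with t ≤ᵇ 2 * s ∸ 4 in eq′ | s + 3 ≤ᵇ t
    ... | true  | _     = ⊥-elim (t≰ (≤ᵇ-true⁻¹ t (2 * s ∸ 4) eq′))
    ... | false | true  = refl
    ... | false | false = refl
    value : ∀ o y → y + o ≡ s + (10 + x) → t + o ≡ 2 * s ∸ 1 → y ≡ t
    value o y h h′ = +-cancelʳ-≡ o y t (trans h (trans (solve 1 (λ x → (con 11 :+ x) :+ (con 10 :+ x) := con 10 :+ x :+ (con 11 :+ x :+ con 0)) refl x) (≡-sym h′)))
    at : ∀ {y} → y ≡ t → (regularᵇ s y ≡ false → Goal y) → Goal t
    at refl f = f irregular
    go : ∀ o → t + o ≡ 2 * s ∸ 1 → Goal t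
    go 0 h = at (value 0 (s + (10 + x)) (+-identityʳ _) h) (exceptional₋₁ (8 + x))
    go 1 h = at (value 1 (s + (9 + x)) (solve 1 (λ x → (con 11 :+ x) :+ (con 9 :+ x) :+ con 1 := (con 11 :+ x) :+ (con 10 :+ x)) refl x) h) (exceptional₋₂ (7 + x))
    go 2 h = at (value 2 (s + (8 + x)) (solve 1 (λ x → (con 11 :+ x) :+ (con 8 :+ x) :+ con 2 := (con 11 :+ x) :+ (con 10 :+ x)) refl x) h) (exceptional₋₃ (6 + x))
    go (suc (suc (suc o))) h = ⊥-elim (t≰ (≤-trans (m≤m+n t o) (≤-reflexive (trans (≡-sym (m+n∸n≡m (t + o) 3)) (cong (_∸ 3) (trans (solve 2 (λ t o → t :+ o :+ con 3 := t :+ (con 3 :+ o)) refl t o) h))))))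

  midLines : ∀ s k r → 7 + (k + r) ≡ s → 11 ≤ s → regularᵇ s (s + (3 + k)) ≡ true → HasExponents s (s + (3 + k))
  midLines _ k r refl 11≤s h = record { holds = Regular.exponents′ k r (+-cancelˡ-≤ 7 4 (k + r) 11≤s) h }

  shortLines : ∀ s j → 3 + j ≡ s → regularᵇ s (s + 2) ≡ false → HasExponents s (s + 2)
  shortLines _ j refl h = exceptional₂ j h

  regular⇒ : ∀ s t → 11 ≤ s → s + 3 ≤ t → t ≤ 2 * s ∸ 4 → regularᵇ s t ≡ true
  regular⇒ s t a b c = cong (_∨ ((s ≡ᵇ 10) ∧ ((t ≡ᵇ 14) ∨ (t ≡ᵇ 15)))) (∧-true (T⇒≡ (≤⇒≤ᵇ a)) (∧-true (T⇒≡ (≤⇒≤ᵇ b)) (T⇒≡ (≤⇒≤ᵇ c))))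
    where
    ∧-true : ∀ {a b} → a ≡ true → b ≡ true → a ∧ b ≡ true
    ∧-true refl refl = refl

  irregular⇒ : ∀ s t → 11 ≤ s → ¬ (s + 3 ≤ t) → regularᵇ s t ≡ false
  irregular⇒ s t a b = cong₂ _∨_ (∧-false (11 ≤ᵇ s) (cong (_∧ (t ≤ᵇ 2 * s ∸ 4)) (≤ᵇ-false b))) (cong (_∧ ((t ≡ᵇ 14) ∨ (t ≡ᵇ 15))) (large s a))
    where
    ∧-false : ∀ a {b} → b ≡ false → a ∧ b ≡ false
    ∧-false true  h = h
    ∧-false false h = refl
    ≤ᵇ-false : ∀ {m n} → ¬ m ≤ n → (m ≤ᵇ n) ≡ false
    ≤ᵇ-false {m} {n} h with m ≤ᵇ n in eq
    ... | true  = ⊥-elim (h (≤ᵇ-true⁻¹ m n eq))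
    ... | false = refl
    large : ∀ s → 11 ≤ s → (s ≡ᵇ 10) ≡ false
    large s a with s ≡ᵇ 10 in eq
    ... | false = refl
    ... | true  = ⊥-elim (<⇒≱ a (≤-reflexive (≡ᵇ⇒≡ s 10 (subst T (≡-sym eq) _))))

  largeCase : ∀ s t → 11 ≤ s → s + 2 ≤ t → t ≤ 2 * s ∸ 1 → HasExponents s t
  largeCase s t 11≤s s+2≤t t≤ = by-length (s + 3 ≤? t) (t ≤? 2 * s ∸ 4)
    where
    top : ∃[ x ] 11 + x ≡ s → ¬ (t ≤ 2 * s ∸ 4) → HasExponents s t
    top (x , eq) = at eq t≤
      where
      at : ∀ {s} → 11 + x ≡ s → t ≤ 2 * s ∸ 1 → ¬ (t ≤ 2 * s ∸ 4) → HasExponents s t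
      at refl h h′ = longLines x t h′ h
    7+k≤s : ∀ k → s + (3 + k) ≡ t → t ≤ 2 * s ∸ 4 → 7 + k ≤ s
    7+k≤s k eq h = +-cancelˡ-≤ s _ _ (≤-trans (≤-reflexive (trans (solve 2 (λ s k → s :+ (con 7 :+ k) := (s :+ (con 3 :+ k)) :+ con 4) refl s k) (cong (_+ 4) eq)))
      (≤-trans (+-monoˡ-≤ 4 h) (≤-reflexive (trans (m∸n+n≡m {2 * s} {4} (≤-trans (≤ᵇ⇒≤ 4 22 _) (*-monoʳ-≤ 2 11≤s))) (cong (s +_) (+-identityʳ s))))))
    mid : ∃[ k ] s + 3 + k ≡ t → s + 3 ≤ t → t ≤ 2 * s ∸ 4 → HasExponents s t
    mid (k , eq) h h′ = go (m≤n⇒∃[o]m+o≡n (7+k≤s k eq′ h′))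
      where
      eq′ : s + (3 + k) ≡ t
      eq′ = trans (≡-sym (+-assoc s 3 k)) eq
      go : ∃[ r ] 7 + k + r ≡ s → HasExponents s t
      go (r , e) = subst (HasExponents s) eq′ (midLines s k r e 11≤s (subst (λ t → regularᵇ s t ≡ true) (≡-sym eq′) (regular⇒ s t 11≤s h h′)))
    by-length : Dec (s + 3 ≤ t) → Dec (t ≤ 2 * s ∸ 4) → HasExponents s t
    by-length _           (no t≰)  = top (m≤n⇒∃[o]m+o≡n 11≤s) t≰
    by-length (yes s+3≤t) (yes t≤′) = mid (m≤n⇒∃[o]m+o≡n s+3≤t) s+3≤t t≤′
    by-length (no t<s+3)  _        = subst (HasExponents s) t≡
      (short (m≤n⇒∃[o]m+o≡n (≤-trans (≤ᵇ⇒≤ 3 11 _) 11≤s)) (irregular⇒ s (s + 2) 11≤s (λ h → <-irrefl refl (≤-trans (≤-reflexive (≡-sym (+-suc s 2))) h))))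
      where
      t≡ : s + 2 ≡ t
      t≡ = ≤-antisym s+2≤t (≤-pred (≤-trans (≰⇒> t<s+3) (≤-reflexive (+-suc s 2))))
      short : ∃[ j ] 3 + j ≡ s → regularᵇ s (s + 2) ≡ false → HasExponents s (s + 2)
      short (j , e) = shortLines s j e

exponents : ∀ s t → 3 ≤ s → s + 2 ≤ t → t ≤ 2 * s ∸ 1 → HasExponents s t
exponents s t 3≤s s+2≤t t≤ = by-size (s <? 11)
  where
  by-size : Dec (s < 11) → HasExponents s t
  by-size (yes s<11) = record { holds = smallCase s<11 (s≤s (≤-trans t≤ (∸-monoˡ-≤ 1 (*-monoʳ-≤ 2 (≤-pred s<11))))) 3≤s s+2≤t t≤ }
  by-size (no s≮11)  = largeCase s t (≮⇒≥ s≮11) s+2≤t t≤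

-- Rare configurations

¬¬-em : ∀ {P : Set} → ¬ ¬ (P ⊎ ¬ P)
¬¬-em k = k (inj₂ (k ∘ inj₁))

¬¬-∀ : ∀ n {P : Fin n → Set} → (∀ i → ¬ ¬ P i) → ¬ ¬ (∀ i → P i)
¬¬-∀ zero    h k = k λ ()
¬¬-∀ (suc n) h k = h zero λ p → ¬¬-∀ n (h ∘ suc) λ ps → k λ { zero → p ; (suc i) → ps i }

Mask : ℕ → Set
Mask n = Fin n → Bool

_⊆ᵐ_ : ∀ {n} → Mask n → Mask n → Set
X ⊆ᵐ Y = ∀ v → X v ≡ true → Y v ≡ true

_∪ᵐ_ _∩ᵐ_ : ∀ {n} → Mask n → Mask n → Mask n
(X ∪ᵐ Y) v = X v ∨ Y v
(X ∩ᵐ Y) v = X v ∧ Y v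

card-∪∩ : ∀ {n} (X Y : Mask n) → card (X ∪ᵐ Y) + card (X ∩ᵐ Y) ≡ card X + card Y
card-∪∩ {n} X Y = trans (≡-sym (∑ᴸ-+ (allFin n) _ _)) (trans (∑-cong n (λ v → cell (X v) (Y v))) (∑ᴸ-+ (allFin n) _ _))
  where
  cell : ∀ a b → 𝟙 (a ∨ b) + 𝟙 (a ∧ b) ≡ 𝟙 a + 𝟙 b
  cell true  b = refl
  cell false b = +-identityʳ _

card-mono : ∀ {n} {X Y : Mask n} → X ⊆ᵐ Y → card X ≤ card Y
card-mono {n} {X} {Y} h = ∑-mono n cell
  where
  cell : ∀ v → 𝟙 (X v) ≤ 𝟙 (Y v)
  cell v with X v in eq
  ... | false = z≤n
  ... | true rewrite h v eq = ≤-refl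

card-strict : ∀ {n} {X Y : Mask n} → X ⊆ᵐ Y → ∀ v → X v ≡ false → Y v ≡ true → card X < card Y
card-strict {n} {X} {Y} h v Xv Yv = begin
  1 + card X                                              ≡⟨ cong (_+ card X) (≡-sym (∑-1δ)) ⟩
  ∑ n (λ w → 𝟙 (w == v) * 1) + card X                     ≡⟨ ≡-sym (∑ᴸ-+ (allFin n) _ _) ⟩
  ∑ n (λ w → 𝟙 (w == v) * 1 + 𝟙 (X w))                    ≤⟨ ∑-mono n cell ⟩
  card Y ∎
  where
  open ≤-Reasoning
  ∑-1δ : ∑ n (λ w → 𝟙 (w == v) * 1) ≡ 1
  ∑-1δ = ∑-δ v (λ _ → 1)
  cell : ∀ w → 𝟙 (w == v) * 1 + 𝟙 (X w) ≤ 𝟙 (Y w)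
  cell w with w ≟ᶠ v
  ... | yes refl rewrite Xv | Yv = ≤-refl
  ... | no _ with X w in eq
  ...   | false = z≤n
  ...   | true rewrite h w eq = ≤-refl

∧-intro : ∀ {a b} → a ≡ true → b ≡ true → a ∧ b ≡ true
∧-intro refl refl = refl

∧-elimˡ : ∀ {a b} → a ∧ b ≡ true → a ≡ true
∧-elimˡ {true} _ = refl

∧-elimʳ : ∀ a {b} → a ∧ b ≡ true → b ≡ true
∧-elimʳ true h = h

∨-introˡ : ∀ {a b} → a ≡ true → a ∨ b ≡ true
∨-introˡ refl = refl

∨-introʳ : ∀ a {b} → b ≡ true → a ∨ b ≡ true
∨-introʳ true  h = refl
∨-introʳ false h = h

module Configurations (N M D μ δ : ℕ) (inc : Fin M → Fin N → Bool) where

  Config : Set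
  Config = Mask N × Mask M

  incidences : Config → ℕ
  incidences (X , 𝓑) = ∑ M (λ B → ∑ N (λ v → 𝟙 (𝓑 B ∧ (X v ∧ inc B v))))

  cost : Config → ℕ
  cost (X , 𝓑) = D * card X + μ * card 𝓑

  infix 4 _⪯_ _⊑_
  -- cost − δ · incidences is the exponent of the expected number of copies of a configuration.
  _⪯_ : Config → Config → Set
  c ⪯ c′ = cost c + δ * incidences c′ ≤ cost c′ + δ * incidences c

  _⊑_ : Config → Config → Set
  (X , 𝓑) ⊑ (X′ , 𝓑′) = X ⊆ᵐ X′ × 𝓑 ⊆ᵐ 𝓑′

  -- Colours are ignored: any two vertices in a common blob count as an edge. This only enlarges the
  -- family of parts that a rare configuration is compared with.
  record Edge (c : Config) (u v : Fin N) (B : Fin M) : Set where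
    field
      u≢v : u ≢ v
      u∈  : proj₁ c u ≡ true
      v∈  : proj₁ c v ≡ true
      B∈  : proj₂ c B ≡ true
      incᵤ : inc B u ≡ true
      incᵥ : inc B v ≡ true

  _⊔_ _⊓_ : Config → Config → Config
  (X , 𝓑) ⊔ (Y , 𝓒) = X ∪ᵐ Y , 𝓑 ∪ᵐ 𝓒
  (X , 𝓑) ⊓ (Y , 𝓒) = X ∩ᵐ Y , 𝓑 ∩ᵐ 𝓒

  cost-modular : ∀ c c′ → cost (c ⊔ c′) + cost (c ⊓ c′) ≡ cost c + cost c′
  cost-modular (X , 𝓑) (Y , 𝓒) = begin
    (D * card (X ∪ᵐ Y) + μ * card (𝓑 ∪ᵐ 𝓒)) + (D * card (X ∩ᵐ Y) + μ * card (𝓑 ∩ᵐ 𝓒))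
      ≡⟨ solve 6 (λ D μ a b c d → (D :* a :+ μ :* b) :+ (D :* c :+ μ :* d) := D :* (a :+ c) :+ μ :* (b :+ d)) refl D μ (card (X ∪ᵐ Y)) (card (𝓑 ∪ᵐ 𝓒)) (card (X ∩ᵐ Y)) (card (𝓑 ∩ᵐ 𝓒)) ⟩
    D * (card (X ∪ᵐ Y) + card (X ∩ᵐ Y)) + μ * (card (𝓑 ∪ᵐ 𝓒) + card (𝓑 ∩ᵐ 𝓒))
      ≡⟨ cong₂ (λ x y → D * x + μ * y) (card-∪∩ X Y) (card-∪∩ 𝓑 𝓒) ⟩
    D * (card X + card Y) + μ * (card 𝓑 + card 𝓒)
      ≡⟨ solve 6 (λ D μ a b c d → D :* (a :+ c) :+ μ :* (b :+ d) := (D :* a :+ μ :* b) :+ (D :* c :+ μ :* d)) refl D μ (card X) (card 𝓑) (card Y) (card 𝓒) ⟩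
    (D * card X + μ * card 𝓑) + (D * card Y + μ * card 𝓒) ∎
    where open ≡-Reasoning

  -- The union may gain incidences between a vertex of one configuration and a blob of the other;
  -- all remaining incidences are counted equally on both sides.
  incidences-supermodular : ∀ c c′ → incidences c + incidences c′ ≤ incidences (c ⊔ c′) + incidences (c ⊓ c′)
  incidences-supermodular (X , 𝓑) (Y , 𝓒) = begin
    incidences (X , 𝓑) + incidences (Y , 𝓒)   ≡⟨ ≡-sym (∑∑-+ _ _) ⟩
    ∑ M (λ B → ∑ N (λ v → 𝟙 (𝓑 B ∧ (X v ∧ inc B v)) + 𝟙 (𝓒 B ∧ (Y v ∧ inc B v))))
      ≤⟨ ∑-mono M (λ B → ∑-mono N (λ v → cell (𝓑 B) (𝓒 B) (X v) (Y v) (inc B v))) ⟩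
    ∑ M (λ B → ∑ N (λ v → 𝟙 ((𝓑 B ∨ 𝓒 B) ∧ ((X v ∨ Y v) ∧ inc B v)) + 𝟙 ((𝓑 B ∧ 𝓒 B) ∧ ((X v ∧ Y v) ∧ inc B v))))
      ≡⟨ ∑∑-+ _ _ ⟩
    incidences (X ∪ᵐ Y , 𝓑 ∪ᵐ 𝓒) + incidences (X ∩ᵐ Y , 𝓑 ∩ᵐ 𝓒) ∎
    where
    open ≤-Reasoning
    ∑∑-+ : ∀ (f g : Fin M → Fin N → ℕ) → ∑ M (λ B → ∑ N (λ v → f B v + g B v)) ≡ ∑ M (λ B → ∑ N (f B)) + ∑ M (λ B → ∑ N (g B))
    ∑∑-+ f g = trans (∑-cong M (λ B → ∑ᴸ-+ (allFin N) (f B) (g B))) (∑ᴸ-+ (allFin M) _ _)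
    cell : ∀ b c x y i → 𝟙 (b ∧ (x ∧ i)) + 𝟙 (c ∧ (y ∧ i)) ≤ 𝟙 ((b ∨ c) ∧ ((x ∨ y) ∧ i)) + 𝟙 ((b ∧ c) ∧ ((x ∧ y) ∧ i))
    cell true  true  true  y     i = ≤-refl
    cell true  true  false y     i = m≤m+n _ _
    cell true  false true  y     i = ≤-refl
    cell true  false false true  i = z≤n
    cell true  false false false i = z≤n
    cell false true  true  true  i = m≤m+n _ _
    cell false true  true  false i = z≤n
    cell false true  false y     i = m≤m+n _ _
    cell false false x     y     i = z≤n

  incidences-mono : ∀ {c c′} → c ⊑ c′ → incidences c ≤ incidences c′
  incidences-mono {X , 𝓑} {Y , 𝓒} (h , h′) = ∑-mono M (λ B → ∑-mono N (cell B))
    where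
    cell : ∀ B v → 𝟙 (𝓑 B ∧ (X v ∧ inc B v)) ≤ 𝟙 (𝓒 B ∧ (Y v ∧ inc B v))
    cell B v with 𝓑 B in eq | X v in eq′
    ... | false | _     = z≤n
    ... | true  | false = z≤n
    ... | true  | true rewrite h′ B eq | h v eq′ = ≤-refl

  TwoBlobs : Config → Set
  TwoBlobs c = ∃[ B ] ∃[ B′ ] (B ≢ B′ × (∃[ u ] ∃[ v ] Edge c u v B) × (∃[ u ] ∃[ v ] Edge c u v B′))

  -- `minimal` is restricted to parts with an edge because two configurations are merged only along
  -- a common edge. `two` guarantees an edge outside any given blob, so a clean copy of K_s, which
  -- lives in one blob, cannot supply a rare configuration by itself. `few` keeps unions small
  -- enough for the sparsity hypothesis.
  record Rare (t : ℕ) (c : Config) : Set where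
    field
      linear  : ∀ u v → u ≢ v → proj₁ c u ≡ true → proj₁ c v ≡ true → ∀ B B′ →
                inc B u ≡ true → inc B v ≡ true → inc B′ u ≡ true → inc B′ v ≡ true → B ≡ B′
      minimal : ∀ c′ → c′ ⊑ c → (∃[ u ] ∃[ v ] ∃[ B ] Edge c′ u v B) → c ⪯ c′
      two     : TwoBlobs c
      few     : card (proj₁ c) ≤ t × card (proj₂ c) ≤ t * t

  edge-up : ∀ {c c′ u v B} → c ⊑ c′ → Edge c u v B → Edge c′ u v B
  edge-up (h , h′) e = record { u≢v = u≢v ; u∈ = h _ u∈ ; v∈ = h _ v∈ ; B∈ = h′ _ B∈ ; incᵤ = incᵤ ; incᵥ = incᵥ }
    where open Edge e

  -- `K` dominates the cost of an edge with its blob, the starting point of the growth. `H` leaves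
  -- room for one more rare configuration on top of a union whose cost is at most `h₁`, so `sparse`
  -- can be applied before the new union is known to be small.
  module Closure (t H h₀ K : ℕ) (1≤D : 1 ≤ D) (1≤μ : 1 ≤ μ)
    (sparse : ∀ c → card (proj₁ c) ≤ H → card (proj₂ c) ≤ H → h₀ ≤ incidences c → δ * incidences c + K < cost c)
    (K≥ : 2 * D + μ ≤ K) (H≥ : (δ * h₀ + K) + (t + t * t) ≤ H) where

    h₁ : ℕ
    h₁ = δ * h₀ + K

    -- By submodularity: r does not outweigh its part common to c, which contains the edge.
    merge : ∀ c r {u v B} → Rare t r → Edge c u v B → Edge r u v B → cost c ≤ δ * incidences c + K →
      cost (c ⊔ r) ≤ δ * incidences (c ⊔ r) + K
    merge c r {u} {v} {B} rare e e′ h = +-cancelʳ-≤ (cost x + δ * incidences x) _ _ (begin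
      cost (c ⊔ r) + (cost x + δ * incidences x)       ≡⟨ ≡-sym (+-assoc (cost (c ⊔ r)) (cost x) _) ⟩
      cost (c ⊔ r) + cost x + δ * incidences x         ≡⟨ cong (_+ δ * incidences x) (cost-modular c r) ⟩
      cost c + cost r + δ * incidences x               ≡⟨ +-assoc (cost c) (cost r) _ ⟩
      cost c + (cost r + δ * incidences x)             ≤⟨ +-mono-≤ h (Rare.minimal rare x x⊑r (u , v , B , edge)) ⟩
      δ * incidences c + K + (cost x + δ * incidences r)
        ≡⟨ solve 5 (λ δ i k a j → δ :* i :+ k :+ (a :+ δ :* j) := δ :* (i :+ j) :+ k :+ a) refl δ (incidences c) K (cost x) (incidences r) ⟩
      δ * (incidences c + incidences r) + K + cost x   ≤⟨ +-monoˡ-≤ (cost x) (+-monoˡ-≤ K (*-monoʳ-≤ δ (incidences-supermodular c r))) ⟩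
      δ * (incidences (c ⊔ r) + incidences x) + K + cost x
        ≡⟨ solve 5 (λ δ i k a j → δ :* (i :+ j) :+ k :+ a := δ :* i :+ k :+ (a :+ δ :* j)) refl δ (incidences (c ⊔ r)) K (cost x) (incidences x) ⟩
      δ * incidences (c ⊔ r) + K + (cost x + δ * incidences x) ∎)
      where
      open ≤-Reasoning
      x : Config
      x = c ⊓ r
      x⊑r : x ⊑ r
      x⊑r = (λ w → ∧-elimʳ (proj₁ c w)) , (λ w → ∧-elimʳ (proj₂ c w))
      edge : Edge x u v B
      edge = record { u≢v = E.u≢v ; u∈ = ∧-intro E.u∈ E′.u∈ ; v∈ = ∧-intro E.v∈ E′.v∈ ; B∈ = ∧-intro E.B∈ E′.B∈ ; incᵤ = E.incᵤ ; incᵥ = E.incᵥ }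
        where
        module E = Edge e
        module E′ = Edge e′

    -- The invariant contradicts `sparse` as soon as there are `h₀` incidences. With fewer
    -- incidences the same invariant bounds the cost, and the bound does not depend on the number of
    -- mergers.
    small : ∀ c → card (proj₁ c) ≤ H → card (proj₂ c) ≤ H → cost c ≤ δ * incidences c + K → cost c ≤ h₁
    small c a b h with h₀ ≤? incidences c
    ... | yes p = ⊥-elim (<⇒≱ (sparse c a b p) h)
    ... | no p  = ≤-trans h (+-monoˡ-≤ K (*-monoʳ-≤ δ (<⇒≤ (≰⇒> p))))

    cards≤cost : ∀ c → card (proj₁ c) ≤ cost c × card (proj₂ c) ≤ cost c
    cards≤cost (X , 𝓑) = ≤-trans (≤-trans (≤-reflexive (≡-sym (*-identityˡ _))) (*-monoˡ-≤ (card X) 1≤D)) (m≤m+n _ _) ,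
                        ≤-trans (≤-trans (≤-reflexive (≡-sym (*-identityˡ _))) (*-monoˡ-≤ (card 𝓑) 1≤μ)) (m≤n+m _ _)

    card-∪ : ∀ {n} (X Y : Mask n) → card (X ∪ᵐ Y) ≤ card X + card Y
    card-∪ X Y = ≤-trans (m≤m+n _ _) (≤-reflexive (card-∪∩ X Y))

    Absorbing : Fin N → Fin N → Fin M → Mask N → Set
    Absorbing u v B X = ∀ r → Rare t r → Edge r u v B → proj₁ r ⊆ᵐ X

    -- The current vertex set is proposed at once. A rare configuration that leaves it refutes the
    -- proposal and supplies the next merger, which adds a vertex; since the number of vertices
    -- never exceeds `h₁`, the fuel suffices. The double negation avoids deciding whether such a
    -- configuration exists.
    grow : ∀ fuel c u v B → Edge c u v B → cost c ≤ δ * incidences c + K → cost c ≤ h₁ → h₁ < card (proj₁ c) + fuel →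
      ¬ ¬ (∃[ X ] (card X ≤ h₁ × Absorbing u v B X))
    grow zero c u v B e h b f = ⊥-elim (<⇒≱ f (≤-trans (≤-reflexive (+-identityʳ _)) (≤-trans (proj₁ (cards≤cost c)) b)))
    grow (suc fuel) c u v B e h b f k = k (proj₁ c , ≤-trans (proj₁ (cards≤cost c)) b , absorb)
      where
      absorb : Absorbing u v B (proj₁ c)
      absorb r rare e′ w w∈r with proj₁ c w in w∉c
      ... | true  = refl
      ... | false = ⊥-elim (grow fuel (c ⊔ r) u v B (edge-up c⊑ e) h′ b′ f′ k)
        where
        c⊑ : c ⊑ (c ⊔ r)
        c⊑ = (λ _ → ∨-introˡ) , (λ _ → ∨-introˡ)
        h′ : cost (c ⊔ r) ≤ δ * incidences (c ⊔ r) + K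
        h′ = merge c r rare e e′ h
        size : ∀ {a b a′ b′} → a ≤ h₁ → b ≤ a′ → a′ ≤ t + t * t → b′ ≤ a + b → b′ ≤ H
        size p q r′ s′ = ≤-trans s′ (≤-trans (+-mono-≤ p (≤-trans q r′)) H≥)
        b′ : cost (c ⊔ r) ≤ h₁
        b′ = small (c ⊔ r)
          (size (≤-trans (proj₁ (cards≤cost c)) b) (proj₁ (Rare.few rare)) (m≤m+n t (t * t)) (card-∪ (proj₁ c) (proj₁ r)))
          (size (≤-trans (proj₂ (cards≤cost c)) b) (proj₂ (Rare.few rare)) (m≤n+m (t * t) t) (card-∪ (proj₂ c) (proj₂ r))) h′
        f′ : h₁ < card (proj₁ (c ⊔ r)) + fuel
        f′ = ≤-trans f (≤-trans (≤-reflexive (+-suc (card (proj₁ c)) fuel)) (+-monoˡ-≤ fuel (card-strict (proj₁ c⊑) w w∉c (∨-introʳ (proj₁ c w) w∈r))))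

    closure : ∀ u v B → u ≢ v → inc B u ≡ true → inc B v ≡ true → ¬ ¬ (∃[ X ] (card X ≤ h₁ × Absorbing u v B X))
    closure u v B u≢v iu iv = grow (suc h₁) c u v B edge (≤-trans cost≤ (m≤n+m K _)) (≤-trans cost≤ (m≤n+m K (δ * h₀))) (m≤n+m (suc h₁) _)
      where
      c : Config
      c = (λ w → (w == u) ∨ (w == v)) , (_== B)
      edge : Edge c u v B
      edge = record { u≢v = u≢v ; u∈ = ∨-introˡ (==-refl u) ; v∈ = ∨-introʳ (v == u) (==-refl v) ; B∈ = ==-refl B ; incᵤ = iu ; incᵥ = iv }
      single : ∀ {n} (a : Fin n) → card (_== a) ≡ 1
      single {n} a = trans (∑-cong n (λ i → ≡-sym (*-identityʳ _))) (∑-δ a (λ _ → 1))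
      cost≤ : cost c ≤ K
      cost≤ = ≤-trans (+-mono-≤ (≤-trans (*-monoʳ-≤ D (≤-trans (card-∪ (_== u) (_== v)) (≤-reflexive (cong₂ _+_ (single u) (single v))))) (≤-reflexive (*-comm D 2)))
        (≤-reflexive (trans (cong (μ *_) (single B)) (*-identityʳ μ)))) K≥

  module Clique (s t u : ℕ) (μ+u : μ + u ≡ 2 * δ) (u≤δ : u ≤ δ) (δ≤D : δ ≤ D) (δ≤μ : δ ≤ μ)
    (s+2≤t : s + 2 ≤ t)
    (extremal : Extremal s t D δ u) (shortLines : ShortLines s t δ u)
    (f : Fin t → Fin N) (f-inj : ∀ a b → f a ≡ f b → a ≡ b)
    (cover : ∀ a b → a ≢ b → ∃[ B ] (inc B (f a) ≡ true × inc B (f b) ≡ true))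
    (linear : ∀ a b → a ≢ b → ∀ B B′ → inc B (f a) ≡ true → inc B (f b) ≡ true → inc B′ (f a) ≡ true → inc B′ (f b) ≡ true → B ≡ B′)
    (short : ∀ B → card (λ a → inc B (f a)) ≤ s)
    where

    J : Fin M → Fin t → Bool
    J B a = inc B (f a)

    open LinearSpace t M s D δ u u≤δ s+2≤t extremal shortLines J cover linear short using (weight; lines)

    image : Mask N
    image v = 1 ≤ᵇ ∑ t (λ a → 𝟙 (v == f a))

    lineSet : Mask M
    lineSet B = 2 ≤ᵇ card (J B)

    full : Config
    full = image , lineSet

    hits≤1 : ∀ v → ∑ t (λ a → 𝟙 (v == f a)) ≤ 1
    hits≤1 v = ∑-unique≤1 t _ (λ a b p q → f-inj a b (trans (≡-sym (==⇒≡ v (f a) p)) (==⇒≡ v (f b) q)))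

    𝟙-image : ∀ v → 𝟙 (image v) ≡ ∑ t (λ a → 𝟙 (v == f a))
    𝟙-image v with ∑ t (λ a → 𝟙 (v == f a)) | hits≤1 v
    ... | 0           | _ = refl
    ... | 1           | _ = refl
    ... | suc (suc _) | s≤s ()

    ∑-image : ∀ (p : Mask N) → ∑ N (λ v → 𝟙 (image v ∧ p v)) ≡ card (p ∘ f)
    ∑-image p = begin
      ∑ N (λ v → 𝟙 (image v ∧ p v))
        ≡⟨ ∑-cong N (λ v → trans (∧≡* (image v) (p v)) (cong (_* 𝟙 (p v)) (𝟙-image v))) ⟩
      ∑ N (λ v → ∑ t (λ a → 𝟙 (v == f a)) * 𝟙 (p v))
        ≡⟨ ∑-cong N (λ v → ≡-sym (∑ᴸ-*ʳ (allFin t) _ (𝟙 (p v)))) ⟩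
      ∑ N (λ v → ∑ t (λ a → 𝟙 (v == f a) * 𝟙 (p v)))
        ≡⟨ ∑ᴸ-swap (allFin N) (allFin t) _ ⟩
      ∑ t (λ a → ∑ N (λ v → 𝟙 (v == f a) * 𝟙 (p v)))
        ≡⟨ ∑-cong t (λ a → ∑-δ (f a) (𝟙 ∘ p)) ⟩
      card (p ∘ f) ∎
      where
      open ≡-Reasoning
      ∧≡* : ∀ a b → 𝟙 (a ∧ b) ≡ 𝟙 a * 𝟙 b
      ∧≡* true  b = ≡-sym (+-identityʳ _)
      ∧≡* false b = refl

    f∈image : ∀ a → image (f a) ≡ true
    f∈image a with ∑ t (λ b → 𝟙 (f a == f b)) | ≤-trans (≤-reflexive (≡-sym (cong 𝟙 (==-refl (f a))))) (∑-term t (λ b → 𝟙 (f a == f b)) a)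
    ... | suc _ | _ = refl

    image⇒ : ∀ v → image v ≡ true → ∃[ a ] v ≡ f a
    image⇒ v h with ∑ᴸ-pos⇒∃ (allFin t) (≤ᵇ⇒≤ 1 (∑ t (λ a → 𝟙 (v == f a))) (subst T (≡-sym h) _))
    ... | a , p with v ≟ᶠ f a
    ...   | yes eq = a , eq

    card-image : card image ≡ t
    card-image = trans (∑-cong N (λ v → cong 𝟙 (≡-sym (∧-true (image v))))) (trans (∑-image (λ _ → true)) (∑-1 t))
      where
      ∧-true : ∀ b → b ∧ true ≡ b
      ∧-true true  = refl
      ∧-true false = refl

    2≤t : 2 ≤ t
    2≤t = ≤-trans (m≤n+m 2 s) s+2≤t

    point₀ point₁ : Fin t
    point₀ = fromℕ< (≤-trans (s≤s z≤n) 2≤t)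
    point₁ = fromℕ< 2≤t

    point₀≢point₁ : point₀ ≢ point₁
    point₀≢point₁ eq with () ← trans (≡-sym (toℕ-fromℕ< (≤-trans (s≤s z≤n) 2≤t))) (trans (cong toℕ eq) (toℕ-fromℕ< 2≤t))

    -- Since `μ + u = 2δ`, a line with `a ≥ 2` points has `δ a = μ + (u + (a-2)δ)`: its incidences
    -- pay for the blob and leave exactly its weight.
    δI≡ : δ * incidences full ≡ μ * card lineSet + ∑ M weight
    δI≡ = begin
      δ * incidences full                                   ≡⟨ ≡-sym (∑ᴸ-* (allFin M) δ _) ⟩
      ∑ M (λ B → δ * ∑ N (λ v → 𝟙 (lineSet B ∧ (image v ∧ inc B v))))  ≡⟨ ∑-cong M each ⟩
      ∑ M (λ B → μ * 𝟙 (lineSet B) + weight B)              ≡⟨ trans (∑ᴸ-+ (allFin M) _ _) (cong₂ _+_ (∑ᴸ-* (allFin M) μ _) refl) ⟩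
      μ * card lineSet + ∑ M weight ∎
      where
      open ≡-Reasoning
      each : ∀ B → δ * ∑ N (λ v → 𝟙 (lineSet B ∧ (image v ∧ inc B v))) ≡ μ * 𝟙 (lineSet B) + weight B
      each B with 2 ≤ᵇ card (J B) in eq
      ... | false = trans (cong (δ *_) (∑-zero N (λ _ → refl))) (trans (*-zeroʳ δ) (≡-sym (trans (+-identityʳ _) (*-zeroʳ μ))))
      ... | true  = trans (cong (δ *_) (∑-image (inc B))) (go (card (J B)) eq)
        where
        go : ∀ a → (2 ≤ᵇ a) ≡ true → δ * a ≡ μ * 1 + (u + (a ∸ 2) * δ)
        go (suc (suc a)) _ = trans (solve 2 (λ δ a → δ :* (con 2 :+ a) := con 2 :* δ :+ a :* δ) refl δ a)
          (trans (cong (_+ a * δ) (≡-sym μ+u)) (solve 3 (λ m u x → m :+ u :+ x := m :* con 1 :+ (u :+ x)) refl μ u (a * δ)))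

    -- The bound of the linear space in terms of expected counts: the exponent of the whole
    -- configuration is at most `2D + μ - 2δ`, that of one edge in a blob.
    full-weight : cost full + 2 * δ ≤ δ * incidences full + (2 * D + μ)
    full-weight = begin
      D * card image + μ * card lineSet + 2 * δ          ≡⟨ cong (λ x → D * x + μ * card lineSet + 2 * δ) (trans card-image (≡-sym (m+[n∸m]≡n 2≤t))) ⟩
      D * (2 + (t ∸ 2)) + μ * card lineSet + 2 * δ       ≡⟨ cong (D * (2 + (t ∸ 2)) + μ * card lineSet +_) (≡-sym μ+u) ⟩
      D * (2 + (t ∸ 2)) + μ * card lineSet + (μ + u)
        ≡⟨ solve 5 (λ D x m c u → D :* (con 2 :+ x) :+ m :* c :+ (m :+ u) := m :* c :+ (D :* x :+ u) :+ (con 2 :* D :+ m)) refl D (t ∸ 2) μ (card lineSet) u ⟩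
      μ * card lineSet + (D * (t ∸ 2) + u) + (2 * D + μ) ≤⟨ +-monoˡ-≤ (2 * D + μ) (+-monoʳ-≤ (μ * card lineSet) (lines (proj₁ (cover point₀ point₁ point₀≢point₁)))) ⟩
      μ * card lineSet + ∑ M weight + (2 * D + μ)        ≡⟨ cong (_+ (2 * D + μ)) (≡-sym δI≡) ⟩
      δ * incidences full + (2 * D + μ) ∎
      where open ≤-Reasoning

    line∈ : ∀ a b B → a ≢ b → J B a ≡ true → J B b ≡ true → lineSet B ≡ true
    line∈ a b B a≢b p q with card (J B) | two≤
      where
      two≤ : 2 ≤ card (J B)
      two≤ = begin
        2                                           ≡⟨ ≡-sym (cong₂ _+_ (∑-δ a (λ _ → 1)) (∑-δ b (λ _ → 1))) ⟩
        ∑ t (λ c → 𝟙 (c == a) * 1) + ∑ t (λ c → 𝟙 (c == b) * 1)  ≡⟨ ≡-sym (∑ᴸ-+ (allFin t) _ _) ⟩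
        ∑ t (λ c → 𝟙 (c == a) * 1 + 𝟙 (c == b) * 1) ≤⟨ ∑-mono t cell ⟩
        card (J B) ∎
        where
        open ≤-Reasoning
        cell : ∀ c → 𝟙 (c == a) * 1 + 𝟙 (c == b) * 1 ≤ 𝟙 (J B c)
        cell c with c ≟ᶠ a | c ≟ᶠ b
        ... | yes refl | yes refl = ⊥-elim (a≢b refl)
        ... | yes refl | no _ rewrite p = ≤-refl
        ... | no _ | yes refl rewrite q = ≤-refl
        ... | no _ | no _ = z≤n
    ... | suc (suc _) | _ = refl
    ... | 1           | s≤s ()

    edgeOf : ∀ a b B → a ≢ b → J B a ≡ true → J B b ≡ true → Edge full (f a) (f b) B
    edgeOf a b B a≢b p q = record
      { u≢v = a≢b ∘ f-inj a b ; u∈ = f∈image a ; v∈ = f∈image b ; B∈ = line∈ a b B a≢b p q ; incᵤ = p ; incᵥ = q }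

    -- A blob holds at most `s < t` points of the clique, so some point `z` avoids the blob `B` of
    -- the first two points; the blob through `z` and the first point is then a second one.
    full-two : TwoBlobs full
    full-two with cover point₀ point₁ point₀≢point₁
    ... | B , p₀ , p₁ with ∑ᴸ-<⇒∃ (allFin t) {λ a → 𝟙 (J B a)} {λ _ → 1} (≤-trans (s≤s (short B)) (≤-trans (≤-trans (≤-reflexive (+-comm 1 s)) (+-monoʳ-≤ s (s≤s z≤n))) (≤-trans s+2≤t (≤-reflexive (≡-sym (∑-1 t))))))
    ...   | z , lt with J B z in z∉
    ...     | true with () ← <-irrefl refl lt
    ...     | false with cover point₀ z (λ eq → contra (trans (≡-sym p₀) (trans (cong (J B) eq) z∉)))
      where
      contra : true ≡ false → ⊥
      contra ()
    ...       | B′ , q₀ , qz = B , B′ , B≢B′ , (_ , _ , edgeOf point₀ point₁ B point₀≢point₁ p₀ p₁) ,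
                (_ , _ , edgeOf point₀ z B′ (λ eq → contra (trans (≡-sym p₀) (trans (cong (J B) eq) z∉))) q₀ qz)
      where
      contra : true ≡ false → ⊥
      contra ()
      B≢B′ : B ≢ B′
      B≢B′ refl = contra (trans (≡-sym qz) z∉)

    private
      -- Beyond the edge and its blob, each vertex has at most one incidence with that blob and
      -- costs `D ≥ δ`, and each further blob has at most one incidence and costs `μ ≥ δ`. Hence no
      -- addition lowers the exponent below that of the edge.
      single-blob : ∀ c {a b B} → Edge c a b B → ¬ TwoBlobs c → δ * incidences c + (2 * D + μ) ≤ cost c + 2 * δ
      single-blob c@(X , 𝓑) {a} {b} {B} e ¬two = +-cancelʳ-≤ (δ * card X + δ * card 𝓑) _ _ (begin
        δ * incidences c + (2 * D + μ) + (δ * card X + δ * card 𝓑)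
          ≤⟨ +-monoˡ-≤ (δ * card X + δ * card 𝓑) (+-monoˡ-≤ (2 * D + μ) δI≤) ⟩
        (δ * card X + δ * rest) + (2 * D + μ) + (δ * card X + δ * card 𝓑)
          ≡⟨ cong (λ y → (δ * card X + δ * rest) + (2 * D + μ) + (δ * card X + δ * y)) 𝓑≡ ⟩
        (δ * x + δ * rest) + (2 * D + μ) + (δ * x + δ * (1 + rest))
          ≡⟨ cong (λ y → (δ * x + δ * rest) + (2 * D + μ) + (δ * y + δ * (1 + rest))) x≡ ⟩
        (δ * x + δ * rest) + (2 * D + μ) + (δ * (2 + x′) + δ * (1 + rest))
          ≡⟨ solve 6 (λ d x r D m x′ → (d :* x :+ d :* r) :+ (con 2 :* D :+ m) :+ (d :* (con 2 :+ x′) :+ d :* (con 1 :+ r))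
               := con 2 :* D :+ d :* x′ :+ (m :+ d :* r) :+ con 2 :* d :+ (d :* x :+ d :* (con 1 :+ r))) refl δ x rest D μ x′ ⟩
        2 * D + δ * x′ + (μ + δ * rest) + 2 * δ + (δ * x + δ * (1 + rest))
          ≤⟨ +-monoˡ-≤ (δ * x + δ * (1 + rest)) (+-monoˡ-≤ (2 * δ) (+-mono-≤ (+-monoʳ-≤ (2 * D) (*-monoˡ-≤ x′ δ≤D)) (+-monoʳ-≤ μ (*-monoˡ-≤ rest δ≤μ)))) ⟩
        2 * D + D * x′ + (μ + μ * rest) + 2 * δ + (δ * x + δ * (1 + rest))
          ≡⟨ solve 6 (λ d x r D m x′ → con 2 :* D :+ D :* x′ :+ (m :+ m :* r) :+ con 2 :* d :+ (d :* x :+ d :* (con 1 :+ r))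
               := (D :* (con 2 :+ x′) :+ m :* (con 1 :+ r)) :+ con 2 :* d :+ (d :* x :+ d :* (con 1 :+ r))) refl δ x rest D μ x′ ⟩
        (D * (2 + x′) + μ * (1 + rest)) + 2 * δ + (δ * x + δ * (1 + rest))
          ≡⟨ cong₂ (λ y z → (D * y + μ * z) + 2 * δ + (δ * x + δ * z)) (≡-sym x≡) (≡-sym 𝓑≡) ⟩
        cost c + 2 * δ + (δ * card X + δ * card 𝓑) ∎)
        where
        open ≤-Reasoning
        open Edge e
        x x′ rest : ℕ
        x = card X
        rest = ∑ M (λ B′ → 𝟙 (not (B′ == B)) * 𝟙 (𝓑 B′))
        𝓑≡ : card 𝓑 ≡ 1 + rest
        𝓑≡ = trans (∑-cong M (λ B′ → trans (≡-sym (*-identityˡ _)) (trans (cong (_* 𝟙 (𝓑 B′)) (≡-sym (𝟙-not (B′ == B)))) (*-distribʳ-+ (𝟙 (𝓑 B′)) (𝟙 (B′ == B)) _))))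
          (trans (∑ᴸ-+ (allFin M) _ _) (cong₂ _+_ (trans (∑-δ B (𝟙 ∘ 𝓑)) (cong 𝟙 B∈)) refl))
        2≤x : 2 ≤ x
        2≤x = begin
          2                                           ≡⟨ ≡-sym (cong₂ _+_ (∑-δ a (λ _ → 1)) (∑-δ b (λ _ → 1))) ⟩
          ∑ N (λ c → 𝟙 (c == a) * 1) + ∑ N (λ c → 𝟙 (c == b) * 1)  ≡⟨ ≡-sym (∑ᴸ-+ (allFin N) _ _) ⟩
          ∑ N (λ c → 𝟙 (c == a) * 1 + 𝟙 (c == b) * 1) ≤⟨ ∑-mono N cell ⟩
          card X ∎
          where
          cell : ∀ c → 𝟙 (c == a) * 1 + 𝟙 (c == b) * 1 ≤ 𝟙 (X c)
          cell c with c ≟ᶠ a | c ≟ᶠ b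
          ... | yes refl | yes refl = ⊥-elim (u≢v refl)
          ... | yes refl | no _ rewrite u∈ = ≤-refl
          ... | no _ | yes refl rewrite v∈ = ≤-refl
          ... | no _ | no _ = z≤n
        x′ = x ∸ 2
        x≡ : x ≡ 2 + x′
        x≡ = ≡-sym (m+[n∸m]≡n 2≤x)
        row : Fin M → ℕ
        row B′ = ∑ N (λ v → 𝟙 (𝓑 B′ ∧ (X v ∧ inc B′ v)))
        row≤ : ∀ B′ → row B′ ≤ 𝟙 (B′ == B) * x + 𝟙 (not (B′ == B)) * 𝟙 (𝓑 B′)
        row≤ B′ with B′ ≟ᶠ B
        ... | yes refl = ≤-trans (∑-mono N (λ v → drop (𝓑 B′) (X v) (inc B′ v))) (≤-reflexive (≡-sym (trans (+-identityʳ _) (+-identityʳ x))))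
          where
          drop : ∀ p q r → 𝟙 (p ∧ (q ∧ r)) ≤ 𝟙 q
          drop true  true  r = 𝟙≤1 r
          drop true  false r = z≤n
          drop false q     r = z≤n
        ... | no B′≢B with 𝓑 B′ in eq
        ...   | false = ≤-reflexive (∑-zero N (λ _ → refl))
        ...   | true  = ∑-unique≤1 N (λ v → X v ∧ inc B′ v) unique
          where
          unique : ∀ v w → X v ∧ inc B′ v ≡ true → X w ∧ inc B′ w ≡ true → v ≡ w
          unique v w p q with v ≟ᶠ w
          ... | yes h = h
          ... | no v≢w = ⊥-elim (¬two (B , B′ , B′≢B ∘ ≡-sym , (a , b , e) ,
            (v , w , record { u≢v = v≢w ; u∈ = ∧-elimˡ p ; v∈ = ∧-elimˡ q ; B∈ = eq ; incᵤ = ∧-elimʳ (X v) p ; incᵥ = ∧-elimʳ (X w) q })))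
        δI≤ : δ * incidences c ≤ δ * card X + δ * rest
        δI≤ = ≤-trans (*-monoʳ-≤ δ (≤-trans (∑-mono M row≤) (≤-reflexive (trans (∑ᴸ-+ (allFin M) _ _) (cong₂ _+_ (∑-δ B (λ _ → x)) refl)))))
          (≤-reflexive (*-distribˡ-+ δ x rest))

      -- The exponent `cost - δ * incidences`, shifted by the constant `δ * incidences full` so that
      -- it stays a natural number on every part of `full`.
      measure : Config → ℕ
      measure c = cost c + δ * (incidences full ∸ incidences c)

      measure⇒⪯ : ∀ {c c′} → c ⊑ full → c′ ⊑ full → measure c ≤ measure c′ → c ⪯ c′
      measure⇒⪯ {c} {c′} h h′ le = +-cancelʳ-≤ (δ * (incidences full ∸ incidences c)) _ _ (begin
        cost c + δ * i′ + δ * (I ∸ i)    ≡⟨ solve 3 (λ a b c → a :+ b :+ c := a :+ c :+ b) refl (cost c) (δ * i′) (δ * (I ∸ i)) ⟩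
        measure c + δ * i′               ≤⟨ +-monoˡ-≤ (δ * i′) le ⟩
        cost c′ + δ * (I ∸ i′) + δ * i′  ≡⟨ solve 4 (λ a d x y → a :+ d :* x :+ d :* y := a :+ d :* (x :+ y)) refl (cost c′) δ (I ∸ i′) i′ ⟩
        cost c′ + δ * (I ∸ i′ + i′)      ≡⟨ cong (λ z → cost c′ + δ * z) (trans (m∸n+n≡m (incidences-mono h′)) (≡-sym (m+[n∸m]≡n (incidences-mono h)))) ⟩
        cost c′ + δ * (i + (I ∸ i))      ≡⟨ solve 4 (λ a d x y → a :+ d :* (x :+ y) := a :+ d :* x :+ d :* y) refl (cost c′) δ i (I ∸ i) ⟩
        cost c′ + δ * i + δ * (I ∸ i) ∎)
        where
        open ≤-Reasoning
        I i i′ : ℕ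
        I = incidences full
        i = incidences c
        i′ = incidences c′

      ⊑-trans : ∀ {c c′ c″} → c ⊑ c′ → c′ ⊑ c″ → c ⊑ c″
      ⊑-trans (a , b) (a′ , b′) = (λ v → a′ v ∘ a v) , (λ v → b′ v ∘ b v)

      Least : Config → Set
      Least c = c ⊑ full × TwoBlobs c × measure c ≤ measure full × (∀ c′ → c′ ⊑ c → TwoBlobs c′ → measure c ≤ measure c′)

      -- Descent on `measure`: a part with two blobs and a smaller measure becomes the new
      -- candidate. Only such parts are compared here; the others are handled through `full`.
      least : ∀ k c → measure c ≤ k → c ⊑ full → TwoBlobs c → measure c ≤ measure full → ¬ ¬ (∃[ c ] Least c)
      least k c m≤k sub two le no-least = no-least (c , sub , two , le , min)
        where
        min : ∀ c′ → c′ ⊑ c → TwoBlobs c′ → measure c ≤ measure c′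
        min c′ sub′ two′ = ≮⇒≥ (descend k m≤k)
          where
          descend : ∀ k → measure c ≤ k → ¬ (measure c′ < measure c)
          descend zero    h lt = <⇒≱ (≤-trans lt h) z≤n
          descend (suc k) h lt = least k c′ (≤-pred (≤-trans lt h)) (⊑-trans {c′} {c} {full} sub′ sub) two′ (≤-trans (<⇒≤ lt) le) no-least

      ⪯-full : ∀ {c c′} → c ⪯ full → δ * incidences c′ + (2 * D + μ) ≤ cost c′ + 2 * δ → c ⪯ c′
      ⪯-full {c} {c′} h h′ = +-cancelʳ-≤ (δ * incidences full + (2 * D + μ)) _ _ (begin
        cost c + δ * i′ + (δ * I + (2 * D + μ))     ≡⟨ solve 4 (λ a b c d → a :+ b :+ (c :+ d) := a :+ c :+ (b :+ d)) refl (cost c) (δ * i′) (δ * I) (2 * D + μ) ⟩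
        cost c + δ * I + (δ * i′ + (2 * D + μ))     ≤⟨ +-mono-≤ h h′ ⟩
        cost full + δ * i + (cost c′ + 2 * δ)       ≡⟨ solve 4 (λ a b c d → a :+ b :+ (c :+ d) := c :+ b :+ (a :+ d)) refl (cost full) (δ * i) (cost c′) (2 * δ) ⟩
        cost c′ + δ * i + (cost full + 2 * δ)       ≤⟨ +-monoʳ-≤ (cost c′ + δ * i) full-weight ⟩
        cost c′ + δ * i + (δ * I + (2 * D + μ)) ∎)
        where
        open ≤-Reasoning
        I i i′ : ℕ
        I = incidences full
        i = incidences c
        i′ = incidences c′

      lineSet≤ : card lineSet ≤ t * t
      lineSet≤ = ≤-trans (∑-mono M each) (≤-trans (≤-reflexive (trans (∑ᴸ-swap (allFin M) (allFin t) _) (∑-cong t (λ a → ∑ᴸ-swap (allFin M) (allFin t) _))))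
        (≤-trans (∑-mono t (λ a → ∑-mono t (λ b → cell a b))) (≤-reflexive (trans (∑-cong t (λ _ → ∑-1 t)) (∑-const t t)))))
        where
        contribution : Fin M → Fin t → Fin t → ℕ
        contribution B a b = 𝟙 (not (a == b)) * (𝟙 (J B a) * 𝟙 (J B b))
        each : ∀ B → 𝟙 (lineSet B) ≤ ∑ t (λ a → ∑ t (λ b → contribution B a b))
        each B with card (J B) | card² (J B)
        ... | 0 | _ = z≤n
        ... | 1 | _ = z≤n
        ... | suc (suc c) | eq = ≤-trans (s≤s z≤n) (≤-reflexive (+-cancelˡ-≡ (suc (suc c)) _ _ eq))
        cell : ∀ a b → ∑ M (λ B → contribution B a b) ≤ 1
        cell a b with a ≟ᶠ b
        ... | yes _ = ≤-trans (≤-reflexive (∑-zero M (λ _ → refl))) z≤n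
        ... | no a≢b = ≤-trans (≤-reflexive (∑-cong M (λ B → trans (+-identityʳ _) (and (J B a) (J B b)))))
            (∑-unique≤1 M (λ B → J B a ∧ J B b) (λ B B′ h h′ → linear a b a≢b B B′ (∧-elimˡ h) (∧-elimʳ (J B a) h) (∧-elimˡ h′) (∧-elimʳ (J B′ a) h′)))
          where
          and : ∀ b c → 𝟙 b * 𝟙 c ≡ 𝟙 (b ∧ c)
          and true  c = +-identityʳ _
          and false c = refl

    -- Parts with two blobs cannot beat the least one. A part with an edge in only one blob has at
    -- least the exponent of an edge, which by `full-weight` is at least that of `full`, and hence
    -- of the least configuration.
    rare : ¬ ¬ (∃[ c ] (Rare t c × proj₁ c ⊆ᵐ image))
    rare k = least (measure full) full ≤-refl ((λ _ h → h) , (λ _ h → h)) full-two ≤-refl found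
      where
      found : ¬ (∃[ c ] Least c)
      found (c , sub , two , le , min) = k (c , record
        { linear = λ u v u≢v u∈ v∈ B B′ → lin u v u≢v (image⇒ u (proj₁ sub u u∈)) (image⇒ v (proj₁ sub v v∈)) B B′
        ; minimal = λ c′ sub′ (a , b , B , e) → decidable-stable (_ ≤? _) λ ¬le → ¬¬-em λ
            { (inj₁ two′) → ¬le (measure⇒⪯ {c} {c′} sub (⊑-trans {c′} {c} {full} sub′ sub) (min c′ sub′ two′))
            ; (inj₂ one) → ¬le (⪯-full {c} {c′} (measure⇒⪯ {c} {full} sub ((λ _ h → h) , (λ _ h → h)) le) (single-blob c′ e one)) }
        ; two = two
        ; few = ≤-trans (card-mono (proj₁ sub)) (≤-reflexive card-image) , ≤-trans (card-mono (proj₂ sub)) lineSet≤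
        } , proj₁ sub)
        where
        lin : ∀ u v → u ≢ v → (∃[ a ] u ≡ f a) → (∃[ b ] v ≡ f b) → ∀ B B′ →
          inc B u ≡ true → inc B v ≡ true → inc B′ u ≡ true → inc B′ v ≡ true → B ≡ B′
        lin u v u≢v (a , refl) (b , refl) B B′ = linear a b (λ { refl → u≢v refl }) B B′

-- Random blobs

bools : List Bool
bools = true ∷ false ∷ []

masks : ∀ n → List (Vec Bool n)
masks n = vecs bools n

cardⱽ : ∀ {n} → Vec Bool n → ℕ
cardⱽ S = card (lookup S)

-- Union bound over subsets, using Σ_S N^{-|S|} = (1 + 1/N)^N ≤ 4.
union-masks : ∀ N → 1 ≤ N → (cnt : Vec Bool N → ℕ) → ∀ K → (∀ S → cnt S * N ^ cardⱽ S ≤ K) → ∑ᴸ (masks N) cnt ≤ 4 * K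
union-masks N 1≤N cnt K h = *-cancelʳ-≤′ (N ^ N) (^-pos N N 1≤N) (begin
  ∑ᴸ (masks N) cnt * N ^ N                                 ≡⟨ ≡-sym (∑ᴸ-*ʳ (masks N) cnt (N ^ N)) ⟩
  ∑ᴸ (masks N) (λ S → cnt S * N ^ N)                       ≤⟨ ∑ᴸ-mono (masks N) each ⟩
  ∑ᴸ (masks N) (λ S → K * ∏ N (λ v → w (lookup S v)))      ≡⟨ ∑ᴸ-* (masks N) K _ ⟩
  K * ∑ᴸ (masks N) (λ S → ∏ N (λ v → w (lookup S v)))      ≡⟨ cong (K *_) (trans (∑ᴸ-vecs-∏ bools N (λ _ → w)) (∏-const N (1 + (N + 0)))) ⟩
  K * (1 + (N + 0)) ^ N                                    ≡⟨ cong (λ x → K * suc x ^ N) (+-identityʳ N) ⟩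
  K * suc N ^ N                                            ≤⟨ *-monoʳ-≤ K ([1+1/y]^n≤4 N N ≤-refl) ⟩
  K * (4 * N ^ N)                                          ≡⟨ solve 2 (λ k n → k :* (con 4 :* n) := con 4 :* k :* n) refl K (N ^ N) ⟩
  4 * K * N ^ N ∎)
  where
  open ≤-Reasoning
  w : Bool → ℕ
  w b = if b then 1 else N
  split : ∀ S → N ^ N ≡ N ^ cardⱽ S * ∏ N (λ v → w (lookup S v))
  split S = trans (≡-sym (∏-const N N)) (trans (∏-cong N (λ v → cell (lookup S v)))
    (trans (∏-* N (λ v → N ^ 𝟙 (lookup S v)) (λ v → w (lookup S v))) (cong (_* ∏ N (λ v → w (lookup S v))) (∏-^ N N _))))
    where
    cell : ∀ b → N ≡ N ^ 𝟙 b * w b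
    cell true  = ≡-sym (trans (*-identityʳ _) (*-identityʳ N))
    cell false = ≡-sym (+-identityʳ N)
  each : ∀ S → cnt S * N ^ N ≤ K * ∏ N (λ v → w (lookup S v))
  each S = ≤-trans (≤-reflexive (trans (cong (cnt S *_) (split S)) (≡-sym (*-assoc (cnt S) _ _)))) (*-monoˡ-≤ _ (h S))

module Random (N M s P : ℕ) (s≤P : s ≤ P) (1≤P : 1 ≤ P) where

  -- The v-th entry of a row is the colour of v in the blob; v lies in the blob when it is less than s.
  Row : Set
  Row = Vec (Fin P) N

  rows : List Row
  rows = vecs (allFin P) N

  Ω : List (Vec Row M)
  Ω = vecs rows M

  rowTotal total : ℕ
  rowTotal = P ^ N
  total = rowTotal ^ M

  ∑rows-1 : ∑ᴸ rows (λ _ → 1) ≡ rowTotal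
  ∑rows-1 = trans (length-vecs (allFin P) N) (cong (_^ N) (∑-1 P))

  ∑Ω-1 : ∑ᴸ Ω (λ _ → 1) ≡ total
  ∑Ω-1 = trans (length-vecs rows M) (cong (_^ M) ∑rows-1)

  1≤rowTotal : 1 ≤ rowTotal
  1≤rowTotal = ^-pos P N 1≤P

  isIn : Fin P → Bool
  isIn x = suc (toℕ x) ≤ᵇ s

  count-in : ∑ P (λ x → 𝟙 (isIn x)) ≡ s
  count-in = go P s s≤P
    where
    go : ∀ p k → k ≤ p → ∑ p (λ x → 𝟙 (suc (toℕ x) ≤ᵇ k)) ≡ k
    go zero    zero    _ = refl
    go (suc p) zero    _ = ∑-zero (suc p) {λ x → 𝟙 (suc (toℕ x) ≤ᵇ zero)} (λ _ → refl)
    go (suc p) (suc k) (s≤s h) = trans (∑-suc p (λ x → 𝟙 (suc (toℕ x) ≤ᵇ suc k))) (cong suc (go p k h))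

  hits : Mask N → Row → Mask N
  hits S r v = S v ∧ isIn (lookup r v)

  trace : Mask N → Row → ℕ
  trace S r = card (hits S r)

  cell≤ : ∀ Λ b → ∑ P (λ x → Λ ^ 𝟙 (b ∧ isIn x)) ≤ P + 𝟙 b * (s * Λ)
  cell≤ Λ false = ≤-reflexive (trans (∑-1 P) (≡-sym (+-identityʳ P)))
  cell≤ Λ true  = begin
    ∑ P (λ x → Λ ^ 𝟙 (isIn x))           ≤⟨ ∑-mono P (λ x → each (isIn x)) ⟩
    ∑ P (λ x → 1 + 𝟙 (isIn x) * Λ)       ≡⟨ trans (∑ᴸ-+ (allFin P) _ _) (cong₂ _+_ (∑-1 P) (∑ᴸ-*ʳ (allFin P) _ Λ)) ⟩
    P + ∑ P (λ x → 𝟙 (isIn x)) * Λ       ≡⟨ cong (λ k → P + k * Λ) count-in ⟩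
    P + s * Λ                            ≡⟨ cong (P +_) (≡-sym (*-identityˡ (s * Λ))) ⟩
    P + 1 * (s * Λ) ∎
    where
    open ≤-Reasoning
    each : ∀ b → Λ ^ 𝟙 b ≤ 1 + 𝟙 b * Λ
    each true  = ≤-trans (≤-reflexive (trans (*-identityʳ Λ) (≡-sym (+-identityʳ Λ)))) (n≤1+n _)
    each false = ≤-refl

  -- The vertices are coloured independently, so the moment is a product in which each vertex of `S`
  -- contributes at most `1 + s Λ / P`.
  trace-moment : ∀ S Λ q → card S * (s * Λ) ≤ q * P → ∑ᴸ rows (λ r → Λ ^ trace S r) ≤ 4 ^ q * rowTotal
  trace-moment S Λ q h = *-cancelʳ-≤′ (P ^ card S) (^-pos P (card S) 1≤P) (begin
    ∑ᴸ rows (λ r → Λ ^ trace S r) * P ^ card S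
      ≡⟨ cong₂ _*_ (trans (∑ᴸ-cong rows (λ r → ≡-sym (∏-^ N Λ _))) (∑ᴸ-vecs-∏ (allFin P) N (λ v x → Λ ^ 𝟙 (S v ∧ isIn x)))) (≡-sym (∏-^ N P _)) ⟩
    ∏ N (λ v → ∑ P (λ x → Λ ^ 𝟙 (S v ∧ isIn x))) * ∏ N (λ v → P ^ 𝟙 (S v))   ≡⟨ ≡-sym (∏-* N _ _) ⟩
    ∏ N (λ v → ∑ P (λ x → Λ ^ 𝟙 (S v ∧ isIn x)) * P ^ 𝟙 (S v))               ≤⟨ ∏-mono N (λ v → each (S v)) ⟩
    ∏ N (λ v → P * (P + s * Λ) ^ 𝟙 (S v))                                    ≡⟨ trans (∏-* N _ _) (cong₂ _*_ (∏-const N P) (∏-^ N (P + s * Λ) _)) ⟩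
    P ^ N * (P + s * Λ) ^ card S                                            ≤⟨ *-monoʳ-≤ (P ^ N) ([b+a]^n≤ P (s * Λ) (card S) q h 1≤P) ⟩
    P ^ N * (4 ^ q * P ^ card S)                                            ≡⟨ solve 3 (λ a b c → a :* (b :* c) := b :* a :* c) refl (P ^ N) (4 ^ q) (P ^ card S) ⟩
    4 ^ q * rowTotal * P ^ card S ∎)
    where
    open ≤-Reasoning
    each : ∀ b → ∑ P (λ x → Λ ^ 𝟙 (b ∧ isIn x)) * P ^ 𝟙 b ≤ P * (P + s * Λ) ^ 𝟙 b
    each true  = ≤-trans (*-monoˡ-≤ (P ^ 1) (≤-trans (cell≤ Λ true) (≤-reflexive (cong (P +_) (*-identityˡ (s * Λ))))))
      (≤-reflexive (solve 2 (λ p x → (p :+ x) :* (p :* con 1) := p :* ((p :+ x) :* con 1)) refl P (s * Λ)))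
    each false = *-monoˡ-≤ 1 (≤-trans (cell≤ Λ false) (≤-reflexive (+-identityʳ P)))

  rows-product : ∀ (f : Row → ℕ) → ∑ᴸ Ω (λ ω → ∏ M (λ i → f (lookup ω i))) ≡ ∑ᴸ rows f ^ M
  rows-product f = trans (∑ᴸ-vecs-∏ rows M (λ _ → f)) (∏-const M _)

  -- Passage from one blob to all `M`: the moments multiply, and `κ` is the surplus of one row over
  -- the trivial value.
  rows-moment : ∀ (f : Row → ℕ) Λ κ q → ∑ᴸ rows (λ r → Λ ^ f r) ≤ rowTotal + κ → M * κ ≤ q * rowTotal →
    ∑ᴸ Ω (λ ω → Λ ^ ∑ M (λ i → f (lookup ω i))) ≤ 4 ^ q * total
  rows-moment f Λ κ q h h′ = begin
    ∑ᴸ Ω (λ ω → Λ ^ ∑ M (λ i → f (lookup ω i)))     ≡⟨ ∑ᴸ-cong Ω (λ ω → ≡-sym (∏-^ M Λ _)) ⟩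
    ∑ᴸ Ω (λ ω → ∏ M (λ i → Λ ^ f (lookup ω i)))     ≡⟨ rows-product (λ r → Λ ^ f r) ⟩
    ∑ᴸ rows (λ r → Λ ^ f r) ^ M                     ≤⟨ ^-mono M h ⟩
    (rowTotal + κ) ^ M                              ≤⟨ [b+a]^n≤ rowTotal κ M q h′ 1≤rowTotal ⟩
    4 ^ q * total ∎
    where open ≤-Reasoning

  doubles : Mask N → Vec Row M → ℕ
  doubles S ω = ∑ M (λ i → 𝟙 (2 ≤ᵇ trace S (lookup ω i)))

  bulk : ℕ → ℕ → ℕ
  bulk x₀ y = if x₀ ≤ᵇ y then y else 0

  large : ℕ → Mask N → Vec Row M → ℕ
  large x₀ S ω = ∑ M (λ i → bulk x₀ (trace S (lookup ω i)))

  -- Since `Λ² ≤ Λ^y` for `y ≥ 2`, the moment of one trace shows that a blob meets `S` twice with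
  -- probability at most `4/Λ²`; the condition on `q` bounds the expected number of such blobs.
  doubles-moment : ∀ S Λ q → card S * (s * Λ) ≤ P → 1 ≤ Λ → 4 * M ≤ q * (Λ * Λ) →
    ∑ᴸ Ω (λ ω → 2 ^ doubles S ω) ≤ 4 ^ q * total
  doubles-moment S Λ q h 1≤Λ h′ = rows-moment (λ r → 𝟙 (2 ≤ᵇ trace S r)) 2 κ q
    (≤-reflexive (trans (∑ᴸ-cong rows (λ r → pow (2 ≤ᵇ trace S r))) (trans (∑ᴸ-+ rows _ _) (cong (_+ κ) ∑rows-1))))
    (*-cancelˡ-≤′ (Λ * Λ) (*-mono-≤ 1≤Λ 1≤Λ) (begin
      Λ * Λ * (M * κ)           ≡⟨ solve 3 (λ l m k → l :* (m :* k) := m :* (l :* k)) refl (Λ * Λ) M κ ⟩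
      M * (Λ * Λ * κ)           ≤⟨ *-monoʳ-≤ M κ≤ ⟩
      M * (4 * rowTotal)        ≡⟨ solve 2 (λ m r → m :* (con 4 :* r) := con 4 :* m :* r) refl M rowTotal ⟩
      4 * M * rowTotal          ≤⟨ *-monoˡ-≤ rowTotal h′ ⟩
      q * (Λ * Λ) * rowTotal    ≡⟨ solve 3 (λ q l r → q :* l :* r := l :* (q :* r)) refl q (Λ * Λ) rowTotal ⟩
      Λ * Λ * (q * rowTotal) ∎))
    where
    open ≤-Reasoning
    κ : ℕ
    κ = ∑ᴸ rows (λ r → 𝟙 (2 ≤ᵇ trace S r))
    pow : ∀ b → 2 ^ 𝟙 b ≡ 1 + 𝟙 b
    pow true  = refl
    pow false = refl
    κ≤ : Λ * Λ * κ ≤ 4 * rowTotal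
    κ≤ = ≤-trans (≤-reflexive (≡-sym (∑ᴸ-* rows (Λ * Λ) _)))
      (≤-trans (∑ᴸ-mono rows (λ r → each (trace S r)))
      (≤-trans (trace-moment S Λ 1 (≤-trans h (≤-reflexive (≡-sym (*-identityˡ P))))) ≤-refl))
      where
      each : ∀ y → Λ * Λ * 𝟙 (2 ≤ᵇ y) ≤ Λ ^ y
      each 0 = ≤-trans (≤-reflexive (*-zeroʳ (Λ * Λ))) z≤n
      each 1 = ≤-trans (≤-reflexive (*-zeroʳ (Λ * Λ))) z≤n
      each (suc (suc y)) = ≤-trans (≤-reflexive (trans (*-identityʳ (Λ * Λ)) (≡-sym (*-identityʳ (Λ * Λ)))))
        (≤-trans (*-monoʳ-≤ (Λ * Λ) (^-pos Λ y 1≤Λ)) (≤-reflexive (*-assoc Λ Λ (Λ ^ y))))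

  -- On traces of size at least `x₀` the moment with base 4 exceeds that with base 2 by a factor
  -- `2^x₀`, and this factor beats the number of blobs.
  large-moment : ∀ S x₀ → card S * (s * 4) ≤ P → 4 * M ≤ 2 ^ x₀ → ∑ᴸ Ω (λ ω → 2 ^ large x₀ S ω) ≤ 4 * total
  large-moment S x₀ h h′ = rows-moment (λ r → bulk x₀ (trace S r)) 2 κ 1
    (≤-trans (∑ᴸ-mono rows (λ r → pow (trace S r))) (≤-reflexive (trans (∑ᴸ-+ rows _ _) (cong (_+ κ) ∑rows-1))))
    (*-cancelˡ-≤′ (2 ^ x₀) (^-pos 2 x₀ (s≤s z≤n)) (begin
      2 ^ x₀ * (M * κ)          ≡⟨ solve 3 (λ l m k → l :* (m :* k) := m :* (l :* k)) refl (2 ^ x₀) M κ ⟩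
      M * (2 ^ x₀ * κ)          ≤⟨ *-monoʳ-≤ M κ≤ ⟩
      M * (4 * rowTotal)        ≡⟨ solve 2 (λ m r → m :* (con 4 :* r) := con 4 :* m :* r) refl M rowTotal ⟩
      4 * M * rowTotal          ≤⟨ *-monoˡ-≤ rowTotal h′ ⟩
      2 ^ x₀ * rowTotal         ≡⟨ cong (2 ^ x₀ *_) (≡-sym (*-identityˡ rowTotal)) ⟩
      2 ^ x₀ * (1 * rowTotal) ∎))
    where
    open ≤-Reasoning
    big : ℕ → ℕ
    big y = 𝟙 (x₀ ≤ᵇ y) * 2 ^ y
    κ : ℕ
    κ = ∑ᴸ rows (λ r → big (trace S r))
    pow : ∀ y → 2 ^ bulk x₀ y ≤ 1 + big y
    pow y with x₀ ≤ᵇ y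
    ... | true  = ≤-trans (≤-reflexive (≡-sym (*-identityˡ (2 ^ y)))) (n≤1+n _)
    ... | false = ≤-refl
    κ≤ : 2 ^ x₀ * κ ≤ 4 * rowTotal
    κ≤ = ≤-trans (≤-reflexive (≡-sym (∑ᴸ-* rows (2 ^ x₀) _)))
      (≤-trans (∑ᴸ-mono rows (λ r → each (trace S r)))
        (trace-moment S 4 1 (≤-trans h (≤-reflexive (≡-sym (*-identityˡ P))))))
      where
      each : ∀ y → 2 ^ x₀ * big y ≤ 4 ^ y
      each y with x₀ ≤ᵇ y in eq
      ... | false = ≤-trans (≤-reflexive (*-zeroʳ (2 ^ x₀))) z≤n
      ... | true  = ≤-trans (*-mono-≤ (^-monoʳ-≤ 2 (≤ᵇ⇒≤ x₀ y (subst T (≡-sym eq) _))) (≤-reflexive (*-identityˡ (2 ^ y))))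
        (≤-reflexive (≡-sym (^-distribʳ-* 2 2 y)))

  inc : Vec Row M → Fin M → Fin N → Bool
  inc ω B v = isIn (lookup (lookup ω B) v)

  incidence : Vec Row M → Mask N → Mask M → ℕ
  incidence ω X 𝓑 = ∑ M (λ B → ∑ N (λ v → 𝟙 (𝓑 B ∧ (X v ∧ inc ω B v))))

  -- At most `y` vertex-blob pairs are involved. They are independent, and each multiplies the
  -- moment by at most `1 + s R / P ≤ 1 + 1/y`.
  incidence-moment : ∀ X 𝓑 R y → 1 ≤ y → card 𝓑 * card X ≤ y → s * R * y ≤ P →
    ∑ᴸ Ω (λ ω → R ^ incidence ω X 𝓑) ≤ 4 * total
  incidence-moment X 𝓑 R y 1≤y small h = *-cancelʳ-≤′ (y ^ c) (^-pos y c 1≤y) (begin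
    ∑ᴸ Ω (λ ω → R ^ incidence ω X 𝓑) * y ^ c
      ≡⟨ cong₂ _*_ product y^c ⟩
    ∏ M (λ B → ∏ N (λ v → f B v)) * ∏ M (λ B → ∏ N (λ v → y ^ b B v))
      ≡⟨ trans (≡-sym (∏-* M _ _)) (∏-cong M (λ B → ≡-sym (∏-* N _ _))) ⟩
    ∏ M (λ B → ∏ N (λ v → f B v * y ^ b B v))
      ≤⟨ ∏-mono M (λ B → ∏-mono N (λ v → cell (𝓑 B) (X v))) ⟩
    ∏ M (λ B → ∏ N (λ v → P * suc y ^ b B v))
      ≡⟨ trans (∏-cong M (λ B → trans (∏-* N _ _) (cong₂ _*_ (∏-const N P) (∏-^ N (suc y) (b B)))))
           (trans (∏-* M _ _) (cong₂ _*_ (∏-const M rowTotal) (trans (∏-^ M (suc y) _) (cong (suc y ^_) ∑b)))) ⟩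
    total * suc y ^ c
      ≤⟨ *-monoʳ-≤ total ([1+1/y]^n≤4 y c small) ⟩
    total * (4 * y ^ c)
      ≡⟨ solve 2 (λ t k → t :* (con 4 :* k) := con 4 :* t :* k) refl total (y ^ c) ⟩
    4 * total * y ^ c ∎)
    where
    open ≤-Reasoning
    c : ℕ
    c = card 𝓑 * card X
    b : Fin M → Fin N → ℕ
    b B v = 𝟙 (𝓑 B ∧ X v)
    f : Fin M → Fin N → ℕ
    f B v = ∑ P (λ x → R ^ 𝟙 (𝓑 B ∧ (X v ∧ isIn x)))
    ∑b : ∑ M (λ B → ∑ N (b B)) ≡ c
    ∑b = trans (∑-cong M (λ B → trans (∑-cong N (λ v → ∧≡* (𝓑 B) (X v))) (∑ᴸ-* (allFin N) (𝟙 (𝓑 B)) _))) (∑ᴸ-*ʳ (allFin M) _ (card X))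
      where
      ∧≡* : ∀ a b → 𝟙 (a ∧ b) ≡ 𝟙 a * 𝟙 b
      ∧≡* true  b = ≡-sym (+-identityʳ _)
      ∧≡* false b = refl
    y^c : y ^ c ≡ ∏ M (λ B → ∏ N (λ v → y ^ b B v))
    y^c = trans (cong (y ^_) (≡-sym ∑b)) (trans (≡-sym (∏-^ M y _)) (∏-cong M (λ B → ≡-sym (∏-^ N y (b B)))))
    product : ∑ᴸ Ω (λ ω → R ^ incidence ω X 𝓑) ≡ ∏ M (λ B → ∏ N (f B))
    product = trans (∑ᴸ-cong Ω (λ ω → trans (≡-sym (∏-^ M R _)) (∏-cong M (λ B → ≡-sym (∏-^ N R _)))))
      (trans (∑ᴸ-vecs-∏ rows M (λ B r → ∏ N (λ v → R ^ 𝟙 (𝓑 B ∧ (X v ∧ isIn (lookup r v))))))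
        (∏-cong M (λ B → ∑ᴸ-vecs-∏ (allFin P) N (λ v x → R ^ 𝟙 (𝓑 B ∧ (X v ∧ isIn x))))))
    cell : ∀ p q → ∑ P (λ x → R ^ 𝟙 (p ∧ (q ∧ isIn x))) * y ^ 𝟙 (p ∧ q) ≤ P * suc y ^ 𝟙 (p ∧ q)
    cell false q     = *-monoˡ-≤ 1 (≤-reflexive (∑-1 P))
    cell true  false = *-monoˡ-≤ 1 (≤-reflexive (∑-1 P))
    cell true  true  = begin
      ∑ P (λ x → R ^ 𝟙 (isIn x)) * (y * 1)   ≤⟨ *-monoˡ-≤ (y * 1) (cell≤ R true) ⟩
      (P + 1 * (s * R)) * (y * 1)            ≡⟨ solve 3 (λ p a y → (p :+ con 1 :* a) :* (y :* con 1) := p :* y :+ a :* y) refl P (s * R) y ⟩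
      P * y + s * R * y                      ≤⟨ +-monoʳ-≤ (P * y) h ⟩
      P * y + P                              ≡⟨ solve 2 (λ p y → p :* y :+ p := p :* ((con 1 :+ y) :* con 1)) refl P y ⟩
      P * (suc y * 1) ∎

  dense : ℕ → ℕ → ℕ → Vec Bool N → Vec Bool M → Vec Row M → ℕ
  dense H R c X 𝓑 ω = 𝟙 ((cardⱽ X ≤ᵇ H) ∧ (cardⱽ 𝓑 ≤ᵇ H)) * 𝟙 (c * (N ^ cardⱽ X * M ^ cardⱽ 𝓑) ≤ᵇ R ^ incidence ω (lookup X) (lookup 𝓑))

  -- Markov's inequality at the threshold `c * N^|X| * M^|𝓑|` gives exactly the powers that the
  -- union bounds over `X` and over `𝓑` require. The constant 64 is one factor 4 from the moment and
  -- one from each union bound.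
  dense-rare : ∀ H R c → 1 ≤ H → 1 ≤ N → 1 ≤ M → s * R * (H * H) ≤ P →
    c * ∑ᴸ (masks N) (λ X → ∑ᴸ (masks M) (λ 𝓑 → ∑ᴸ Ω (dense H R c X 𝓑))) ≤ 64 * total
  dense-rare H R c 1≤H 1≤N 1≤M h = begin
    c * ∑ᴸ (masks N) (λ X → ∑ᴸ (masks M) (λ 𝓑 → ∑ᴸ Ω (dense H R c X 𝓑)))   ≡⟨ ≡-sym (∑ᴸ-* (masks N) c _) ⟩
    ∑ᴸ (masks N) (λ X → c * ∑ᴸ (masks M) (λ 𝓑 → ∑ᴸ Ω (dense H R c X 𝓑)))   ≤⟨ union-masks N 1≤N _ (16 * total) outer ⟩
    4 * (16 * total)                                                    ≡⟨ ≡-sym (*-assoc 4 16 total) ⟩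
    64 * total ∎
    where
    open ≤-Reasoning
    inner : ∀ X 𝓑 → ∑ᴸ Ω (dense H R c X 𝓑) * (c * N ^ cardⱽ X) * M ^ cardⱽ 𝓑 ≤ 4 * total
    inner X 𝓑 with (cardⱽ X ≤ᵇ H) in eq₁ | (cardⱽ 𝓑 ≤ᵇ H) in eq₂
    ... | false | _     = ≤-trans (≤-reflexive (cong (λ z → z * (c * N ^ cardⱽ X) * M ^ cardⱽ 𝓑) (∑ᴸ-zero Ω))) z≤n
    ... | true  | false = ≤-trans (≤-reflexive (cong (λ z → z * (c * N ^ cardⱽ X) * M ^ cardⱽ 𝓑) (∑ᴸ-zero Ω))) z≤n
    ... | true  | true  = begin
      ∑ᴸ Ω (λ ω → 1 * 𝟙 (θ ≤ᵇ R ^ incidence ω (lookup X) (lookup 𝓑))) * (c * N ^ cardⱽ X) * M ^ cardⱽ 𝓑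
        ≡⟨ cong (λ z → z * (c * N ^ cardⱽ X) * M ^ cardⱽ 𝓑) (∑ᴸ-cong Ω (λ _ → *-identityˡ _)) ⟩
      Z * (c * N ^ cardⱽ X) * M ^ cardⱽ 𝓑
        ≡⟨ solve 4 (λ z c n m → z :* (c :* n) :* m := c :* (n :* m) :* z) refl Z c (N ^ cardⱽ X) (M ^ cardⱽ 𝓑) ⟩
      θ * Z                                                             ≤⟨ markov Ω _ θ ⟩
      ∑ᴸ Ω (λ ω → R ^ incidence ω (lookup X) (lookup 𝓑))                 ≤⟨ incidence-moment (lookup X) (lookup 𝓑) R (H * H) (*-mono-≤ 1≤H 1≤H)
                                                                             (*-mono-≤ (leq (cardⱽ 𝓑) H eq₂) (leq (cardⱽ X) H eq₁)) h ⟩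
      4 * total ∎
      where
      θ Z : ℕ
      θ = c * (N ^ cardⱽ X * M ^ cardⱽ 𝓑)
      Z = ∑ᴸ Ω (λ ω → 𝟙 (θ ≤ᵇ R ^ incidence ω (lookup X) (lookup 𝓑)))
      leq : ∀ a b → (a ≤ᵇ b) ≡ true → a ≤ b
      leq a b e = ≤ᵇ⇒≤ a b (subst T (≡-sym e) _)
    outer : ∀ X → c * ∑ᴸ (masks M) (λ 𝓑 → ∑ᴸ Ω (dense H R c X 𝓑)) * N ^ cardⱽ X ≤ 16 * total
    outer X = begin
      c * ∑ᴸ (masks M) (λ 𝓑 → ∑ᴸ Ω (dense H R c X 𝓑)) * N ^ cardⱽ X
        ≡⟨ solve 3 (λ c z n → c :* z :* n := z :* (c :* n)) refl c _ (N ^ cardⱽ X) ⟩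
      ∑ᴸ (masks M) (λ 𝓑 → ∑ᴸ Ω (dense H R c X 𝓑)) * (c * N ^ cardⱽ X)   ≡⟨ ≡-sym (∑ᴸ-*ʳ (masks M) _ _) ⟩
      ∑ᴸ (masks M) (λ 𝓑 → ∑ᴸ Ω (dense H R c X 𝓑) * (c * N ^ cardⱽ X))   ≤⟨ union-masks M 1≤M _ (4 * total) (inner X) ⟩
      4 * (4 * total)                                                  ≡⟨ ≡-sym (*-assoc 4 4 total) ⟩
      16 * total ∎

-- Exact rainbow hits

∏-pos : ∀ n (f : Fin n → ℕ) → 1 ≤ ∏ n f → ∀ i → 1 ≤ f i
∏-pos (suc n) f h zero with f zero
... | zero  = h
... | suc _ = s≤s z≤n
∏-pos (suc n) f h (suc i) = ∏-pos n (f ∘ suc) (rest (f zero) _ h) i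
  where
  rest : ∀ a b → 1 ≤ a * b → 1 ≤ b
  rest a zero    h = subst (1 ≤_) (*-zeroʳ a) h
  rest a (suc b) h = s≤s z≤n

∏-≤1 : ∀ n (f : Fin n → ℕ) → (∀ i → f i ≤ 1) → ∏ n f ≤ 1
∏-≤1 n f h = ≤-trans (∏-mono n h) (≤-reflexive (trans (∏-const n 1) (^-zeroˡ n)))

∏-all1 : ∀ n (f : Fin n → ℕ) → (∀ i → f i ≡ 1) → ∏ n f ≡ 1
∏-all1 n f h = trans (∏-cong n h) (trans (∏-const n 1) (^-zeroˡ n))

*-pos : ∀ a b → 1 ≤ a * b → 1 ≤ a × 1 ≤ b
*-pos zero    b       ()
*-pos (suc a) zero    h with () ← subst (1 ≤_) (*-zeroʳ a) h
*-pos (suc a) (suc b) h = s≤s z≤n , s≤s z≤n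

pos⇒true : ∀ b → 1 ≤ 𝟙 b → b ≡ true
pos⇒true true _ = refl

module Tuples {N : ℕ} (S : Mask N) where

  m : ℕ
  m = card S

  inside : ∀ {n} → Vec (Fin N) n → ℕ
  inside {n} τ = ∏ n (λ c → 𝟙 (S (lookup τ c)))

  tuples : ∀ n → List (Vec (Fin N) n)
  tuples = vecs (allFin N)

  ∑-inside : ∀ n → ∑ᴸ (tuples n) inside ≡ m ^ n
  ∑-inside n = trans (∑ᴸ-vecs-∏ (allFin N) n (λ _ v → 𝟙 (S v))) (∏-const n m)

  ∑-one : ∀ n (b : Fin n) (h : Fin N → ℕ) →
    ∑ᴸ (tuples n) (λ τ → inside τ * h (lookup τ b)) * m ≡ m ^ n * ∑ N (λ v → 𝟙 (S v) * h v)
  ∑-one (suc n) zero h = begin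
    ∑ᴸ (tuples (suc n)) (λ τ → inside τ * h (lookup τ zero)) * m
      ≡⟨ cong (_* m) (trans (∑ᴸ-vecs (allFin N) n _) (∑ᴸ-cong (allFin N) (λ x →
           trans (∑ᴸ-cong (tuples n) (λ τ → solve 3 (λ a b c → a :* b :* c := a :* c :* b) refl (𝟙 (S x)) (inside τ) (h x)))
                 (trans (∑ᴸ-* (tuples n) (𝟙 (S x) * h x) inside) (cong (𝟙 (S x) * h x *_) (∑-inside n)))))) ⟩
    ∑ N (λ x → 𝟙 (S x) * h x * m ^ n) * m     ≡⟨ cong (_* m) (∑ᴸ-*ʳ (allFin N) _ (m ^ n)) ⟩
    ∑ N (λ x → 𝟙 (S x) * h x) * m ^ n * m     ≡⟨ solve 3 (λ a b c → a :* b :* c := c :* b :* a) refl _ (m ^ n) m ⟩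
    m ^ suc n * ∑ N (λ v → 𝟙 (S v) * h v) ∎
    where open ≡-Reasoning
  ∑-one (suc n) (suc b) h = begin
    ∑ᴸ (tuples (suc n)) (λ τ → inside τ * h (lookup τ (suc b))) * m
      ≡⟨ cong (_* m) (trans (∑ᴸ-vecs (allFin N) n _) (trans (∑ᴸ-cong (allFin N) (λ x →
           trans (∑ᴸ-cong (tuples n) (λ τ → *-assoc (𝟙 (S x)) (inside τ) _)) (∑ᴸ-* (tuples n) (𝟙 (S x)) _)))
           (∑ᴸ-*ʳ (allFin N) _ _))) ⟩
    m * ∑ᴸ (tuples n) (λ τ → inside τ * h (lookup τ b)) * m   ≡⟨ *-assoc m _ m ⟩
    m * (∑ᴸ (tuples n) (λ τ → inside τ * h (lookup τ b)) * m) ≡⟨ cong (m *_) (∑-one n b h) ⟩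
    m * (m ^ n * ∑ N (λ v → 𝟙 (S v) * h v))                   ≡⟨ ≡-sym (*-assoc m (m ^ n) _) ⟩
    m ^ suc n * ∑ N (λ v → 𝟙 (S v) * h v) ∎
    where open ≡-Reasoning

  -- Two coordinates are singled out and the others range freely over `S`; the factor `m * m` avoids
  -- the exponent `n - 2`.
  ∑-two : ∀ n (a b : Fin n) → a ≢ b → (g : Fin N → Fin N → ℕ) →
    ∑ᴸ (tuples n) (λ τ → inside τ * g (lookup τ a) (lookup τ b)) * (m * m) ≡ m ^ n * ∑ N (λ u → 𝟙 (S u) * ∑ N (λ v → 𝟙 (S v) * g u v))
  ∑-two (suc n) zero zero a≢b g = ⊥-elim (a≢b refl)
  ∑-two (suc n) zero (suc b) _ g = begin
    ∑ᴸ (tuples (suc n)) (λ τ → inside τ * g (lookup τ zero) (lookup τ (suc b))) * (m * m)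
      ≡⟨ cong (_* (m * m)) (trans (∑ᴸ-vecs (allFin N) n _) (∑ᴸ-cong (allFin N) (λ x →
           trans (∑ᴸ-cong (tuples n) (λ τ → *-assoc (𝟙 (S x)) (inside τ) _)) (∑ᴸ-* (tuples n) (𝟙 (S x)) _)))) ⟩
    ∑ N (λ x → 𝟙 (S x) * ∑ᴸ (tuples n) (λ τ → inside τ * g x (lookup τ b))) * (m * m)
      ≡⟨ solve 2 (λ a m → a :* (m :* m) := m :* (a :* m)) refl (∑ N (λ x → 𝟙 (S x) * ∑ᴸ (tuples n) (λ τ → inside τ * g x (lookup τ b)))) m ⟩
    m * (∑ N (λ x → 𝟙 (S x) * ∑ᴸ (tuples n) (λ τ → inside τ * g x (lookup τ b))) * m)
      ≡⟨ cong (m *_) (trans (≡-sym (∑ᴸ-*ʳ (allFin N) _ m)) (∑ᴸ-cong (allFin N) (λ x →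
           trans (*-assoc (𝟙 (S x)) _ m) (trans (cong (𝟙 (S x) *_) (∑-one n b (g x)))
             (solve 3 (λ a b c → a :* (b :* c) := b :* (a :* c)) refl (𝟙 (S x)) (m ^ n) _))))) ⟩
    m * ∑ N (λ x → m ^ n * (𝟙 (S x) * ∑ N (λ v → 𝟙 (S v) * g x v)))   ≡⟨ cong (m *_) (∑ᴸ-* (allFin N) (m ^ n) _) ⟩
    m * (m ^ n * ∑ N (λ x → 𝟙 (S x) * ∑ N (λ v → 𝟙 (S v) * g x v)))   ≡⟨ ≡-sym (*-assoc m (m ^ n) _) ⟩
    m ^ suc n * ∑ N (λ u → 𝟙 (S u) * ∑ N (λ v → 𝟙 (S v) * g u v)) ∎
    where open ≡-Reasoning
  ∑-two (suc n) (suc a) zero _ g = trans (∑-two (suc n) zero (suc a) (λ ()) (λ u v → g v u))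
    (cong (m ^ suc n *_) (begin
      ∑ N (λ u → 𝟙 (S u) * ∑ N (λ v → 𝟙 (S v) * g v u))     ≡⟨ ∑-cong N (λ u → ≡-sym (∑ᴸ-* (allFin N) (𝟙 (S u)) _)) ⟩
      ∑ N (λ u → ∑ N (λ v → 𝟙 (S u) * (𝟙 (S v) * g v u)))   ≡⟨ ∑ᴸ-swap (allFin N) (allFin N) _ ⟩
      ∑ N (λ v → ∑ N (λ u → 𝟙 (S u) * (𝟙 (S v) * g v u)))
        ≡⟨ ∑-cong N (λ v → trans (∑-cong N (λ u → solve 3 (λ a b c → a :* (b :* c) := b :* (a :* c)) refl (𝟙 (S u)) (𝟙 (S v)) (g v u))) (∑ᴸ-* (allFin N) (𝟙 (S v)) _)) ⟩
      ∑ N (λ v → 𝟙 (S v) * ∑ N (λ u → 𝟙 (S u) * g v u)) ∎))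
    where open ≡-Reasoning
  ∑-two (suc n) (suc a) (suc b) a≢b g = begin
    ∑ᴸ (tuples (suc n)) (λ τ → inside τ * g (lookup τ (suc a)) (lookup τ (suc b))) * (m * m)
      ≡⟨ cong (_* (m * m)) (trans (∑ᴸ-vecs (allFin N) n _) (trans (∑ᴸ-cong (allFin N) (λ x →
           trans (∑ᴸ-cong (tuples n) (λ τ → *-assoc (𝟙 (S x)) (inside τ) _)) (∑ᴸ-* (tuples n) (𝟙 (S x)) _)))
           (∑ᴸ-*ʳ (allFin N) _ _))) ⟩
    m * ∑ᴸ (tuples n) (λ τ → inside τ * g (lookup τ a) (lookup τ b)) * (m * m)   ≡⟨ *-assoc m _ (m * m) ⟩
    m * (∑ᴸ (tuples n) (λ τ → inside τ * g (lookup τ a) (lookup τ b)) * (m * m)) ≡⟨ cong (m *_) (∑-two n a b (a≢b ∘ cong suc) g) ⟩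
    m * (m ^ n * ∑ N (λ u → 𝟙 (S u) * ∑ N (λ v → 𝟙 (S v) * g u v)))             ≡⟨ ≡-sym (*-assoc m (m ^ n) _) ⟩
    m ^ suc n * ∑ N (λ u → 𝟙 (S u) * ∑ N (λ v → 𝟙 (S v) * g u v)) ∎
    where open ≡-Reasoning

  pairSum : ∀ {n} → (Fin N → Fin N → ℕ) → Vec (Fin N) n → ℕ
  pairSum {n} g τ = ∑ n (λ a → ∑ n (λ b → 𝟙 (not (a == b)) * g (lookup τ a) (lookup τ b)))

  ∑-pairSum : ∀ n g → ∑ᴸ (tuples n) (λ τ → inside τ * pairSum g τ) * (m * m) ≤ n * n * (m ^ n * ∑ N (λ u → 𝟙 (S u) * ∑ N (λ v → 𝟙 (S v) * g u v)))
  ∑-pairSum n g = begin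
    ∑ᴸ (tuples n) (λ τ → inside τ * pairSum g τ) * (m * m)
      ≡⟨ cong (_* (m * m)) (trans (∑ᴸ-cong (tuples n) (λ τ → trans (≡-sym (∑ᴸ-* (allFin n) (inside τ) _)) (∑-cong n (λ a → ≡-sym (∑ᴸ-* (allFin n) (inside τ) _)))))
           (trans (∑ᴸ-swap (tuples n) (allFin n) _) (∑-cong n (λ a → ∑ᴸ-swap (tuples n) (allFin n) _)))) ⟩
    ∑ n (λ a → ∑ n (λ b → ∑ᴸ (tuples n) (λ τ → inside τ * (𝟙 (not (a == b)) * g (lookup τ a) (lookup τ b))))) * (m * m)
      ≡⟨ trans (≡-sym (∑ᴸ-*ʳ (allFin n) _ (m * m))) (∑-cong n (λ a → ≡-sym (∑ᴸ-*ʳ (allFin n) _ (m * m)))) ⟩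
    ∑ n (λ a → ∑ n (λ b → ∑ᴸ (tuples n) (λ τ → inside τ * (𝟙 (not (a == b)) * g (lookup τ a) (lookup τ b))) * (m * m)))
      ≤⟨ ∑-mono n (λ a → ∑-mono n (λ b → cell a b)) ⟩
    ∑ n (λ a → ∑ n (λ b → G))   ≡⟨ trans (∑-cong n (λ a → ∑-const n G)) (∑-const n (n * G)) ⟩
    n * (n * G)                 ≡⟨ ≡-sym (*-assoc n n G) ⟩
    n * n * G ∎
    where
    open ≤-Reasoning
    G : ℕ
    G = m ^ n * ∑ N (λ u → 𝟙 (S u) * ∑ N (λ v → 𝟙 (S v) * g u v))
    cell : ∀ a b → ∑ᴸ (tuples n) (λ τ → inside τ * (𝟙 (not (a == b)) * g (lookup τ a) (lookup τ b))) * (m * m) ≤ G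
    cell a b with a ≟ᶠ b
    ... | yes _ = ≤-trans (≤-reflexive (cong (_* (m * m)) (trans (∑ᴸ-cong (tuples n) (λ τ → *-zeroʳ (inside τ))) (∑ᴸ-zero (tuples n))))) z≤n
    ... | no a≢b = ≤-reflexive (trans (cong (_* (m * m)) (∑ᴸ-cong (tuples n) (λ τ → cong (inside τ *_) (*-identityˡ _)))) (∑-two n a b a≢b g))

  equalities : ∀ {n} → Vec (Fin N) n → ℕ
  equalities = pairSum (λ u v → 𝟙 (u == v))

  distinct : ∀ {n} → Vec (Fin N) n → ℕ
  distinct τ = 𝟙 (equalities τ ≤ᵇ 0)

  distinct⇒ : ∀ {n} (τ : Vec (Fin N) n) → 1 ≤ distinct τ → ∀ a b → a ≢ b → lookup τ a ≢ lookup τ b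
  distinct⇒ {n} τ h a b a≢b eq = <⇒≱ (s≤s z≤n) (≤-trans one (≤ᵇ⇒≤ (equalities τ) 0 (subst T (≡-sym (pos⇒true _ h)) _)))
    where
    one : 1 ≤ equalities τ
    one = ≤-trans (≤-reflexive (≡-sym (cong₂ (λ x y → 𝟙 (not x) * 𝟙 y) (≢⇒== a≢b) (trans (cong (_== lookup τ b) eq) (==-refl (lookup τ b))))))
      (≤-trans (∑-term n (λ b → 𝟙 (not (a == b)) * 𝟙 (lookup τ a == lookup τ b)) b) (∑-term n (λ a → ∑ n (λ b → 𝟙 (not (a == b)) * 𝟙 (lookup τ a == lookup τ b))) a))

  -- Among `n` random elements of `S` the expected number of equal ordered pairs is at most `n²/m`,
  -- hence at most one half.
  many-distinct : ∀ n → 1 ≤ n → 1 ≤ m → 2 * (n * n) ≤ m → m ^ n ≤ 2 * ∑ᴸ (tuples n) (λ τ → inside τ * distinct τ)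
  many-distinct n 1≤n 1≤m 2n²≤m = +-cancelʳ-≤ (m ^ n) _ _ (begin
    m ^ n + m ^ n                   ≡⟨ solve 1 (λ x → x :+ x := con 2 :* x) refl (m ^ n) ⟩
    2 * m ^ n                       ≡⟨ cong (2 *_) (≡-sym (∑-inside n)) ⟩
    2 * ∑ᴸ (tuples n) inside        ≤⟨ *-monoʳ-≤ 2 (≤-trans (∑ᴸ-mono (tuples n) split) (≤-reflexive (∑ᴸ-+ (tuples n) _ _))) ⟩
    2 * (X + Y)                     ≡⟨ *-distribˡ-+ 2 X Y ⟩
    2 * X + 2 * Y                   ≤⟨ +-monoʳ-≤ (2 * X) 2Y≤ ⟩
    2 * X + m ^ n ∎)
    where
    open ≤-Reasoning
    X Y : ℕ
    X = ∑ᴸ (tuples n) (λ τ → inside τ * distinct τ)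
    Y = ∑ᴸ (tuples n) (λ τ → inside τ * equalities τ)
    split : ∀ τ → inside τ ≤ inside τ * distinct τ + inside τ * equalities τ
    split τ = ≤-trans (≤-reflexive (≡-sym (*-identityʳ (inside τ)))) (≤-trans (*-monoʳ-≤ (inside τ) (cases (equalities τ))) (≤-reflexive (*-distribˡ-+ (inside τ) _ _)))
      where
      cases : ∀ k → 1 ≤ 𝟙 (k ≤ᵇ 0) + k
      cases zero    = ≤-refl
      cases (suc k) = s≤s z≤n
    diagonal : ∑ N (λ u → 𝟙 (S u) * ∑ N (λ v → 𝟙 (S v) * 𝟙 (u == v))) ≡ m
    diagonal = ∑-cong N (λ u → trans (cong (𝟙 (S u) *_) (trans (∑-cong N (λ v → trans (*-comm (𝟙 (S v)) _) (cong (λ b → 𝟙 b * 𝟙 (S v)) (==-sym u v)))) (∑-δ u (𝟙 ∘ S)))) (𝟙-idem (S u)))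
    Y≤ : Y * m ≤ n * n * m ^ n
    Y≤ = *-cancelʳ-≤′ m 1≤m (≤-trans (≤-reflexive (*-assoc Y m m)) (≤-trans (∑-pairSum n (λ u v → 𝟙 (u == v)))
      (≤-reflexive (trans (cong (λ z → n * n * (m ^ n * z)) diagonal) (≡-sym (*-assoc (n * n) (m ^ n) m))))))
    2Y≤ : 2 * Y ≤ m ^ n
    2Y≤ = *-cancelˡ-≤′ (n * n) (*-mono-≤ 1≤n 1≤n) (≤-trans (≤-reflexive (solve 2 (λ a y → a :* (con 2 :* y) := con 2 :* a :* y) refl (n * n) Y))
      (≤-trans (*-monoˡ-≤ Y 2n²≤m) (≤-trans (≤-reflexive (*-comm m Y)) Y≤)))

module Hits (N M s P : ℕ) (s≤P : s ≤ P) (1≤P : 1 ≤ P) (S : Mask N) where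
  open Random N M s P s≤P 1≤P
  open Tuples S

  Tuple : Set
  Tuple = Vec (Fin N) s

  multiplicity : Tuple → Fin N → ℕ
  multiplicity τ v = ∑ s (λ c → 𝟙 (v == lookup τ c))

  cell : Tuple → Fin N → Fin P → ℕ
  cell τ v x = ∏ s (λ c → if v == lookup τ c then 𝟙 (toℕ x ≡ᵇ toℕ c) else 1)
             * (if S v ∧ not (1 ≤ᵇ multiplicity τ v) then 𝟙 (not (isIn x)) else 1)

  -- Indicator that the blob meets S exactly in τ and the c-th vertex of τ has colour c.
  exact : Tuple → Row → ℕ
  exact τ r = ∏ N (λ v → cell τ v (lookup r v))

  private
    if-≤1 : ∀ b {x} → x ≤ 1 → (if b then x else 1) ≤ 1
    if-≤1 true  h = h
    if-≤1 false h = ≤-refl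

    cell≤1 : ∀ τ v x → cell τ v x ≤ 1
    cell≤1 τ v x = *-mono-≤ (∏-≤1 s _ (λ c → if-≤1 (v == lookup τ c) (𝟙≤1 _))) (if-≤1 (S v ∧ not (1 ≤ᵇ multiplicity τ v)) (𝟙≤1 _))

  exact≤1 : ∀ τ r → exact τ r ≤ 1
  exact≤1 τ r = ∏-≤1 N _ (λ v → cell≤1 τ v (lookup r v))

  exact-colour : ∀ τ r → 1 ≤ exact τ r → ∀ c → toℕ (lookup r (lookup τ c)) ≡ toℕ c
  exact-colour τ r h c = ≡ᵇ⇒≡ _ _ (subst T (≡-sym (pos⇒true _ at-c)) _)
    where
    v : Fin N
    v = lookup τ c
    at-c : 1 ≤ 𝟙 (toℕ (lookup r v) ≡ᵇ toℕ c)
    at-c with ∏-pos s _ (proj₁ (*-pos _ _ (∏-pos N _ h v))) c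
    ... | p rewrite ==-refl v = p

  multiplicity⇒ : ∀ τ v → 1 ≤ multiplicity τ v → ∃[ c ] v ≡ lookup τ c
  multiplicity⇒ τ v h with ∑ᴸ-pos⇒∃ (allFin s) h
  ... | c , p = c , ==⇒≡ v (lookup τ c) (pos⇒true _ p)

  exact-only : ∀ τ r → 1 ≤ exact τ r → ∀ v → S v ≡ true → isIn (lookup r v) ≡ true → ∃[ c ] v ≡ lookup τ c
  exact-only τ r h v Sv rv with 1 ≤? multiplicity τ v
  ... | yes p = multiplicity⇒ τ v p
  ... | no ¬p with proj₂ (*-pos (∏ s (λ c → if v == lookup τ c then 𝟙 (toℕ (lookup r v) ≡ᵇ toℕ c) else 1)) _ (∏-pos N _ h v))
  ...   | q with S v | Sv | multiplicity τ v | ¬p | isIn (lookup r v) | rv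
  ...     | true | refl | zero  | _ | true | refl with () ← q
  ...     | true | refl | suc _ | np | _ | _ = ⊥-elim (np (s≤s z≤n))

  mult≤1 : ∀ τ → 1 ≤ distinct τ → ∀ v → multiplicity τ v ≤ 1
  mult≤1 τ d v = ∑-unique≤1 s _ unique
    where
    unique : ∀ a b → (v == lookup τ a) ≡ true → (v == lookup τ b) ≡ true → a ≡ b
    unique a b p q with a ≟ᶠ b
    ... | yes h = h
    ... | no a≢b = ⊥-elim (distinct⇒ τ d a b a≢b (trans (≡-sym (==⇒≡ v _ p)) (==⇒≡ v _ q)))

  ∑-multiplicity : ∀ τ → ∑ N (multiplicity τ) ≡ s
  ∑-multiplicity τ = trans (∑ᴸ-swap (allFin N) (allFin s) _) (trans (∑-cong s (λ c → trans (∑-cong N (λ v → ≡-sym (*-identityʳ _))) (∑-δ (lookup τ c) (λ _ → 1)))) (∑-1 s))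

  private
    mass : Tuple → Fin N → ℕ
    mass τ v = ∑ P (cell τ v)

    ∑-exact : ∀ τ → ∑ᴸ rows (exact τ) ≡ ∏ N (mass τ)
    ∑-exact τ = ∑ᴸ-vecs-∏ (allFin P) N (cell τ)

    P^s : ∀ τ → P ^ s ≡ ∏ N (λ v → P ^ multiplicity τ v)
    P^s τ = trans (cong (P ^_) (≡-sym (∑-multiplicity τ))) (≡-sym (∏-^ N P (multiplicity τ)))

    mass≤P : ∀ τ v → mass τ v ≤ P
    mass≤P τ v = ≤-trans (∑-mono P (cell≤1 τ v)) (≤-reflexive (∑-1 P))

    ∏-term : ∀ n (f : Fin n → ℕ) → (∀ i → f i ≤ 1) → ∀ i → ∏ n f ≤ f i
    ∏-term (suc n) f h zero    = ≤-trans (*-monoʳ-≤ (f zero) (∏-≤1 n (f ∘ suc) (h ∘ suc))) (≤-reflexive (*-identityʳ _))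
    ∏-term (suc n) f h (suc i) = ≤-trans (*-monoˡ-≤ _ (h zero)) (≤-trans (≤-reflexive (+-identityʳ _)) (∏-term n (f ∘ suc) (h ∘ suc) i))

    mass≤1 : ∀ τ c → mass τ (lookup τ c) ≤ 1
    mass≤1 τ c = ≤-trans (∑-mono P (λ x → ≤-trans (*-monoʳ-≤ (∏ s (λ c′ → if v == lookup τ c′ then 𝟙 (toℕ x ≡ᵇ toℕ c′) else 1)) (if-≤1 (S v ∧ not (1 ≤ᵇ multiplicity τ v)) (𝟙≤1 _)))
        (≤-trans (≤-reflexive (*-identityʳ _)) (≤-trans (∏-term s _ (λ c′ → if-≤1 (v == lookup τ c′) (𝟙≤1 _)) c) (at x)))))
      (∑-unique≤1 P (λ x → toℕ x ≡ᵇ toℕ c) (λ x y p q → toℕ-injective (trans (≡ᵇ⇒≡ _ _ (subst T (≡-sym p) _)) (≡-sym (≡ᵇ⇒≡ _ _ (subst T (≡-sym q) _))))))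
      where
      v : Fin N
      v = lookup τ c
      at : ∀ x → (if v == v then 𝟙 (toℕ x ≡ᵇ toℕ c) else 1) ≤ 𝟙 (toℕ x ≡ᵇ toℕ c)
      at x rewrite ==-refl v = ≤-refl

    mass≥1 : ∀ τ → 1 ≤ distinct τ → ∀ c → 1 ≤ mass τ (lookup τ c)
    mass≥1 τ d c = ≤-trans (≤-reflexive (≡-sym value)) (∑-term P (cell τ v) x₀)
      where
      v : Fin N
      v = lookup τ c
      x₀ : Fin P
      x₀ = inject≤ c s≤P
      ≡ᵇ-true : ∀ {a b} → a ≡ b → (a ≡ᵇ b) ≡ true
      ≡ᵇ-true {a} refl = T⇒ (≡⇒≡ᵇ a a refl)
        where
        T⇒ : ∀ {b} → T b → b ≡ true
        T⇒ {true} _ = refl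
      factor : ∀ c′ → (if v == lookup τ c′ then 𝟙 (toℕ x₀ ≡ᵇ toℕ c′) else 1) ≡ 1
      factor c′ with v == lookup τ c′ in eq
      ... | false = refl
      ... | true with c ≟ᶠ c′
      ...   | yes refl = cong 𝟙 (≡ᵇ-true (toℕ-inject≤ c s≤P))
      ...   | no c≢c′ = ⊥-elim (distinct⇒ τ d c c′ c≢c′ (==⇒≡ v _ eq))
      present : 1 ≤ multiplicity τ v
      present = ≤-trans (≤-reflexive (≡-sym (cong 𝟙 (==-refl v)))) (∑-term s (λ c′ → 𝟙 (v == lookup τ c′)) c)
      second : (if S v ∧ not (1 ≤ᵇ multiplicity τ v) then 𝟙 (not (isIn x₀)) else 1) ≡ 1
      second with multiplicity τ v | present | S v
      ... | suc _ | _ | true  = refl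
      ... | suc _ | _ | false = refl
      value : cell τ v x₀ ≡ 1
      value = cong₂ _*_ (∏-all1 s _ factor) second

    mass-outside : ∀ τ v → multiplicity τ v ≡ 0 → P ≤ mass τ v + 𝟙 (S v) * s
    mass-outside τ v none = begin
      P                                                    ≡⟨ ≡-sym (∑-1 P) ⟩
      ∑ P (λ _ → 1)                                        ≤⟨ ∑-mono P point ⟩
      ∑ P (λ x → cell τ v x + 𝟙 (S v) * 𝟙 (isIn x))        ≡⟨ trans (∑ᴸ-+ (allFin P) _ _) (cong₂ _+_ refl (trans (∑ᴸ-* (allFin P) (𝟙 (S v)) _) (cong (𝟙 (S v) *_) count-in))) ⟩
      mass τ v + 𝟙 (S v) * s ∎
      where
      open ≤-Reasoning
      absent : ∀ c → (v == lookup τ c) ≡ false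
      absent c with v == lookup τ c in eq
      ... | false = refl
      ... | true  = ⊥-elim (<⇒≱ (s≤s z≤n) (≤-trans (≤-reflexive (≡-sym (cong 𝟙 eq))) (≤-trans (∑-term s (λ c → 𝟙 (v == lookup τ c)) c) (≤-reflexive none))))
      first : ∀ x → ∏ s (λ c → if v == lookup τ c then 𝟙 (toℕ x ≡ᵇ toℕ c) else 1) ≡ 1
      first x = ∏-all1 s _ (λ c → cong (λ b → if b then 𝟙 (toℕ x ≡ᵇ toℕ c) else 1) (absent c))
      point : ∀ x → 1 ≤ cell τ v x + 𝟙 (S v) * 𝟙 (isIn x)
      point x rewrite first x | none with S v | isIn x
      ... | true  | true  = ≤-refl
      ... | true  | false = ≤-refl
      ... | false | _     = ≤-refl

    present-at : ∀ τ v k → multiplicity τ v ≡ suc k → ∃[ c ] v ≡ lookup τ c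
    present-at τ v k eq = multiplicity⇒ τ v (≤-trans (s≤s z≤n) (≤-reflexive (≡-sym eq)))

  exact-upper : ∀ τ → 1 ≤ distinct τ → P ^ s * ∑ᴸ rows (exact τ) ≤ rowTotal
  exact-upper τ d = begin
    P ^ s * ∑ᴸ rows (exact τ)                              ≡⟨ cong₂ _*_ (P^s τ) (∑-exact τ) ⟩
    ∏ N (λ v → P ^ multiplicity τ v) * ∏ N (mass τ)        ≡⟨ ≡-sym (∏-* N _ _) ⟩
    ∏ N (λ v → P ^ multiplicity τ v * mass τ v)            ≤⟨ ∏-mono N each ⟩
    ∏ N (λ v → P)                                          ≡⟨ ∏-const N P ⟩
    rowTotal ∎
    where
    open ≤-Reasoning
    each : ∀ v → P ^ multiplicity τ v * mass τ v ≤ P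
    each v = go (multiplicity τ v) refl (mult≤1 τ d v)
      where
      go : ∀ k → multiplicity τ v ≡ k → k ≤ 1 → P ^ k * mass τ v ≤ P
      go 0 eq _ = ≤-trans (≤-reflexive (+-identityʳ _)) (mass≤P τ v)
      go 1 eq _ with present-at τ v 0 eq
      ... | c , refl = ≤-trans (*-monoʳ-≤ (P * 1) (mass≤1 τ c)) (≤-reflexive (trans (*-identityʳ _) (*-identityʳ P)))
      go (suc (suc _)) _ (s≤s ())

  -- The `s` prescribed colours cost `P^s`, and keeping the rest of `S` out of the blob costs at
  -- most `(1 - s/P)^m`, which is at least 1/4 under the hypothesis on `m * s`.
  exact-lower : ∀ τ → 1 ≤ distinct τ → m * s ≤ P ∸ s → 1 ≤ P ∸ s → rowTotal ≤ 4 * (P ^ s * ∑ᴸ rows (exact τ))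
  exact-lower τ d h 1≤P∸s = *-cancelˡ-≤′ ((P ∸ s) ^ m) (^-pos (P ∸ s) m 1≤P∸s) (begin
    (P ∸ s) ^ m * rowTotal                            ≡⟨ cong₂ _*_ (≡-sym (∏-^ N (P ∸ s) _)) (≡-sym (∏-const N P)) ⟩
    ∏ N (λ v → (P ∸ s) ^ 𝟙 (S v)) * ∏ N (λ _ → P)     ≡⟨ ≡-sym (∏-* N _ _) ⟩
    ∏ N (λ v → (P ∸ s) ^ 𝟙 (S v) * P)                 ≤⟨ ∏-mono N each ⟩
    ∏ N (λ v → P ^ 𝟙 (S v) * (P ^ multiplicity τ v * mass τ v))
      ≡⟨ trans (∏-* N _ _) (cong₂ _*_ (∏-^ N P _) (trans (∏-* N _ _) (cong₂ _*_ (≡-sym (P^s τ)) (≡-sym (∑-exact τ))))) ⟩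
    P ^ m * (P ^ s * ∑ᴸ rows (exact τ))               ≤⟨ *-monoˡ-≤ _ P^m≤ ⟩
    4 * (P ∸ s) ^ m * (P ^ s * ∑ᴸ rows (exact τ))     ≡⟨ solve 3 (λ a b c → a :* b :* c := b :* (a :* c)) refl 4 ((P ∸ s) ^ m) (P ^ s * ∑ᴸ rows (exact τ)) ⟩
    (P ∸ s) ^ m * (4 * (P ^ s * ∑ᴸ rows (exact τ))) ∎)
    where
    open ≤-Reasoning
    P^m≤ : P ^ m ≤ 4 * (P ∸ s) ^ m
    P^m≤ = subst (λ x → x ^ m ≤ 4 * (P ∸ s) ^ m) (m∸n+n≡m s≤P) ([b+a]^n≤ (P ∸ s) s m 1 (≤-trans h (≤-reflexive (≡-sym (*-identityˡ _)))) 1≤P∸s)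
    each : ∀ v → (P ∸ s) ^ 𝟙 (S v) * P ≤ P ^ 𝟙 (S v) * (P ^ multiplicity τ v * mass τ v)
    each v = go (multiplicity τ v) refl (mult≤1 τ d v)
      where
      away : ∀ b → P ≤ mass τ v + 𝟙 b * s → (P ∸ s) ^ 𝟙 b * P ≤ P ^ 𝟙 b * (1 * mass τ v)
      away true  q = ≤-trans (≤-reflexive (trans (cong (_* P) (*-identityʳ (P ∸ s))) (*-comm (P ∸ s) P)))
          (≤-trans (*-monoʳ-≤ P (m≤n+o⇒m∸n≤o P s (≤-trans q (≤-reflexive (trans (cong (mass τ v +_) (*-identityˡ s)) (+-comm _ s))))))
            (≤-reflexive (≡-sym (cong₂ _*_ (*-identityʳ P) (*-identityˡ _)))))
      away false q = *-monoʳ-≤ 1 (≤-trans q (≤-reflexive (trans (+-identityʳ _) (≡-sym (+-identityʳ _)))))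
      go : ∀ k → multiplicity τ v ≡ k → k ≤ 1 → (P ∸ s) ^ 𝟙 (S v) * P ≤ P ^ 𝟙 (S v) * (P ^ k * mass τ v)
      go 0 eq _ = away (S v) (mass-outside τ v eq)
      go 1 eq _ with present-at τ v 0 eq
      ... | c , refl = *-mono-≤ (^-mono (𝟙 (S (lookup τ c))) (m∸n≤m P s)) (≤-trans (≤-reflexive (≡-sym (trans (*-identityʳ _) (*-identityʳ P)))) (*-monoʳ-≤ (P * 1) (mass≥1 τ d c)))
      go (suc (suc _)) _ (s≤s ())

  hit : Row → ℕ
  hit r = ∑ᴸ (tuples s) (λ τ → inside τ * distinct τ * exact τ r)

  hit-tuple : ∀ r → 1 ≤ hit r → ∃[ τ ] (1 ≤ inside τ × 1 ≤ distinct τ × 1 ≤ exact τ r)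
  hit-tuple r h with ∑ᴸ-pos⇒∃ (tuples s) h
  ... | τ , p with *-pos _ _ p
  ...   | q , e = τ , proj₁ (*-pos (inside τ) (distinct τ) q) , proj₂ (*-pos (inside τ) (distinct τ) q) , e

  -- The row determines the tuple: a vertex of another exact tuple lies in `S` and in the blob,
  -- hence occurs in `τ₀`, and its colour tells at which position.
  hit≤1 : ∀ r → hit r ≤ 1
  hit≤1 r with 1 ≤? hit r
  ... | no ¬p = <⇒≤ (≰⇒> ¬p)
  ... | yes p with hit-tuple r p
  ...   | τ₀ , i₀ , d₀ , e₀ = begin
    hit r                                                         ≤⟨ ∑ᴸ-mono (tuples s) term ⟩
    ∑ᴸ (tuples s) (λ τ → ∏ s (λ c → 𝟙 (lookup τ c == lookup τ₀ c)))  ≡⟨ ∑ᴸ-vecs-∏ (allFin N) s (λ c v → 𝟙 (v == lookup τ₀ c)) ⟩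
    ∏ s (λ c → ∑ N (λ v → 𝟙 (v == lookup τ₀ c)))                   ≡⟨ ∏-all1 s _ (λ c → trans (∑-cong N (λ v → ≡-sym (*-identityʳ _))) (∑-δ (lookup τ₀ c) (λ _ → 1))) ⟩
    1 ∎
    where
    open ≤-Reasoning
    term : ∀ τ → inside τ * distinct τ * exact τ r ≤ ∏ s (λ c → 𝟙 (lookup τ c == lookup τ₀ c))
    term τ with 1 ≤? inside τ * distinct τ * exact τ r
    ... | no ¬q = ≤-trans (≤-pred (≰⇒> ¬q)) z≤n
    ... | yes q with *-pos _ _ q
    ...   | id , e = ≤-trans (*-mono-≤ (*-mono-≤ (∏-≤1 s _ (λ c → 𝟙≤1 _)) (𝟙≤1 _)) (exact≤1 τ r)) (≤-reflexive (≡-sym (∏-all1 s _ same)))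
      where
      in-S : ∀ c → S (lookup τ c) ≡ true
      in-S c = pos⇒true _ (∏-pos s _ (proj₁ (*-pos (inside τ) (distinct τ) id)) c)
      coloured : ∀ c → isIn (lookup r (lookup τ c)) ≡ true
      coloured c rewrite exact-colour τ r e c = T⇒ (≤⇒≤ᵇ (Data.Fin.Properties.toℕ<n c))
        where
        import Data.Fin.Properties
        T⇒ : ∀ {b} → T b → b ≡ true
        T⇒ {true} _ = refl
      same : ∀ c → 𝟙 (lookup τ c == lookup τ₀ c) ≡ 1
      same c with exact-only τ₀ r e₀ (lookup τ c) (in-S c) (coloured c)
      ... | c′ , eq = cong 𝟙 (subst (λ c″ → (lookup τ c == lookup τ₀ c″) ≡ true) (≡-sym c≡) (subst (λ w → (lookup τ c == w) ≡ true) eq (==-refl _)))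
        where
        c≡ : c ≡ c′
        c≡ = toℕ-injective (trans (≡-sym (exact-colour τ r e c)) (trans (cong (toℕ ∘ lookup r) eq) (exact-colour τ₀ r e₀ c′)))

  ∑-hit : 1 ≤ s → 1 ≤ m → 2 * (s * s) ≤ m → m * s ≤ P ∸ s → 1 ≤ P ∸ s → m ^ s * rowTotal ≤ 8 * (P ^ s * ∑ᴸ rows hit)
  ∑-hit 1≤s 1≤m h h′ 1≤P∸s = begin
    m ^ s * rowTotal                                           ≤⟨ *-monoˡ-≤ rowTotal (many-distinct s 1≤s 1≤m h) ⟩
    2 * ∑ᴸ (tuples s) (λ τ → inside τ * distinct τ) * rowTotal
      ≡⟨ trans (*-assoc 2 (∑ᴸ (tuples s) (λ τ → inside τ * distinct τ)) rowTotal) (cong (2 *_) (≡-sym (∑ᴸ-*ʳ (tuples s) (λ τ → inside τ * distinct τ) rowTotal))) ⟩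
    2 * ∑ᴸ (tuples s) (λ τ → inside τ * distinct τ * rowTotal)  ≤⟨ *-monoʳ-≤ 2 (∑ᴸ-mono (tuples s) term) ⟩
    2 * ∑ᴸ (tuples s) (λ τ → 4 * P ^ s * (inside τ * distinct τ * ∑ᴸ rows (exact τ)))
      ≡⟨ cong (2 *_) (trans (∑ᴸ-* (tuples s) (4 * P ^ s) _) (cong (4 * P ^ s *_) (trans (∑ᴸ-cong (tuples s) (λ τ → ≡-sym (∑ᴸ-* rows (inside τ * distinct τ) (exact τ)))) (∑ᴸ-swap (tuples s) rows _)))) ⟩
    2 * (4 * P ^ s * ∑ᴸ rows hit)
      ≡⟨ solve 2 (λ p h → con 2 :* (con 4 :* p :* h) := con 8 :* (p :* h)) refl (P ^ s) (∑ᴸ rows hit) ⟩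
    8 * (P ^ s * ∑ᴸ rows hit) ∎
    where
    open ≤-Reasoning
    term : ∀ τ → inside τ * distinct τ * rowTotal ≤ 4 * P ^ s * (inside τ * distinct τ * ∑ᴸ rows (exact τ))
    term τ with 1 ≤? distinct τ
    ... | yes d = ≤-trans (*-monoʳ-≤ (inside τ * distinct τ) (exact-lower τ d h′ 1≤P∸s))
          (≤-reflexive (solve 4 (λ a b p e → a :* b :* (con 4 :* (p :* e)) := con 4 :* p :* (a :* b :* e)) refl (inside τ) (distinct τ) (P ^ s) (∑ᴸ rows (exact τ))))
    ... | no ¬d = ≤-trans (≤-reflexive (trans (cong (λ z → inside τ * z * rowTotal) (n<1⇒n≡0 (≰⇒> ¬d))) (cong (_* rowTotal) (*-zeroʳ (inside τ))))) z≤n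

  misses : Vec Row M → ℕ
  misses ω = ∑ M (λ i → 1 ∸ hit (lookup ω i))

  -- Lower tail of the number of hits. As `hit` is 0 or 1, `2^(1-hit) = 2 - hit`, so each row
  -- contributes `2 - p` with `p` the hit probability, and the deficit compounds to `2^(-q)` over
  -- `M` rows.
  misses-moment : ∀ q → 1 ≤ s → 1 ≤ m → 2 * (s * s) ≤ m → m * s ≤ P ∸ s → 1 ≤ P ∸ s → 16 * (q * P ^ s) ≤ M * m ^ s →
    2 ^ q * ∑ᴸ Ω (λ ω → 2 ^ misses ω) ≤ 2 ^ M * total
  misses-moment q 1≤s 1≤m h h′ 1≤P∸s qP = begin
    2 ^ q * ∑ᴸ Ω (λ ω → 2 ^ misses ω)                ≡⟨ cong (2 ^ q *_) (trans (∑ᴸ-cong Ω (λ ω → ≡-sym (∏-^ M 2 _))) (rows-product (λ r → 2 ^ (1 ∸ hit r)))) ⟩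
    2 ^ q * C ^ M                                    ≤⟨ 2^q*c^n≤ C H M q main (≤-trans 1≤rowTotal (≤-trans (m≤m+n rowTotal (rowTotal + 0)) (≤-reflexive (≡-sym C+H)))) ⟩
    (C + H) ^ M                                      ≡⟨ trans (cong (_^ M) C+H) (^-distribʳ-* 2 rowTotal M) ⟩
    2 ^ M * total ∎
    where
    open ≤-Reasoning
    C H : ℕ
    C = ∑ᴸ rows (λ r → 2 ^ (1 ∸ hit r))
    H = ∑ᴸ rows hit
    C+H : C + H ≡ 2 * rowTotal
    C+H = trans (≡-sym (∑ᴸ-+ rows _ _)) (trans (∑ᴸ-cong rows (λ r → two (hit r) (hit≤1 r))) (trans (∑ᴸ-cong rows (λ _ → ≡-sym (*-identityʳ 2))) (trans (∑ᴸ-* rows 2 (λ _ → 1)) (cong (2 *_) ∑rows-1))))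
      where
      two : ∀ k → k ≤ 1 → 2 ^ (1 ∸ k) + k ≡ 2
      two 0 _ = refl
      two 1 _ = refl
      two (suc (suc _)) (s≤s ())
    main : q * (C + H) ≤ M * H
    main = *-cancelˡ-≤′ (8 * P ^ s) (*-mono-≤ (s≤s (z≤n {7})) (^-pos P s 1≤P)) (begin
      8 * P ^ s * (q * (C + H))          ≡⟨ cong (λ z → 8 * P ^ s * (q * z)) C+H ⟩
      8 * P ^ s * (q * (2 * rowTotal))   ≡⟨ solve 3 (λ p q r → con 8 :* p :* (q :* (con 2 :* r)) := con 16 :* (q :* p) :* r) refl (P ^ s) q rowTotal ⟩
      16 * (q * P ^ s) * rowTotal        ≤⟨ *-monoˡ-≤ rowTotal qP ⟩
      M * m ^ s * rowTotal               ≡⟨ *-assoc M (m ^ s) rowTotal ⟩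
      M * (m ^ s * rowTotal)             ≤⟨ *-monoʳ-≤ M (∑-hit 1≤s 1≤m h h′ 1≤P∸s) ⟩
      M * (8 * (P ^ s * H))              ≡⟨ solve 3 (λ m p h → m :* (con 8 :* (p :* h)) := con 8 :* p :* (m :* h)) refl M (P ^ s) H ⟩
      8 * P ^ s * (M * H) ∎)

  shared : List Row → Fin N → Fin N → ℕ
  shared rs u v = 𝟙 (not (u == v)) * ∑ᴸ rs (λ r → 𝟙 (isIn (lookup r u)) * 𝟙 (isIn (lookup r v)))

  covered : List Row → ℕ
  covered rs = ∑ᴸ rs (λ r → pairs (hits S r))

  spoil : List Row → Row → ℕ
  spoil rs r = ∑ᴸ (tuples s) (λ τ → inside τ * distinct τ * exact τ r * pairSum (shared rs) τ)

  ∑-shared : ∀ rs → ∑ N (λ u → 𝟙 (S u) * ∑ N (λ v → 𝟙 (S v) * shared rs u v)) ≡ covered rs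
  ∑-shared rs = begin
    ∑ N (λ u → 𝟙 (S u) * ∑ N (λ v → 𝟙 (S v) * shared rs u v))
      ≡⟨ ∑-cong N (λ u → trans (≡-sym (∑ᴸ-* (allFin N) (𝟙 (S u)) _)) (∑-cong N (λ v → push u v))) ⟩
    ∑ N (λ u → ∑ N (λ v → ∑ᴸ rs (λ r → 𝟙 (not (u == v)) * (𝟙 (hits S r u) * 𝟙 (hits S r v)))))
      ≡⟨ ≡-sym (trans (∑ᴸ-swap rs (allFin N) _) (∑-cong N (λ u → ∑ᴸ-swap rs (allFin N) _))) ⟩
    covered rs ∎
    where
    open ≡-Reasoning
    ∧≡* : ∀ a b → 𝟙 (a ∧ b) ≡ 𝟙 a * 𝟙 b
    ∧≡* true  b = ≡-sym (+-identityʳ _)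
    ∧≡* false b = refl
    push : ∀ u v → 𝟙 (S u) * (𝟙 (S v) * shared rs u v) ≡ ∑ᴸ rs (λ r → 𝟙 (not (u == v)) * (𝟙 (hits S r u) * 𝟙 (hits S r v)))
    push u v = trans (solve 4 (λ a b c d → a :* (b :* (c :* d)) := c :* (a :* b) :* d) refl (𝟙 (S u)) (𝟙 (S v)) (𝟙 (not (u == v))) (∑ᴸ rs (λ r → 𝟙 (isIn (lookup r u)) * 𝟙 (isIn (lookup r v)))))
      (trans (≡-sym (∑ᴸ-* rs (𝟙 (not (u == v)) * (𝟙 (S u) * 𝟙 (S v))) _)) (∑ᴸ-cong rs (λ r →
        trans (solve 5 (λ c a b x y → c :* (a :* b) :* (x :* y) := c :* ((a :* x) :* (b :* y))) refl (𝟙 (not (u == v))) (𝟙 (S u)) (𝟙 (S v)) (𝟙 (isIn (lookup r u))) (𝟙 (isIn (lookup r v))))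
              (cong (𝟙 (not (u == v)) *_) (≡-sym (cong₂ _*_ (∧≡* (S u) _) (∧≡* (S v) _)))))))

  -- With `rs` fixed and only `r` random, every distinct tuple is hit with probability at most
  -- `P^(-s)`. Summation over tuples in `S` then counts each covered pair about `s² m^s / m²` times.
  ∑-spoil : ∀ rs → P ^ s * (m * m) * ∑ᴸ rows (spoil rs) ≤ rowTotal * (s * s * (m ^ s * covered rs))
  ∑-spoil rs = begin
    P ^ s * (m * m) * ∑ᴸ rows (spoil rs)
      ≡⟨ cong (P ^ s * (m * m) *_) (trans (∑ᴸ-swap rows (tuples s) _) (∑ᴸ-cong (tuples s) (λ τ →
           trans (∑ᴸ-cong rows (λ r → solve 3 (λ a e g → a :* e :* g := a :* g :* e) refl (inside τ * distinct τ) (exact τ r) (pairSum (shared rs) τ)))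
                 (∑ᴸ-* rows (inside τ * distinct τ * pairSum (shared rs) τ) (exact τ))))) ⟩
    P ^ s * (m * m) * ∑ᴸ (tuples s) (λ τ → inside τ * distinct τ * pairSum (shared rs) τ * ∑ᴸ rows (exact τ))
      ≡⟨ solve 3 (λ p m x → p :* m :* x := m :* (p :* x)) refl (P ^ s) (m * m) (∑ᴸ (tuples s) (λ τ → inside τ * distinct τ * pairSum (shared rs) τ * ∑ᴸ rows (exact τ))) ⟩
    m * m * (P ^ s * ∑ᴸ (tuples s) (λ τ → inside τ * distinct τ * pairSum (shared rs) τ * ∑ᴸ rows (exact τ)))
      ≡⟨ cong (m * m *_) (≡-sym (∑ᴸ-* (tuples s) (P ^ s) _)) ⟩
    m * m * ∑ᴸ (tuples s) (λ τ → P ^ s * (inside τ * distinct τ * pairSum (shared rs) τ * ∑ᴸ rows (exact τ)))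
      ≤⟨ *-monoʳ-≤ (m * m) (∑ᴸ-mono (tuples s) term) ⟩
    m * m * ∑ᴸ (tuples s) (λ τ → rowTotal * (inside τ * pairSum (shared rs) τ))
      ≡⟨ trans (cong (m * m *_) (∑ᴸ-* (tuples s) rowTotal _)) (solve 3 (λ m r x → m :* (r :* x) := r :* (x :* m)) refl (m * m) rowTotal _) ⟩
    rowTotal * (∑ᴸ (tuples s) (λ τ → inside τ * pairSum (shared rs) τ) * (m * m))
      ≤⟨ *-monoʳ-≤ rowTotal (∑-pairSum s (shared rs)) ⟩
    rowTotal * (s * s * (m ^ s * ∑ N (λ u → 𝟙 (S u) * ∑ N (λ v → 𝟙 (S v) * shared rs u v))))
      ≡⟨ cong (λ z → rowTotal * (s * s * (m ^ s * z))) (∑-shared rs) ⟩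
    rowTotal * (s * s * (m ^ s * covered rs)) ∎
    where
    open ≤-Reasoning
    term : ∀ τ → P ^ s * (inside τ * distinct τ * pairSum (shared rs) τ * ∑ᴸ rows (exact τ)) ≤ rowTotal * (inside τ * pairSum (shared rs) τ)
    term τ with 1 ≤? distinct τ
    ... | no ¬d = ≤-trans (≤-reflexive (trans (cong (λ z → P ^ s * (inside τ * z * pairSum (shared rs) τ * ∑ᴸ rows (exact τ))) (n<1⇒n≡0 (≰⇒> ¬d)))
            (trans (cong (λ z → P ^ s * (z * pairSum (shared rs) τ * ∑ᴸ rows (exact τ))) (*-zeroʳ (inside τ))) (*-zeroʳ (P ^ s))))) z≤n
    ... | yes d = begin
      P ^ s * (inside τ * distinct τ * pairSum (shared rs) τ * ∑ᴸ rows (exact τ))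
        ≡⟨ solve 5 (λ p a d g e → p :* (a :* d :* g :* e) := (p :* e) :* (d :* (a :* g))) refl (P ^ s) (inside τ) (distinct τ) (pairSum (shared rs) τ) (∑ᴸ rows (exact τ)) ⟩
      (P ^ s * ∑ᴸ rows (exact τ)) * (distinct τ * (inside τ * pairSum (shared rs) τ))
        ≤⟨ *-mono-≤ (exact-upper τ d) (≤-trans (*-monoˡ-≤ _ (𝟙≤1 (equalities τ ≤ᵇ 0))) (≤-reflexive (*-identityˡ _))) ⟩
      rowTotal * (inside τ * pairSum (shared rs) τ) ∎

  spoiled : List Row → Row → ℕ
  spoiled rs r = 𝟙 (1 ≤ᵇ spoil rs r)

  -- A hit is spoiled when another blob contains two of its vertices. The indicators of spoiling
  -- depend on each other, so each row is tested separately against the rows after it and the rows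
  -- before it; when rows are revealed one by one, the current row is then independent of the list
  -- in the test.
  module Spoiling (Q₀ q : ℕ) (1≤m : 1 ≤ m) (h : 15 * (M * (s * s * (m ^ s * Q₀))) ≤ q * (P ^ s * (m * m))) where

    private
      B A κ : ℕ
      B = P ^ s * (m * m)
      A = rowTotal * (s * s * (m ^ s * Q₀))
      1≤B : 1 ≤ B
      1≤B = *-mono-≤ (^-pos P s 1≤P) (*-mono-≤ 1≤m 1≤m)
      -- A spoiled row counts 16 instead of 1, a surplus of 15. The quotient is rounded down, which
      -- is harmless because the number of spoiled rows is an integer.
      κ = 15 * (_/_ A B {{>-nonZero 1≤B}})

      bound : ∀ x → B * x ≤ A → 15 * x ≤ κ
      bound x h = *-monoʳ-≤ 15 (subst (_≤ _/_ A B {{>-nonZero 1≤B}}) (m*n/n≡m x B {{>-nonZero 1≤B}})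
        (/-monoˡ-≤ B {{>-nonZero 1≤B}} (≤-trans (≤-reflexive (*-comm x B)) h)))

      Mκ≤ : M * κ ≤ q * rowTotal
      Mκ≤ = *-cancelʳ-≤′ B 1≤B (begin
        M * (15 * d) * B               ≡⟨ solve 3 (λ m d b → m :* (con 15 :* d) :* b := con 15 :* m :* (d :* b)) refl M d B ⟩
        15 * M * (d * B)               ≤⟨ *-monoʳ-≤ (15 * M) (m/n*n≤m A B {{>-nonZero 1≤B}}) ⟩
        15 * M * (rowTotal * X)        ≡⟨ solve 3 (λ m r x → con 15 :* m :* (r :* x) := con 15 :* (m :* x) :* r) refl M rowTotal X ⟩
        15 * (M * X) * rowTotal        ≤⟨ *-monoˡ-≤ rowTotal h ⟩
        q * B * rowTotal               ≡⟨ solve 3 (λ q b r → q :* b :* r := q :* r :* b) refl q B rowTotal ⟩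
        q * rowTotal * B ∎)
        where
        open ≤-Reasoning
        d X : ℕ
        d = _/_ A B {{>-nonZero 1≤B}}
        X = s * s * (m ^ s * Q₀)

      step : ∀ rs → covered rs ≤ Q₀ → ∑ᴸ rows (λ r → 16 ^ spoiled rs r) ≤ rowTotal + κ
      step rs cov = begin
        ∑ᴸ rows (λ r → 16 ^ spoiled rs r)           ≡⟨ ∑ᴸ-cong rows (λ r → pow (1 ≤ᵇ spoil rs r)) ⟩
        ∑ᴸ rows (λ r → 1 + 15 * spoiled rs r)       ≡⟨ trans (∑ᴸ-+ rows _ _) (cong₂ _+_ ∑rows-1 (∑ᴸ-* rows 15 _)) ⟩
        rowTotal + 15 * ∑ᴸ rows (spoiled rs)        ≤⟨ +-monoʳ-≤ rowTotal (bound _ (≤-trans (*-monoʳ-≤ B (∑ᴸ-mono rows (λ r → small (spoil rs r))))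
                                                        (≤-trans (∑-spoil rs) (*-monoʳ-≤ rowTotal (*-monoʳ-≤ (s * s) (*-monoʳ-≤ (m ^ s) cov)))))) ⟩
        rowTotal + κ ∎
        where
        open ≤-Reasoning
        pow : ∀ b → 16 ^ 𝟙 b ≡ 1 + 15 * 𝟙 b
        pow true  = refl
        pow false = refl
        small : ∀ k → 𝟙 (1 ≤ᵇ k) ≤ k
        small zero    = z≤n
        small (suc k) = s≤s z≤n

    later : ∀ {n} → Vec Row n → Fin n → List Row
    later (r ∷ rs) zero    = toList rs
    later (r ∷ rs) (suc i) = later rs i

    earlier : ∀ {n} → List Row → Vec Row n → Fin n → List Row
    earlier acc (r ∷ rs) zero    = acc
    earlier acc (r ∷ rs) (suc i) = earlier (r ∷ acc) rs i

    spoiledLater : ∀ {n} → Vec Row n → ℕ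
    spoiledLater {n} rs = ∑ n (λ i → spoiled (later rs i) (lookup rs i))

    spoiledEarlier : ∀ {n} → List Row → Vec Row n → ℕ
    spoiledEarlier {n} acc rs = ∑ n (λ i → spoiled (earlier acc rs i) (lookup rs i))

    private
      -- The bound on covered pairs is a property of the whole sample, but it is inherited by
      -- sublists. Being an indicator it equals its square: one copy is spent on the current row,
      -- the other is handed to the remaining rows.
      nice : ℕ → ℕ
      nice k = 𝟙 (k ≤ᵇ Q₀)

      nice-mono : ∀ {j k} → j ≤ k → nice k ≤ nice j
      nice-mono {j} {k} h with k ≤ᵇ Q₀ in eq
      ... | false = z≤n
      ... | true  = ≤-reflexive (≡-sym (cong 𝟙 (T⇒ (≤⇒≤ᵇ (≤-trans h (≤ᵇ⇒≤ k Q₀ (subst T (≡-sym eq) _)))))))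
        where
        T⇒ : ∀ {b} → T b → b ≡ true
        T⇒ {true} _ = refl

      nice-step : ∀ rs → nice (covered rs) * ∑ᴸ rows (λ r → 16 ^ spoiled rs r) ≤ rowTotal + κ
      nice-step rs with covered rs ≤ᵇ Q₀ in eq
      ... | false = z≤n
      ... | true  = ≤-trans (≤-reflexive (*-identityˡ _)) (step rs (≤ᵇ⇒≤ (covered rs) Q₀ (subst T (≡-sym eq) _)))

      -- The first row is averaged first, with the later rows, which form its test list, held fixed.
      later-weight : ∀ n → ∑ᴸ (vecs rows n) (λ rs → nice (covered (toList rs)) * 16 ^ spoiledLater rs) ≤ (rowTotal + κ) ^ n
      later-weight zero    = ≤-trans (≤-reflexive (+-identityʳ _)) (*-mono-≤ (𝟙≤1 (0 ≤ᵇ Q₀)) ≤-refl)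
      later-weight (suc n) = begin
        ∑ᴸ (vecs rows (suc n)) (λ rs → nice (covered (toList rs)) * 16 ^ spoiledLater rs)
          ≡⟨ trans (∑ᴸ-vecs rows n _) (∑ᴸ-swap rows (vecs rows n) _) ⟩
        ∑ᴸ (vecs rows n) (λ rs → ∑ᴸ rows (λ r → nice (pairs (hits S r) + covered (toList rs)) * 16 ^ spoiledLater (r ∷ rs)))
          ≤⟨ ∑ᴸ-mono (vecs rows n) each ⟩
        ∑ᴸ (vecs rows n) (λ rs → (rowTotal + κ) * (nice (covered (toList rs)) * 16 ^ spoiledLater rs))
          ≡⟨ ∑ᴸ-* (vecs rows n) (rowTotal + κ) _ ⟩
        (rowTotal + κ) * ∑ᴸ (vecs rows n) (λ rs → nice (covered (toList rs)) * 16 ^ spoiledLater rs)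
          ≤⟨ *-monoʳ-≤ (rowTotal + κ) (later-weight n) ⟩
        (rowTotal + κ) ^ suc n ∎
        where
        open ≤-Reasoning
        each : ∀ rs → ∑ᴸ rows (λ r → nice (pairs (hits S r) + covered (toList rs)) * 16 ^ spoiledLater (r ∷ rs))
               ≤ (rowTotal + κ) * (nice (covered (toList rs)) * 16 ^ spoiledLater rs)
        each rs = begin
          ∑ᴸ rows (λ r → nice (pairs (hits S r) + covered (toList rs)) * 16 ^ spoiledLater (r ∷ rs))
            ≤⟨ ∑ᴸ-mono rows (λ r → *-mono-≤ (nice-mono (m≤n+m c (pairs (hits S r))))
                 (≤-reflexive (trans (cong (16 ^_) (∑-suc n (λ i → spoiled (later (r ∷ rs) i) (lookup (r ∷ rs) i)))) (^-distribˡ-+-* 16 (spoiled (toList rs) r) (spoiledLater rs))))) ⟩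
          ∑ᴸ rows (λ r → nice c * (16 ^ spoiled (toList rs) r * 16 ^ spoiledLater rs))
            ≡⟨ trans (∑ᴸ-cong rows (λ r → solve 3 (λ a b c → a :* (b :* c) := a :* c :* b) refl (nice c) (16 ^ spoiled (toList rs) r) (16 ^ spoiledLater rs)))
                 (∑ᴸ-* rows (nice c * 16 ^ spoiledLater rs) _) ⟩
          nice c * 16 ^ spoiledLater rs * Z
            ≡⟨ trans (cong (λ k → k * 16 ^ spoiledLater rs * Z) (≡-sym (𝟙-idem (c ≤ᵇ Q₀))))
                 (solve 3 (λ a b z → a :* a :* b :* z := (a :* z) :* (a :* b)) refl (nice c) (16 ^ spoiledLater rs) Z) ⟩
          (nice c * Z) * (nice c * 16 ^ spoiledLater rs)
            ≤⟨ *-monoˡ-≤ _ (nice-step (toList rs)) ⟩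
          (rowTotal + κ) * (nice c * 16 ^ spoiledLater rs) ∎
          where
          c Z : ℕ
          c = covered (toList rs)
          Z = ∑ᴸ rows (λ r → 16 ^ spoiled (toList rs) r)

      -- The order is opposite to that of `later-weight`: the remaining rows are averaged first, for
      -- each value of the current row, and the current row last against the fixed list `acc`.
      earlier-weight : ∀ n acc → ∑ᴸ (vecs rows n) (λ rs → nice (covered acc + covered (toList rs)) * 16 ^ spoiledEarlier acc rs) ≤ (rowTotal + κ) ^ n
      earlier-weight zero    acc = ≤-trans (≤-reflexive (+-identityʳ _)) (*-mono-≤ (𝟙≤1 (covered acc + 0 ≤ᵇ Q₀)) ≤-refl)
      earlier-weight (suc n) acc = begin
        ∑ᴸ (vecs rows (suc n)) (λ rs → nice (covered acc + covered (toList rs)) * 16 ^ spoiledEarlier acc rs)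
          ≡⟨ ∑ᴸ-vecs rows n _ ⟩
        ∑ᴸ rows (λ r → ∑ᴸ (vecs rows n) (λ rs → nice (covered acc + (pairs (hits S r) + covered (toList rs))) * 16 ^ spoiledEarlier acc (r ∷ rs)))
          ≤⟨ ∑ᴸ-mono rows each ⟩
        ∑ᴸ rows (λ r → nice (covered acc) * 16 ^ spoiled acc r * (rowTotal + κ) ^ n)
          ≡⟨ trans (∑ᴸ-*ʳ rows _ ((rowTotal + κ) ^ n)) (cong (_* (rowTotal + κ) ^ n) (∑ᴸ-* rows (nice (covered acc)) _)) ⟩
        nice (covered acc) * ∑ᴸ rows (λ r → 16 ^ spoiled acc r) * (rowTotal + κ) ^ n
          ≤⟨ *-monoˡ-≤ ((rowTotal + κ) ^ n) (nice-step acc) ⟩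
        (rowTotal + κ) ^ suc n ∎
        where
        open ≤-Reasoning
        each : ∀ r → ∑ᴸ (vecs rows n) (λ rs → nice (covered acc + (pairs (hits S r) + covered (toList rs))) * 16 ^ spoiledEarlier acc (r ∷ rs))
               ≤ nice (covered acc) * 16 ^ spoiled acc r * (rowTotal + κ) ^ n
        each r = begin
          ∑ᴸ (vecs rows n) (λ rs → nice (covered acc + (p + covered (toList rs))) * 16 ^ spoiledEarlier acc (r ∷ rs))
            ≤⟨ ∑ᴸ-mono (vecs rows n) cell′ ⟩
          ∑ᴸ (vecs rows n) (λ rs → nice (covered acc) * 16 ^ spoiled acc r * (nice (covered (r ∷ acc) + covered (toList rs)) * 16 ^ spoiledEarlier (r ∷ acc) rs))
            ≡⟨ ∑ᴸ-* (vecs rows n) (nice (covered acc) * 16 ^ spoiled acc r) _ ⟩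
          nice (covered acc) * 16 ^ spoiled acc r * ∑ᴸ (vecs rows n) (λ rs → nice (covered (r ∷ acc) + covered (toList rs)) * 16 ^ spoiledEarlier (r ∷ acc) rs)
            ≤⟨ *-monoʳ-≤ (nice (covered acc) * 16 ^ spoiled acc r) (earlier-weight n (r ∷ acc)) ⟩
          nice (covered acc) * 16 ^ spoiled acc r * (rowTotal + κ) ^ n ∎
          where
          p : ℕ
          p = pairs (hits S r)
          cell′ : ∀ rs → nice (covered acc + (p + covered (toList rs))) * 16 ^ spoiledEarlier acc (r ∷ rs)
            ≤ nice (covered acc) * 16 ^ spoiled acc r * (nice (covered (r ∷ acc) + covered (toList rs)) * 16 ^ spoiledEarlier (r ∷ acc) rs)
          cell′ rs = begin
            nice k * 16 ^ spoiledEarlier acc (r ∷ rs)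
              ≡⟨ cong₂ _*_ (≡-sym (𝟙-idem (k ≤ᵇ Q₀))) (trans (cong (16 ^_) (∑-suc n (λ i → spoiled (earlier acc (r ∷ rs) i) (lookup (r ∷ rs) i)))) (^-distribˡ-+-* 16 (spoiled acc r) (spoiledEarlier (r ∷ acc) rs))) ⟩
            nice k * nice k * (16 ^ spoiled acc r * 16 ^ spoiledEarlier (r ∷ acc) rs)
              ≤⟨ *-monoˡ-≤ _ (*-mono-≤ (nice-mono (m≤m+n (covered acc) _)) (≤-reflexive (cong nice
                   (solve 3 (λ a p c → a :+ (p :+ c) := p :+ a :+ c) refl (covered acc) p (covered (toList rs)))))) ⟩
            nice (covered acc) * nice (p + covered acc + covered (toList rs)) * (16 ^ spoiled acc r * 16 ^ spoiledEarlier (r ∷ acc) rs)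
              ≡⟨ *-interchange (nice (covered acc)) _ (16 ^ spoiled acc r) _ ⟩
            nice (covered acc) * 16 ^ spoiled acc r * (nice (covered (r ∷ acc) + covered (toList rs)) * 16 ^ spoiledEarlier (r ∷ acc) rs) ∎
            where
            k : ℕ
            k = covered acc + (p + covered (toList rs))

    later-moment : ∑ᴸ Ω (λ ω → 𝟙 (covered (toList ω) ≤ᵇ Q₀) * 16 ^ spoiledLater ω) ≤ 4 ^ q * total
    later-moment = ≤-trans (later-weight M) ([b+a]^n≤ rowTotal κ M q Mκ≤ 1≤rowTotal)

    earlier-moment : ∑ᴸ Ω (λ ω → 𝟙 (covered (toList ω) ≤ᵇ Q₀) * 16 ^ spoiledEarlier [] ω) ≤ 4 ^ q * total
    earlier-moment = ≤-trans (earlier-weight M []) ([b+a]^n≤ rowTotal κ M q Mκ≤ 1≤rowTotal)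

-- A choice of blobs that is sparse and rich in clean hits

𝟙≡0⇒≰ : ∀ {m n} → 𝟙 (m ≤ᵇ n) ≡ 0 → n < m
𝟙≡0⇒≰ {m} {n} h with m ≤? n
... | yes p with () ← trans (≡-sym (cong 𝟙 (≤ᵇ-true p))) h
... | no ¬p = ≰⇒> ¬p

^-reflect-< : ∀ b {m n} → 1 ≤ b → b ^ m < b ^ n → m < n
^-reflect-< b 1≤b h = ≰⇒> λ n≤m → <⇒≱ h (^-mono-exp b 1≤b n≤m)

+≡0 : ∀ a {b} → a + b ≡ 0 → a ≡ 0 × b ≡ 0
+≡0 zero h = refl , h

∑≡0 : ∀ {A : Set} {xs : List A} {f : A → ℕ} → ∑ᴸ xs f ≡ 0 → ∀ {x} → x ∈ xs → f x ≡ 0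
∑≡0 {f = f} h p = n≤0⇒n≡0 (≤-trans (∑ᴸ-term f p) (≤-reflexive h))

vecs-complete : ∀ {A : Set} (xs : List A) → (∀ x → x ∈ xs) → ∀ n (v : Vec A n) → v ∈ vecs xs n
vecs-complete xs all zero    []      = here refl
vecs-complete xs all (suc n) (x ∷ v) = ∈-concatMap⁺ (λ x → map (x ∷_) (vecs xs n)) (Any-map (λ { refl → ∈-map⁺ (x ∷_) (vecs-complete xs all n v) }) (all x))

bools-complete : ∀ b → b ∈ bools
bools-complete true  = here refl
bools-complete false = there (here refl)

masks-complete : ∀ n (S : Vec Bool n) → S ∈ masks n
masks-complete = vecs-complete bools bools-complete

∑-toList : ∀ {A : Set} {n} (v : Vec A n) (f : A → ℕ) → ∑ᴸ (toList v) f ≡ ∑ n (λ i → f (lookup v i))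
∑-toList []      f = refl
∑-toList {n = suc n} (x ∷ v) f = trans (cong (f x +_) (∑-toList v f)) (≡-sym (∑-suc n (λ i → f (lookup (x ∷ v) i))))

scale : ∀ y T κ → 512 ≤ κ → κ * y ≤ 64 * T → 64 * y ≤ 8 * T
scale y T κ 512≤κ h = *-cancelˡ-≤′ 8 (s≤s z≤n) (≤-trans (≤-reflexive (≡-sym (*-assoc 8 64 y))) (≤-trans (*-monoˡ-≤ y 512≤κ) (≤-trans h (≤-reflexive (*-assoc 8 8 T)))))

module Good (N M s P : ℕ) (s≤P : s ≤ P) (1≤P : 1 ≤ P) where
  open Random N M s P s≤P 1≤P

  record Clean (S : Mask N) (ω : Vec Row M) (i : Fin M) : Set where
    field
      τ        : Vec (Fin N) s
      in-S     : ∀ c → S (lookup τ c) ≡ true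
      distinct : ∀ a b → a ≢ b → lookup τ a ≢ lookup τ b
      colour   : ∀ c → toℕ (lookup (lookup ω i) (lookup τ c)) ≡ toℕ c
      alone    : ∀ a b → a ≢ b → ∀ j → j ≢ i → inc ω j (lookup τ a) ≡ true → inc ω j (lookup τ b) ≡ false

  -- The numerical input of the tail bounds. In `double-ok`, `large-ok`, `hit-ok` and `spoil-ok` the
  -- threshold must outweigh `N^m`, the price of a union over all `m`-sets; `size-ok` and the
  -- density estimate concern events that do not depend on such a set.
  record Thresholds (κ m H R k′ q₁ A₀ qA Λ W₀ x₀ Q₀ q₄ R₄ q₅ R₅ : ℕ) : Set where
    field
      1≤s  : 1 ≤ s
      512≤κ : 512 ≤ κ
      1≤N  : 1 ≤ N
      1≤M  : 1 ≤ M
      1≤H  : 1 ≤ H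
      1≤Λ  : 1 ≤ Λ
      1≤P∸s : 1 ≤ P ∸ s
      2s²≤m : 2 * (s * s) ≤ m
      dense-ok : s * R * (H * H) ≤ P
      size-q   : N * (s * 2) ≤ q₁ * P
      size-ok  : 64 * M * 4 ^ q₁ ≤ 2 ^ k′
      double-Λ : m * (s * Λ) ≤ P
      double-q : 4 * M ≤ qA * (Λ * Λ)
      double-ok : N ^ m * (64 * 4 ^ qA) ≤ 2 ^ A₀
      large-4  : m * (s * 4) ≤ P
      large-x₀ : 4 * M ≤ 2 ^ x₀
      large-ok : N ^ m * 256 ≤ 2 ^ W₀
      hit-P    : m * s ≤ P ∸ s
      hit-q    : 16 * (q₄ * P ^ s) ≤ M * m ^ s
      hit-ok   : N ^ m * (64 * 2 ^ R₄) ≤ 2 ^ q₄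
      R₄≤M     : R₄ ≤ M
      covered-ok : x₀ * x₀ * A₀ + k′ * W₀ ≤ Q₀
      spoil-q  : 15 * (M * (s * s * (m ^ s * Q₀))) ≤ q₅ * (P ^ s * (m * m))
      spoil-ok : N ^ m * (64 * 4 ^ q₅) ≤ 16 ^ R₅

  record GoodFor (κ m H R r : ℕ) (ω : Vec Row M) : Set where
    field
      sparse : ∀ X 𝓑 → card X ≤ H → card 𝓑 ≤ H → R ^ incidence ω X 𝓑 < κ * (N ^ card X * M ^ card 𝓑)
      clean  : ∀ S → card S ≡ m → ∃[ C ] (r ≤ card C × (∀ i → C i ≡ true → Clean S ω i))

  module _ {κ m H R k′ q₁ A₀ qA Λ W₀ x₀ Q₀ q₄ R₄ q₅ R₅ : ℕ} (th : Thresholds κ m H R k′ q₁ A₀ qA Λ W₀ x₀ Q₀ q₄ R₄ q₅ R₅) where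
    open Thresholds th

    private
      1≤m : 1 ≤ m
      1≤m = ≤-trans (*-mono-≤ {1} {2} (s≤s z≤n) (*-mono-≤ 1≤s 1≤s)) 2s²≤m

      all : Mask N
      all _ = true

      module H′ (S : Vec Bool N) = Hits N M s P s≤P 1≤P (lookup S)

      module _ (S : Vec Bool N) (|S| : cardⱽ S ≡ m) where
        private module Sp = H′.Spoiling S Q₀ q₅ (subst (1 ≤_) (≡-sym |S|) 1≤m)
                   (subst (λ m → 15 * (M * (s * s * (m ^ s * Q₀))) ≤ q₅ * (P ^ s * (m * m))) (≡-sym |S|) spoil-q)

        sLater sEarlier : Vec Row M → ℕ
        sLater ω = 𝟙 (H′.covered S (toList ω) ≤ᵇ Q₀) * 16 ^ Sp.spoiledLater ω
        sEarlier ω = 𝟙 (H′.covered S (toList ω) ≤ᵇ Q₀) * 16 ^ Sp.spoiledEarlier [] ω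

        failures : Vec Row M → ℕ
        failures ω = 𝟙 (2 ^ A₀ ≤ᵇ 2 ^ doubles (lookup S) ω) + (𝟙 (2 ^ W₀ ≤ᵇ 2 ^ large x₀ (lookup S) ω)
          + (𝟙 (2 ^ (M ∸ R₄) ≤ᵇ 2 ^ H′.misses S ω) + (𝟙 (16 ^ R₅ ≤ᵇ sLater ω) + 𝟙 (16 ^ R₅ ≤ᵇ sEarlier ω))))

        private
          use : ∀ (W : Vec Row M → ℕ) θ K → ∑ᴸ Ω W ≤ K * total → N ^ m * (64 * K) ≤ θ → 1 ≤ θ → 64 * (∑ᴸ Ω (λ ω → 𝟙 (θ ≤ᵇ W ω)) * N ^ m) ≤ total
          use W θ K h h′ 1≤θ = *-cancelˡ-≤′ θ 1≤θ (begin
            θ * (64 * (C * N ^ m))      ≡⟨ solve 3 (λ t c n → t :* (con 64 :* (c :* n)) := con 64 :* n :* (t :* c)) refl θ C (N ^ m) ⟩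
            64 * N ^ m * (θ * C)        ≤⟨ *-monoʳ-≤ (64 * N ^ m) (≤-trans (markov Ω W θ) h) ⟩
            64 * N ^ m * (K * total)    ≡⟨ solve 3 (λ n k t → con 64 :* n :* (k :* t) := n :* (con 64 :* k) :* t) refl (N ^ m) K total ⟩
            N ^ m * (64 * K) * total    ≤⟨ *-monoˡ-≤ total h′ ⟩
            θ * total ∎)
            where
            open ≤-Reasoning
            C : ℕ
            C = ∑ᴸ Ω (λ ω → 𝟙 (θ ≤ᵇ W ω))
          at : (Q : ℕ → Set) → Q m → Q (cardⱽ S)
          at Q = subst Q (≡-sym |S|)
          missing : 64 * (∑ᴸ Ω (λ ω → 𝟙 (2 ^ (M ∸ R₄) ≤ᵇ 2 ^ H′.misses S ω)) * N ^ m) ≤ total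
          missing = *-cancelˡ-≤′ (2 ^ q₄) (^-pos 2 q₄ (s≤s z≤n)) (*-cancelˡ-≤′ θ (^-pos 2 (M ∸ R₄) (s≤s z≤n)) (begin
            θ * (2 ^ q₄ * (64 * (C * N ^ m)))        ≡⟨ solve 4 (λ t q c n → t :* (q :* (con 64 :* (c :* n))) := con 64 :* n :* (q :* (t :* c))) refl θ (2 ^ q₄) C (N ^ m) ⟩
            64 * N ^ m * (2 ^ q₄ * (θ * C))          ≤⟨ *-monoʳ-≤ (64 * N ^ m) (≤-trans (*-monoʳ-≤ (2 ^ q₄) (markov Ω _ θ)) moment) ⟩
            64 * N ^ m * (2 ^ M * total)             ≡⟨ cong (λ z → 64 * N ^ m * (z * total)) (trans (cong (2 ^_) (≡-sym (m∸n+n≡m R₄≤M))) (^-distribˡ-+-* 2 (M ∸ R₄) R₄)) ⟩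
            64 * N ^ m * (θ * 2 ^ R₄ * total)        ≡⟨ solve 4 (λ n t r x → con 64 :* n :* (t :* r :* x) := t :* (n :* (con 64 :* r) :* x)) refl (N ^ m) θ (2 ^ R₄) total ⟩
            θ * (N ^ m * (64 * 2 ^ R₄) * total)      ≤⟨ *-monoʳ-≤ θ (*-monoˡ-≤ total hit-ok) ⟩
            θ * (2 ^ q₄ * total) ∎))
            where
            open ≤-Reasoning
            θ C : ℕ
            θ = 2 ^ (M ∸ R₄)
            C = ∑ᴸ Ω (λ ω → 𝟙 (2 ^ (M ∸ R₄) ≤ᵇ 2 ^ H′.misses S ω))
            moment : 2 ^ q₄ * ∑ᴸ Ω (λ ω → 2 ^ H′.misses S ω) ≤ 2 ^ M * total
            moment = H′.misses-moment S q₄ 1≤s (at (1 ≤_) 1≤m) (at (2 * (s * s) ≤_) 2s²≤m) (at (λ m → m * s ≤ P ∸ s) hit-P) 1≤P∸s (at (λ m → 16 * (q₄ * P ^ s) ≤ M * m ^ s) hit-q)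

        failures-rare : 64 * (∑ᴸ Ω failures * N ^ m) ≤ 5 * total
        failures-rare = begin
          64 * (∑ᴸ Ω failures * N ^ m)
            ≡⟨ cong (λ z → 64 * (z * N ^ m)) (trans (∑ᴸ-+ Ω _ _) (cong (a +_) (trans (∑ᴸ-+ Ω _ _) (cong (b +_) (trans (∑ᴸ-+ Ω _ _) (cong (c +_) (∑ᴸ-+ Ω _ _))))))) ⟩
          64 * ((a + (b + (c + (d + e)))) * N ^ m)
            ≡⟨ solve 6 (λ a b c d e n → con 64 :* ((a :+ (b :+ (c :+ (d :+ e)))) :* n) := con 64 :* (a :* n) :+ (con 64 :* (b :* n) :+ (con 64 :* (c :* n) :+ (con 64 :* (d :* n) :+ con 64 :* (e :* n))))) refl a b c d e (N ^ m) ⟩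
          64 * (a * N ^ m) + (64 * (b * N ^ m) + (64 * (c * N ^ m) + (64 * (d * N ^ m) + 64 * (e * N ^ m))))
            ≤⟨ +-mono-≤ (use _ (2 ^ A₀) (4 ^ qA) (doubles-moment (lookup S) Λ qA (at (λ m → m * (s * Λ) ≤ P) double-Λ) 1≤Λ double-q) double-ok (^-pos 2 A₀ (s≤s z≤n)))
              (+-mono-≤ (use _ (2 ^ W₀) 4 (large-moment (lookup S) x₀ (at (λ m → m * (s * 4) ≤ P) large-4) large-x₀) large-ok (^-pos 2 W₀ (s≤s z≤n)))
              (+-mono-≤ missing
              (+-mono-≤ (use sLater (16 ^ R₅) (4 ^ q₅) Sp.later-moment spoil-ok (^-pos 16 R₅ (s≤s z≤n)))
                        (use sEarlier (16 ^ R₅) (4 ^ q₅) Sp.earlier-moment spoil-ok (^-pos 16 R₅ (s≤s z≤n)))))) ⟩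
          total + (total + (total + (total + total)))   ≡⟨ solve 1 (λ t → t :+ (t :+ (t :+ (t :+ t))) := con 5 :* t) refl total ⟩
          5 * total ∎
          where
          open ≤-Reasoning
          a b c d e : ℕ
          a = ∑ᴸ Ω (λ ω → 𝟙 (2 ^ A₀ ≤ᵇ 2 ^ doubles (lookup S) ω))
          b = ∑ᴸ Ω (λ ω → 𝟙 (2 ^ W₀ ≤ᵇ 2 ^ large x₀ (lookup S) ω))
          c = ∑ᴸ Ω (λ ω → 𝟙 (2 ^ (M ∸ R₄) ≤ᵇ 2 ^ H′.misses S ω))
          d = ∑ᴸ Ω (λ ω → 𝟙 (16 ^ R₅ ≤ᵇ sLater ω))
          e = ∑ᴸ Ω (λ ω → 𝟙 (16 ^ R₅ ≤ᵇ sEarlier ω))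

        split : ∀ {n} (rs : Vec Row n) acc i j → j ≢ i → lookup rs j ∈ Sp.later rs i ⊎ lookup rs j ∈ Sp.earlier acc rs i
        split (r ∷ rs) acc zero    zero    j≢i = ⊥-elim (j≢i refl)
        split (r ∷ rs) acc zero    (suc j) j≢i = inj₁ (∈-toList rs j)
          where
          ∈-toList : ∀ {n} (rs : Vec Row n) j → lookup rs j ∈ toList rs
          ∈-toList (r ∷ rs) zero    = here refl
          ∈-toList (r ∷ rs) (suc j) = there (∈-toList rs j)
        split (r ∷ rs) acc (suc i) zero    j≢i = inj₂ (keep rs (r ∷ acc) i (here refl))
          where
          keep : ∀ {n} (rs : Vec Row n) acc i {r} → r ∈ acc → r ∈ Sp.earlier acc rs i
          keep (x ∷ rs) acc zero    p = p
          keep (x ∷ rs) acc (suc i) p = keep rs (x ∷ acc) i (there p)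
        split (r ∷ rs) acc (suc i) (suc j) j≢i = split rs (r ∷ acc) i j (j≢i ∘ cong suc)

        unspoiled : ∀ rs r τ → 1 ≤ Tuples.inside (lookup S) τ → 1 ≤ Tuples.distinct (lookup S) τ → 1 ≤ H′.exact S τ r → H′.spoil S rs r ≡ 0 →
          ∀ a b → a ≢ b → ∀ r′ → r′ ∈ rs → isIn (lookup r′ (lookup τ a)) ≡ true → isIn (lookup r′ (lookup τ b)) ≡ false
        unspoiled rs r τ i d e none a b a≢b r′ r′∈ p with isIn (lookup r′ (lookup τ b)) in q
        ... | false = refl
        ... | true  = ⊥-elim (<⇒≱ (s≤s z≤n) (≤-trans positive (≤-reflexive none)))
          where
          u v : Fin N
          u = lookup τ a
          v = lookup τ b
          shared≥1 : 1 ≤ H′.shared S rs u v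
          shared≥1 rewrite ≢⇒== (Tuples.distinct⇒ (lookup S) τ d a b a≢b) =
            ≤-trans (≤-trans (≤-reflexive (≡-sym (cong₂ (λ x y → 𝟙 x * 𝟙 y) p q))) (∑ᴸ-term (λ r → 𝟙 (isIn (lookup r u)) * 𝟙 (isIn (lookup r v))) r′∈)) (≤-reflexive (≡-sym (+-identityʳ _)))
          pair≥1 : 1 ≤ Tuples.pairSum (lookup S) (H′.shared S rs) τ
          pair≥1 = ≤-trans shared≥1 (≤-trans (≤-trans (≤-reflexive (trans (≡-sym (*-identityˡ _)) (cong (λ b → 𝟙 (not b) * H′.shared S rs u v) (≡-sym (≢⇒== a≢b)))))
            (∑-term s (λ b → 𝟙 (not (a == b)) * H′.shared S rs (lookup τ a) (lookup τ b)) b))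
            (∑-term s (λ a → ∑ s (λ b → 𝟙 (not (a == b)) * H′.shared S rs (lookup τ a) (lookup τ b))) a))
          positive : 1 ≤ H′.spoil S rs r
          positive = ≤-trans (*-mono-≤ (*-mono-≤ (*-mono-≤ i d) e) pair≥1)
            (∑ᴸ-term (λ τ → Tuples.inside (lookup S) τ * Tuples.distinct (lookup S) τ * H′.exact S τ r * Tuples.pairSum (lookup S) (H′.shared S rs) τ) (vecs-complete (allFin N) ∈-allFin s τ))

        trace≤ : ∀ r → trace (lookup S) r ≤ trace all r
        trace≤ r = card-mono {X = hits (lookup S) r} {Y = hits all r} (λ v → ∧-elimʳ (lookup S v))

        extract : ∀ ω → (∀ i → trace all (lookup ω i) < k′) → failures ω ≡ 0 →
          ∃[ C ] (R₄ ∸ 2 * R₅ ≤ card C × (∀ i → C i ≡ true → Clean (lookup S) ω i))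
        extract ω sizes none = C , count , clean
          where
          f₁ = +≡0 _ none
          f₂ = +≡0 _ (proj₂ f₁)
          f₃ = +≡0 _ (proj₂ f₂)
          f₄ = +≡0 _ (proj₂ f₃)
          few-doubles : doubles (lookup S) ω < A₀
          few-doubles = ^-reflect-< 2 (s≤s z≤n) (𝟙≡0⇒≰ (proj₁ f₁))
          few-large : large x₀ (lookup S) ω < W₀
          few-large = ^-reflect-< 2 (s≤s z≤n) (𝟙≡0⇒≰ (proj₁ f₂))
          few-misses : H′.misses S ω < M ∸ R₄
          few-misses = ^-reflect-< 2 (s≤s z≤n) (𝟙≡0⇒≰ (proj₁ f₃))
          -- A blob with at most `x₀` points of `S` covers at most `x₀²` pairs and only matters if
          -- it has two such points. A larger one covers at most `k′` pairs per point, since no blob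
          -- has more than `k′` vertices. Neither bound alone would be strong enough.
          cov : H′.covered S (toList ω) ≤ Q₀
          cov = begin
            H′.covered S (toList ω)                                     ≡⟨ ∑-toList ω _ ⟩
            ∑ M (λ i → pairs (hits (lookup S) (lookup ω i)))            ≤⟨ ∑-mono M each ⟩
            ∑ M (λ i → x₀ * x₀ * 𝟙 (2 ≤ᵇ trace (lookup S) (lookup ω i)) + k′ * bulk x₀ (trace (lookup S) (lookup ω i)))
              ≡⟨ trans (∑ᴸ-+ (allFin M) _ _) (cong₂ _+_ (∑ᴸ-* (allFin M) (x₀ * x₀) _) (∑ᴸ-* (allFin M) k′ _)) ⟩
            x₀ * x₀ * doubles (lookup S) ω + k′ * large x₀ (lookup S) ω ≤⟨ +-mono-≤ (*-monoʳ-≤ (x₀ * x₀) (<⇒≤ few-doubles)) (*-monoʳ-≤ k′ (<⇒≤ few-large)) ⟩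
            x₀ * x₀ * A₀ + k′ * W₀                                      ≤⟨ covered-ok ⟩
            Q₀ ∎
            where
            open ≤-Reasoning
            each : ∀ i → pairs (hits (lookup S) (lookup ω i)) ≤ x₀ * x₀ * 𝟙 (2 ≤ᵇ trace (lookup S) (lookup ω i)) + k′ * bulk x₀ (trace (lookup S) (lookup ω i))
            each i = go y (pairs p) (card² p) (≤-trans (trace≤ (lookup ω i)) (<⇒≤ (sizes i)))
              where
              p : Mask N
              p = hits (lookup S) (lookup ω i)
              y : ℕ
              y = card p
              go : ∀ y z → y * y ≡ y + z → y ≤ k′ → z ≤ x₀ * x₀ * 𝟙 (2 ≤ᵇ y) + k′ * bulk x₀ y
              go 0 z eq _ = ≤-trans (≤-reflexive (≡-sym eq)) z≤n
              go 1 z eq _ = ≤-trans (≤-reflexive (suc-injective (≡-sym eq))) z≤n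
              go y@(suc (suc _)) z eq y≤k with x₀ ≤ᵇ y in le
              ... | true  = ≤-trans (≤-trans (m≤n+m z y) (≤-trans (≤-reflexive (≡-sym eq)) (*-monoˡ-≤ y y≤k))) (m≤n+m _ _)
              ... | false = ≤-trans (≤-trans (m≤n+m z y) (≤-trans (≤-reflexive (≡-sym eq)) (≤-trans (*-mono-≤ y≤x y≤x) (≤-reflexive (≡-sym (*-identityʳ _)))))) (m≤m+n _ _)
                where
                y≤x : y ≤ x₀
                y≤x = <⇒≤ (≰⇒> λ h → contra (trans (≡-sym le) (≤ᵇ-true h)))
                  where
                  contra : false ≡ true → ⊥
                  contra ()
          nice≡1 : 𝟙 (H′.covered S (toList ω) ≤ᵇ Q₀) ≡ 1
          nice≡1 = cong 𝟙 (≤ᵇ-true cov)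
          few-later : Sp.spoiledLater ω < R₅
          few-later = ^-reflect-< 16 (s≤s z≤n) (subst (_< 16 ^ R₅) (trans (cong (_* 16 ^ Sp.spoiledLater ω) nice≡1) (*-identityˡ _)) (𝟙≡0⇒≰ (proj₁ f₄)))
          few-earlier : Sp.spoiledEarlier [] ω < R₅
          few-earlier = ^-reflect-< 16 (s≤s z≤n) (subst (_< 16 ^ R₅) (trans (cong (_* 16 ^ Sp.spoiledEarlier [] ω) nice≡1) (*-identityˡ _)) (𝟙≡0⇒≰ (proj₂ f₄)))
          bad : Fin M → Bool
          bad i = (1 ≤ᵇ H′.spoil S (Sp.later ω i) (lookup ω i)) ∨ (1 ≤ᵇ H′.spoil S (Sp.earlier [] ω i) (lookup ω i))
          C : Mask M
          C i = (1 ≤ᵇ H′.hit S (lookup ω i)) ∧ not (bad i)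
          many-hits : R₄ ≤ ∑ M (λ i → H′.hit S (lookup ω i))
          many-hits = +-cancelʳ-≤ (M ∸ R₄) _ _ (begin
            R₄ + (M ∸ R₄)                                              ≡⟨ trans (m+[n∸m]≡n R₄≤M) (≡-sym (∑-1 M)) ⟩
            ∑ M (λ _ → 1)                                              ≤⟨ ∑-mono M (λ i → m≤n+m∸n 1 (H′.hit S (lookup ω i))) ⟩
            ∑ M (λ i → H′.hit S (lookup ω i) + (1 ∸ H′.hit S (lookup ω i)))  ≡⟨ ∑ᴸ-+ (allFin M) _ _ ⟩
            ∑ M (λ i → H′.hit S (lookup ω i)) + H′.misses S ω          ≤⟨ +-monoʳ-≤ (∑ M (λ i → H′.hit S (lookup ω i))) (<⇒≤ few-misses) ⟩
            ∑ M (λ i → H′.hit S (lookup ω i)) + (M ∸ R₄) ∎)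
            where open ≤-Reasoning
          count : R₄ ∸ 2 * R₅ ≤ card C
          count = m≤n+o⇒m∸n≤o R₄ (2 * R₅) (begin
            R₄                                                         ≤⟨ many-hits ⟩
            ∑ M (λ i → H′.hit S (lookup ω i))                          ≤⟨ ∑-mono M each ⟩
            ∑ M (λ i → (H′.spoiled S (Sp.later ω i) (lookup ω i) + H′.spoiled S (Sp.earlier [] ω i) (lookup ω i)) + 𝟙 (C i))
              ≡⟨ trans (∑ᴸ-+ (allFin M) _ _) (cong (_+ card C) (∑ᴸ-+ (allFin M) _ _)) ⟩
            Sp.spoiledLater ω + Sp.spoiledEarlier [] ω + card C        ≤⟨ +-monoˡ-≤ (card C) (+-mono-≤ (<⇒≤ few-later) (<⇒≤ few-earlier)) ⟩
            R₅ + R₅ + card C                                           ≡⟨ cong (λ z → R₅ + z + card C) (≡-sym (+-identityʳ R₅)) ⟩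
            2 * R₅ + card C ∎)
            where
            open ≤-Reasoning
            cases : ∀ h b c → h ≤ 1 → h ≤ (𝟙 b + 𝟙 c) + 𝟙 ((1 ≤ᵇ h) ∧ not (b ∨ c))
            cases 0 b c _ = z≤n
            cases 1 true  c     _ = s≤s z≤n
            cases 1 false true  _ = s≤s z≤n
            cases 1 false false _ = s≤s z≤n
            cases (suc (suc h)) b c (s≤s ())
            each : ∀ i → H′.hit S (lookup ω i) ≤ (H′.spoiled S (Sp.later ω i) (lookup ω i) + H′.spoiled S (Sp.earlier [] ω i) (lookup ω i)) + 𝟙 (C i)
            each i = cases (H′.hit S (lookup ω i)) (1 ≤ᵇ H′.spoil S (Sp.later ω i) (lookup ω i)) (1 ≤ᵇ H′.spoil S (Sp.earlier [] ω i) (lookup ω i)) (H′.hit≤1 S (lookup ω i))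
          clean : ∀ i → C i ≡ true → Clean (lookup S) ω i
          clean i h with H′.hit-tuple S (lookup ω i) (≤ᵇ⇒≤ 1 _ (subst T (≡-sym (∧-elimˡ h)) _))
          ... | τ , ins , dis , ex = record
            { τ = τ
            ; in-S = λ c → pos⇒true _ (∏-pos s _ ins c)
            ; distinct = Tuples.distinct⇒ (lookup S) τ dis
            ; colour = H′.exact-colour S τ (lookup ω i) ex
            ; alone = λ a b a≢b j j≢i → alone a b a≢b j (split ω [] i j j≢i)
            }
            where
            zero-spoil : ∀ k → (1 ≤ᵇ k) ≡ false → k ≡ 0
            zero-spoil zero _ = refl
            not-bad : bad i ≡ false
            not-bad with bad i | ∧-elimʳ (1 ≤ᵇ H′.hit S (lookup ω i)) h
            ... | false | _ = refl
            ∨-false : ∀ {a b} → a ∨ b ≡ false → a ≡ false × b ≡ false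
            ∨-false {false} {false} _ = refl , refl
            alone : ∀ a b → a ≢ b → ∀ j → lookup ω j ∈ Sp.later ω i ⊎ lookup ω j ∈ Sp.earlier [] ω i →
              inc ω j (lookup τ a) ≡ true → inc ω j (lookup τ b) ≡ false
            alone a b a≢b j (inj₁ p) = unspoiled (Sp.later ω i) (lookup ω i) τ ins dis ex (zero-spoil _ (proj₁ (∨-false not-bad))) a b a≢b (lookup ω j) p
            alone a b a≢b j (inj₂ p) = unspoiled (Sp.earlier [] ω i) (lookup ω i) τ ins dis ex (zero-spoil _ (proj₂ (∨-false not-bad))) a b a≢b (lookup ω j) p

      oversized : Vec Row M → ℕ
      oversized ω = ∑ M (λ i → 𝟙 (k′ ≤ᵇ trace all (lookup ω i)))

      -- One oversized blob already lifts `64^oversized` to 64 while the mean is at most 4, hence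
      -- the fraction 1/16.
      oversized-rare : 16 * ∑ᴸ Ω (λ ω → 𝟙 (64 ≤ᵇ 64 ^ oversized ω)) ≤ total
      oversized-rare = *-cancelˡ-≤′ 4 (s≤s z≤n) (≤-trans (≤-reflexive (≡-sym (*-assoc 4 16 (∑ᴸ Ω (λ ω → 𝟙 (64 ≤ᵇ 64 ^ oversized ω)))))) (≤-trans (markov Ω (λ ω → 64 ^ oversized ω) 64)
        (rows-moment (λ r → 𝟙 (k′ ≤ᵇ trace all r)) 64 (64 * cnt) 1
          (≤-trans (∑ᴸ-mono rows (λ r → pow (k′ ≤ᵇ trace all r))) (≤-reflexive (trans (∑ᴸ-+ rows _ _) (cong₂ _+_ ∑rows-1 (∑ᴸ-* rows 64 _)))))
          (*-cancelˡ-≤′ (2 ^ k′) (^-pos 2 k′ (s≤s z≤n)) (begin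
            2 ^ k′ * (M * (64 * cnt))         ≡⟨ solve 3 (λ t m c → t :* (m :* (con 64 :* c)) := con 64 :* m :* (t :* c)) refl (2 ^ k′) M cnt ⟩
            64 * M * (2 ^ k′ * cnt)           ≤⟨ *-monoʳ-≤ (64 * M) cnt≤ ⟩
            64 * M * (4 ^ q₁ * rowTotal)      ≡⟨ ≡-sym (*-assoc (64 * M) (4 ^ q₁) rowTotal) ⟩
            64 * M * 4 ^ q₁ * rowTotal        ≤⟨ *-monoˡ-≤ rowTotal size-ok ⟩
            2 ^ k′ * rowTotal                 ≡⟨ cong (2 ^ k′ *_) (≡-sym (*-identityˡ rowTotal)) ⟩
            2 ^ k′ * (1 * rowTotal) ∎)))))
        where
        open ≤-Reasoning
        cnt : ℕ
        cnt = ∑ᴸ rows (λ r → 𝟙 (k′ ≤ᵇ trace all r))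
        pow : ∀ b → 64 ^ 𝟙 b ≤ 1 + 64 * 𝟙 b
        pow true  = ≤ᵇ⇒≤ 64 65 _
        pow false = ≤-refl
        cnt≤ : 2 ^ k′ * cnt ≤ 4 ^ q₁ * rowTotal
        cnt≤ = ≤-trans (≤-trans (*-monoʳ-≤ (2 ^ k′) (∑ᴸ-mono rows (λ r → same k′ (trace all r)))) (markov rows (λ r → 2 ^ trace all r) (2 ^ k′)))
          (trace-moment all 2 q₁ (subst (λ n → n * (s * 2) ≤ q₁ * P) (≡-sym (∑-1 N)) size-q))
          where
          same : ∀ k y → 𝟙 (k ≤ᵇ y) ≤ 𝟙 (2 ^ k ≤ᵇ 2 ^ y)
          same k y with k ≤ᵇ y in eq
          ... | false = z≤n
          ... | true  = ≤-reflexive (≡-sym (cong 𝟙 (≤ᵇ-true (^-monoʳ-≤ 2 (≤ᵇ⇒≤ k y (subst T (≡-sym eq) _))))))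

      failing : (S : Vec Bool N) → Dec (cardⱽ S ≡ m) → Vec Row M → ℕ
      failing S (yes p) ω = failures S p ω
      failing S (no _)  ω = 0

      failing-rare : ∀ S d → 64 * ∑ᴸ Ω (failing S d) * N ^ cardⱽ S ≤ 5 * total
      failing-rare S (yes p) = ≤-trans (≤-reflexive (trans (*-assoc 64 (∑ᴸ Ω (failures S p)) (N ^ cardⱽ S)) (cong (λ k → 64 * (∑ᴸ Ω (failures S p) * N ^ k)) {cardⱽ S} {m} p))) (failures-rare S p)
      failing-rare S (no _)  = ≤-trans (≤-reflexive (cong (λ z → 64 * z * N ^ cardⱽ S) (∑ᴸ-zero Ω))) z≤n

      bad₁ bad₂ bad₃ : Vec Row M → ℕ
      bad₁ ω = 𝟙 (64 ≤ᵇ 64 ^ oversized ω)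
      bad₂ ω = ∑ᴸ (masks N) (λ X → ∑ᴸ (masks M) (λ 𝓑 → dense H R κ X 𝓑 ω))
      bad₃ ω = ∑ᴸ (masks N) (λ S → failing S (cardⱽ S ≟ m) ω)

      -- Out of 64 parts, oversized blobs take 4, dense configurations 8, and the five failures of
      -- an `m`-set 20, where the union bound contributes a factor 4.
      bad<total : ∑ᴸ Ω (λ ω → bad₁ ω + (bad₂ ω + bad₃ ω)) < ∑ᴸ Ω (λ _ → 1)
      bad<total = subst (∑ᴸ Ω (λ ω → bad₁ ω + (bad₂ ω + bad₃ ω)) <_) (≡-sym ∑Ω-1) (*-cancelˡ-< 64 _ _ (begin-strict
        64 * ∑ᴸ Ω (λ ω → bad₁ ω + (bad₂ ω + bad₃ ω))
          ≡⟨ cong (64 *_) (trans (∑ᴸ-+ Ω _ _) (cong (x +_) (∑ᴸ-+ Ω _ _))) ⟩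
        64 * (x + (y + z))                          ≡⟨ solve 3 (λ x y z → con 64 :* (x :+ (y :+ z)) := con 4 :* (con 16 :* x) :+ (con 64 :* y :+ con 64 :* z)) refl x y z ⟩
        4 * (16 * x) + (64 * y + 64 * z)            ≤⟨ +-mono-≤ (*-monoʳ-≤ 4 oversized-rare) (+-mono-≤ y≤ z≤) ⟩
        4 * total + (8 * total + 20 * total)        ≡⟨ solve 1 (λ t → con 4 :* t :+ (con 8 :* t :+ con 20 :* t) := con 32 :* t) refl total ⟩
        32 * total                                  <⟨ *-monoˡ-< total {{total-nonzero}} {32} {64} (≤ᵇ⇒≤ 33 64 _) ⟩
        64 * total ∎))
        where
        open ≤-Reasoning
        total-nonzero : NonZero total
        total-nonzero = >-nonZero (^-pos rowTotal M 1≤rowTotal)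
        x y z : ℕ
        x = ∑ᴸ Ω bad₁
        y = ∑ᴸ Ω bad₂
        z = ∑ᴸ Ω bad₃
        y≤ : 64 * y ≤ 8 * total
        y≤ = scale y total κ 512≤κ (≤-trans (≤-reflexive (cong (κ *_) (trans (∑ᴸ-swap Ω (masks N) _) (∑ᴸ-cong (masks N) (λ X → ∑ᴸ-swap Ω (masks M) _)))))
          (dense-rare H R κ 1≤H 1≤N 1≤M dense-ok))
        z≤ : 64 * z ≤ 20 * total
        z≤ = ≤-trans (≤-reflexive (trans (cong (64 *_) (∑ᴸ-swap Ω (masks N) _)) (≡-sym (∑ᴸ-* (masks N) 64 _))))
          (≤-trans (union-masks N 1≤N _ (5 * total) (λ S → failing-rare S (cardⱽ S ≟ m))) (≤-reflexive (≡-sym (*-assoc 4 5 total))))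

    exists : ∃[ ω ] GoodFor κ m H R (R₄ ∸ 2 * R₅) ω
    exists = proj₁ found , good (proj₁ found) (proj₂ found)
      where
      found : ∃[ ω ] (bad₁ ω + (bad₂ ω + bad₃ ω) < 1)
      found = ∑ᴸ-<⇒∃ Ω bad<total

      good : ∀ ω → bad₁ ω + (bad₂ ω + bad₃ ω) < 1 → GoodFor κ m H R (R₄ ∸ 2 * R₅) ω
      good ω lt = record { sparse = sparse ; clean = clean }
       where
        none : bad₁ ω + (bad₂ ω + bad₃ ω) ≡ 0
        none = n<1⇒n≡0 lt
        none₁ = +≡0 (bad₁ ω) none
        none₂ = +≡0 (bad₂ ω) (proj₂ none₁)
        card-tabulate : ∀ {n} (X : Mask n) → card X ≡ cardⱽ (tabulateⱽ X)
        card-tabulate {n} X = ∑-cong n (λ v → cong 𝟙 (≡-sym (lookup∘tabulate X v)))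
        sparse : ∀ X 𝓑 → card X ≤ H → card 𝓑 ≤ H → R ^ incidence ω X 𝓑 < κ * (N ^ card X * M ^ card 𝓑)
        sparse X 𝓑 hX h𝓑 = transport (𝟙≡0⇒≰ cell)
          where
          X′ : Vec Bool N
          X′ = tabulateⱽ X
          𝓑′ : Vec Bool M
          𝓑′ = tabulateⱽ 𝓑
          cell : 𝟙 (κ * (N ^ cardⱽ X′ * M ^ cardⱽ 𝓑′) ≤ᵇ R ^ incidence ω (lookup X′) (lookup 𝓑′)) ≡ 0
          cell = trans (≡-sym (*-identityˡ _)) (trans (cong (λ b → 𝟙 b * 𝟙 (κ * (N ^ cardⱽ X′ * M ^ cardⱽ 𝓑′) ≤ᵇ R ^ incidence ω (lookup X′) (lookup 𝓑′)))
            (≡-sym (∧-intro (≤ᵇ-true (subst (_≤ H) (card-tabulate X) hX)) (≤ᵇ-true (subst (_≤ H) (card-tabulate 𝓑) h𝓑)))))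
            (∑≡0 {xs = masks M} (∑≡0 {xs = masks N} (proj₁ none₂) (masks-complete N X′)) (masks-complete M 𝓑′)))
          same-incidence : incidence ω (lookup X′) (lookup 𝓑′) ≡ incidence ω X 𝓑
          same-incidence = ∑-cong M (λ B → ∑-cong N (λ v → cong₂ (λ a b → 𝟙 (a ∧ (b ∧ inc ω B v))) (lookup∘tabulate 𝓑 B) (lookup∘tabulate X v)))
          transport : R ^ incidence ω (lookup X′) (lookup 𝓑′) < κ * (N ^ cardⱽ X′ * M ^ cardⱽ 𝓑′) → R ^ incidence ω X 𝓑 < κ * (N ^ card X * M ^ card 𝓑)
          transport = subst₂ _<_ (cong (R ^_) same-incidence) (cong₂ (λ x y → κ * (N ^ x * M ^ y)) (≡-sym (card-tabulate X)) (≡-sym (card-tabulate 𝓑)))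
        sizes : ∀ i → trace all (lookup ω i) < k′
        sizes i = 𝟙≡0⇒≰ (n≤0⇒n≡0 (≤-trans (∑-term M (λ i → 𝟙 (k′ ≤ᵇ trace all (lookup ω i))) i) (≤-pred (^-reflect-< 64 {oversized ω} {1} (s≤s z≤n) (𝟙≡0⇒≰ {64} {64 ^ oversized ω} (proj₁ none₁))))))
        clean : ∀ S → card S ≡ m → ∃[ C ] (R₄ ∸ 2 * R₅ ≤ card C × (∀ i → C i ≡ true → Clean S ω i))
        clean S |S| = convert (extract S′ (trans (≡-sym (card-tabulate S)) |S|) ω sizes (at (cardⱽ S′ ≟ m) (∑≡0 {xs = masks N} (proj₂ none₂) (masks-complete N S′))))
          where
          S′ : Vec Bool N
          S′ = tabulateⱽ S
          at : ∀ d → failing S′ d ω ≡ 0 → failures S′ (trans (≡-sym (card-tabulate S)) |S|) ω ≡ 0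
          at (yes p) h = subst (λ (p : cardⱽ S′ ≡ m) → failures S′ p ω ≡ 0) (≡-irrelevant p (trans (≡-sym (card-tabulate S)) |S|)) h
          at (no ¬p) _ = ⊥-elim (¬p (trans (≡-sym (card-tabulate S)) |S|))
          convert : ∃[ C ] (R₄ ∸ 2 * R₅ ≤ card C × (∀ i → C i ≡ true → Clean (lookup S′) ω i)) → ∃[ C ] (R₄ ∸ 2 * R₅ ≤ card C × (∀ i → C i ≡ true → Clean S ω i))
          convert (C , count , f) = C , count , λ i h → record
            { τ = Clean.τ (f i h)
            ; in-S = λ c → trans (≡-sym (lookup∘tabulate S _)) (Clean.in-S (f i h) c)
            ; distinct = Clean.distinct (f i h)
            ; colour = Clean.colour (f i h)
            ; alone = Clean.alone (f i h)
            }

-- Random coins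

module Coins (N Q : ℕ) (1≤Q : 1 ≤ Q) where

  -- One coin for every ordered pair, which saves the choice of an orientation; an edge will need
  -- both of its coins. A coin is on when it shows 0, with probability `1/(Q+1)`.
  Coin : Set
  Coin = Vec (Vec (Fin (suc Q)) N) N

  coins : List Coin
  coins = vecs (vecs (allFin (suc Q)) N) N

  record Pattern : Set where
    field
      on off : Fin N → Fin N → Bool
  open Pattern public

  support : Pattern → Fin N → Fin N → Bool
  support p x y = on p x y ∨ off p x y

  isZero : Fin (suc Q) → Bool
  isZero c = toℕ c ≡ᵇ 0

  weight : Pattern → Fin N → Fin N → Fin (suc Q) → ℕ
  weight p x y c = if on p x y then 𝟙 (isZero c) else (if off p x y then 𝟙 (not (isZero c)) else 1)

  Weights : Set
  Weights = Fin N → Fin N → Fin (suc Q) → ℕ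

  prod : Weights → Coin → ℕ
  prod G k = ∏ N (λ x → ∏ N (λ y → G x y (lookup (lookup k x) y)))

  mean : Weights → ℕ
  mean G = ∏ N (λ x → ∏ N (λ y → ∑ (suc Q) (G x y)))

  ∑-prod : ∀ G → ∑ᴸ coins (prod G) ≡ mean G
  ∑-prod G = trans (∑ᴸ-vecs-∏ (vecs (allFin (suc Q)) N) N (λ x row → ∏ N (λ y → G x y (lookup row y))))
    (∏-cong N (λ x → ∑ᴸ-vecs-∏ (allFin (suc Q)) N (G x)))

  unit : Weights
  unit _ _ _ = 1

  total : ℕ
  total = mean unit

  total-coins : ∑ᴸ coins (λ _ → 1) ≡ total
  total-coins = trans (∑ᴸ-cong coins (λ k → ≡-sym (∏∏-1))) (∑-prod unit)
    where
    ∏∏-1 : ∏ N (λ x → ∏ N (λ y → 1)) ≡ 1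
    ∏∏-1 = trans (∏-cong N (λ _ → trans (∏-const N 1) (^-zeroˡ N))) (trans (∏-const N 1) (^-zeroˡ N))

  sat : Pattern → Coin → ℕ
  sat p = prod (weight p)

  weight≤1 : ∀ p x y c → weight p x y c ≤ 1
  weight≤1 p x y c with on p x y | off p x y
  ... | true  | _     = 𝟙≤1 _
  ... | false | true  = 𝟙≤1 _
  ... | false | false = ≤-refl

  sat≤1 : ∀ p k → sat p k ≤ 1
  sat≤1 p k = ∏-≤1 N _ (λ x → ∏-≤1 N _ (λ y → weight≤1 p x y (lookup (lookup k x) y)))

  none : List Pattern → Coin → ℕ
  none []       k = 1
  none (p ∷ ps) k = (1 ∸ sat p k) * none ps k

  ∏∏-* : ∀ (f g : Fin N → Fin N → ℕ) → ∏ N (λ x → ∏ N (λ y → f x y * g x y)) ≡ ∏ N (λ x → ∏ N (f x)) * ∏ N (λ x → ∏ N (g x))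
  ∏∏-* f g = trans (∏-cong N (λ x → ∏-* N (f x) (g x))) (∏-* N _ _)

  _⊙_ : Weights → Weights → Weights
  (G ⊙ G′) x y c = G x y c * G′ x y c

  Free : Weights → Pattern → Set
  Free G p = ∀ x y → support p x y ≡ true → ∀ c → G x y c ≡ 1

  independent : ∀ G p → Free G p → mean (G ⊙ weight p) * total ≡ mean G * mean (weight p)
  independent G p free = trans (≡-sym (∏∏-* _ _)) (trans (∏-cong N (λ x → ∏-cong N (λ y → cell x y))) (∏∏-* _ _))
    where
    cell : ∀ x y → ∑ (suc Q) (λ c → G x y c * weight p x y c) * ∑ (suc Q) (λ _ → 1) ≡ ∑ (suc Q) (G x y) * ∑ (suc Q) (weight p x y)
    cell x y with on p x y | off p x y | free x y
    ... | true | _ | h = trans (cong₂ _*_ (∑-cong (suc Q) (λ c → trans (cong (_* 𝟙 (isZero c)) (h refl c)) (*-identityˡ _))) (≡-sym (∑-cong (suc Q) (h refl)))) (*-comm _ (∑ (suc Q) (G x y)))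
    ... | false | true | h = trans (cong₂ _*_ (∑-cong (suc Q) (λ c → trans (cong (_* 𝟙 (not (isZero c))) (h refl c)) (*-identityˡ _))) (≡-sym (∑-cong (suc Q) (h refl)))) (*-comm _ (∑ (suc Q) (G x y)))
    ... | false | false | h = cong₂ _*_ (∑-cong (suc Q) {λ c → G x y c * 1} {G x y} (λ c → *-identityʳ (G x y c))) refl

  misses : List Pattern → ℕ
  misses []       = 1
  misses (p ∷ ps) = (total ∸ mean (weight p)) * misses ps

  data Disjoint : List Pattern → Set where
    []  : Disjoint []
    _∷_ : ∀ {p ps} → (∀ {p′} → p′ ∈ ps → ∀ x y → support p x y ≡ true → support p′ x y ≡ true → ⊥) → Disjoint ps → Disjoint (p ∷ ps)

  mean-weight≤ : ∀ p → mean (weight p) ≤ total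
  mean-weight≤ p = ∏-mono N (λ x → ∏-mono N (λ y → ∑-mono (suc Q) (weight≤1 p x y)))

  -- The weight `G` makes the induction possible. Expanding `1 - sat p` leaves the same sum without
  -- `p`, minus the one in which `p` is imposed through `G`. The second sum is carried to the other
  -- side to avoid subtraction, and disjointness keeps the new `G` trivial on later supports.
  none-mean : ∀ ps G → Disjoint ps → (∀ {p} → p ∈ ps → Free G p) →
    ∑ᴸ coins (λ k → prod G k * none ps k) * total ^ length ps ≡ mean G * misses ps
  none-mean [] G _ _ = trans (*-identityʳ _) (trans (∑ᴸ-cong coins (λ k → *-identityʳ _)) (trans (∑-prod G) (≡-sym (*-identityʳ _))))
  none-mean (p ∷ ps) G (dis ∷ disjoint) free = +-cancelʳ-≡ (mean G * mean (weight p) * misses ps) _ _ (begin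
    e * (total * Tˡ) + mean G * mean (weight p) * misses ps
      ≡⟨ cong (e * (total * Tˡ) +_) (trans (cong (_* misses ps) (≡-sym (independent G p (free (here refl)))))
           (solve 3 (λ a t m → a :* t :* m := t :* (a :* m)) refl (mean (G ⊙ weight p)) total (misses ps))) ⟩
    e * (total * Tˡ) + total * (mean (G ⊙ weight p) * misses ps)
      ≡⟨ cong (λ z → e * (total * Tˡ) + total * z) (≡-sym (none-mean ps (G ⊙ weight p) disjoint free′)) ⟩
    e * (total * Tˡ) + total * (e₁ * Tˡ)
      ≡⟨ solve 4 (λ e t x f → e :* (t :* x) :+ t :* (f :* x) := t :* ((e :+ f) :* x)) refl e total Tˡ e₁ ⟩
    total * ((e + e₁) * Tˡ)
      ≡⟨ cong (λ z → total * (z * Tˡ)) split ⟩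
    total * (e₀ * Tˡ)
      ≡⟨ cong (total *_) (none-mean ps G disjoint (λ q → free (there q))) ⟩
    total * (mean G * misses ps)
      ≡⟨ cong (_* (mean G * misses ps)) (≡-sym (m∸n+n≡m (mean-weight≤ p))) ⟩
    (total ∸ mean (weight p) + mean (weight p)) * (mean G * misses ps)
      ≡⟨ solve 4 (λ a b g m → (a :+ b) :* (g :* m) := g :* (a :* m) :+ g :* b :* m) refl (total ∸ mean (weight p)) (mean (weight p)) (mean G) (misses ps) ⟩
    mean G * ((total ∸ mean (weight p)) * misses ps) + mean G * mean (weight p) * misses ps ∎)
    where
    open ≡-Reasoning
    Tˡ e e₀ e₁ : ℕ
    Tˡ = total ^ length ps
    e = ∑ᴸ coins (λ k → prod G k * none (p ∷ ps) k)
    e₀ = ∑ᴸ coins (λ k → prod G k * none ps k)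
    e₁ = ∑ᴸ coins (λ k → prod (G ⊙ weight p) k * none ps k)
    split : e + e₁ ≡ e₀
    split = trans (≡-sym (∑ᴸ-+ coins _ _)) (∑ᴸ-cong coins (λ k → trans (cong (λ z → prod G k * ((1 ∸ sat p k) * none ps k) + z * none ps k) (∏∏-* _ _))
      (trans (solve 4 (λ g a n b → g :* (a :* n) :+ g :* b :* n := g :* ((a :+ b) :* n)) refl (prod G k) (1 ∸ sat p k) (none ps k) (sat p k))
        (cong (λ z → prod G k * z) (trans (cong (_* none ps k) (m∸n+n≡m (sat≤1 p k))) (*-identityˡ _))))))
    free′ : ∀ {p′} → p′ ∈ ps → Free (G ⊙ weight p) p′
    free′ {p′} q x y h c = trans (cong₂ _*_ (free (there q) x y h c) (blank x y (dis q x y) h c)) refl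
      where
      blank : ∀ x y → (support p x y ≡ true → support p′ x y ≡ true → ⊥) → support p′ x y ≡ true → ∀ c → weight p x y c ≡ 1
      blank x y no-overlap h c with on p x y | off p x y
      ... | true  | _     = ⊥-elim (no-overlap refl h)
      ... | false | true  = ⊥-elim (no-overlap refl h)
      ... | false | false = refl

  count∑ : (Fin N → Fin N → Bool) → ℕ
  count∑ b = ∑ N (λ x → ∑ N (λ y → 𝟙 (b x y)))

  -- Coins required to be off are almost free: as many as `Q` of them together cost a factor 4,
  -- whereas each coin required to be on costs `Q+1`. For this reason `Q` must dominate the number
  -- of related pairs.
  likely : ∀ p e → count∑ (off p) ≤ Q → count∑ (on p) ≤ e → total ≤ 4 * suc Q ^ e * mean (weight p)
  likely p e few-off few-on = *-cancelˡ-≤′ (Q ^ f) (^-pos Q f 1≤Q) (begin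
    Q ^ f * total
      ≡⟨ trans (cong (_* total) (∏∏-^ Q (off p))) (≡-sym (∏∏-* _ _)) ⟩
    ∏ N (λ x → ∏ N (λ y → Q ^ 𝟙 (off p x y) * ∑ (suc Q) (λ _ → 1)))
      ≤⟨ ∏-mono N (λ x → ∏-mono N (λ y → cell x y)) ⟩
    ∏ N (λ x → ∏ N (λ y → suc Q ^ 𝟙 (off p x y) * (suc Q ^ 𝟙 (on p x y) * ∑ (suc Q) (weight p x y))))
      ≡⟨ trans (∏∏-* _ _) (cong₂ _*_ (≡-sym (∏∏-^ (suc Q) (off p))) (trans (∏∏-* _ _) (cong (_* mean (weight p)) (≡-sym (∏∏-^ (suc Q) (on p)))))) ⟩
    suc Q ^ f * (suc Q ^ count∑ (on p) * mean (weight p))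
      ≤⟨ *-mono-≤ ([1+1/y]^n≤4 Q f few-off) (*-monoˡ-≤ (mean (weight p)) (^-monoʳ-≤ (suc Q) few-on)) ⟩
    4 * Q ^ f * (suc Q ^ e * mean (weight p))
      ≡⟨ solve 3 (λ q z m → con 4 :* q :* (z :* m) := q :* (con 4 :* z :* m)) refl (Q ^ f) (suc Q ^ e) (mean (weight p)) ⟩
    Q ^ f * (4 * suc Q ^ e * mean (weight p)) ∎)
    where
    open ≤-Reasoning
    f : ℕ
    f = count∑ (off p)
    ∏∏-^ : ∀ q (b : Fin N → Fin N → Bool) → q ^ count∑ b ≡ ∏ N (λ x → ∏ N (λ y → q ^ 𝟙 (b x y)))
    ∏∏-^ q b = trans (≡-sym (∏-^ N q _)) (∏-cong N (λ x → ≡-sym (∏-^ N q _)))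
    zeros : ∑ (suc Q) (λ c → 𝟙 (isZero c)) ≡ 1
    zeros = trans (∑-suc Q (λ c → 𝟙 (isZero c))) (cong suc (∑-zero Q {λ c → 𝟙 (isZero (suc c))} (λ _ → refl)))
    nonzeros : ∑ (suc Q) (λ c → 𝟙 (not (isZero c))) ≡ Q
    nonzeros = trans (∑-suc Q (λ c → 𝟙 (not (isZero c)))) (∑-1 Q)
    cell : ∀ x y → Q ^ 𝟙 (off p x y) * ∑ (suc Q) (λ _ → 1) ≤ suc Q ^ 𝟙 (off p x y) * (suc Q ^ 𝟙 (on p x y) * ∑ (suc Q) (weight p x y))
    cell x y with on p x y | off p x y
    ... | true  | o     = *-mono-≤ (^-mono (𝟙 o) (n≤1+n Q)) (≤-reflexive (trans (∑-1 (suc Q)) (≡-sym (trans (cong₂ _*_ (*-identityʳ (suc Q)) zeros) (*-identityʳ (suc Q))))))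
    ... | false | true  = ≤-reflexive (trans (cong₂ _*_ (*-identityʳ Q) (∑-1 (suc Q))) (trans (*-comm Q (suc Q)) (≡-sym (cong₂ _*_ (*-identityʳ (suc Q)) (trans (*-identityˡ _) nonzeros)))))
    ... | false | false = ≤-reflexive (cong (1 *_) (≡-sym (*-identityˡ _)))

  none-unlikely : ∀ ps e q → Disjoint ps → (∀ {p} → p ∈ ps → count∑ (off p) ≤ Q × count∑ (on p) ≤ e) →
    q * (4 * suc Q ^ e) ≤ length ps → 2 ^ q * ∑ᴸ coins (none ps) ≤ total
  none-unlikely ps e q disjoint small enough = *-cancelʳ-≤′ (total ^ ℓ * Y ^ ℓ) (*-mono-≤ (^-pos total ℓ 1≤total) (^-pos Y ℓ 1≤Y)) (begin
    2 ^ q * Z * (total ^ ℓ * Y ^ ℓ)       ≡⟨ solve 4 (λ q z t y → q :* z :* (t :* y) := q :* (z :* t :* y)) refl (2 ^ q) Z (total ^ ℓ) (Y ^ ℓ) ⟩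
    2 ^ q * (Z * total ^ ℓ * Y ^ ℓ)       ≡⟨ cong (λ z → 2 ^ q * (z * Y ^ ℓ)) eq ⟩
    2 ^ q * (total * misses ps * Y ^ ℓ)   ≡⟨ solve 4 (λ q t m y → q :* (t :* m :* y) := t :* (q :* (m :* y))) refl (2 ^ q) total (misses ps) (Y ^ ℓ) ⟩
    total * (2 ^ q * (misses ps * Y ^ ℓ)) ≤⟨ *-monoʳ-≤ total (*-monoʳ-≤ (2 ^ q) (bound ps small)) ⟩
    total * (2 ^ q * (y ^ ℓ * total ^ ℓ)) ≡⟨ solve 4 (λ t q y x → t :* (q :* (y :* x)) := t :* (x :* (q :* y))) refl total (2 ^ q) (y ^ ℓ) (total ^ ℓ) ⟩
    total * (total ^ ℓ * (2 ^ q * y ^ ℓ)) ≤⟨ *-monoʳ-≤ total (*-monoʳ-≤ (total ^ ℓ) (≤-trans (2^q*y^n≤z^n y q ℓ (≤-trans (≤-reflexive (cong (q *_) (≡-sym Y≡))) enough)) (≤-reflexive (cong (_^ ℓ) (≡-sym Y≡))))) ⟩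
    total * (total ^ ℓ * Y ^ ℓ) ∎)
    where
    open ≤-Reasoning
    ℓ Y y Z : ℕ
    ℓ = length ps
    Y = 4 * suc Q ^ e
    y = pred Y
    Z = ∑ᴸ coins (none ps)
    1≤Y : 1 ≤ Y
    1≤Y = *-mono-≤ {1} {4} (s≤s z≤n) (^-pos (suc Q) e (s≤s z≤n))
    Y≡ : Y ≡ suc y
    Y≡ with Y | 1≤Y
    ... | suc _ | _ = refl
    1≤total : 1 ≤ total
    1≤total = ≤-trans (≤-reflexive (≡-sym (trans (∏-cong N (λ _ → trans (∏-const N 1) (^-zeroˡ N))) (trans (∏-const N 1) (^-zeroˡ N)))))
      (∏-mono N (λ x → ∏-mono N (λ y → ≤-trans (s≤s z≤n) (≤-reflexive (≡-sym (∑-1 (suc Q)))))))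
    eq : Z * total ^ ℓ ≡ total * misses ps
    eq = trans (cong (_* total ^ ℓ) (∑ᴸ-cong coins (λ k → ≡-sym (trans (cong (_* none ps k) ∏∏-1) (*-identityˡ _))))) (none-mean ps unit disjoint (λ _ _ _ _ _ → refl))
      where
      ∏∏-1 : ∏ N (λ x → ∏ N (λ y → 1)) ≡ 1
      ∏∏-1 = trans (∏-cong N (λ _ → trans (∏-const N 1) (^-zeroˡ N))) (trans (∏-const N 1) (^-zeroˡ N))
    bound : ∀ ps → (∀ {p} → p ∈ ps → count∑ (off p) ≤ Q × count∑ (on p) ≤ e) → misses ps * Y ^ length ps ≤ y ^ length ps * total ^ length ps
    bound []       _     = ≤-refl
    bound (p ∷ ps) small = begin
      (total ∸ pr) * misses ps * (Y * Y ^ length ps)      ≡⟨ *-interchange (total ∸ pr) (misses ps) Y (Y ^ length ps) ⟩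
      ((total ∸ pr) * Y) * (misses ps * Y ^ length ps)    ≤⟨ *-mono-≤ one (bound ps (λ q → small (there q))) ⟩
      (y * total) * (y ^ length ps * total ^ length ps)   ≡⟨ *-interchange y total (y ^ length ps) (total ^ length ps) ⟩
      (y * y ^ length ps) * (total * total ^ length ps) ∎
      where
      pr : ℕ
      pr = mean (weight p)
      one : (total ∸ pr) * Y ≤ y * total
      one = begin
        (total ∸ pr) * Y          ≡⟨ *-distribʳ-∸ Y total pr ⟩
        total * Y ∸ pr * Y        ≤⟨ ∸-monoʳ-≤ (total * Y) (≤-trans (likely p e (proj₁ (small (here refl))) (proj₂ (small (here refl)))) (≤-reflexive (*-comm Y pr))) ⟩
        total * Y ∸ total         ≡⟨ cong (λ z → total * z ∸ total) Y≡ ⟩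
        total * suc y ∸ total     ≡⟨ cong (_∸ total) (*-suc total y) ⟩
        total + total * y ∸ total ≡⟨ m+n∸m≡n total (total * y) ⟩
        total * y                 ≡⟨ *-comm total y ⟩
        y * total ∎

  none≡0⇒ : ∀ ps k → none ps k ≡ 0 → ∃[ p ] (p ∈ ps × 1 ≤ sat p k)
  none≡0⇒ (p ∷ ps) k h with 1 ≤? sat p k
  ... | yes q = p , here refl , q
  ... | no ¬q with none≡0⇒ ps k (trans (≡-sym (trans (cong (λ z → (1 ∸ z) * none ps k) (n<1⇒n≡0 (≰⇒> ¬q))) (*-identityˡ _))) h)
  ...   | p′ , q , r = p′ , there q , r

  sat-on : ∀ p k → 1 ≤ sat p k → ∀ x y → on p x y ≡ true → isZero (lookup (lookup k x) y) ≡ true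
  sat-on p k h x y o with ∏-pos N _ (∏-pos N _ h x) y
  ... | q rewrite o = pos⇒true _ q

  sat-off : ∀ p k → 1 ≤ sat p k → ∀ x y → on p x y ≡ false → off p x y ≡ true → isZero (lookup (lookup k x) y) ≡ false
  sat-off p k h x y o o′ with ∏-pos N _ (∏-pos N _ h x) y
  ... | q rewrite o | o′ with isZero (lookup (lookup k x) y) | q
  ...   | false | _ = refl

-- Coins that save a copy of K_s in every set of `m` vertices

data Separated {n} (conflict : Fin n → Fin n → Bool) : List (Fin n) → Set where
  []  : Separated conflict []
  _∷_ : ∀ {i is} → (∀ {j} → j ∈ is → conflict i j ≡ false) → Separated conflict is → Separated conflict (i ∷ is)

-- Each round discards the conflicts of the chosen index, at most `Δ` candidates. The budget of
-- `suc Δ` per round also ensures that the next round has a candidate.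
greedy : ∀ {n} (conflict : Fin n → Fin n → Bool) Δ k (C : Mask n) →
  (∀ i → C i ≡ true → ∑ n (λ j → 𝟙 (C j ∧ conflict i j)) ≤ Δ) → k * suc Δ ≤ card C →
  ∃[ is ] (length is ≡ k × Separated conflict is × (∀ {i} → i ∈ is → C i ≡ true))
greedy conflict Δ zero C deg enough = [] , refl , [] , λ ()
greedy {n} conflict Δ (suc k) C deg enough = pick (∑ᴸ-pos⇒∃ (allFin n) (≤-trans (s≤s z≤n) enough))
  where
  pick : ∃[ i ] (1 ≤ 𝟙 (C i)) → ∃[ is ] (length is ≡ suc k × Separated conflict is × (∀ {i} → i ∈ is → C i ≡ true))
  pick (i , p) = extend (greedy conflict Δ k C′ deg′ enough′)
    where
    i∈ : C i ≡ true
    i∈ = pos⇒true _ p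
    C′ : Mask n
    C′ j = C j ∧ not (conflict i j)
    weaker : ∀ j c → 𝟙 ((C j ∧ not (conflict i j)) ∧ c) ≤ 𝟙 (C j ∧ c)
    weaker j c with C j | conflict i j
    ... | true  | true  = z≤n
    ... | true  | false = ≤-refl
    ... | false | _     = z≤n
    deg′ : ∀ j → C′ j ≡ true → ∑ n (λ l → 𝟙 (C′ l ∧ conflict j l)) ≤ Δ
    deg′ j h = ≤-trans (∑-mono n (λ l → weaker l (conflict j l))) (deg j (∧-elimˡ h))
    enough′ : k * suc Δ ≤ card C′
    enough′ = +-cancelˡ-≤ Δ _ _ (≤-trans (≤-trans (n≤1+n _) enough) (≤-trans (≤-reflexive (trans (∑-cong n (λ j → split (C j) (conflict i j))) (∑ᴸ-+ (allFin n) _ _))) (+-monoˡ-≤ (card C′) (deg i i∈))))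
      where
      split : ∀ a b → 𝟙 a ≡ 𝟙 (a ∧ b) + 𝟙 (a ∧ not b)
      split true  true  = refl
      split true  false = refl
      split false _     = refl
    extend : ∃[ is ] (length is ≡ k × Separated conflict is × (∀ {j} → j ∈ is → C′ j ≡ true)) →
      ∃[ is ] (length is ≡ suc k × Separated conflict is × (∀ {i} → i ∈ is → C i ≡ true))
    extend (is , len , sep , sub) = i ∷ is , cong suc len , ((λ {j} q → apart j (sub q)) ∷ sep) , λ { (here refl) → i∈ ; (there q) → ∧-elimˡ (sub q) }
      where
      apart : ∀ j → C′ j ≡ true → conflict i j ≡ false
      apart j h with conflict i j | ∧-elimʳ (C j) h
      ... | false | _ = refl

module Selection (N M s m Q k q L h : ℕ) (1≤Q : 1 ≤ Q)
  (rel : (u v x y : Fin N) → Bool) (rel-sym : ∀ u v x y → rel u v x y ≡ rel x y u v)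
  (degree : ∀ u v → ∑ N (λ x → ∑ N (λ y → 𝟙 (rel u v x y))) ≤ h)
  (1≤N : 1 ≤ N) (σ≤Q : s * s * suc h ≤ Q) (k-ok : k * suc (s * s * suc h * suc h) ≤ L) (q-ok : q * (4 * suc Q ^ (s * s)) ≤ k) (N-ok : 8 * N ^ m ≤ 2 ^ q)
  where

  open Coins N Q 1≤Q

  private
    d σ : ℕ
    d = suc h
    σ = s * s * d

  On : Coin → Fin N → Fin N → Set
  On κ u v = isZero (lookup (lookup κ u) v) ≡ true

  record Packing (C : Mask M) : Set where
    field
      τ        : ∀ i → C i ≡ true → Vec (Fin N) s
      distinct : ∀ i e a b → a ≢ b → lookup (τ i e) a ≢ lookup (τ i e) b
      owner    : ∀ i e j e′ a b a′ b′ → a ≢ b → lookup (τ i e) a ≡ lookup (τ j e′) a′ → lookup (τ i e) b ≡ lookup (τ j e′) b′ → i ≡ j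

  record Outcome {C : Mask M} (pk : Packing C) (κ : Coin) : Set where
    open Packing pk
    field
      i  : Fin M
      i∈ : C i ≡ true
      pairs-on    : ∀ a b → a ≢ b → On κ (lookup (τ i i∈) a) (lookup (τ i i∈) b)
      related-off : ∀ a b → a ≢ b → ∀ x y → rel (lookup (τ i i∈) a) (lookup (τ i i∈) b) x y ≡ true →
        On κ x y → ∃[ a′ ] ∃[ b′ ] (a′ ≢ b′ × x ≡ lookup (τ i i∈) a′ × y ≡ lookup (τ i i∈) b′)

  touch : (u v x y : Fin N) → ℕ
  touch u v x y = 𝟙 (x == u) * 𝟙 (y == v) + 𝟙 (rel u v x y)

  ∑-single : ∀ u v → ∑ N (λ x → ∑ N (λ y → 𝟙 (x == u) * 𝟙 (y == v))) ≡ 1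
  ∑-single u v = trans (∑-cong N (λ x → trans (∑ᴸ-* (allFin N) (𝟙 (x == u)) _) (cong (𝟙 (x == u) *_) (trans (∑-cong N (λ y → ≡-sym (*-identityʳ _))) (∑-δ v (λ _ → 1)))))) (∑-δ u (λ _ → 1))

  ∑-touch : ∀ u v → ∑ N (λ x → ∑ N (touch u v x)) ≤ d
  ∑-touch u v = ≤-trans (≤-reflexive (trans (∑-cong N (λ x → ∑ᴸ-+ (allFin N) _ _)) (∑ᴸ-+ (allFin N) _ _))) (+-mono-≤ (≤-reflexive (∑-single u v)) (degree u v))

  touch-sym : ∀ u v x y → touch u v x y ≡ touch x y u v
  touch-sym u v x y = cong₂ _+_ (cong₂ (λ a b → 𝟙 a * 𝟙 b) (==-sym x u) (==-sym y v)) (cong 𝟙 (rel-sym u v x y))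

  pairOf : Vec (Fin N) s → Fin N → Fin N → ℕ
  pairOf τ u v = ∑ s (λ a → ∑ s (λ b → 𝟙 (not (a == b)) * (𝟙 (u == lookup τ a) * 𝟙 (v == lookup τ b))))

  pairOf⇒ : ∀ τ u v → 1 ≤ pairOf τ u v → ∃[ a ] ∃[ b ] (a ≢ b × u ≡ lookup τ a × v ≡ lookup τ b)
  pairOf⇒ τ u v h with ∑ᴸ-pos⇒∃ (allFin s) h
  ... | a , h′ with ∑ᴸ-pos⇒∃ (allFin s) h′
  ...   | b , p with a ≟ᶠ b | u ≟ᶠ lookup τ a | v ≟ᶠ lookup τ b
  ...     | no a≢b | yes p₁ | yes p₂ = a , b , a≢b , p₁ , p₂

  ⇒pairOf : ∀ τ a b → a ≢ b → 1 ≤ pairOf τ (lookup τ a) (lookup τ b)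
  ⇒pairOf τ a b a≢b = ≤-trans (≤-trans (≤-reflexive (≡-sym value)) (∑-term s (term a) b)) (∑-term s (λ a → ∑ s (term a)) a)
    where
    term : Fin s → Fin s → ℕ
    term a′ b′ = 𝟙 (not (a′ == b′)) * (𝟙 (lookup τ a == lookup τ a′) * 𝟙 (lookup τ b == lookup τ b′))
    value : term a b ≡ 1
    value = cong₂ (λ x y → 𝟙 (not x) * y) (≢⇒== a≢b) (cong₂ (λ x y → 𝟙 x * 𝟙 y) (==-refl (lookup τ a)) (==-refl (lookup τ b)))

  pairOf≤1 : ∀ τ → (∀ a b → a ≢ b → lookup τ a ≢ lookup τ b) → ∀ u v → pairOf τ u v ≤ 1
  pairOf≤1 τ distinct u v = begin
    pairOf τ u v                                                         ≤⟨ ∑-mono s (λ a → ∑-mono s (λ b → ≤-trans (*-monoˡ-≤ _ (𝟙≤1 (not (a == b)))) (≤-reflexive (*-identityˡ _)))) ⟩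
    ∑ s (λ a → ∑ s (λ b → 𝟙 (u == lookup τ a) * 𝟙 (v == lookup τ b)))    ≡⟨ trans (∑-cong s (λ a → ∑ᴸ-* (allFin s) (𝟙 (u == lookup τ a)) _)) (∑ᴸ-*ʳ (allFin s) _ _) ⟩
    ∑ s (λ a → 𝟙 (u == lookup τ a)) * ∑ s (λ b → 𝟙 (v == lookup τ b))    ≤⟨ *-mono-≤ (once u) (once v) ⟩
    1 ∎
    where
    open ≤-Reasoning
    once : ∀ w → ∑ s (λ a → 𝟙 (w == lookup τ a)) ≤ 1
    once w = ∑-unique≤1 s _ λ a b p p′ → same a b p p′
      where
      same : ∀ a b → (w == lookup τ a) ≡ true → (w == lookup τ b) ≡ true → a ≡ b
      same a b p p′ with a ≟ᶠ b
      ... | yes h = h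
      ... | no a≢b = ⊥-elim (distinct a b a≢b (trans (≡-sym (==⇒≡ w _ p)) (==⇒≡ w _ p′)))

  ∑-pairOf : ∀ τ → ∑ N (λ u → ∑ N (pairOf τ u)) ≤ s * s
  ∑-pairOf τ = begin
    ∑ N (λ u → ∑ N (λ v → ∑ s (λ a → ∑ s (λ b → 𝟙 (not (a == b)) * (𝟙 (u == lookup τ a) * 𝟙 (v == lookup τ b))))))
      ≤⟨ ∑-mono N (λ u → ∑-mono N (λ v → ∑-mono s (λ a → ∑-mono s (λ b → ≤-trans (*-monoˡ-≤ _ (𝟙≤1 (not (a == b)))) (≤-reflexive (*-identityˡ _)))))) ⟩
    ∑ N (λ u → ∑ N (λ v → ∑ s (λ a → ∑ s (λ b → 𝟙 (u == lookup τ a) * 𝟙 (v == lookup τ b)))))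
      ≡⟨ trans (∑-cong N (λ u → trans (∑ᴸ-swap (allFin N) (allFin s) _) (∑-cong s (λ a → ∑ᴸ-swap (allFin N) (allFin s) _)))) (trans (∑ᴸ-swap (allFin N) (allFin s) _) (∑-cong s (λ a → ∑ᴸ-swap (allFin N) (allFin s) _))) ⟩
    ∑ s (λ a → ∑ s (λ b → ∑ N (λ u → ∑ N (λ v → 𝟙 (u == lookup τ a) * 𝟙 (v == lookup τ b)))))
      ≡⟨ ∑-cong s (λ a → ∑-cong s (λ b → ∑-single (lookup τ a) (lookup τ b))) ⟩
    ∑ s (λ a → ∑ s (λ b → 1))   ≡⟨ trans (∑-cong s (λ _ → ∑-1 s)) (∑-const s s) ⟩
    s * s ∎
    where open ≤-Reasoning

  module For (C : Mask M) (pk : Packing C) where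

    open Packing pk

    -- The value of `C i` travels together with its equation, because `τ` takes a proof of
    -- membership as an argument.
    at : ∀ i b → C i ≡ b → Fin N → Fin N → ℕ
    at i true  e = pairOf (τ i e)
    at i false e = λ _ _ → 0

    pairC : Fin M → Fin N → Fin N → ℕ
    pairC i = at i (C i) refl

    view : ∀ i → (∃[ e ] (pairC i ≡ pairOf (τ i e))) ⊎ (pairC i ≡ λ _ _ → 0)
    view i = go (C i) refl
      where
      go : ∀ b (e : C i ≡ b) → (∃[ e′ ] (at i b e ≡ pairOf (τ i e′))) ⊎ (at i b e ≡ λ _ _ → 0)
      go true  e = inj₁ (e , refl)
      go false e = inj₂ refl

    cleanAt : ∀ i → C i ≡ true → ∃[ e ] (pairC i ≡ pairOf (τ i e))
    cleanAt i e = go (C i) refl e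
      where
      go : ∀ b (e : C i ≡ b) → b ≡ true → ∃[ e′ ] (at i b e ≡ pairOf (τ i e′))
      go true e refl = e , refl

    pairC≤1 : ∀ i u v → pairC i u v ≤ 1
    pairC≤1 i u v with pairC i | view i
    ... | _ | inj₁ (e , refl) = pairOf≤1 (τ i e) (distinct i e) u v
    ... | _ | inj₂ refl       = z≤n

    ∑-pairC : ∀ i → ∑ N (λ u → ∑ N (pairC i u)) ≤ s * s
    ∑-pairC i with pairC i | view i
    ... | _ | inj₁ (e , refl) = ∑-pairOf (τ i e)
    ... | _ | inj₂ refl       = ≤-trans (≤-reflexive (∑-zero N (λ _ → ∑-zero N (λ _ → refl)))) z≤n

    pairC⇒ : ∀ i u v → 1 ≤ pairC i u v → ∃[ e ] ∃[ a ] ∃[ b ] (a ≢ b × u ≡ lookup (τ i e) a × v ≡ lookup (τ i e) b)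
    pairC⇒ i u v h with pairC i | view i
    ... | _ | inj₁ (e , refl) = e , pairOf⇒ (τ i e) u v h
    ... | _ | inj₂ refl with () ← h

    unique-owner : ∀ u v → ∑ M (λ i → pairC i u v) ≤ 1
    unique-owner u v = ≤-trans (∑-mono M (λ i → small (pairC i u v) (pairC≤1 i u v))) (∑-unique≤1 M (λ i → 1 ≤ᵇ pairC i u v) same)
      where
      small : ∀ k → k ≤ 1 → k ≤ 𝟙 (1 ≤ᵇ k)
      small 0 _ = z≤n
      small 1 _ = ≤-refl
      small (suc (suc _)) (s≤s ())
      same : ∀ i j → (1 ≤ᵇ pairC i u v) ≡ true → (1 ≤ᵇ pairC j u v) ≡ true → i ≡ j
      same i j p p′ with pairC⇒ i u v (≤ᵇ⇒≤ 1 _ (subst T (≡-sym p) _)) | pairC⇒ j u v (≤ᵇ⇒≤ 1 _ (subst T (≡-sym p′) _))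
      ... | e , a , b , a≢b , eq₁ , eq₂ | e′ , a′ , b′ , _ , eq₃ , eq₄ = owner i e j e′ a b a′ b′ a≢b (trans (≡-sym eq₁) eq₃) (trans (≡-sym eq₂) eq₄)

    reach : Fin M → Fin N → Fin N → ℕ
    reach i x y = ∑ N (λ u → ∑ N (λ v → pairC i u v * touch u v x y))

    ∑-reach : ∀ i → ∑ N (λ x → ∑ N (reach i x)) ≤ σ
    ∑-reach i = begin
      ∑ N (λ x → ∑ N (λ y → ∑ N (λ u → ∑ N (λ v → pairC i u v * touch u v x y))))
        ≡⟨ trans (∑-cong N (λ x → trans (∑ᴸ-swap (allFin N) (allFin N) _) (∑-cong N (λ u → ∑ᴸ-swap (allFin N) (allFin N) _)))) (trans (∑ᴸ-swap (allFin N) (allFin N) _) (∑-cong N (λ u → ∑ᴸ-swap (allFin N) (allFin N) _))) ⟩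
      ∑ N (λ u → ∑ N (λ v → ∑ N (λ x → ∑ N (λ y → pairC i u v * touch u v x y))))
        ≡⟨ ∑-cong N (λ u → ∑-cong N (λ v → trans (∑-cong N (λ x → ∑ᴸ-* (allFin N) (pairC i u v) _)) (∑ᴸ-* (allFin N) (pairC i u v) _))) ⟩
      ∑ N (λ u → ∑ N (λ v → pairC i u v * ∑ N (λ x → ∑ N (touch u v x))))
        ≤⟨ ∑-mono N (λ u → ∑-mono N (λ v → *-monoʳ-≤ (pairC i u v) (∑-touch u v))) ⟩
      ∑ N (λ u → ∑ N (λ v → pairC i u v * d))     ≡⟨ trans (∑-cong N (λ u → ∑ᴸ-*ʳ (allFin N) _ d)) (∑ᴸ-*ʳ (allFin N) _ d) ⟩
      ∑ N (λ u → ∑ N (pairC i u)) * d             ≤⟨ *-monoˡ-≤ d (∑-pairC i) ⟩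
      σ ∎
      where open ≤-Reasoning

    -- A pair belongs to at most one of the tuples, so the sum over tuples is at most a sum over all
    -- pairs that touch `(x , y)`; as the relation is symmetric, this is the degree of `(x , y)`.
    reached : ∀ x y → ∑ M (λ i → reach i x y) ≤ d
    reached x y = begin
      ∑ M (λ i → ∑ N (λ u → ∑ N (λ v → pairC i u v * touch u v x y)))
        ≡⟨ trans (∑ᴸ-swap (allFin M) (allFin N) _) (∑-cong N (λ u → trans (∑ᴸ-swap (allFin M) (allFin N) _) (∑-cong N (λ v → ∑ᴸ-*ʳ (allFin M) _ _)))) ⟩
      ∑ N (λ u → ∑ N (λ v → ∑ M (λ i → pairC i u v) * touch u v x y))
        ≤⟨ ∑-mono N (λ u → ∑-mono N (λ v → ≤-trans (*-monoˡ-≤ (touch u v x y) (unique-owner u v)) (≤-reflexive (trans (*-identityˡ _) (touch-sym u v x y))))) ⟩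
      ∑ N (λ u → ∑ N (touch x y u))   ≤⟨ ∑-touch x y ⟩
      d ∎
      where open ≤-Reasoning

    common : Fin M → Fin M → ℕ
    common i j = ∑ N (λ x → ∑ N (λ y → reach i x y * reach j x y))

    conflict : Fin M → Fin M → Bool
    conflict i j = 1 ≤ᵇ common i j

    -- Double counting through shared pairs: a tuple reaches at most `σ` pairs, and each of them is
    -- reached at most `d` times in all.
    conflicts≤ : ∀ i → C i ≡ true → ∑ M (λ j → 𝟙 (C j ∧ conflict i j)) ≤ σ * d
    conflicts≤ i _ = begin
      ∑ M (λ j → 𝟙 (C j ∧ conflict i j))          ≤⟨ ∑-mono M (λ j → small (C j) (common i j)) ⟩
      ∑ M (λ j → ∑ N (λ x → ∑ N (λ y → reach i x y * reach j x y)))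
        ≡⟨ trans (∑ᴸ-swap (allFin M) (allFin N) _) (∑-cong N (λ x → trans (∑ᴸ-swap (allFin M) (allFin N) _) (∑-cong N (λ y → ∑ᴸ-* (allFin M) (reach i x y) _)))) ⟩
      ∑ N (λ x → ∑ N (λ y → reach i x y * ∑ M (λ j → reach j x y)))   ≤⟨ ∑-mono N (λ x → ∑-mono N (λ y → *-monoʳ-≤ (reach i x y) (reached x y))) ⟩
      ∑ N (λ x → ∑ N (λ y → reach i x y * d))     ≡⟨ trans (∑-cong N (λ u → ∑ᴸ-*ʳ (allFin N) _ d)) (∑ᴸ-*ʳ (allFin N) _ d) ⟩
      ∑ N (λ x → ∑ N (reach i x)) * d             ≤⟨ *-monoˡ-≤ d (∑-reach i) ⟩
      σ * d ∎
      where
      open ≤-Reasoning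
      small : ∀ b k → 𝟙 (b ∧ (1 ≤ᵇ k)) ≤ k
      small true  zero    = z≤n
      small true  (suc k) = s≤s z≤n
      small false k       = z≤n

    -- Pairs inside one tuple may be related to each other and must nevertheless be on, so they are
    -- excepted from `off`.
    pattern′ : Fin M → Pattern
    pattern′ i = record { on = λ x y → 1 ≤ᵇ pairC i x y ; off = λ x y → not (1 ≤ᵇ pairC i x y) ∧ (1 ≤ᵇ reach i x y) }

    𝟙-≤ : ∀ k → 𝟙 (1 ≤ᵇ k) ≤ k
    𝟙-≤ zero    = z≤n
    𝟙-≤ (suc k) = s≤s z≤n

    pattern-size : ∀ i → count∑ (off (pattern′ i)) ≤ Q × count∑ (on (pattern′ i)) ≤ s * s
    pattern-size i = ≤-trans (∑-mono N (λ x → ∑-mono N (λ y → ≤-trans (drop (not (1 ≤ᵇ pairC i x y)) _) (𝟙-≤ (reach i x y))))) (≤-trans (∑-reach i) σ≤Q) ,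
      ≤-trans (∑-mono N (λ x → ∑-mono N (λ y → 𝟙-≤ (pairC i x y)))) (∑-pairC i)
      where
      drop : ∀ a b → 𝟙 (a ∧ b) ≤ 𝟙 b
      drop true  b = ≤-refl
      drop false b = z≤n

    support⇒reach : ∀ i x y → support (pattern′ i) x y ≡ true → 1 ≤ reach i x y
    support⇒reach i x y h with 1 ≤ᵇ pairC i x y in eq
    ... | false = ≤ᵇ⇒≤ 1 _ (subst T (≡-sym h) _)
    ... | true  = ≤-trans (*-mono-≤ (≤ᵇ⇒≤ 1 (pairC i x y) (subst T (≡-sym eq) _)) (≤-trans (≤-reflexive (≡-sym (cong₂ (λ a b → 𝟙 a * 𝟙 b) (==-refl x) (==-refl y)))) (m≤m+n _ _)))
      (≤-trans (∑-term N (λ v → pairC i x v * touch x v x y) y) (∑-term N (λ u → ∑ N (λ v → pairC i u v * touch u v x y)) x))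

    separated⇒disjoint : ∀ {is} → Separated conflict is → Disjoint (map pattern′ is)
    separated⇒disjoint [] = []
    separated⇒disjoint (_∷_ {i} {is} apart sep) = (λ {p′} p∈ x y h h′ → clash x y h h′ (∈-map⁻ pattern′ p∈)) ∷ separated⇒disjoint sep
      where
      clash : ∀ x y {p′} → support (pattern′ i) x y ≡ true → support p′ x y ≡ true → ∃[ j ] (j ∈ is × p′ ≡ pattern′ j) → ⊥
      clash x y h h′ (j , j∈ , refl) = contra (trans (≡-sym (apart j∈)) (≤ᵇ-true positive))
        where
        contra : false ≡ true → ⊥
        contra ()
        positive : 1 ≤ common i j
        positive = ≤-trans (*-mono-≤ (support⇒reach i x y h) (support⇒reach j x y h′))
          (≤-trans (∑-term N (λ y → reach i x y * reach j x y) y) (∑-term N (λ x → ∑ N (λ y → reach i x y * reach j x y)) x))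

    satisfied : ∀ κ i e → pairC i ≡ pairOf (τ i e) → 1 ≤ sat (pattern′ i) κ → Outcome pk κ
    satisfied κ i e eq sat≥1 = record
      { i = i
      ; i∈ = e
      ; pairs-on = λ a b a≢b → sat-on (pattern′ i) κ sat≥1 (lookup (τ i e) a) (lookup (τ i e) b) (≤ᵇ-true (pair≥1 a b a≢b))
      ; related-off = λ a b a≢b x y r on-xy → owned a b a≢b x y r on-xy (1 ≤ᵇ pairC i x y) refl
      }
      where
      contra : true ≡ false → ⊥
      contra ()
      pair≥1 : ∀ a b → a ≢ b → 1 ≤ pairC i (lookup (τ i e) a) (lookup (τ i e) b)
      pair≥1 a b a≢b = subst (λ p → 1 ≤ p (lookup (τ i e) a) (lookup (τ i e) b)) (≡-sym eq) (⇒pairOf (τ i e) a b a≢b)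
      related : ∀ a b → a ≢ b → ∀ x y → rel (lookup (τ i e) a) (lookup (τ i e) b) x y ≡ true → 1 ≤ reach i x y
      related a b a≢b x y r = ≤-trans (*-mono-≤ (pair≥1 a b a≢b) (≤-trans (≤-reflexive (≡-sym (cong 𝟙 r))) (m≤n+m _ _)))
        (≤-trans (∑-term N (λ v → pairC i (lookup (τ i e) a) v * touch (lookup (τ i e) a) v x y) (lookup (τ i e) b)) (∑-term N (λ u → ∑ N (λ v → pairC i u v * touch u v x y)) (lookup (τ i e) a)))
      owned : ∀ a b → a ≢ b → ∀ x y → rel (lookup (τ i e) a) (lookup (τ i e) b) x y ≡ true → On κ x y → ∀ c → (1 ≤ᵇ pairC i x y) ≡ c →
        ∃[ a′ ] ∃[ b′ ] (a′ ≢ b′ × x ≡ lookup (τ i e) a′ × y ≡ lookup (τ i e) b′)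
      owned a b a≢b x y r on-xy true  on? = pairOf⇒ (τ i e) x y (subst (λ p → 1 ≤ p x y) eq (≤ᵇ⇒≤ 1 (pairC i x y) (subst T (≡-sym on?) _)))
      owned a b a≢b x y r on-xy false on? = ⊥-elim (contra (trans (≡-sym on-xy) (sat-off (pattern′ i) κ sat≥1 x y on? (cong₂ (λ p r → not p ∧ r) on? (≤ᵇ-true (related a b a≢b x y r))))))

    pattern-sizes : ∀ is {p} → p ∈ map pattern′ is → count∑ (off p) ≤ Q × count∑ (on p) ≤ s * s
    pattern-sizes is p∈ = at-index (∈-map⁻ pattern′ p∈)
      where
      at-index : ∀ {p} → ∃[ i ] (i ∈ is × p ≡ pattern′ i) → count∑ (off p) ≤ Q × count∑ (on p) ≤ s * s
      at-index (i , _ , refl) = pattern-size i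

    useful : ∀ is → (∀ {i} → i ∈ is → C i ≡ true) → ∀ κ p → p ∈ map pattern′ is → 1 ≤ sat p κ → Outcome pk κ
    useful is sub κ p p∈ h = at-index h (∈-map⁻ pattern′ p∈)
      where
      at-index : ∀ {p} → 1 ≤ sat p κ → ∃[ i ] (i ∈ is × p ≡ pattern′ i) → Outcome pk κ
      at-index h (i , i∈ , refl) = satisfied κ i (proj₁ (cleanAt i (sub i∈))) (proj₂ (cleanAt i (sub i∈))) h

    family : L ≤ card C → ∃[ ps ] (2 ^ q * ∑ᴸ coins (none ps) ≤ total × (∀ κ p → p ∈ ps → 1 ≤ sat p κ → Outcome pk κ))
    family enough = finish (greedy conflict (σ * d) k C conflicts≤ (≤-trans k-ok enough))
      where
      finish : ∃[ is ] (length is ≡ k × Separated conflict is × (∀ {i} → i ∈ is → C i ≡ true)) →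
        ∃[ ps ] (2 ^ q * ∑ᴸ coins (none ps) ≤ total × (∀ κ p → p ∈ ps → 1 ≤ sat p κ → Outcome pk κ))
      finish (is , len , sep , sub) = map pattern′ is ,
        none-unlikely (map pattern′ is) (s * s) q (separated⇒disjoint sep) (pattern-sizes is) (≤-trans q-ok (≤-reflexive (≡-sym (trans (length-map pattern′ is) len)))) ,
        useful is sub

  module _ (C : ∀ (S : Vec Bool N) → cardⱽ S ≡ m → Mask M) (enough : ∀ S p → L ≤ card (C S p)) (pk : ∀ S p → Packing (C S p)) where

    failing : (S : Vec Bool N) → Dec (cardⱽ S ≡ m) → Coin → ℕ
    failing S (yes p) κ = none (proj₁ (For.family (C S p) (pk S p) (enough S p))) κ
    failing S (no _)  κ = 0

    failing-rare : ∀ S e → 8 * ∑ᴸ coins (failing S e) * N ^ cardⱽ S ≤ total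
    failing-rare S (no _)  = ≤-trans (≤-reflexive (cong (λ z → 8 * z * N ^ cardⱽ S) (∑ᴸ-zero coins))) z≤n
    failing-rare S (yes p) = ≤-trans (≤-reflexive (trans (cong (λ j → 8 * Z * N ^ j) {cardⱽ S} {m} p) (solve 2 (λ z n → con 8 :* z :* n := (con 8 :* n) :* z) refl Z (N ^ m))))
      (≤-trans (*-monoˡ-≤ Z N-ok) (proj₁ (proj₂ (For.family (C S p) (pk S p) (enough S p)))))
      where
      Z : ℕ
      Z = ∑ᴸ coins (none (proj₁ (For.family (C S p) (pk S p) (enough S p))))

    bad : Coin → ℕ
    bad κ = ∑ᴸ (masks N) (λ S → failing S (cardⱽ S ≟ m) κ)

    bad<total : ∑ᴸ coins bad < ∑ᴸ coins (λ _ → 1)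
    bad<total = subst (∑ᴸ coins bad <_) (≡-sym total-coins) (*-cancelˡ-< 8 _ _ (begin-strict
      8 * ∑ᴸ coins bad
        ≡⟨ trans (cong (8 *_) (∑ᴸ-swap coins (masks N) _)) (≡-sym (∑ᴸ-* (masks N) 8 _)) ⟩
      ∑ᴸ (masks N) (λ S → 8 * ∑ᴸ coins (failing S (cardⱽ S ≟ m)))   ≤⟨ union-masks N 1≤N _ total (λ S → failing-rare S (cardⱽ S ≟ m)) ⟩
      4 * total                                                    <⟨ *-monoˡ-< total {{>-nonZero 1≤total}} {4} {8} (s≤s (s≤s (s≤s (s≤s (s≤s z≤n))))) ⟩
      8 * total ∎))
      where
      open ≤-Reasoning
      1≤total : 1 ≤ total
      1≤total = ≤-trans (≤-reflexive (≡-sym (trans (∏-cong N (λ _ → trans (∏-const N 1) (^-zeroˡ N))) (trans (∏-const N 1) (^-zeroˡ N)))))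
        (∏-mono N (λ x → ∏-mono N (λ y → ≤-trans (s≤s z≤n) (≤-reflexive (≡-sym (∑-1 (suc Q)))))))

    good-coin : ∃[ κ ] ∀ S (p : cardⱽ S ≡ m) → Outcome (pk S p) κ
    good-coin = proj₁ found , λ S p → at (proj₁ found) S p (cardⱽ S ≟ m) (∑≡0 {xs = masks N} (n<1⇒n≡0 (proj₂ found)) (masks-complete N S))
      where
      found : ∃[ κ ] (bad κ < 1)
      found = ∑ᴸ-<⇒∃ coins bad<total
      at : ∀ κ S (p : cardⱽ S ≡ m) e → failing S e κ ≡ 0 → Outcome (pk S p) κ
      at κ S p (no ¬p) _ = ⊥-elim (¬p p)
      at κ S p (yes p′) h = subst (λ p → Outcome (pk S p) κ) (≡-irrelevant p′ p) (use (none≡0⇒ (proj₁ F) κ h))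
        where
        F : ∃[ ps ] (2 ^ q * ∑ᴸ coins (none ps) ≤ total × (∀ κ p → p ∈ ps → 1 ≤ sat p κ → Outcome (pk S p′) κ))
        F = For.family (C S p′) (pk S p′) (enough S p′)
        use : ∃[ p ] (p ∈ proj₁ F × 1 ≤ sat p κ) → Outcome (pk S p′) κ
        use (p , p∈ , s≥1) = proj₂ (proj₂ F) κ p p∈ s≥1

-- The graph

Dense : ∀ {N} → Graph N → (s m : ℕ) → Set
Dense {N} G s m = ∀ S → cardⱽ S ≡ m → Σ (Fin s → Fin N) λ f → (∀ a b → f a ≡ f b → a ≡ b) ×
  (∀ a b → a ≢ b → adj G (f a) (f b) ≡ true) × (∀ a → lookup S (f a) ≡ true)

Witness : (s t N m : ℕ) → Set
Witness s t N m = Σ (Graph N) λ G → KFree G t × Dense G s m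

module Assembly (N M s P : ℕ) (s≤P : s ≤ P) (1≤P : 1 ≤ P) (ω : Vec (Vec (Fin P) N) M) (D μ δ : ℕ) where

  open Random N M s P s≤P 1≤P using (inc; isIn)
  open Good N M s P s≤P 1≤P using (Clean)
  open Configurations N M D μ δ (inc ω)

  module Kill (t u m H h₀ K Q k q L : ℕ)
    (μ+u : μ + u ≡ 2 * δ) (u≤δ : u ≤ δ) (δ≤D : δ ≤ D) (δ≤μ : δ ≤ μ) (1≤D : 1 ≤ D) (1≤μ : 1 ≤ μ)
    (s+2≤t : s + 2 ≤ t) (extremal : Extremal s t D δ u) (shortLines : ShortLines s t δ u)
    (sparse : ∀ c → card (proj₁ c) ≤ H → card (proj₂ c) ≤ H → h₀ ≤ incidences c → δ * incidences c + K < cost c)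
    (K≥ : 2 * D + μ ≤ K) (H≥ : (δ * h₀ + K) + (t + t * t) ≤ H)
    (clean : ∀ S → card S ≡ m → ∃[ C ] (L ≤ card C × (∀ i → C i ≡ true → Clean S ω i)))
    (1≤N : 1 ≤ N) (1≤Q : 1 ≤ Q) (σ≤Q : s * s * suc ((δ * h₀ + K) * (δ * h₀ + K)) ≤ Q)
    (k-ok : k * suc (s * s * suc ((δ * h₀ + K) * (δ * h₀ + K)) * suc ((δ * h₀ + K) * (δ * h₀ + K))) ≤ L)
    (q-ok : q * (4 * suc Q ^ (s * s)) ≤ k) (N-ok : 8 * N ^ m ≤ 2 ^ q)
    where

    private
      h₁ : ℕ
      h₁ = δ * h₀ + K

    open Closure t H h₀ K 1≤D 1≤μ sparse K≥ H≥ using (closure)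
    open Coins N Q 1≤Q

    Rel : (u v x y : Fin N) → Set
    Rel u v x y = ∃[ c ] (Rare t c × (∃[ B ] Edge c u v B) × (∃[ B ] Edge c x y B))

    Rel-sym : ∀ {u v x y} → Rel u v x y → Rel x y u v
    Rel-sym (c , r , e , e′) = c , r , e′ , e

    colour : Fin M → Fin N → Fin P
    colour B v = lookup (lookup ω B) v

    Adjacent : Fin N → Fin N → Set
    Adjacent u v = u ≢ v × (∃[ B ] (inc ω B u ≡ true × inc ω B v ≡ true × colour B u ≢ colour B v)) ×
      (∀ B B′ → inc ω B u ≡ true → inc ω B v ≡ true → inc ω B′ u ≡ true → inc ω B′ v ≡ true → B ≡ B′)

    On : Coin → Fin N → Fin N → Set
    On κ u v = isZero (lookup (lookup κ u) v) ≡ true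

    Killed : Coin → Fin N → Fin N → Set
    Killed κ u v = ∃[ c ] (Rare t c × (∃[ B ] Edge c u v B) × (∀ x y B → Edge c x y B → On κ x y))

    Kept : Coin → Fin N → Fin N → Set
    Kept κ u v = Adjacent u v × On κ u v × On κ v u × ¬ Killed κ u v

    edge-sym : ∀ {c u v B} → Edge c u v B → Edge c v u B
    edge-sym e = record { u≢v = Edge.u≢v e ∘ ≡-sym ; u∈ = Edge.v∈ e ; v∈ = Edge.u∈ e ; B∈ = Edge.B∈ e ; incᵤ = Edge.incᵥ e ; incᵥ = Edge.incᵤ e }

    Kept-sym : ∀ κ u v → Kept κ u v → Kept κ v u
    Kept-sym κ u v ((u≢v , (B , p , p′ , c) , unique) , on , on′ , alive) =
      (u≢v ∘ ≡-sym , (B , p′ , p , c ∘ ≡-sym) , λ B B′ a b a′ b′ → unique B B′ b a b′ a′) , on′ , on ,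
      λ (c , r , (B , e) , h) → alive (c , r , (B , edge-sym e) , h)

    -- The clique contains a rare configuration; its edges are kept, so all on, which kills them.
    no-clique : ∀ κ (f : Fin t → Fin N) → (∀ a b → f a ≡ f b → a ≡ b) → (∀ a b → a ≢ b → Kept κ (f a) (f b)) → ⊥
    no-clique κ f inj kept = Clique.rare s t u μ+u u≤δ δ≤D δ≤μ s+2≤t extremal shortLines f inj cover linear short found
      where
      cover : ∀ a b → a ≢ b → ∃[ B ] (inc ω B (f a) ≡ true × inc ω B (f b) ≡ true)
      cover a b a≢b with kept a b a≢b
      ... | (_ , (B , p , q , _) , _) , _ = B , p , q
      linear : ∀ a b → a ≢ b → ∀ B B′ → inc ω B (f a) ≡ true → inc ω B (f b) ≡ true → inc ω B′ (f a) ≡ true → inc ω B′ (f b) ≡ true → B ≡ B′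
      linear a b a≢b with kept a b a≢b
      ... | (_ , _ , unique) , _ = unique
      rainbow : ∀ B a b → a ≢ b → inc ω B (f a) ≡ true → inc ω B (f b) ≡ true → colour B (f a) ≢ colour B (f b)
      rainbow B a b a≢b p q with kept a b a≢b
      ... | (_ , (B′ , p′ , q′ , c) , unique) , _ with unique B B′ p q p′ q′
      ...   | refl = c
      -- Two clique points in `B` have `B` as their only common blob and so differ in colour there,
      -- and only `s` of the `P` colours stand for membership.
      short : ∀ B → card (λ a → inc ω B (f a)) ≤ s
      short B = begin
        card (λ a → inc ω B (f a))                                ≡⟨ ∑-cong t (λ a → ≡-sym (one a)) ⟩
        ∑ t (λ a → ∑ s (λ c → 𝟙 (inc ω B (f a) ∧ matches a c)))   ≡⟨ ∑ᴸ-swap (allFin t) (allFin s) _ ⟩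
        ∑ s (λ c → ∑ t (λ a → 𝟙 (inc ω B (f a) ∧ matches a c)))   ≤⟨ ∑-mono s (λ c → ∑-unique≤1 t _ (unique c)) ⟩
        ∑ s (λ _ → 1)                                             ≡⟨ ∑-1 s ⟩
        s ∎
        where
        open ≤-Reasoning
        matches : Fin t → Fin s → Bool
        matches a c = toℕ (colour B (f a)) ≡ᵇ toℕ c
        one : ∀ a → ∑ s (λ c → 𝟙 (inc ω B (f a) ∧ matches a c)) ≡ 𝟙 (inc ω B (f a))
        one a with inc ω B (f a) in eq
        ... | false = ∑-zero s (λ _ → refl)
        ... | true  = trans (∑-cong s (λ c → trans (cong 𝟙 (same c)) (≡-sym (*-identityʳ _)))) (∑-δ c₀ (λ _ → 1))
          where
          bound : toℕ (colour B (f a)) < s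
          bound = ≤ᵇ⇒≤ _ _ (subst T (≡-sym eq) _)
          c₀ : Fin s
          c₀ = fromℕ< bound
          same : ∀ c → matches a c ≡ (c == c₀)
          same c with c ≟ᶠ c₀
          ... | yes refl = T⇒≡ (≡⇒≡ᵇ _ _ (≡-sym (toℕ-fromℕ< bound)))
          ... | no c≢ with matches a c in m≡
          ...   | false = refl
          ...   | true  = ⊥-elim (c≢ (toℕ-injective (trans (≡-sym (≡ᵇ⇒≡ _ _ (subst T (≡-sym m≡) _))) (≡-sym (toℕ-fromℕ< bound)))))
        unique : ∀ c a b → inc ω B (f a) ∧ matches a c ≡ true → inc ω B (f b) ∧ matches b c ≡ true → a ≡ b
        unique c a b p p′ with a ≟ᶠ b
        ... | yes h = h
        ... | no a≢b = ⊥-elim (rainbow B a b a≢b (∧-elimˡ p) (∧-elimˡ p′) (toℕ-injective (trans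
                (≡ᵇ⇒≡ _ _ (subst T (≡-sym (∧-elimʳ (inc ω B (f a)) p)) _)) (≡-sym (≡ᵇ⇒≡ _ _ (subst T (≡-sym (∧-elimʳ (inc ω B (f b)) p′)) _))))))
      found : ¬ (∃[ c ] (Rare t c × proj₁ c ⊆ᵐ Clique.image s t u μ+u u≤δ δ≤D δ≤μ s+2≤t extremal shortLines f inj cover linear short))
      found (c , rare , sub) with Rare.two rare
      ... | B , _ , _ , (x , y , e) , _ = dead (preimage x (Edge.u∈ e)) (preimage y (Edge.v∈ e))
        where
        preimage : ∀ x → proj₁ c x ≡ true → ∃[ a ] x ≡ f a
        preimage x h = Clique.image⇒ s t u μ+u u≤δ δ≤D δ≤μ s+2≤t extremal shortLines f inj cover linear short x (sub x h)
        dead : ∃[ a ] x ≡ f a → ∃[ b ] y ≡ f b → ⊥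
        dead (a , refl) (b , refl) with kept a b (λ { refl → Edge.u≢v e refl })
        ... | _ , _ , _ , alive = alive (c , rare , (B , e) , all-on)
          where
          all-on : ∀ x y B → Edge c x y B → On κ x y
          all-on x y B e′ = at (preimage x (Edge.u∈ e′)) (preimage y (Edge.v∈ e′)) (Edge.u≢v e′)
            where
            at : ∃[ a ] x ≡ f a → ∃[ b ] y ≡ f b → x ≢ y → On κ x y
            at (a , refl) (b , refl) x≢y = proj₁ (proj₂ (kept a b (λ { refl → x≢y refl })))

    KeptClique : Coin → Mask N → Set
    KeptClique κ S = Σ (Fin s → Fin N) λ f → (∀ a b → f a ≡ f b → a ≡ b) × (∀ a b → a ≢ b → Kept κ (f a) (f b)) × (∀ a → S (f a) ≡ true)

    module WithRelation (rel? : ∀ u v x y → Dec (Rel u v x y))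
      (degree : ∀ u v → ∑ N (λ x → ∑ N (λ y → 𝟙 ⌊ rel? u v x y ⌋)) ≤ h₁ * h₁) where

      rel : (u v x y : Fin N) → Bool
      rel u v x y = ⌊ rel? u v x y ⌋

      rel-true : ∀ {u v x y} → Rel u v x y → rel u v x y ≡ true
      rel-true {u} {v} {x} {y} h with rel? u v x y
      ... | yes _ = refl
      ... | no ¬h = ⊥-elim (¬h h)

      rel-sym : ∀ u v x y → rel u v x y ≡ rel x y u v
      rel-sym u v x y with rel? u v x y | rel? x y u v
      ... | yes _ | yes _ = refl
      ... | no _  | no _  = refl
      ... | yes h | no ¬h = ⊥-elim (¬h (Rel-sym h))
      ... | no ¬h | yes h = ⊥-elim (¬h (Rel-sym h))

      module Sel = Selection N M s m Q k q L (h₁ * h₁) 1≤Q rel rel-sym degree 1≤N σ≤Q k-ok q-ok N-ok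

      Cleans : Vec Bool N → Mask M → Set
      Cleans S C = ∀ i → C i ≡ true → Clean (lookup S) ω i

      contra : true ≡ false → ⊥
      contra ()

      incident : ∀ {S i} (cl : Clean S ω i) a → inc ω i (lookup (Clean.τ cl) a) ≡ true
      incident cl a = T⇒≡ (≤⇒≤ᵇ (subst (λ z → suc z ≤ s) (≡-sym (Clean.colour cl a)) (toℕ<n a)))

      packing : ∀ S C → Cleans S C → Sel.Packing C
      packing S C cl = record
        { τ = λ i e → Clean.τ (cl i e)
        ; distinct = λ i e → Clean.distinct (cl i e)
        ; owner = λ i e j e′ a b a′ b′ a≢b eq eq′ → decidable-stable (i ≟ᶠ j) λ i≢j →
            contra (trans (≡-sym (subst (λ w → inc ω j w ≡ true) (≡-sym eq′) (incident (cl j e′) b′)))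
              (Clean.alone (cl i e) a b a≢b j (i≢j ∘ ≡-sym) (subst (λ w → inc ω j w ≡ true) (≡-sym eq) (incident (cl j e′) a′))))
        }

      module _ (S : Vec Bool N) (C : Mask M) (cl : Cleans S C) (κ : Coin) (out : Sel.Outcome (packing S C cl) κ) where
        open Sel.Outcome out
        clᵢ : Clean (lookup S) ω i
        clᵢ = cl i i∈
        τ : Vec (Fin N) s
        τ = Clean.τ clᵢ
        only : ∀ a b → a ≢ b → ∀ B → inc ω B (lookup τ a) ≡ true → inc ω B (lookup τ b) ≡ true → B ≡ i
        only a b a≢b B p p′ = decidable-stable (B ≟ᶠ i) λ B≢i → contra (trans (≡-sym p′) (Clean.alone clᵢ a b a≢b B B≢i p))
        own : ∀ {c} B x y → B ≢ i → Edge c x y B → ∃[ a′ ] ∃[ b′ ] (a′ ≢ b′ × x ≡ lookup τ a′ × y ≡ lookup τ b′) → ⊥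
        own B x y B≢i e (a′ , b′ , a′≢b′ , eq , eq′) = B≢i (only a′ b′ a′≢b′ B (subst (λ w → inc ω B w ≡ true) eq (Edge.incᵤ e)) (subst (λ w → inc ω B w ≡ true) eq′ (Edge.incᵥ e)))
        other : ∀ c → TwoBlobs c → ∃[ B ] (B ≢ i × ∃[ x ] ∃[ y ] Edge c x y B)
        other c (B , B′ , B≢B′ , e , e′) = choose (B ≟ᶠ i)
          where
          choose : Dec (B ≡ i) → ∃[ B ] (B ≢ i × ∃[ x ] ∃[ y ] Edge c x y B)
          choose (no B≢i) = B , B≢i , e
          choose (yes eq) = B′ , (λ h → B≢B′ (trans eq (≡-sym h))) , e′
        -- A surviving rare configuration through this pair has an edge in a blob other than `i`.
        -- That edge is related to the pair and on, so by the choice of coins it joins two vertices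
        -- of `τ`; but no blob other than `i` contains two vertices of `τ`.
        alive : ∀ a b → a ≢ b → ¬ Killed κ (lookup τ a) (lookup τ b)
        alive a b a≢b (c , rare , edge , all-on) = at (other c (Rare.two rare))
          where
          at : ∃[ B ] (B ≢ i × ∃[ x ] ∃[ y ] Edge c x y B) → ⊥
          at (B , B≢i , x , y , e) = own B x y B≢i e (related-off a b a≢b x y (rel-true (c , rare , edge , (B , e))) (all-on x y B e))
        colours : ∀ a b → a ≢ b → colour i (lookup τ a) ≢ colour i (lookup τ b)
        colours a b a≢b h = a≢b (toℕ-injective (trans (≡-sym (Clean.colour clᵢ a)) (trans (cong toℕ h) (Clean.colour clᵢ b))))
        kept : ∀ a b → a ≢ b → Kept κ (lookup τ a) (lookup τ b)
        kept a b a≢b = (Clean.distinct clᵢ a b a≢b , (i , incident clᵢ a , incident clᵢ b , colours a b a≢b) ,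
            λ B B′ p p′ r r′ → trans (only a b a≢b B p p′) (≡-sym (only a b a≢b B′ r r′))) ,
          pairs-on a b a≢b , pairs-on b a (a≢b ∘ ≡-sym) , alive a b a≢b
        kept-clique : KeptClique κ (lookup S)
        kept-clique = lookup τ , (λ a b h → decidable-stable (a ≟ᶠ b) λ a≢b → Clean.distinct clᵢ a b a≢b h) , kept , Clean.in-S clᵢ

      rich : ∃[ κ ] (∀ S → cardⱽ S ≡ m → KeptClique κ (lookup S))
      rich = proj₁ coin , λ S p → kept-clique S (C S p) (cl S p) (proj₁ coin) (proj₂ coin S p)
        where
        C : ∀ S → cardⱽ S ≡ m → Mask M
        C S p = proj₁ (clean (lookup S) p)
        cl : ∀ S p → Cleans S (C S p)
        cl S p = proj₂ (proj₂ (clean (lookup S) p))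
        coin : ∃[ κ ] (∀ S (p : cardⱽ S ≡ m) → Sel.Outcome (packing S (C S p) (cl S p)) κ)
        coin = Sel.good-coin C (λ S p → proj₁ (proj₂ (clean (lookup S) p))) (λ S p → packing S (C S p) (cl S p))

    -- A rare configuration through `u` and `v` uses a common blob of the two, and `linear` forces
    -- it to be the chosen blob `B`. One closure therefore absorbs all rare configurations in
    -- question, and both vertices of every related pair lie in a set of at most `h₁` vertices.
    degree : (rel? : ∀ u v x y → Dec (Rel u v x y)) → ∀ u v → ¬ ¬ (∑ N (λ x → ∑ N (λ y → 𝟙 ⌊ rel? u v x y ⌋)) ≤ h₁ * h₁)
    degree rel? u v k = ¬¬-em {∃[ B ] (u ≢ v × inc ω B u ≡ true × inc ω B v ≡ true)} λ
      { (inj₂ none) → k (≤-trans (≤-reflexive (∑-zero N (λ x → ∑-zero N (λ y → absent none x y)))) z≤n)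
      ; (inj₁ (B , u≢v , p , p′)) → closure u v B u≢v p p′ λ (X , small , absorbing) →
          k (≤-trans (∑-mono N (λ x → ∑-mono N (λ y → inside B p p′ X absorbing x y)))
            (≤-trans (≤-reflexive (trans (∑-cong N (λ x → ∑ᴸ-* (allFin N) (𝟙 (X x)) _)) (∑ᴸ-*ʳ (allFin N) _ (card X)))) (*-mono-≤ small small))) }
      where
      absent : ¬ (∃[ B ] (u ≢ v × inc ω B u ≡ true × inc ω B v ≡ true)) → ∀ x y → 𝟙 ⌊ rel? u v x y ⌋ ≡ 0
      absent none x y with rel? u v x y
      ... | no _ = refl
      ... | yes (c , r , (B , e) , _) = ⊥-elim (none (B , Edge.u≢v e , Edge.incᵤ e , Edge.incᵥ e))
      inside : ∀ B → inc ω B u ≡ true → inc ω B v ≡ true → ∀ X → (∀ r → Rare t r → Edge r u v B → proj₁ r ⊆ᵐ X) → ∀ x y → 𝟙 ⌊ rel? u v x y ⌋ ≤ 𝟙 (X x) * 𝟙 (X y)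
      inside B p p′ X absorbing x y with rel? u v x y
      ... | no _ = z≤n
      ... | yes (c , r , (B′ , e) , (_ , e′)) with Rare.linear r u v (Edge.u≢v e) (Edge.u∈ e) (Edge.v∈ e) B B′ p p′ (Edge.incᵤ e) (Edge.incᵥ e)
      ...   | refl = ≤-reflexive (≡-sym (cong₂ (λ a b → 𝟙 a * 𝟙 b) (absorbing c r e x (Edge.u∈ e′)) (absorbing c r e y (Edge.v∈ e′))))

    -- Relatedness and survival quantify over rare configurations and are not decided by
    -- computation. There are finitely many instances, so under the double negation all of them may
    -- be assumed decided.
    graph : ¬ ¬ Witness s t N m
    graph k = ¬¬-∀ N (λ u → ¬¬-∀ N (λ v → ¬¬-∀ N (λ x → ¬¬-∀ N (λ y → ¬¬-excluded-middle {A = Rel u v x y})))) λ rel? →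
      ¬¬-∀ N (λ u → ¬¬-∀ N (λ v → degree rel? u v)) λ deg → withCoin (WithRelation.rich rel? deg)
      where
      withCoin : ∃[ κ ] (∀ S → cardⱽ S ≡ m → KeptClique κ (lookup S)) → ⊥
      withCoin (κ , rich) = ¬¬-∀ N (λ u → ¬¬-∀ N (λ v → ¬¬-excluded-middle {A = Kept κ u v})) λ kept? → k (build kept?)
        where
        build : (∀ u v → Dec (Kept κ u v)) → Witness s t N m
        build kept? =
          record { adj = λ u v → ⌊ kept? u v ⌋ ; sym = symmetric ; irrefl = irreflexive } ,
          (λ (f , inj , adj) → no-clique κ f (λ a b h → inj h) (λ a b a≢b → fromTrue (f a) (f b) (adj a b a≢b))) ,
          λ S p → convert S (rich S p)
          where
          fromTrue : ∀ u v → ⌊ kept? u v ⌋ ≡ true → Kept κ u v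
          fromTrue u v h with kept? u v
          ... | yes p = p
          toTrue : ∀ u v → Kept κ u v → ⌊ kept? u v ⌋ ≡ true
          toTrue u v h with kept? u v
          ... | yes _ = refl
          ... | no ¬h = ⊥-elim (¬h h)
          symmetric : ∀ u v → ⌊ kept? u v ⌋ ≡ ⌊ kept? v u ⌋
          symmetric u v with kept? u v | kept? v u
          ... | yes _ | yes _ = refl
          ... | no _  | no _  = refl
          ... | yes h | no ¬h = ⊥-elim (¬h (Kept-sym κ u v h))
          ... | no ¬h | yes h = ⊥-elim (¬h (Kept-sym κ v u h))
          irreflexive : ∀ u → ⌊ kept? u u ⌋ ≡ false
          irreflexive u with kept? u u
          ... | no _ = refl
          ... | yes ((u≢u , _) , _) = ⊥-elim (u≢u refl)
          convert : ∀ S → KeptClique κ (lookup S) → Σ (Fin s → Fin N) λ f → (∀ a b → f a ≡ f b → a ≡ b) × (∀ a b → a ≢ b → ⌊ kept? (f a) (f b) ⌋ ≡ true) × (∀ a → lookup S (f a) ≡ true)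
          convert S (f , inj , kept , inS) = f , inj , (λ a b a≢b → toTrue (f a) (f b) (kept a b a≢b)) , inS

-- Choice of the parameters

2^+ : ∀ a b → 2 ^ (a + b) ≡ 2 ^ a * 2 ^ b
2^+ = ^-distribˡ-+-* 2

2^-pos : ∀ n → 1 ≤ 2 ^ n
2^-pos n = ^-pos 2 n (s≤s z≤n)

4^≡2^ : ∀ n → 4 ^ n ≡ 2 ^ (2 * n)
4^≡2^ n = ^-*-assoc 2 2 n

16^≡2^ : ∀ n → 16 ^ n ≡ 2 ^ (4 * n)
16^≡2^ n = ^-*-assoc 2 4 n

-- All constants that occur are at most A and all powers of w at most w ^ B, so that
-- A * w ^ B ≤ 2 ^ y makes them negligible; w ^ z is the final logarithmic loss.
module Constants (s t D δ u : ℕ) where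
  z E μ K cH cd cQ a₁ a₂ a₃ a₄ A B : ℕ
  z = s * s + 2 * s + 4
  E = z * s ∸ (4 * s + 3)
  μ = 2 * δ ∸ u
  K = 2 * D + μ
  cH = δ * (9 + K) + K + (t + t * t)
  cd = suc (cH * cH)
  cQ = 4 * (2 * (s * s * cd)) ^ (s * s)
  a₁ = s * (cH * cH) + 16 + (D + 6)
  a₂ = 60 * (s * s) * ((1 + 4 * s) * (8 + D))
  a₃ = 480 * (s * s) * ((2 + μ) * (2 + μ)) * (6 + D) + (6 + μ) + s
  a₄ = 2 * ((D + 3) * cQ * (2 * (s * s * cd * cd)))
  A = a₁ + a₂ + (a₃ + a₄)
  B = z + 6 + E + 1

module Parameters (s t D num δ u y : ℕ)
  (D≡ : D ≡ num + δ) (u≡ : u + (s ∸ 2) * δ ≡ (s ∸ 1) * num) (1≤num : 1 ≤ num) (num<δ : num < δ) (1≤u : 1 ≤ u) (u<δ : u < δ)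
  (3≤s : 3 ≤ s) (A≤w : Constants.A s t D δ u ≤ 4 * y)
  (big : Constants.A s t D δ u * (4 * y) ^ Constants.B s t D δ u ≤ 2 ^ y) where

  open Constants s t D δ u

  A₁ : a₁ ≤ A
  A₁ = ≤-trans (m≤m+n a₁ a₂) (m≤m+n (a₁ + a₂) (a₃ + a₄))

  A₂ : a₂ ≤ A
  A₂ = ≤-trans (m≤n+m a₂ a₁) (m≤m+n (a₁ + a₂) (a₃ + a₄))

  A₃ : a₃ ≤ A
  A₃ = ≤-trans (m≤m+n a₃ a₄) (m≤n+m (a₃ + a₄) (a₁ + a₂))

  A₄ : a₄ ≤ A
  A₄ = ≤-trans (m≤n+m a₄ a₃) (m≤n+m (a₃ + a₄) (a₁ + a₂))

  B≥ : z + 6 + E + 1 ≤ B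
  B≥ = ≤-refl

  w : ℕ
  w = 4 * y

  N M P m X H h₀ R k′ q₁ A₀ qA Λ W₀ x₀ Q₀ q₄ R₄ R₅ h₁ d σ q k L : ℕ
  X = 2 ^ (w * num)
  N = 2 ^ (w * D)
  M = 2 ^ (w * μ)
  -- The density bound needs `s * R * H² ≤ P`: one factor `w` is that of `R`, two come from `H`,
  -- which is at most `cH * w`, and the last absorbs the constants.
  P = 2 ^ (w * δ) * w ^ 4
  m = X * w ^ z
  -- The factor `w` per incidence in `R` must outweigh `2^9`, the constant of the union bound, and
  -- `2^(w K)`, the slack allowed in the invariant of the closure; `h₀` incidences suffice, as `w`
  -- is at least 2.
  h₀ = 9 + w * K
  h₁ = δ * h₀ + K
  H = h₁ + (t + t * t)
  R = 2 ^ (w * δ) * w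
  q₁ = 2 * s * X
  k′ = 6 + w * μ + 2 * q₁
  -- About `P/m`, lowered by `2^y` to absorb `s * w^z`. The square of this loss reappears as
  -- `2^(2y)` in `qA`.
  Λ = 2 ^ (w * (δ ∸ num) ∸ y)
  qA = 4 * 2 ^ (w * (2 * num ∸ u) + 2 * y)
  A₀ = 2 * qA + 6 + w * D * m
  x₀ = 2 + w * μ
  W₀ = 8 + w * D * m
  q₄ = X * w ^ suc (suc E)
  R₄ = X * w ^ suc E
  R₅ = X * w ^ E
  Q₀ = x₀ * x₀ * A₀ + k′ * W₀
  d = suc (h₁ * h₁)
  σ = s * s * d
  q = w * D * m + 3
  k = q * (4 * suc σ ^ (s * s))
  L = R₄ ∸ 2 * R₅

  16≤A : 16 ≤ A
  16≤A = ≤-trans (≤-trans (m≤n+m 16 (s * (cH * cH))) (m≤m+n (s * (cH * cH) + 16) (D + 6))) A₁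

  16≤w : 16 ≤ w
  16≤w = ≤-trans 16≤A A≤w

  D+6≤w : D + 6 ≤ w
  D+6≤w = ≤-trans (m≤n+m (D + 6) (s * (cH * cH) + 16)) (≤-trans A₁ A≤w)

  scH²≤w : s * (cH * cH) ≤ w
  scH²≤w = ≤-trans (≤-trans (m≤m+n (s * (cH * cH)) 16) (m≤m+n (s * (cH * cH) + 16) (D + 6))) (≤-trans A₁ A≤w)

  1≤w : 1 ≤ w
  1≤w = ≤-trans (s≤s z≤n) 16≤w

  1≤y : 1 ≤ y
  1≤y = nonzero y 16≤w
    where
    nonzero : ∀ y → 16 ≤ 4 * y → 1 ≤ y
    nonzero (suc y) _ = s≤s z≤n

  1≤X : 1 ≤ X
  1≤X = 2^-pos (w * num)

  y≤w : y ≤ w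
  y≤w = m≤m+n y (3 * y)

  1≤w^ : ∀ n → 1 ≤ w ^ n
  1≤w^ n = ^-pos w n 1≤w

  negligible : ∀ c e → c ≤ A → e ≤ B → c * w ^ e ≤ 2 ^ y
  negligible c e h h′ = ≤-trans (*-mono-≤ h (^-mono-exp w 1≤w h′)) big

  2^y≤X : 2 ^ y ≤ X
  2^y≤X = ^-monoʳ-≤ 2 (≤-trans y≤w (≤-trans (≤-reflexive (≡-sym (*-identityʳ w))) (*-monoʳ-≤ w 1≤num)))

  u≤2δ : u ≤ 2 * δ
  u≤2δ = ≤-trans (<⇒≤ u<δ) (m≤m+n δ _)

  μ+u : μ + u ≡ 2 * δ
  μ+u = m∸n+n≡m u≤2δ

  δ≤μ : δ ≤ μ
  δ≤μ = +-cancelʳ-≤ u _ _ (≤-trans (+-monoʳ-≤ δ (<⇒≤ u<δ)) (≤-reflexive (trans (cong (δ +_) (≡-sym (+-identityʳ δ))) (≡-sym μ+u))))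

  num<μ : num < μ
  num<μ = ≤-trans num<δ δ≤μ

  u≤num : u ≤ num
  u≤num = +-cancelʳ-≤ ((s ∸ 2) * δ) _ _ (≤-trans (≤-reflexive (trans u≡ (cong (_* num) (split s 3≤s)))) (+-monoʳ-≤ num (*-monoʳ-≤ (s ∸ 2) (<⇒≤ num<δ))))
    where
    split : ∀ s → 3 ≤ s → s ∸ 1 ≡ suc (s ∸ 2)
    split 1 (s≤s ())
    split (suc (suc s)) _ = refl

  -- This is the equation M m^s = X P^s up to logarithms: a set of m vertices has about X exact rainbow hits.
  exponent : μ + s * num ≡ num + s * δ
  exponent = +-cancelʳ-≡ u (μ + s * num) (num + s * δ) (trans (trans (solve 3 (λ a b c → a :+ b :+ c := (a :+ c) :+ b) refl μ (s * num) u) (cong (_+ s * num) μ+u)) (go s 3≤s u≡))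
    where
    go : ∀ s → 3 ≤ s → u + (s ∸ 2) * δ ≡ (s ∸ 1) * num → 2 * δ + s * num ≡ num + s * δ + u
    go 1 (s≤s ())
    go (suc (suc s)) _ e = trans (solve 3 (λ d n x → con 2 :* d :+ (con 2 :+ x) :* n := con 2 :* d :+ n :+ (con 1 :+ x) :* n) refl δ num s)
      (trans (cong (2 * δ + num +_) (≡-sym e)) (solve 4 (λ d n x u → con 2 :* d :+ n :+ (u :+ x :* d) := n :+ (con 2 :+ x) :* d :+ u) refl δ num s u))

  -- This explains `z`: it is half of the left side, so the inequality is `2z ≤ z(s-1)`, which holds
  -- from `s = 3` on.
  z≥ : 2 * (s * s) + 4 * s + 8 ≤ z * (s ∸ 1)
  z≥ = ≤-trans (≤-reflexive (solve 1 (λ s → con 2 :* (s :* s) :+ con 4 :* s :+ con 8 := (s :* s :+ con 2 :* s :+ con 4) :* con 2) refl s)) (*-monoʳ-≤ z (∸-monoˡ-≤ 1 3≤s))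

  zs≡ : z * s ≡ E + (4 * s + 3)
  zs≡ = ≡-sym (m∸n+n≡m (≤-trans (≤-trans (+-monoʳ-≤ (4 * s) (≤-trans (≤ᵇ⇒≤ 3 8 _) (m≤n+m 8 (2 * (s * s))))) (≤-reflexive (solve 2 (λ a b → b :+ (a :+ con 8) := a :+ b :+ con 8) refl (2 * (s * s)) (4 * s))))
    (≤-trans z≥ (*-monoʳ-≤ z (m∸n≤m s 1)))))

  -- The selection of coins consumes `m`, a factor `w`, then `w^(2s²)` for the probability of a
  -- pattern and `w^4` for conflicts: the exponent `z + 2s² + 5` in total, which must fit below the
  -- spoiled hits.
  E≥ : z + (2 * (s * s) + 5) ≤ E
  E≥ = +-cancelʳ-≤ (4 * s + 3) _ _ (≤-trans (≤-trans (≤-reflexive (solve 3 (λ z a b → z :+ (a :+ con 5) :+ (b :+ con 3) := z :+ (a :+ b :+ con 8)) refl z (2 * (s * s)) (4 * s))) (+-monoʳ-≤ z z≥))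
    (≤-reflexive (trans (≡-sym (*-suc z (s ∸ 1))) (trans (cong (z *_) (m+[n∸m]≡n (≤-trans (s≤s z≤n) 3≤s))) zs≡))))

  X≤m : X ≤ m
  X≤m = ≤-trans (≤-reflexive (≡-sym (*-identityʳ X))) (*-monoʳ-≤ X (1≤w^ z))

  1≤m : 1 ≤ m
  1≤m = ≤-trans 1≤X X≤m

  1≤P : 1 ≤ P
  1≤P = *-mono-≤ (2^-pos (w * δ)) (1≤w^ 4)

  2^wδ≤P : 2 ^ (w * δ) ≤ P
  2^wδ≤P = ≤-trans (≤-reflexive (≡-sym (*-identityʳ _))) (*-monoʳ-≤ (2 ^ (w * δ)) (1≤w^ 4))

  N^m : N ^ m ≡ 2 ^ (w * D * m)
  N^m = ^-*-assoc 2 (w * D) m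

  -- The union over `m`-sets costs `log N^m`, of order `X * w^(z+1)`, and `E` exceeds `z` by enough
  -- to hide it below `R₅`.
  wD+ : ∀ c → c ≤ 6 → w * D * m + c ≤ R₅
  wD+ c c≤6 = begin
    w * D * m + c             ≤⟨ +-monoʳ-≤ (w * D * m) (≤-trans c≤6 (m≤m*n 6 (w * m) {{>-nonZero (*-mono-≤ 1≤w 1≤m)}})) ⟩
    w * D * m + 6 * (w * m)   ≡⟨ solve 3 (λ w d m → w :* d :* m :+ con 6 :* (w :* m) := (d :+ con 6) :* (w :* m)) refl w D m ⟩
    (D + 6) * (w * m)         ≤⟨ *-monoˡ-≤ (w * m) D+6≤w ⟩
    w * (w * (X * w ^ z))     ≡⟨ solve 3 (λ w x p → w :* (w :* (x :* p)) := x :* (w :* (w :* p))) refl w X (w ^ z) ⟩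
    X * w ^ (2 + z)           ≤⟨ *-monoʳ-≤ X (^-mono-exp w 1≤w (≤-trans (≤-reflexive (+-comm 2 z)) (≤-trans (+-monoʳ-≤ z (≤-trans (≤ᵇ⇒≤ 2 5 _) (m≤n+m 5 (2 * (s * s))))) E≥))) ⟩
    R₅ ∎
    where
    open ≤-Reasoning

  4R₅≤R₄ : 4 * R₅ ≤ R₄
  4R₅≤R₄ = ≤-trans (*-monoˡ-≤ R₅ (≤-trans (≤ᵇ⇒≤ 4 16 _) 16≤w)) (≤-reflexive (solve 3 (λ w x p → w :* (x :* p) := x :* (w :* p)) refl w X (w ^ E)))

  2R₄≤q₄ : 2 * R₄ ≤ q₄
  2R₄≤q₄ = ≤-trans (*-monoˡ-≤ R₄ (≤-trans (≤ᵇ⇒≤ 2 16 _) 16≤w)) (≤-reflexive (solve 3 (λ w x p → w :* (x :* p) := x :* (w :* p)) refl w X (w ^ suc E)))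

  cH≥ : H ≤ cH * w
  cH≥ = begin
    δ * (9 + w * K) + K + (t + t * t)
      ≤⟨ +-mono-≤ (+-mono-≤ (*-monoʳ-≤ δ (≤-trans (+-monoˡ-≤ (w * K) (≤-trans (≤-reflexive (≡-sym (*-identityˡ 9))) (*-monoˡ-≤ 9 1≤w))) (≤-reflexive (≡-sym (*-distribˡ-+ w 9 K))))) (up K)) (up (t + t * t)) ⟩
    δ * (w * (9 + K)) + w * K + w * (t + t * t)
      ≡⟨ solve 5 (λ d w a k x → d :* (w :* a) :+ w :* k :+ w :* x := (d :* a :+ k :+ x) :* w) refl δ w (9 + K) K (t + t * t) ⟩
    cH * w ∎
    where
    open ≤-Reasoning
    up : ∀ a → a ≤ w * a
    up a = ≤-trans (≤-reflexive (≡-sym (*-identityˡ a))) (*-monoˡ-≤ a 1≤w)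

  dense-ok : s * R * (H * H) ≤ P
  dense-ok = begin
    s * (2 ^ (w * δ) * w) * (H * H)              ≤⟨ *-monoʳ-≤ (s * R) (*-mono-≤ cH≥ cH≥) ⟩
    s * (2 ^ (w * δ) * w) * (cH * w * (cH * w))  ≡⟨ solve 4 (λ s p w c → s :* (p :* w) :* (c :* w :* (c :* w)) := p :* (s :* (c :* c) :* (w :* (w :* (w :* con 1))))) refl s (2 ^ (w * δ)) w cH ⟩
    2 ^ (w * δ) * (s * (cH * cH) * w ^ 3)        ≤⟨ *-monoʳ-≤ (2 ^ (w * δ)) (*-monoˡ-≤ (w ^ 3) scH²≤w) ⟩
    P ∎
    where open ≤-Reasoning

  size-q : N * (s * 2) ≤ q₁ * P
  size-q = begin
    N * (s * 2)                           ≡⟨ cong (_* (s * 2)) (trans (cong (λ e → 2 ^ (w * e)) D≡) (trans (cong (2 ^_) (*-distribˡ-+ w num δ)) (2^+ (w * num) (w * δ)))) ⟩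
    X * 2 ^ (w * δ) * (s * 2)             ≡⟨ solve 3 (λ x p s → x :* p :* (s :* con 2) := con 2 :* s :* x :* p) refl X (2 ^ (w * δ)) s ⟩
    q₁ * 2 ^ (w * δ)                      ≤⟨ *-monoʳ-≤ q₁ 2^wδ≤P ⟩
    q₁ * P ∎
    where open ≤-Reasoning

  size-ok : 64 * M * 4 ^ q₁ ≤ 2 ^ k′
  size-ok = ≤-reflexive (trans (cong (64 * M *_) (4^≡2^ q₁)) (≡-sym (trans (2^+ (6 + w * μ) (2 * q₁)) (cong (_* 2 ^ (2 * q₁)) (2^+ 6 (w * μ))))))

  gap : y ≤ w * (δ ∸ num)
  gap = ≤-trans y≤w (≤-trans (≤-reflexive (≡-sym (*-identityʳ w))) (*-monoʳ-≤ w (m<n⇒0<n∸m num<δ)))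

  Λ≡ : Λ * 2 ^ y ≡ 2 ^ (w * (δ ∸ num))
  Λ≡ = trans (≡-sym (2^+ (w * (δ ∸ num) ∸ y) y)) (cong (2 ^_) (m∸n+n≡m gap))

  XΛ : X * 2 ^ (w * (δ ∸ num)) ≡ 2 ^ (w * δ)
  XΛ = trans (≡-sym (2^+ (w * num) _)) (cong (2 ^_) (trans (≡-sym (*-distribˡ-+ w num _)) (cong (w *_) (m+[n∸m]≡n (<⇒≤ num<δ)))))

  double-Λ : m * (s * Λ) ≤ P
  double-Λ = *-cancelʳ-≤′ (2 ^ y) (2^-pos y) (begin
    X * w ^ z * (s * Λ) * 2 ^ y            ≡⟨ solve 5 (λ x p s l y → x :* p :* (s :* l) :* y := (s :* p) :* (x :* (l :* y))) refl X (w ^ z) s Λ (2 ^ y) ⟩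
    s * w ^ z * (X * (Λ * 2 ^ y))          ≡⟨ cong (s * w ^ z *_) (trans (cong (X *_) Λ≡) XΛ) ⟩
    s * w ^ z * 2 ^ (w * δ)                ≤⟨ *-monoˡ-≤ (2 ^ (w * δ)) (negligible s z (≤-trans (m≤n+m s _) A₃) (≤-trans (≤-trans (≤-trans (m≤m+n z 6) (m≤m+n _ E)) (m≤m+n _ 1)) B≥)) ⟩
    2 ^ y * 2 ^ (w * δ)                    ≡⟨ *-comm (2 ^ y) _ ⟩
    2 ^ (w * δ) * 2 ^ y                    ≤⟨ *-monoˡ-≤ (2 ^ y) 2^wδ≤P ⟩
    P * 2 ^ y ∎)
    where open ≤-Reasoning

  double-q : 4 * M ≤ qA * (Λ * Λ)
  double-q = ≤-reflexive (≡-sym (begin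
    4 * 2 ^ (w * e + 2 * y) * (Λ * Λ)      ≡⟨ cong (λ z → 4 * z * (Λ * Λ)) (trans (2^+ (w * e) (2 * y)) (cong (2 ^ (w * e) *_) (trans (cong (2 ^_) (cong (y +_) (+-identityʳ y))) (2^+ y y)))) ⟩
    4 * (2 ^ (w * e) * (2 ^ y * 2 ^ y)) * (Λ * Λ)
      ≡⟨ solve 3 (λ a y l → con 4 :* (a :* (y :* y)) :* (l :* l) := con 4 :* (a :* ((l :* y) :* (l :* y)))) refl (2 ^ (w * e)) (2 ^ y) Λ ⟩
    4 * (2 ^ (w * e) * ((Λ * 2 ^ y) * (Λ * 2 ^ y)))   ≡⟨ cong (λ z → 4 * (2 ^ (w * e) * (z * z))) Λ≡ ⟩
    4 * (2 ^ (w * e) * (2 ^ (w * g) * 2 ^ (w * g)))   ≡⟨ cong (4 *_) (trans (cong (2 ^ (w * e) *_) (≡-sym (2^+ (w * g) (w * g)))) (≡-sym (2^+ (w * e) _))) ⟩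
    4 * 2 ^ (w * e + (w * g + w * g))                 ≡⟨ cong (λ x → 4 * 2 ^ x) (trans (solve 3 (λ w e g → w :* e :+ (w :* g :+ w :* g) := w :* (e :+ con 2 :* g)) refl w e g) (cong (w *_) e+2g)) ⟩
    4 * M ∎))
    where
    open ≡-Reasoning
    e g : ℕ
    e = 2 * num ∸ u
    g = δ ∸ num
    u≤2num : u ≤ 2 * num
    u≤2num = ≤-trans u≤num (m≤m+n num _)
    e+2g : e + 2 * g ≡ μ
    e+2g = +-cancelʳ-≡ u _ _ (trans (solve 3 (λ e g u → e :+ con 2 :* g :+ u := (e :+ u) :+ con 2 :* g) refl e g u)
      (trans (cong (_+ 2 * g) (m∸n+n≡m u≤2num)) (trans (≡-sym (*-distribˡ-+ 2 num g)) (trans (cong (2 *_) (m+[n∸m]≡n (<⇒≤ num<δ))) (≡-sym μ+u)))))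

  double-ok : N ^ m * (64 * 4 ^ qA) ≤ 2 ^ A₀
  double-ok = ≤-reflexive (trans (cong₂ (λ a b → a * (64 * b)) N^m (4^≡2^ qA)) (trans (solve 3 (λ a b c → a :* (b :* c) := (c :* b) :* a) refl (2 ^ (w * D * m)) 64 (2 ^ (2 * qA)))
    (≡-sym (trans (2^+ (2 * qA + 6) (w * D * m)) (cong (_* 2 ^ (w * D * m)) (2^+ (2 * qA) 6))))))

  large-4 : m * (s * 4) ≤ P
  large-4 = ≤-trans (*-monoʳ-≤ m (*-monoʳ-≤ s (^-monoʳ-≤ 2 2≤))) double-Λ
    where
    2≤ : 2 ≤ w * (δ ∸ num) ∸ y
    2≤ = +-cancelʳ-≤ y _ _ (≤-trans (≤-trans (+-monoˡ-≤ y (*-monoʳ-≤ 2 1≤y)) (≤-trans (≤-reflexive (solve 1 (λ y → con 2 :* y :+ y := con 3 :* y) refl y)) (*-monoˡ-≤ y (≤ᵇ⇒≤ 3 4 _))))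
      (≤-trans (≤-trans (≤-reflexive (≡-sym (*-identityʳ w))) (*-monoʳ-≤ w (m<n⇒0<n∸m num<δ))) (≤-reflexive (≡-sym (m∸n+n≡m gap)))))

  large-x₀ : 4 * M ≤ 2 ^ x₀
  large-x₀ = ≤-reflexive (≡-sym (2^+ 2 (w * μ)))

  large-ok : N ^ m * 256 ≤ 2 ^ W₀
  large-ok = ≤-reflexive (trans (cong (_* 256) N^m) (trans (*-comm (2 ^ (w * D * m)) 256) (≡-sym (2^+ 8 (w * D * m)))))

  2ms≤P : m * s + m * s ≤ P
  2ms≤P = ≤-trans (≤-trans (m≤m+n _ (m * s + m * s)) (≤-reflexive (solve 2 (λ m s → m :* s :+ m :* s :+ (m :* s :+ m :* s) := m :* (s :* con 4)) refl m s))) large-4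

  s≤ms : s ≤ m * s
  s≤ms = ≤-trans (≤-reflexive (≡-sym (*-identityˡ s))) (*-monoˡ-≤ s 1≤m)

  s≤P : s ≤ P
  s≤P = ≤-trans s≤ms (≤-trans (m≤m+n _ _) 2ms≤P)

  hit-P : m * s ≤ P ∸ s
  hit-P = +-cancelʳ-≤ s _ _ (≤-trans (+-monoʳ-≤ (m * s) s≤ms) (≤-trans 2ms≤P (≤-reflexive (≡-sym (m∸n+n≡m s≤P)))))

  1≤P∸s : 1 ≤ P ∸ s
  1≤P∸s = ≤-trans (*-mono-≤ 1≤m (≤-trans (s≤s z≤n) 3≤s)) hit-P

  -- `exponent` settles the powers of 2. Among the powers of `w`, `m^s` brings `z s` and `P^s` takes
  -- `4s`; the difference is `E + 3` by the definition of `E`.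
  main-identity : M * m ^ s ≡ X * w ^ (E + 3) * P ^ s
  main-identity = begin
    M * (X * w ^ z) ^ s                            ≡⟨ cong (M *_) (trans (^-distribʳ-* X (w ^ z) s) (cong₂ _*_ (trans (^-*-assoc 2 (w * num) s) (cong (2 ^_) (trans (*-assoc w num s) (cong (w *_) (*-comm num s))))) (^-*-assoc w z s))) ⟩
    2 ^ (w * μ) * (2 ^ (w * (s * num)) * w ^ (z * s))   ≡⟨ trans (≡-sym (*-assoc (2 ^ (w * μ)) _ _)) (cong₂ _*_ (trans (≡-sym (2^+ (w * μ) _)) (cong (2 ^_) (≡-sym (*-distribˡ-+ w μ (s * num))))) (cong (w ^_) zs≡)) ⟩
    2 ^ (w * (μ + s * num)) * w ^ (E + (4 * s + 3))     ≡⟨ cong₂ _*_ (trans (cong (λ e → 2 ^ (w * e)) exponent) (trans (cong (2 ^_) (*-distribˡ-+ w num (s * δ))) (2^+ (w * num) _)))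
                                                            (trans (cong (w ^_) (solve 2 (λ e s → e :+ (s :+ con 3) := e :+ con 3 :+ s) refl E (4 * s))) (^-distribˡ-+-* w (E + 3) (4 * s))) ⟩
    X * 2 ^ (w * (s * δ)) * (w ^ (E + 3) * w ^ (4 * s))  ≡⟨ *-interchange X _ (w ^ (E + 3)) _ ⟩
    X * w ^ (E + 3) * (2 ^ (w * (s * δ)) * w ^ (4 * s))  ≡⟨ cong (X * w ^ (E + 3) *_) (≡-sym (trans (^-distribʳ-* (2 ^ (w * δ)) (w ^ 4) s) (cong₂ _*_ (trans (^-*-assoc 2 (w * δ) s) (cong (2 ^_) (trans (*-assoc w δ s) (cong (w *_) (*-comm δ s))))) (^-*-assoc w 4 s)))) ⟩
    X * w ^ (E + 3) * P ^ s ∎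
    where open ≡-Reasoning

  hit-q : 16 * (q₄ * P ^ s) ≤ M * m ^ s
  hit-q = ≤-trans (≤-reflexive (≡-sym (*-assoc 16 q₄ (P ^ s)))) (≤-trans (*-monoˡ-≤ (P ^ s) (≤-trans (*-monoˡ-≤ q₄ 16≤w)
      (≤-reflexive (trans (solve 3 (λ w x p → w :* (x :* p) := x :* (w :* p)) refl w X (w ^ suc (suc E))) (cong (λ e → X * w ^ e) (+-comm 3 E))))))
    (≤-reflexive (≡-sym main-identity)))

  hit-ok : N ^ m * (64 * 2 ^ R₄) ≤ 2 ^ q₄
  hit-ok = ≤-trans (≤-reflexive (trans (cong (_* (64 * 2 ^ R₄)) N^m) (trans (≡-sym (*-assoc (2 ^ (w * D * m)) 64 (2 ^ R₄))) (≡-sym (trans (2^+ (w * D * m + 6) R₄) (cong (_* 2 ^ R₄) (2^+ (w * D * m) 6)))))))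
    (^-monoʳ-≤ 2 (≤-trans (+-monoˡ-≤ R₄ (≤-trans (wD+ 6 ≤-refl) (≤-trans (m≤m+n R₅ _) 4R₅≤R₄))) (≤-trans (≤-reflexive (cong (R₄ +_) (≡-sym (+-identityʳ R₄)))) 2R₄≤q₄)))

  R₄≤M : R₄ ≤ M
  R₄≤M = begin
    X * w ^ suc E          ≤⟨ *-monoʳ-≤ X (≤-trans (≤-reflexive (≡-sym (*-identityˡ _))) (≤-trans (negligible 1 (suc E) (≤-trans (s≤s (z≤n {15})) 16≤A)
                                (≤-trans (≤-trans (≤-reflexive (+-comm 1 E)) (+-monoˡ-≤ 1 (m≤n+m E (z + 6)))) B≥)) (^-monoʳ-≤ 2 y≤w))) ⟩
    X * 2 ^ w              ≡⟨ ≡-sym (2^+ (w * num) w) ⟩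
    2 ^ (w * num + w)      ≤⟨ ^-monoʳ-≤ 2 (≤-trans (≤-reflexive (trans (+-comm (w * num) w) (≡-sym (*-suc w num)))) (*-monoʳ-≤ w num<μ)) ⟩
    M ∎
    where open ≤-Reasoning

  spoil-ok : N ^ m * (64 * 4 ^ R₅) ≤ 16 ^ R₅
  spoil-ok = ≤-trans (≤-reflexive (trans (cong₂ (λ a b → a * (64 * b)) N^m (4^≡2^ R₅)) (trans (≡-sym (*-assoc (2 ^ (w * D * m)) 64 _)) (≡-sym (trans (2^+ (w * D * m + 6) (2 * R₅)) (cong (_* 2 ^ (2 * R₅)) (2^+ (w * D * m) 6)))))))
    (≤-trans (^-monoʳ-≤ 2 (≤-trans (+-monoˡ-≤ (2 * R₅) (≤-trans (wD+ 6 ≤-refl) (m≤m+n R₅ _))) (≤-reflexive (solve 1 (λ r → r :+ (r :+ con 0) :+ (r :+ (r :+ con 0)) := con 4 :* r) refl R₅)))) (≤-reflexive (≡-sym (16^≡2^ R₅))))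

  -- Here `w = 4y` and `1 ≤ u` meet: the factor `2^(-wu)` saves at least `2^(4y)`, of which `2^(2y)`
  -- repays the loss in `Λ` and `2^(2y)` remains for logarithmic factors.
  4X²≤ : qA * 2 ^ (2 * y) ≤ 4 * (X * X)
  4X²≤ = ≤-trans (≤-reflexive (trans (*-assoc 4 (2 ^ (w * (2 * num ∸ u) + 2 * y)) (2 ^ (2 * y))) (cong (4 *_) (≡-sym (2^+ (w * (2 * num ∸ u) + 2 * y) (2 * y)))))) (*-monoʳ-≤ 4 (≤-trans (^-monoʳ-≤ 2 exp≤) (≤-reflexive (2^+ (w * num) (w * num)))))
    where
    exp≤ : w * (2 * num ∸ u) + 2 * y + 2 * y ≤ w * num + w * num
    exp≤ = begin
      w * (2 * num ∸ u) + 2 * y + 2 * y   ≡⟨ solve 2 (λ a y → a :+ con 2 :* y :+ con 2 :* y := a :+ con 4 :* y) refl (w * (2 * num ∸ u)) y ⟩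
      w * (2 * num ∸ u) + w               ≡⟨ trans (+-comm _ w) (≡-sym (*-suc w _)) ⟩
      w * suc (2 * num ∸ u)               ≤⟨ *-monoʳ-≤ w (≤-trans (≤-reflexive (+-comm 1 _)) (≤-trans (+-monoʳ-≤ (2 * num ∸ u) 1≤u) (≤-reflexive (m∸n+n≡m (≤-trans u≤num (m≤m+n num _)))))) ⟩
      w * (2 * num)                       ≡⟨ solve 2 (λ w n → w :* (con 2 :* n) := w :* n :+ w :* n) refl w num ⟩
      w * num + w * num ∎
      where open ≤-Reasoning

  -- Blobs with few points of `S` cover far fewer than `m²` pairs, by `4X²≤` and because `X` exceeds
  -- every power of `w` in play. Large blobs are the tight case: `k′ * W₀` is of order `X * w * m`,
  -- and only the power `w^z` in `m` makes it small.
  covered-small : 15 * (s * s) * w ^ 3 * Q₀ ≤ m * m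
  covered-small = ≤-trans (≤-reflexive (*-distribˡ-+ (15 * (s * s) * w ^ 3) (x₀ * x₀ * A₀) (k′ * W₀)))
    (*-cancelˡ-≤′ 2 (s≤s z≤n) (≤-trans (≤-reflexive (*-distribˡ-+ 2 (15 * (s * s) * w ^ 3 * (x₀ * x₀ * A₀)) (15 * (s * s) * w ^ 3 * (k′ * W₀)))) (≤-trans (+-mono-≤ part₁ part₂) (≤-reflexive (cong (m * m +_) (≡-sym (+-identityʳ (m * m))))))))
    where
    open ≤-Reasoning
    up : ∀ a → a ≤ a * w
    up a = ≤-trans (≤-reflexive (≡-sym (*-identityʳ a))) (*-monoʳ-≤ a 1≤w)
    μ-ok : 6 + w * μ ≤ X
    μ-ok = ≤-trans (≤-trans (+-monoˡ-≤ (w * μ) (up 6)) (≤-reflexive (solve 2 (λ w m → con 6 :* w :+ w :* m := (con 6 :+ m) :* (w :* con 1)) refl w μ)))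
      (≤-trans (negligible (6 + μ) 1 (≤-trans (≤-trans (m≤n+m (6 + μ) _) (m≤m+n _ s)) A₃) (≤-trans (m≤n+m 1 _) B≥)) 2^y≤X)
    k′≤ : k′ ≤ (1 + 4 * s) * X
    k′≤ = ≤-trans (+-monoˡ-≤ (2 * q₁) μ-ok) (≤-reflexive (solve 2 (λ x s → x :+ con 2 :* (con 2 :* s :* x) := (con 1 :+ con 4 :* s) :* x) refl X s))
    W₀≤ : W₀ ≤ (8 + D) * (w * m)
    W₀≤ = ≤-trans (+-monoˡ-≤ (w * D * m) (≤-trans (≤-reflexive (≡-sym (*-identityʳ 8))) (*-monoʳ-≤ 8 (*-mono-≤ 1≤w 1≤m)))) (≤-reflexive (solve 3 (λ w d m → con 8 :* (w :* m) :+ w :* d :* m := (con 8 :+ d) :* (w :* m)) refl w D m))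
    part₂ : 2 * (15 * (s * s) * w ^ 3 * (k′ * W₀)) ≤ m * m
    part₂ = begin
      2 * (15 * (s * s) * w ^ 3 * (k′ * W₀))                                    ≤⟨ *-monoʳ-≤ 2 (*-monoʳ-≤ (15 * (s * s) * w ^ 3) (*-mono-≤ k′≤ W₀≤)) ⟩
      2 * (15 * (s * s) * w ^ 3 * ((1 + 4 * s) * X * ((8 + D) * (w * m))))
        ≡⟨ solve 7 (λ s w3 a x b w m → con 2 :* (con 15 :* (s :* s) :* w3 :* (a :* x :* (b :* (w :* m)))) := con 30 :* (s :* s) :* (a :* b) :* ((w :* w3) :* x) :* m) refl s (w ^ 3) (1 + 4 * s) X (8 + D) w m ⟩
      30 * (s * s) * ((1 + 4 * s) * (8 + D)) * (w ^ 4 * X) * m                  ≤⟨ *-monoˡ-≤ m (*-monoˡ-≤ (w ^ 4 * X) (≤-trans (≤-trans (*-monoˡ-≤ ((1 + 4 * s) * (8 + D)) (*-monoˡ-≤ (s * s) (≤ᵇ⇒≤ 30 60 _))) A₂) A≤w)) ⟩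
      w * (w ^ 4 * X) * m                                                       ≡⟨ cong (_* m) (solve 3 (λ w p x → w :* (p :* x) := x :* (w :* p)) refl w (w ^ 4) X) ⟩
      X * w ^ 5 * m                                                             ≤⟨ *-monoˡ-≤ m (*-monoʳ-≤ X (^-mono-exp w 1≤w 5≤z)) ⟩
      m * m ∎
      where
      5≤z : 5 ≤ z
      5≤z = ≤-trans (≤-trans (≤ᵇ⇒≤ 5 10 _) (+-monoˡ-≤ 4 (*-monoʳ-≤ 2 3≤s))) (+-monoˡ-≤ 4 (m≤n+m (2 * s) (s * s)))
    x₀≤ : x₀ ≤ (2 + μ) * w
    x₀≤ = ≤-trans (+-monoˡ-≤ (w * μ) (up 2)) (≤-reflexive (solve 2 (λ w m → con 2 :* w :+ w :* m := (con 2 :+ m) :* w) refl w μ))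
    c : ℕ
    c = (s * s) * ((2 + μ) * (2 + μ))
    front : ∀ a → 2 * (15 * (s * s) * w ^ 3 * (x₀ * x₀ * a)) ≤ 30 * c * w ^ 5 * a
    front a = ≤-trans (*-monoʳ-≤ 2 (*-monoʳ-≤ (15 * (s * s) * w ^ 3) (*-monoˡ-≤ a (*-mono-≤ x₀≤ x₀≤))))
      (≤-reflexive (solve 4 (λ s m w a → con 2 :* (con 15 :* (s :* s) :* (w :* (w :* (w :* con 1))) :* (m :* w :* (m :* w) :* a)) := con 30 :* ((s :* s) :* (m :* m)) :* (w :* (w :* (w :* (w :* (w :* con 1))))) :* a) refl s (2 + μ) w a))
    split-A₀ : A₀ ≤ 2 * qA + (6 + D) * (w * m)
    split-A₀ = ≤-trans (≤-reflexive (+-assoc (2 * qA) 6 (w * D * m))) (+-monoʳ-≤ (2 * qA) (≤-trans (+-monoˡ-≤ (w * D * m) (≤-trans (≤-reflexive (≡-sym (*-identityʳ 6))) (*-monoʳ-≤ 6 (*-mono-≤ 1≤w 1≤m)))) (≤-reflexive (solve 3 (λ w d m → con 6 :* (w :* m) :+ w :* d :* m := (con 6 :+ d) :* (w :* m)) refl w D m))))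
    A₃′ : 480 * c ≤ A
    A₃′ = ≤-trans (≤-trans (≤-reflexive (≡-sym (*-assoc 480 (s * s) _))) (m≤m*n _ (6 + D))) (≤-trans (≤-trans (m≤m+n _ (6 + μ)) (m≤m+n _ s)) A₃)
    A₃″ : 480 * c * (6 + D) ≤ A
    A₃″ = ≤-trans (≤-reflexive (cong (_* (6 + D)) (≡-sym (*-assoc 480 (s * s) _)))) (≤-trans (≤-trans (m≤m+n _ (6 + μ)) (m≤m+n _ s)) A₃)
    e≤B : ∀ e → e ≤ 6 → e ≤ B
    e≤B e h = ≤-trans h (≤-trans (≤-trans (≤-trans (m≤n+m 6 z) (m≤m+n _ E)) (m≤m+n _ 1)) B≥)
    half₁ : 2 * (30 * c * w ^ 5 * (2 * qA)) ≤ m * m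
    half₁ = *-cancelʳ-≤′ (2 ^ (2 * y)) (2^-pos (2 * y)) (begin
      2 * (30 * c * w ^ 5 * (2 * qA)) * 2 ^ (2 * y)  ≡⟨ solve 4 (λ c p a b → con 2 :* (con 30 :* c :* p :* (con 2 :* a)) :* b := con 120 :* c :* p :* (a :* b)) refl c (w ^ 5) qA (2 ^ (2 * y)) ⟩
      120 * c * w ^ 5 * (qA * 2 ^ (2 * y))           ≤⟨ *-monoʳ-≤ (120 * c * w ^ 5) 4X²≤ ⟩
      120 * c * w ^ 5 * (4 * (X * X))                ≡⟨ solve 3 (λ c p x → con 120 :* c :* p :* (con 4 :* x) := con 480 :* c :* p :* x) refl c (w ^ 5) (X * X) ⟩
      480 * c * w ^ 5 * (X * X)                      ≤⟨ *-mono-≤ (negligible (480 * c) 5 A₃′ (e≤B 5 (≤ᵇ⇒≤ 5 6 _))) (*-mono-≤ X≤m X≤m) ⟩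
      2 ^ y * (m * m)                                ≤⟨ *-monoˡ-≤ (m * m) (^-monoʳ-≤ 2 (m≤m+n y _)) ⟩
      2 ^ (2 * y) * (m * m)                          ≡⟨ *-comm _ (m * m) ⟩
      m * m * 2 ^ (2 * y) ∎)
    half₂ : 2 * (30 * c * w ^ 5 * ((6 + D) * (w * m))) ≤ m * m
    half₂ = begin
      2 * (30 * c * w ^ 5 * ((6 + D) * (w * m)))     ≡⟨ solve 5 (λ c p d w m → con 2 :* (con 30 :* c :* p :* (d :* (w :* m))) := con 60 :* c :* d :* (w :* p) :* m) refl c (w ^ 5) (6 + D) w m ⟩
      60 * c * (6 + D) * w ^ 6 * m                   ≤⟨ *-monoˡ-≤ m (≤-trans (negligible (60 * c * (6 + D)) 6 (≤-trans (*-monoˡ-≤ (6 + D) (*-monoˡ-≤ c (≤ᵇ⇒≤ 60 480 _))) A₃″) (e≤B 6 ≤-refl)) (≤-trans 2^y≤X X≤m)) ⟩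
      m * m ∎
    part₁ : 2 * (15 * (s * s) * w ^ 3 * (x₀ * x₀ * A₀)) ≤ m * m
    part₁ = *-cancelˡ-≤′ 2 (s≤s z≤n) (begin
      2 * (2 * (15 * (s * s) * w ^ 3 * (x₀ * x₀ * A₀)))       ≤⟨ *-monoʳ-≤ 2 (≤-trans (front A₀) (*-monoʳ-≤ (30 * c * w ^ 5) split-A₀)) ⟩
      2 * (30 * c * w ^ 5 * (2 * qA + (6 + D) * (w * m)))     ≡⟨ solve 3 (λ a b c → con 2 :* (a :* (b :+ c)) := con 2 :* (a :* b) :+ con 2 :* (a :* c)) refl (30 * c * w ^ 5) (2 * qA) ((6 + D) * (w * m)) ⟩
      2 * (30 * c * w ^ 5 * (2 * qA)) + 2 * (30 * c * w ^ 5 * ((6 + D) * (w * m)))   ≤⟨ +-mono-≤ half₁ half₂ ⟩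
      m * m + m * m                                           ≡⟨ cong (m * m +_) (≡-sym (+-identityʳ (m * m))) ⟩
      2 * (m * m) ∎)

  spoil-q : 15 * (M * (s * s * (m ^ s * Q₀))) ≤ R₅ * (P ^ s * (m * m))
  spoil-q = begin
    15 * (M * (s * s * (m ^ s * Q₀)))             ≡⟨ solve 4 (λ m s p q → con 15 :* (m :* (s :* (p :* q))) := (m :* p) :* (con 15 :* s :* q)) refl M (s * s) (m ^ s) Q₀ ⟩
    M * m ^ s * (15 * (s * s) * Q₀)               ≡⟨ cong (_* (15 * (s * s) * Q₀)) (trans main-identity (cong (λ e → X * e * P ^ s) (^-distribˡ-+-* w E 3))) ⟩
    X * (w ^ E * w ^ 3) * P ^ s * (15 * (s * s) * Q₀)   ≡⟨ solve 6 (λ x e t p s q → x :* (e :* t) :* p :* (con 15 :* s :* q) := (x :* e) :* (p :* (con 15 :* s :* t :* q))) refl X (w ^ E) (w ^ 3) (P ^ s) (s * s) Q₀ ⟩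
    R₅ * (P ^ s * (15 * (s * s) * w ^ 3 * Q₀))    ≤⟨ *-monoʳ-≤ R₅ (*-monoʳ-≤ (P ^ s) covered-small) ⟩
    R₅ * (P ^ s * (m * m)) ∎
    where open ≤-Reasoning

  private
    1≤s : 1 ≤ s
    1≤s = ≤-trans (s≤s z≤n) 3≤s

    1≤D : 1 ≤ D
    1≤D = ≤-trans 1≤num (≤-trans (m≤m+n num δ) (≤-reflexive (≡-sym D≡)))

    1≤μ : 1 ≤ μ
    1≤μ = ≤-trans (s≤s z≤n) num<μ

    1≤s² : 1 ≤ s * s
    1≤s² = *-mono-≤ 1≤s 1≤s

    2s²≤m : 2 * (s * s) ≤ m
    2s²≤m = ≤-trans (≤-trans (≤-trans (≤-trans (*-monoˡ-≤ (s * s) (≤ᵇ⇒≤ 2 60 _)) (m≤m*n (60 * (s * s)) ((1 + 4 * s) * (8 + D)))) A₂) (≤-trans (≤-reflexive (≡-sym (*-identityʳ A))) (*-monoʳ-≤ A (1≤w^ B))))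
      (≤-trans big (≤-trans 2^y≤X X≤m))

    d≤ : d ≤ cd * (w * w)
    d≤ = ≤-trans (s≤s (*-mono-≤ h₁≤ h₁≤)) (≤-trans (+-monoˡ-≤ (cH * w * (cH * w)) (*-mono-≤ 1≤w 1≤w)) (≤-reflexive (solve 2 (λ c w → w :* w :+ c :* w :* (c :* w) := (con 1 :+ c :* c) :* (w :* w)) refl cH w)))
      where
      h₁≤ : h₁ ≤ cH * w
      h₁≤ = ≤-trans (m≤m+n h₁ (t + t * t)) cH≥

    1≤cdw² : 1 ≤ cd * (w * w)
    1≤cdw² = ≤-trans (s≤s z≤n) d≤

    sucσ≤ : suc σ ≤ 2 * (s * s * cd) * (w * w)
    sucσ≤ = ≤-trans (+-mono-≤ (*-mono-≤ 1≤s² 1≤cdw²) (*-monoʳ-≤ (s * s) d≤)) (≤-reflexive (solve 3 (λ s c w → s :* (c :* w) :+ s :* (c :* w) := con 2 :* (s :* c) :* w) refl (s * s) cd (w * w)))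

    coins≤ : 4 * suc σ ^ (s * s) ≤ cQ * w ^ (2 * (s * s))
    coins≤ = ≤-trans (*-monoʳ-≤ 4 (≤-trans (^-mono (s * s) sucσ≤) (≤-reflexive (trans (^-distribʳ-* (2 * (s * s * cd)) (w * w) (s * s))
      (cong ((2 * (s * s * cd)) ^ (s * s) *_) (trans (cong (_^ (s * s)) (cong (w *_) (≡-sym (*-identityʳ w)))) (^-*-assoc w 2 (s * s)))))))) (≤-reflexive (≡-sym (*-assoc 4 ((2 * (s * s * cd)) ^ (s * s)) (w ^ (2 * (s * s))))))

    σd≤ : suc (σ * d) ≤ 2 * (s * s * cd * cd) * w ^ 4
    σd≤ = ≤-trans (+-mono-≤ (*-mono-≤ (*-mono-≤ 1≤s² 1≤cdw²) 1≤cdw²) (*-mono-≤ (*-monoʳ-≤ (s * s) d≤) d≤))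
      (≤-reflexive (solve 3 (λ s c w → s :* (c :* (w :* w)) :* (c :* (w :* w)) :+ s :* (c :* (w :* w)) :* (c :* (w :* w)) := con 2 :* (s :* c :* c) :* (w :* (w :* (w :* (w :* con 1))))) refl (s * s) cd w))

    q≤ : q ≤ (D + 3) * (w * m)
    q≤ = ≤-trans (+-monoʳ-≤ (w * D * m) (≤-trans (≤-reflexive (≡-sym (*-identityʳ 3))) (*-monoʳ-≤ 3 (*-mono-≤ 1≤w 1≤m)))) (≤-reflexive (solve 3 (λ w d m → w :* d :* m :+ con 3 :* (w :* m) := (d :+ con 3) :* (w :* m)) refl w D m))

    -- The clean hits, at least half of `R₄`, must provide `k` tuples without conflicts; the powers
    -- of `w` are those of `E≥`, and the constants are absorbed by the extra factor `w` in `R₄`.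
    k-ok : k * suc (σ * d) ≤ L
    k-ok = *-cancelˡ-≤′ 2 (s≤s z≤n) (begin
      2 * (k * suc (σ * d))     ≤⟨ *-monoʳ-≤ 2 (*-mono-≤ (*-mono-≤ q≤ coins≤) σd≤) ⟩
      2 * ((D + 3) * (w * m) * (cQ * w ^ (2 * (s * s))) * (2 * (s * s * cd * cd) * w ^ 4))
        ≡⟨ solve 8 (λ D w x p c r k f → con 2 :* (D :* (w :* (x :* p)) :* (c :* r) :* (k :* f)) := con 2 :* (D :* c :* k) :* (x :* (p :* (r :* (w :* f))))) refl (D + 3) w X (w ^ z) cQ (w ^ (2 * (s * s))) (2 * (s * s * cd * cd)) (w ^ 4) ⟩
      C * (X * (w ^ z * (w ^ (2 * (s * s)) * w ^ 5)))
        ≡⟨ cong (λ e → C * (X * e)) (trans (cong (w ^ z *_) (≡-sym (^-distribˡ-+-* w (2 * (s * s)) 5))) (≡-sym (^-distribˡ-+-* w z (2 * (s * s) + 5)))) ⟩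
      C * (X * w ^ (z + (2 * (s * s) + 5)))   ≤⟨ *-mono-≤ (≤-trans A₄ A≤w) (*-monoʳ-≤ X (^-mono-exp w 1≤w E≥)) ⟩
      w * (X * w ^ E)                         ≡⟨ solve 3 (λ w x p → w :* (x :* p) := x :* (w :* p)) refl w X (w ^ E) ⟩
      R₄                                      ≤⟨ half ⟩
      2 * L ∎)
      where
      open ≤-Reasoning
      C : ℕ
      C = 2 * ((D + 3) * cQ * (2 * (s * s * cd * cd)))
      half : R₄ ≤ 2 * L
      half = +-cancelʳ-≤ R₄ _ _ (begin
        R₄ + R₄                            ≡⟨ cong (R₄ +_) (≡-sym (+-identityʳ R₄)) ⟩
        2 * R₄                             ≡⟨ cong (2 *_) (≡-sym (m∸n+n≡m 2R₅≤R₄)) ⟩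
        2 * (L + 2 * R₅)                   ≡⟨ solve 2 (λ l r → con 2 :* (l :+ con 2 :* r) := con 2 :* l :+ con 4 :* r) refl L R₅ ⟩
        2 * L + 4 * R₅                     ≤⟨ +-monoʳ-≤ (2 * L) 4R₅≤R₄ ⟩
        2 * L + R₄ ∎)
        where
        2R₅≤R₄ : 2 * R₅ ≤ R₄
        2R₅≤R₄ = ≤-trans (*-monoˡ-≤ R₅ (≤ᵇ⇒≤ 2 4 _)) 4R₅≤R₄

    N-ok : 8 * N ^ m ≤ 2 ^ q
    N-ok = ≤-reflexive (trans (cong (8 *_) N^m) (trans (*-comm 8 (2 ^ (w * D * m))) (≡-sym (2^+ (w * D * m) 3))))

    κ : ℕ
    κ = 2 ^ 9

  open Good N M s P s≤P 1≤P

  private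
    thresholds : Thresholds κ m H R k′ q₁ A₀ qA Λ W₀ x₀ Q₀ q₄ R₄ R₅ R₅
    thresholds = record
      { 1≤s = 1≤s ; 512≤κ = ≤-refl ; 1≤N = 2^-pos (w * D) ; 1≤M = 2^-pos (w * μ)
      ; 1≤H = ≤-trans (≤-trans 1≤D (≤-trans (m≤m+n D (D + 0)) (m≤m+n (2 * D) μ))) (≤-trans (m≤n+m K (δ * h₀)) (m≤m+n h₁ (t + t * t)))
      ; 1≤Λ = 2^-pos (w * (δ ∸ num) ∸ y) ; 1≤P∸s = 1≤P∸s ; 2s²≤m = 2s²≤m
      ; dense-ok = dense-ok ; size-q = size-q ; size-ok = size-ok ; double-Λ = double-Λ ; double-q = double-q ; double-ok = double-ok
      ; large-4 = large-4 ; large-x₀ = large-x₀ ; large-ok = large-ok ; hit-P = hit-P ; hit-q = hit-q ; hit-ok = hit-ok ; R₄≤M = R₄≤M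
      ; covered-ok = ≤-refl ; spoil-q = spoil-q ; spoil-ok = spoil-ok }

  -- Takes logarithms in the density bound. If the cost were at most `δ * inc + K`, the right side
  -- would be at most `2^(w δ inc) * 2^h₀`, and the factor `w^inc` of `R^inc` is at least `2^h₀`.
  sparse⇒ : ∀ inc a b → h₀ ≤ inc → R ^ inc < κ * (N ^ a * M ^ b) → δ * inc + K < D * a + μ * b
  sparse⇒ i a b h lt = ≰⇒> λ cost≤ → <⇒≱ lt (begin
    κ * (N ^ a * M ^ b)                     ≡⟨ cong (κ *_) (cong₂ _*_ (^-*-assoc 2 (w * D) a) (^-*-assoc 2 (w * μ) b)) ⟩
    κ * (2 ^ (w * D * a) * 2 ^ (w * μ * b)) ≡⟨ cong (κ *_) (trans (≡-sym (2^+ (w * D * a) (w * μ * b))) (cong (2 ^_) (solve 5 (λ w d a m b → w :* d :* a :+ w :* m :* b := w :* (d :* a :+ m :* b)) refl w D a μ b))) ⟩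
    2 ^ 9 * 2 ^ (w * (D * a + μ * b))       ≡⟨ ≡-sym (2^+ 9 (w * (D * a + μ * b))) ⟩
    2 ^ (9 + w * (D * a + μ * b))           ≤⟨ ^-monoʳ-≤ 2 (+-monoʳ-≤ 9 (*-monoʳ-≤ w cost≤)) ⟩
    2 ^ (9 + w * (δ * i + K))               ≡⟨ cong (2 ^_) (solve 5 (λ n w d i k → n :+ w :* (d :* i :+ k) := w :* d :* i :+ (n :+ w :* k)) refl 9 w δ i K) ⟩
    2 ^ (w * δ * i + h₀)                    ≡⟨ 2^+ (w * δ * i) h₀ ⟩
    2 ^ (w * δ * i) * 2 ^ h₀                ≤⟨ *-monoʳ-≤ (2 ^ (w * δ * i)) (≤-trans (^-monoʳ-≤ 2 h) (^-mono i (≤-trans (≤ᵇ⇒≤ 2 16 _) 16≤w))) ⟩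
    2 ^ (w * δ * i) * w ^ i                 ≡⟨ ≡-sym (trans (^-distribʳ-* (2 ^ (w * δ)) w i) (cong (_* w ^ i) (^-*-assoc 2 (w * δ) i))) ⟩
    R ^ i ∎)
    where open ≤-Reasoning

  construction : s + 2 ≤ t → Extremal s t D δ u → ShortLines s t δ u → ¬ ¬ Witness s t N m
  construction s+2≤t extremal shortLines k = build (exists thresholds)
    where
    build : ∃[ ω ] GoodFor κ m H R L ω → ⊥
    build (ω , good) = Assembly.Kill.graph N M s P s≤P 1≤P ω D μ δ t u m H h₀ K σ (q * (4 * suc σ ^ (s * s))) q L
      μ+u (<⇒≤ u<δ) (≤-trans (m≤n+m δ num) (≤-reflexive (≡-sym D≡))) δ≤μ 1≤D 1≤μ s+2≤t extremal shortLines
      (λ (X , 𝓑) hX h𝓑 hi → sparse⇒ _ (card X) (card 𝓑) hi (GoodFor.sparse good X 𝓑 hX h𝓑))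
      ≤-refl ≤-refl (GoodFor.clean good) (2^-pos (w * D)) (*-mono-≤ 1≤s² (s≤s z≤n)) ≤-refl k-ok ≤-refl N-ok k

-- The Erdős–Rogers function

emptyInducedKFree : ∀ {n} (G : Graph n) s → 1 ≤ s → InducedKFree G ⊥ˢ s
emptyInducedKFree G (suc s) _ (f , _ , f∈) = ∉⊥ (f∈ zero)

-- `gap` bounds how much larger a free set can be. A larger one refutes the claim that `S` is
-- maximum and takes its place with a smaller gap.
¬¬maxKFree : ∀ {n} (G : Graph n) s b → (∀ S → InducedKFree G S s → ∣ S ∣ ≤ b) →
  ∀ gap S → InducedKFree G S s → b ≤ ∣ S ∣ + gap → ¬ ¬ (∃[ m ] IsMaxKFree G s m)
¬¬maxKFree G s b bound zero S free b≤ k =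
  k (∣ S ∣ , (S , free , refl) ,
    λ T T-free → ≤-trans (bound T T-free) (subst (b ≤_) (+-identityʳ ∣ S ∣) b≤))
¬¬maxKFree G s b bound (suc gap) S free b≤ k =
  k (∣ S ∣ , (S , free , refl) , λ T T-free → ≮⇒≥ λ S<T →
    ¬¬maxKFree G s b bound gap T T-free
      (≤-trans (subst (b ≤_) (+-suc ∣ S ∣ gap) b≤) (+-monoˡ-≤ gap S<T)) k)

-- `IsErdosRogers` compares only with graphs whose maximum is exhibited. That maximum is available
-- up to double negation, which is enough because `m ≤ b` is decidable.
ErdosRogers≤ : ∀ {s t n m b} → 1 ≤ s → IsErdosRogers s t n m → (G : Graph n) → KFree G t →
  (∀ S → InducedKFree G S s → ∣ S ∣ ≤ b) → m ≤ b
ErdosRogers≤ {s} {n = n} {m} {b} 1≤s (_ , minimal) G G-free bound =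
  decidable-stable (m ≤? b) λ m≰b →
    ¬¬maxKFree G s b bound b ⊥ˢ (emptyInducedKFree G s 1≤s)
      (≤-reflexive (≡-sym (cong+ (∣⊥∣≡0 n))))
      λ (m′ , (S , free , S≡m′) , max) →
        m≰b (≤-trans (minimal G m′ G-free ((S , free , S≡m′) , max))
                     (subst (_≤ b) S≡m′ (bound S free)))
  where
  cong+ : ∀ {x} → x ≡ 0 → x + b ≡ b
  cong+ refl = refl

restrict : ∀ {n N} → n ≤ N → Graph N → Graph n
restrict n≤N G = record
  { adj    = λ u v → adj G (inject≤ u n≤N) (inject≤ v n≤N)
  ; sym    = λ u v → sym G (inject≤ u n≤N) (inject≤ v n≤N)
  ; irrefl = λ u → irrefl G (inject≤ u n≤N)
  }

restrict-KFree : ∀ {n N} (n≤N : n ≤ N) (G : Graph N) {t} → KFree G t → KFree (restrict n≤N G) t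
restrict-KFree n≤N G free (f , f-inj , f-adj) =
  free ((λ i → inject≤ (f i) n≤N) , (λ eq → f-inj (inject≤-injective n≤N n≤N _ _ eq)) , f-adj)

n<2^[1+log₂n] : ∀ n → n < 2 ^ suc ⌊log₂ n ⌋
n<2^[1+log₂n] n = ≰⇒> λ 2^≤n →
  1+n≰n (subst (_≤ ⌊log₂ n ⌋) (⌊log₂[2^n]⌋≡n (suc ⌊log₂ n ⌋)) (⌊log₂⌋-mono-≤ 2^≤n))

2^log₂n≤n : ∀ n → 1 ≤ n → 2 ^ ⌊log₂ n ⌋ ≤ n
2^log₂n≤n n = go n (<-wellFounded n)
  where
  go : ∀ n a → 1 ≤ n → 2 ^ ⌊log2⌋ n a ≤ n
  go 1             _        _ = ≤-refl
  go (suc (suc n)) (accessible rs) _ = begin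
    2 * 2 ^ ⌊log2⌋ (suc ⌊ n /2⌋) _ ≤⟨ *-monoʳ-≤ 2 (go (suc ⌊ n /2⌋) (rs _) (s≤s z≤n)) ⟩
    2 * suc ⌊ n /2⌋                ≡⟨ solve 1 (λ h → con 2 :* (con 1 :+ h) := con 2 :+ (h :+ h)) refl ⌊ n /2⌋ ⟩
    2 + (⌊ n /2⌋ + ⌊ n /2⌋)        ≤⟨ +-monoʳ-≤ 2 (+-monoʳ-≤ ⌊ n /2⌋ (⌊n/2⌋≤⌈n/2⌉ n)) ⟩
    2 + (⌊ n /2⌋ + ⌈ n /2⌉)        ≡⟨ cong (2 +_) (⌊n/2⌋+⌈n/2⌉≡n n) ⟩
    2 + n ∎
    where open ≤-Reasoning

nextMultiple : ∀ c ℓ → 1 ≤ c → ∃[ y ] (ℓ < c * y × c * y ≤ ℓ + c)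
nextMultiple c zero    1≤c = 1 , ≤-trans 1≤c (≤-reflexive (≡-sym (*-identityʳ c))) , ≤-reflexive (*-identityʳ c)
nextMultiple c (suc ℓ) 1≤c = step (nextMultiple c ℓ 1≤c)
  where
  step : ∃[ y ] (ℓ < c * y × c * y ≤ ℓ + c) → ∃[ y ] (suc ℓ < c * y × c * y ≤ suc ℓ + c)
  step (y , ℓ<cy , cy≤) with m≤n⇒m<n∨m≡n ℓ<cy
  ... | inj₁ lt = y , lt , m≤n⇒m≤1+n cy≤
  ... | inj₂ eq = suc y
    , ≤-trans (+-mono-≤ 1≤c (≤-reflexive eq)) (≤-reflexive (≡-sym (*-suc c y)))
    , ≤-reflexive (trans (*-suc c y) (trans (cong (c +_) (≡-sym eq)) (+-comm c (suc ℓ))))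

empty-card : ∀ N → cardⱽ (replicateⱽ N false) ≡ 0
empty-card zero    = refl
empty-card (suc N) = trans (∑-suc N (λ v → 𝟙 (lookup (replicateⱽ (suc N) false) v))) (empty-card N)

lookup-empty : ∀ {N} (v : Fin N) → lookup (replicateⱽ N false) v ≢ true
lookup-empty zero    ()
lookup-empty (suc v) = lookup-empty v

Lift : ∀ {n N} → n ≤ N → Subset n → Fin N → Set
Lift {n} n≤N S v = Σ (Fin n) λ x → x ∈ˢ S × inject≤ x n≤N ≡ v

-- The construction speaks of sets of exactly `m` vertices among all `N`. This cuts a larger subset
-- of the first `n` vertices down to such a set and remembers preimages.
shrink : ∀ {n N} (n≤N : n ≤ N) (S : Subset n) m → m ≤ ∣ S ∣ →
  Σ (Vec Bool N) λ S′ → cardⱽ S′ ≡ m × (∀ v → lookup S′ v ≡ true → Lift n≤N S v)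
shrink {N = N} n≤N S zero _ = replicateⱽ N false , empty-card N , λ v eq → ⊥-elim (lookup-empty v eq)
shrink {N = suc N} (s≤s n≤N) (false ∷ S) (suc m) h with shrink n≤N S (suc m) h
... | S′ , eq , mem = false ∷ S′ , trans (∑-suc N (λ v → 𝟙 (lookup (false ∷ S′) v))) eq ,
  λ { (suc v) p → let x , x∈ , e = mem v p in suc x , thereⱽ x∈ , cong suc e }
shrink {N = suc N} (s≤s n≤N) (true ∷ S) (suc m) (s≤s h) with shrink n≤N S m h
... | S′ , eq , mem = true ∷ S′ , trans (∑-suc N (λ v → 𝟙 (lookup (true ∷ S′) v))) (cong suc eq) ,
  λ { zero _ → zero , hereⱽ , refl ; (suc v) p → let x , x∈ , e = mem v p in suc x , thereⱽ x∈ , cong suc e }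

restrict-bound : ∀ {n N s m} (n≤N : n ≤ N) (G : Graph N) → Dense G s m →
  ∀ S → InducedKFree (restrict n≤N G) S s → ∣ S ∣ ≤ m
restrict-bound {n} {N} {s} {m} n≤N G dense S free = ≮⇒≥ λ m<S → large (shrink n≤N S m (<⇒≤ m<S))
  where
  large : Σ (Vec Bool N) (λ S′ → cardⱽ S′ ≡ m × (∀ v → lookup S′ v ≡ true → Lift n≤N S v)) → ⊥
  large (S′ , |S′| , mem) with dense S′ |S′|
  ... | f , f-inj , f-adj , f∈ = free (g , (inj , edge) , λ a → proj₁ (proj₂ (back a)))
    where
    back : ∀ a → Lift n≤N S (f a)
    back a = mem (f a) (f∈ a)
    g : Fin s → Fin n
    g a = proj₁ (back a)
    g≡f : ∀ a → inject≤ (g a) n≤N ≡ f a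
    g≡f a = proj₂ (proj₂ (back a))
    inj : ∀ {a b} → g a ≡ g b → a ≡ b
    inj {a} {b} eq = f-inj a b (trans (≡-sym (g≡f a)) (trans (cong (λ x → inject≤ x n≤N) eq) (g≡f b)))
    edge : ∀ a b → a ≢ b → adj (restrict n≤N G) (g a) (g b) ≡ true
    edge a b a≢b = trans (cong₂ (adj G) (g≡f a) (g≡f b)) (f-adj a b a≢b)

-- The power `2^(w num D)` is the `num`-th power of `2^(wD)`, which is at most `2^(4D) * n`. All
-- constant factors together are at most `ℓ`, whence the successor in the exponent of the logarithm.
conversion : ∀ n ℓ w D num z → 2 ^ ℓ ≤ n → w * D ≤ ℓ + 4 * D → w ≤ 2 * ℓ → 2 ^ (4 * D * num + z * D) ≤ ℓ →
  (2 ^ (w * num) * w ^ z) ^ D ≤ n ^ num * ℓ ^ suc (z * D)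
conversion n ℓ w D num z 2^ℓ≤n wD≤ w≤2ℓ const≤ℓ = begin
  (2 ^ (w * num) * w ^ z) ^ D                          ≡⟨ ^-distribʳ-* (2 ^ (w * num)) (w ^ z) D ⟩
  (2 ^ (w * num)) ^ D * (w ^ z) ^ D                    ≡⟨ cong₂ _*_ (trans (^-*-assoc 2 (w * num) D) (trans (cong (2 ^_) (solve 3 (λ w a d → w :* a :* d := w :* d :* a) refl w num D)) (≡-sym (^-*-assoc 2 (w * D) num)))) (^-*-assoc w z D) ⟩
  (2 ^ (w * D)) ^ num * w ^ (z * D)                    ≤⟨ *-mono-≤ (^-mono num (^-monoʳ-≤ 2 wD≤)) (^-mono (z * D) w≤2ℓ) ⟩
  (2 ^ (ℓ + 4 * D)) ^ num * (2 * ℓ) ^ (z * D)          ≡⟨ cong₂ _*_ (trans (cong (_^ num) (2^+ ℓ (4 * D))) (trans (^-distribʳ-* (2 ^ ℓ) (2 ^ (4 * D)) num) (cong ((2 ^ ℓ) ^ num *_) (^-*-assoc 2 (4 * D) num)))) (^-distribʳ-* 2 ℓ (z * D)) ⟩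
  (2 ^ ℓ) ^ num * 2 ^ (4 * D * num) * (2 ^ (z * D) * ℓ ^ (z * D))
    ≡⟨ solve 4 (λ a b c d → a :* b :* (c :* d) := a :* (b :* c :* d)) refl ((2 ^ ℓ) ^ num) (2 ^ (4 * D * num)) (2 ^ (z * D)) (ℓ ^ (z * D)) ⟩
  (2 ^ ℓ) ^ num * (2 ^ (4 * D * num) * 2 ^ (z * D) * ℓ ^ (z * D))
    ≡⟨ cong (λ v → (2 ^ ℓ) ^ num * (v * ℓ ^ (z * D))) (≡-sym (2^+ (4 * D * num) (z * D))) ⟩
  (2 ^ ℓ) ^ num * (2 ^ (4 * D * num + z * D) * ℓ ^ (z * D)) ≤⟨ *-mono-≤ (^-mono num 2^ℓ≤n) (*-monoˡ-≤ (ℓ ^ (z * D)) const≤ℓ) ⟩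
  n ^ num * ℓ ^ suc (z * D) ∎
  where open ≤-Reasoning

module _ (s t D num δ u : ℕ) (D≡ : D ≡ num + δ) (u≡ : u + (s ∸ 2) * δ ≡ (s ∸ 1) * num)
  (1≤num : 1 ≤ num) (num<δ : num < δ) (1≤u : 1 ≤ u) (u<δ : u < δ) (3≤s : 3 ≤ s)
  (s+2≤t : s + 2 ≤ t)
  (extremal : Extremal s t D δ u) (shortLines : ShortLines s t δ u) where

  private
    open Constants s t D δ u using (z; A; B)

    y₀ ℓ₀ : ℕ
    y₀ = proj₁ (poly≤exp (A * 4 ^ B) B) + A
    -- The summands make `y` at least `y₀`, keep the rounding error `4 * D` below the logarithm, and
    -- let the logarithm absorb the constants in `conversion`.
    ℓ₀ = 4 * D * y₀ + 4 * D + 2 ^ (4 * D * num + z * D)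

    1≤D : 1 ≤ D
    1≤D = ≤-trans 1≤num (≤-trans (m≤m+n num δ) (≤-reflexive (≡-sym D≡)))

    big : ∀ y → y₀ ≤ y → A * (4 * y) ^ B ≤ 2 ^ y
    big y h = begin
      A * (4 * y) ^ B     ≡⟨ cong (A *_) (^-distribʳ-* 4 y B) ⟩
      A * (4 ^ B * y ^ B) ≡⟨ ≡-sym (*-assoc A (4 ^ B) (y ^ B)) ⟩
      A * 4 ^ B * y ^ B   ≤⟨ proj₂ (poly≤exp (A * 4 ^ B) B) y (≤-trans (m≤m+n _ A) h) ⟩
      2 ^ y ∎
      where open ≤-Reasoning

    module _ (n m : ℕ) (large : 2 ^ ℓ₀ ≤ n) (er : IsErdosRogers s t n m) where
      ℓ : ℕ
      ℓ = ⌊log₂ n ⌋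

      ℓ₀≤ℓ : ℓ₀ ≤ ℓ
      ℓ₀≤ℓ = subst (_≤ ℓ) (⌊log₂[2^n]⌋≡n ℓ₀) (⌊log₂⌋-mono-≤ large)

      bound : ∃[ y ] (ℓ < 4 * D * y × 4 * D * y ≤ ℓ + 4 * D) → m ^ D ≤ n ^ num * ℓ ^ suc (z * D)
      bound (y , lower , upper) = ≤-trans (^-mono D m≤)
        (conversion n ℓ w D num z (2^log₂n≤n n (≤-trans (2^-pos ℓ₀) large)) wD≤ w≤2ℓ
          (≤-trans (m≤n+m _ (4 * D * y₀ + 4 * D)) ℓ₀≤ℓ))
        where
        w : ℕ
        w = 4 * y
        4Dy≡ : 4 * D * y ≡ w * D
        4Dy≡ = solve 2 (λ d y → con 4 :* d :* y := con 4 :* y :* d) refl D y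
        wD≤ : w * D ≤ ℓ + 4 * D
        wD≤ = subst (_≤ ℓ + 4 * D) 4Dy≡ upper
        4D≤ℓ : 4 * D ≤ ℓ
        4D≤ℓ = ≤-trans (≤-trans (m≤n+m (4 * D) (4 * D * y₀)) (m≤m+n (4 * D * y₀ + 4 * D) (2 ^ (4 * D * num + z * D)))) ℓ₀≤ℓ
        w≤2ℓ : w ≤ 2 * ℓ
        w≤2ℓ = ≤-trans (≤-trans (≤-reflexive (≡-sym (*-identityʳ w))) (*-monoʳ-≤ w 1≤D))
          (≤-trans wD≤ (+-monoʳ-≤ ℓ (≤-trans 4D≤ℓ (≤-reflexive (≡-sym (+-identityʳ ℓ))))))
        y₀≤y : y₀ ≤ y
        y₀≤y = <⇒≤ (*-cancelˡ-< (4 * D) y₀ y (≤-<-trans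
          (≤-trans (≤-trans (m≤m+n (4 * D * y₀) (4 * D)) (m≤m+n (4 * D * y₀ + 4 * D) (2 ^ (4 * D * num + z * D)))) ℓ₀≤ℓ) lower))
        A≤w : A ≤ w
        A≤w = ≤-trans (≤-trans (m≤n+m A (proj₁ (poly≤exp (A * 4 ^ B) B))) y₀≤y) (m≤m+n y (3 * y))
        n≤N : n ≤ 2 ^ (w * D)
        n≤N = ≤-trans (<⇒≤ (n<2^[1+log₂n] n)) (^-monoʳ-≤ 2 (subst (suc ℓ ≤_) 4Dy≡ lower))
        m≤ : m ≤ 2 ^ (w * num) * w ^ z
        m≤ = decidable-stable (m ≤? 2 ^ (w * num) * w ^ z) λ m≰ → Parameters.construction
          s t D num δ u y D≡ u≡ 1≤num num<δ 1≤u u<δ 3≤s A≤w (big y y₀≤y) s+2≤t extremal shortLines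
          λ (G , G-free , dense) → m≰ (ErdosRogers≤ (≤-trans (s≤s z≤n) 3≤s) er (restrict n≤N G) (restrict-KFree n≤N G G-free) (restrict-bound n≤N G dense))

  asymptotic : ∃[ c ] ∃[ N ] ∀ n → N ≤ n → ∀ m → IsErdosRogers s t n m → m ^ D ≤ n ^ num * ⌊log₂ n ⌋ ^ c
  asymptotic = suc (z * D) , 2 ^ ℓ₀ , λ n h m er → bound n m h er (nextMultiple (4 * D) ⌊log₂ n ⌋ (≤-trans 1≤D (m≤m+n D (3 * D))))

theorem1p3 : ∀ s t → 3 ≤ s → s + 2 ≤ t → t ≤ 2 * s ∸ 1 →
  ∃[ c ] ∃[ N ] ∀ n → N ≤ n → ∀ m → IsErdosRogers s t n m →
    m ^ alphaDen s t ≤ n ^ alphaNum s t * ⌊log₂ n ⌋ ^ c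
theorem1p3 s t 3≤s s+2≤t t≤2s∸1 with exponents s t 3≤s s+2≤t t≤2s∸1
... | record { δ = δ ; u = u ; holds = D≡ , u≡ , 1≤num , num<δ , 1≤u , u<δ , extremal , shortLines } =
  asymptotic s t (alphaDen s t) (alphaNum s t) δ u D≡ u≡ 1≤num num<δ 1≤u u<δ 3≤s s+2≤t extremal shortLines
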